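{- Let $k$ be a positive integer, let $c\in\{0,1,\dots,k\}$, let $R=(c^{k+1-c})$, and let $0\le i\le k+1-c$. Then \[ \tilde{s}^{(k)}_{(c^{k+1-c-i},\,(c-1)^{i})}=\sum_{\lambda\subseteq R}\ \sum_{\{x_1,\dots,x_i\}} \mathbf u_{\left((R\cup\lambda)/\lambda\right)\setminus\{x_1,\dots,x_i\}}, \] where the first sum is over all partitions $\lambda$ contained in $R$, and the second sum is over all sets of $i$ distinct cells of the diagram of $R\cup\lambda$ lying in rows strictly below the first $k+1-c$ rows, no two of which lie in the same row, and which satisfy condition (C2) with respect to the partition $R\cup\lambda$.
   Context: Affine symmetric group: $W$ is the group of bijections $w:\mathbb Z\to\mathbb Z$ with $w(m+k+1)=w(m)+k+1$ for all $m$ and $\sum_{m=1}^{k+1}w(m)=\sum_{m=1}^{k+1}m$. For $r\in\{0,\dots,k\}$, $s_r$ exchanges $r+t(k+1)$ and $r+1+t(k+1)$ for all $t$ and fixes other integers; $s_a:=s_{a\bmod(k+1)}$ for any integer $a$. $\ell$ is Coxeter length with respect to $s_0,\dots,s_k$; $W_0=\langle s_1,\dots,s_k\rangle$ and $W^0$ is the set of minimal length coset representatives of $W/W_0$. Affine nilCoxeter algebra $\mathbb A$: generated by $\mathbf u_0,\dots,\mathbf u_k$ with $\mathbf u_r^2=0$, $\mathbf u_r\mathbf u_{r+1}\mathbf u_r=\mathbf u_{r+1}\mathbf u_r\mathbf u_{r+1}$ (indices mod $k+1$), $\mathbf u_r\mathbf u_q=\mathbf u_q\mathbf u_r$ if $r-q\not\equiv\pm1$;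 basis $\mathbf u_w=\mathbf u_{r_1}\cdots\mathbf u_{r_m}$ for reduced $w=s_{r_1}\cdots s_{r_m}$. For $D\subsetneq\{0,\dots,k\}$, $w_D$ is the unique product of the $s_d$, $d\in D$, each once, with $s_{m+1}$ before $s_m$ whenever $m,m+1\in D$ (mod $k+1$); $\mathbf h_r=\sum_{|D|=r}\mathbf u_{w_D}$. The $\mathbf h_1,\dots,\mathbf h_k$ commute and generate a subalgebra $\mathbb B\cong\mathbb Q[h_1,\dots,h_k]$ via $h_r\mapsto \mathbf h_r$. The non-commutative $k$-Schur function $\tilde s^{(k)}_\mu$ is the image of the $k$-Schur function $s^{(k)}_\mu$; for $\mu\subseteq R$ it is the unique element of $\mathbb B$ whose coefficient of $\mathbf u_w$, for each $w\in W^0$, is $1$ if $w=w_\mu$ and $0$ otherwise. Diagrams: cell $(a,b)$ is in row $a$ (top to bottom) and column $b$ (left to right), with residue $(b-a)\bmod(k+1)$. For a finite set $\mathcal D$ of cells, reading the cells from the bottom row to the top row, each row right to left, with residues $r_1,\dots,r_m$, set $w_{\mathcal D}=s_{r_1}\cdots s_{r_m}$ and $\mathbf u_{\mathcal D}=\mathbf u_{r_1}\cdots\mathbf u_{r_m}$; $w_\mu$ is this for the diagram of $\mu$. $R\cup\lambda$ is the partition whose parts are those of $R$ followed by those of $\lambda$; $(R\cup\lambda)/\lambda$ removes the cells of $\lambda$ from its top-left corner; $\setminus X$ removes the cells of $X$. Condition (C2) on cells $x_a=(i_a,j_a)$ with respect to a partition $\nu$: whenever $i_a>i_b$ and $j_a<j_b$,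 the cell $(i_a,j_b)$ is not in $\nu$. -}

module Defs where

open import Data.Bool using (Bool; true; false; _∧_; _∨_; not; if_then_else_; T)
open import Data.Nat as ℕ using (ℕ; zero; suc; _+_; _*_; _∸_; _≤_; _≡ᵇ_; _<ᵇ_; _≤ᵇ_)
open import Data.Integer as ℤ using (ℤ; +_; _%ℕ_; _/ℕ_; ∣_∣)
open import Data.Integer.DivMod using (n%ℕd<d)
open import Data.Rational as ℚ using (ℚ; 0ℚ; 1ℚ)
open import Data.Fin as Fin using (Fin; toℕ; fromℕ<)
open import Data.Vec as Vec using (Vec; lookup; tabulate; toList)
open import Data.Vec.Properties using (≡-dec)
open import Data.List as List using (List; []; _∷_; [_]; _++_; map; concatMap; foldl; foldr;
  length; upTo; downFrom; filterᵇ; replicate)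
open import Data.Bool.ListAction using (all; any)
open import Data.Nat.ListAction using (sum)
open import Data.Product using (_×_; _,_; proj₁; proj₂; Σ; ∃)
open import Relation.Binary.PropositionalEquality using (_≡_)
open import Relation.Nullary.Decidable using (⌊_⌋)

-- Affine symmetric group W for a fixed k (n = k+1).
-- An element w is stored by its window (w(0), w(1), ..., w(k));
-- w(m) = w(m mod n) + (m div n)·n for all m ∈ ℤ.

Window : ℕ → Set
Window k = Vec ℤ (suc k)

evalW : ∀ {k} → Window k → ℤ → ℤ
evalW {k} w m =
  lookup w (fromℕ< (n%ℕd<d m (suc k))) ℤ.+ (m /ℕ suc k) ℤ.* (+ suc k)

sgen : (k r : ℕ) → ℤ → ℤ
sgen k r m =
  if (m %ℕ suc k) ≡ᵇ (r ℕ.% suc k) then m ℤ.+ ℤ.1ℤ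
  else if (m %ℕ suc k) ≡ᵇ (suc r ℕ.% suc k) then m ℤ.- ℤ.1ℤ
  else m

idW : ∀ {k} → Window k
idW = tabulate (λ m → + toℕ m)

rmul : ∀ {k} → Window k → ℕ → Window k
rmul {k} w r = tabulate (λ m → evalW w (sgen k r (+ toℕ m)))

permOf : ∀ k → List ℕ → Window k
permOf k ws = foldl rmul (idW {k}) ws

_≟W_ : ∀ {k} → (v w : Window k) → _
_≟W_ = ≡-dec ℤ._≟_

-- Coxeter length, as the number of inversions
--   #{(i,j) : 0 ≤ i ≤ k, j > i, w(i) > w(j)}
-- (every such j satisfies j < k+1 + 2·Σ|w(m)|, so the search range below is exhaustive).
absSum : ∀ {k} → Window k → ℕ
absSum w = sum (map ∣_∣ (toList w))

inversions : ∀ {k} → Window k → List (ℕ × ℕ)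
inversions {k} w =
  filterᵇ (λ p → ⌊ evalW w (+ proj₂ p) ℤ.<? evalW w (+ proj₁ p) ⌋)
    (concatMap (λ i → map (λ d → (i , i + suc d)) (upTo (suc k + 2 * absSum w)))
               (upTo (suc k)))

len : ∀ {k} → Window k → ℕ
len w = length (inversions w)

-- w ∈ W : window determines a bijection ℤ → ℤ (residues mod k+1 distinct)
-- and Σ_{m=1}^{k+1} w(m) = Σ_{m=1}^{k+1} m  (equivalently Σ_{m=0}^{k} w(m) = Σ_{m=0}^{k} m)
IsAffPerm : ∀ k → Window k → Set
IsAffPerm k w =
  ((a b : Fin (suc k)) → lookup w a %ℕ suc k ≡ lookup w b %ℕ suc k → a ≡ b)
  × (foldr ℤ._+_ (+ 0) (toList w) ≡ + sum (upTo (suc k)))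

-- w ∈ W^0 : w has minimal length in its coset w W_0, W_0 = ⟨s_1,…,s_k⟩
InW0 : ∀ k → Window k → Set
InW0 k w = (v : List (Fin k)) → len w ≤ len (foldl rmul w (map (λ j → suc (toℕ j)) v))

-- Affine nilCoxeter algebra 𝔸.
-- An element is a formal ℚ-combination of words in u_0,…,u_k;
-- the word u_{r_1}⋯u_{r_m} equals u_w if s_{r_1}⋯s_{r_m} is a reduced
-- expression of w, and 0 otherwise.

Word : Set
Word = List ℕ

Elem : Set
Elem = List (ℚ × Word)

isReduced : ∀ k → Word → Bool
isReduced k ws = len (permOf k ws) ≡ᵇ length ws

coeff : ∀ k → Elem → Window k → ℚ
coeff k e w =
  foldr ℚ._+_ 0ℚ
    (map proj₁ (filterᵇ (λ t → isReduced k (proj₂ t) ∧ ⌊ permOf k (proj₂ t) ≟W w ⌋) e))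

_·_ : Elem → Elem → Elem
e · f = concatMap (λ s → map (λ t → (proj₁ s ℚ.* proj₁ t , proj₂ s ++ proj₂ t)) f) e

oneE : Elem
oneE = [ (1ℚ , []) ]

scaleE : ℚ → Elem → Elem
scaleE q e = map (λ t → (q ℚ.* proj₁ t , proj₂ t)) e

prodE : List Elem → Elem
prodE = foldr _·_ oneE

choose : {A : Set} → ℕ → List A → List (List A)
choose zero xs = [ [] ]
choose (suc r) [] = []
choose (suc r) (x ∷ xs) = map (x ∷_) (choose r xs) ++ choose (suc r) xs

memℕ : ℕ → List ℕ → Bool
memℕ x xs = any (λ y → y ≡ᵇ x) xs

headOr : ℕ → List ℕ → ℕ
headOr d [] = d
headOr d (x ∷ _) = x

-- w_D for D ⊊ {0,…,k}: with a ∉ D minimal, read a+k, a+k-1, …, a+1 (mod k+1)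
-- and keep the elements of D; so s_{m+1} precedes s_m whenever m, m+1 ∈ D.
wordD : ℕ → List ℕ → Word
wordD k D = filterᵇ (λ x → memℕ x D) (map (λ t → (a + suc t) ℕ.% suc k) (downFrom k))
  where
  a : ℕ
  a = headOr 0 (filterᵇ (λ x → not (memℕ x D)) (upTo (suc k)))

hE : ℕ → ℕ → Elem
hE k r = map (λ D → (1ℚ , wordD k D)) (choose r (upTo (suc k)))

Poly : ℕ → Set
Poly k = List (ℚ × List (Fin k))

evalPoly : ∀ k → Poly k → Elem
evalPoly k P = concatMap (λ t → scaleE (proj₁ t) (prodE (map (λ j → hE k (suc (toℕ j))) (proj₂ t)))) P

InB : ∀ k → Elem → Set
InB k x = Σ (Poly k) λ P → (w : Window k) → coeff k (evalPoly k P) w ≡ coeff k x w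

-- Diagrams. Cells (a , b): row a, column b, both 1-indexed.
-- A partition is a weakly decreasing list of parts (zero parts allowed).

Cell : Set
Cell = ℕ × ℕ

partAt : List ℕ → ℕ → ℕ
partAt p zero = 0
partAt [] (suc a) = 0
partAt (x ∷ p) (suc zero) = x
partAt (x ∷ p) (suc (suc a)) = partAt p (suc a)

inShape : List ℕ → Cell → Bool
inShape p (a , b) = (1 ≤ᵇ a) ∧ (1 ≤ᵇ b) ∧ (b ≤ᵇ partAt p a)

residue : ℕ → Cell → ℕ
residue k (a , b) = (+ b ℤ.- + a) %ℕ suc k

readWord : ℕ → (Cell → Bool) → ℕ → ℕ → Word
readWord k mem maxRow maxCol =
  concatMap (λ a → concatMap (λ b → if mem (a , b) then [ residue k (a , b) ] else [])
                                   (map suc (downFrom maxCol)))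
            (map suc (downFrom maxRow))

-- partitions with at most r parts, each ≤ m, padded with zeros to length r
partsIn : ℕ → ℕ → List (List ℕ)
partsIn zero m = [ [] ]
partsIn (suc r) m = concatMap (λ x → map (x ∷_) (partsIn r x)) (upTo (suc m))

memCell : Cell → List Cell → Bool
memCell (a , b) xs = any (λ y → (proj₁ y ≡ᵇ a) ∧ (proj₂ y ≡ᵇ b)) xs

distinctRows : List Cell → Bool
distinctRows [] = true
distinctRows (x ∷ xs) = all (λ y → not (proj₁ y ≡ᵇ proj₁ x)) xs ∧ distinctRows xs

C2 : List ℕ → List Cell → Bool
C2 ν xs = all (λ x → all (λ y →
   not ((proj₁ y <ᵇ proj₁ x) ∧ (proj₂ x <ᵇ proj₂ y)) ∨ not (inShape ν (proj₁ x , proj₂ y))) xs) xs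

rowsR : ℕ → ℕ → ℕ
rowsR k c = suc k ∸ c

muPart : ℕ → ℕ → ℕ → List ℕ
muPart k c i = replicate (rowsR k c ∸ i) c ++ replicate i (c ∸ 1)

wMu : (k c i : ℕ) → Window k
wMu k c i = permOf k (readWord k (inShape (muPart k c i)) (rowsR k c) c)

bottomCells : ℕ → ℕ → List ℕ → List Cell
bottomCells k c RL =
  concatMap (λ a → map (λ b → (a , b)) (map suc (upTo (partAt RL a))))
            (map (λ t → rowsR k c + suc t) (upTo (rowsR k c)))

admissible : ℕ → ℕ → ℕ → List ℕ → List (List Cell)
admissible k c i RL =
  filterᵇ (λ xs → distinctRows xs ∧ C2 RL xs) (choose i (bottomCells k c RL))

skewWord : ℕ → ℕ → List ℕ → List Cell → Word
skewWord k c lam xs =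
  readWord k (λ x → inShape RL x ∧ not (inShape lam x) ∧ not (memCell x xs))
           (rowsR k c + rowsR k c) c
  where
  RL : List ℕ
  RL = replicate (rowsR k c) c ++ lam

rhs : ℕ → ℕ → ℕ → Elem
rhs k c i =
  concatMap (λ lam → let RL = replicate (rowsR k c) c ++ lam in
                     map (λ xs → (1ℚ , skewWord k c lam xs)) (admissible k c i RL))
            (partsIn (rowsR k c) c)

-- x = s̃^{(k)}_μ for μ ⊆ R, with w_μ given: x ∈ 𝔹 and, for every w ∈ W^0,
-- the coefficient of 𝐮_w in x is 1 if w = w_μ and 0 otherwise.
IsNCkSchur : ∀ k → Window k → Elem → Set
IsNCkSchur k wμ x =
  InB k x ×
  ((w : Window k) → IsAffPerm k w → InW0 k w →
     coeff k x w ≡ (if ⌊ w ≟W wμ ⌋ then 1ℚ else 0ℚ))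

{-# OPTIONS --safe #-}

-- The subalgebra is the common kernel of Monk (Chevalley) operators, and its
-- elements are determined by their coefficients on minimal coset
-- representatives. The terms of the right-hand side are exactly the w for
-- which g(q) = w(q) + m − n satisfies q − n ≤ g(q) ≤ q and is noncrossing (no
-- e − n ≤ g(f) < g(e) < f < e), each occurring once. Exchanging the covers
-- w·t(p,b) and w·t(a,p) and summing over a window puts the sum in the kernel;
-- its only minimal coset representative is w_μ.

module Submission where

open import Data.Bool using (Bool; true; false; if_then_else_; T; T?; _∧_; _∨_; not)
import Data.Bool.Properties as Boolₚ
open import Data.Empty using (⊥; ⊥-elim)
open import Data.Fin as Fin using (Fin; toℕ; fromℕ<; zero; suc)
open import Data.Integer as ℤ using (ℤ; +_; -[1+_]; 0ℤ; 1ℤ; _%ℕ_; _/ℕ_; ∣_∣; +≤+; +<+)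
import Data.Integer.Properties as ℤP
open import Data.List as List using (List; []; _∷_; [_]; _++_; map; concatMap; length)
open import Data.List.Relation.Unary.All as All using (All; []; _∷_)
open import Data.List.Relation.Unary.Any as Any using (Any; here; there)
open import Data.Nat as ℕ using (ℕ; zero; suc)
open import Data.Product using (_×_; _,_; proj₁; proj₂; Σ; ∃)
import Data.Rational.Properties as ℚP
open import Data.Sum using (_⊎_; inj₁; inj₂)
open import Data.Unit using (⊤; tt)
open import Data.Vec as Vec using (Vec; lookup; []; _∷_)
open import Function using (_∘_; id; _$_; flip)
open import Relation.Binary using (tri<; tri≈; tri>; IsStrictPartialOrder; IsEquivalence)
open import Relation.Binary.PropositionalEquality hiding ([_])
open import Relation.Nullary using (¬_; Dec; yes; no)
open import Relation.Nullary.Decidable using (⌊_⌋; _×-dec_; _⊎-dec_; _→-dec_; ¬?; map′; does; toWitness)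

-- That the kernel lies in 𝔹 asks for an actual polynomial. It comes from triangularity: on
-- increasing permutations, multiplying by 𝐡_r, with r the number of low letters of x, carries the
-- point function of a shorter element to that of x, up to points with more low letters. So some
-- polynomial agrees with a given element on minimal coset representatives; the difference is again
-- in the kernel and vanishes by transitions. The exchange of covers is proved only in one
-- direction. For each p there is at most one admissible cover to the right, and it produces some
-- admissible cover from the left, an inequality between two counts. Over a period the two totals
-- agree, so every inequality is an equality; this replaces the construction of an inverse exchange.
-- Cutting the circle at s turns a noncrossing element into a `Conf`, a line of holes, free slots
-- and attached slots. The cut is a parameter because three are used: 1 - m gives the skew diagrams,
-- 1 makes increasing permutations visible, and the point just above g(b) is where the exchange is
-- read off.

-- Linear integer arithmetic by reflection

module LinearArithmetic where

 open import Data.Integer using (_+_; _*_; -_; _-_; _≤_; _<_)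
 open import Data.Integer.Tactic.RingSolver using (solve-∀)
 open import Data.Bool.Properties using (T-∧; T-∨)
 import Data.List.Relation.Unary.Any.Properties as Anyₚ
 import Data.List.Relation.Unary.All.Properties as Allₚ
 open import Data.Vec using (replicate; zipWith)
 open import Function.Bundles using (module Equivalence)

 Con : ℕ → Set
 Con m = ℤ × Vec ℤ m

 dot : ∀ {m} → Vec ℤ m → Vec ℤ m → ℤ
 dot [] [] = 0ℤ
 dot (a ∷ as) (x ∷ xs) = a * x + dot as xs

 ev : ∀ {m} → Vec ℤ m → Con m → ℤ
 ev ρ (c , as) = c + dot as ρ

 addC : ∀ {m} → Con m → Con m → Con m
 addC (c , as) (d , bs) = c + d , zipWith _+_ as bs

 scaleC : ∀ {m} → ℤ → Con m → Con m
 scaleC q (c , as) = q * c , Vec.map (q *_) as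

 dot-add : ∀ {m} (as bs ρ : Vec ℤ m) → dot (zipWith _+_ as bs) ρ ≡ dot as ρ + dot bs ρ
 dot-add [] [] [] = refl
 dot-add (a ∷ as) (b ∷ bs) (x ∷ ρ) rewrite dot-add as bs ρ = shuffle a b x (dot as ρ) (dot bs ρ)
  where
  shuffle : ∀ a b x s t → (a + b) * x + (s + t) ≡ a * x + s + (b * x + t)
  shuffle = solve-∀

 dot-scale : ∀ {m} q (as ρ : Vec ℤ m) → dot (Vec.map (q *_) as) ρ ≡ q * dot as ρ
 dot-scale q [] [] = sym (ℤP.*-zeroʳ q)
 dot-scale q (a ∷ as) (x ∷ ρ) rewrite dot-scale q as ρ = shuffle q a x (dot as ρ)
  where
  shuffle : ∀ q a x s → q * a * x + q * s ≡ q * (a * x + s)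
  shuffle = solve-∀

 ev-add : ∀ {m} (ρ : Vec ℤ m) p q → ev ρ (addC p q) ≡ ev ρ p + ev ρ q
 ev-add ρ (c , as) (d , bs) rewrite dot-add as bs ρ = shuffle c d (dot as ρ) (dot bs ρ)
  where
  shuffle : ∀ c d s t → c + d + (s + t) ≡ c + s + (d + t)
  shuffle = solve-∀

 ev-scale : ∀ {m} (ρ : Vec ℤ m) q p → ev ρ (scaleC q p) ≡ q * ev ρ p
 ev-scale ρ q (c , as) rewrite dot-scale q as ρ = sym (ℤP.*-distribˡ-+ q c (dot as ρ))

 data Expr (m : ℕ) : Set where
  var : Fin m → Expr m
  con : ℤ → Expr m
  _:+_ _:-_ : Expr m → Expr m → Expr m

 infixl 6 _:+_ _:-_

 ⟦_⟧ₑ : ∀ {m} → Expr m → Vec ℤ m → ℤ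
 ⟦ var i ⟧ₑ ρ = lookup ρ i
 ⟦ con c ⟧ₑ ρ = c
 ⟦ e :+ f ⟧ₑ ρ = ⟦ e ⟧ₑ ρ + ⟦ f ⟧ₑ ρ
 ⟦ e :- f ⟧ₑ ρ = ⟦ e ⟧ₑ ρ - ⟦ f ⟧ₑ ρ

 unit : ∀ {m} → Fin m → Vec ℤ m
 unit zero = 1ℤ ∷ replicate _ 0ℤ
 unit (suc i) = 0ℤ ∷ unit i

 dot-zero : ∀ {m} (ρ : Vec ℤ m) → dot (replicate m 0ℤ) ρ ≡ 0ℤ
 dot-zero [] = refl
 dot-zero (x ∷ ρ) rewrite dot-zero ρ | ℤP.*-zeroˡ x = refl

 dot-unit : ∀ {m} (i : Fin m) ρ → dot (unit i) ρ ≡ lookup ρ i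
 dot-unit zero (x ∷ ρ) rewrite dot-zero ρ = trans (ℤP.+-identityʳ _) (ℤP.*-identityˡ x)
 dot-unit (suc i) (x ∷ ρ) rewrite dot-unit i ρ | ℤP.*-zeroˡ x = ℤP.+-identityˡ _

 norm : ∀ {m} → Expr m → Con m
 norm (var i) = 0ℤ , unit i
 norm (con c) = c , replicate _ 0ℤ
 norm (e :+ f) = addC (norm e) (norm f)
 norm (e :- f) = addC (norm e) (scaleC (-[1+ 0 ]) (norm f))

 norm-sound : ∀ {m} (ρ : Vec ℤ m) e → ev ρ (norm e) ≡ ⟦ e ⟧ₑ ρ
 norm-sound ρ (var i) = trans (ℤP.+-identityˡ _) (dot-unit i ρ)
 norm-sound ρ (con c) = trans (cong (λ z → c + z) (dot-zero ρ)) (ℤP.+-identityʳ c)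
 norm-sound ρ (e :+ f) = trans (ev-add ρ (norm e) (norm f)) (cong₂ _+_ (norm-sound ρ e) (norm-sound ρ f))
 norm-sound ρ (e :- f) = trans (ev-add ρ (norm e) (scaleC (-[1+ 0 ]) (norm f)))
  (cong₂ _+_ (norm-sound ρ e)
   (trans (ev-scale ρ (-[1+ 0 ]) (norm f)) (trans (ℤP.-1*i≡-i _) (cong -_ (norm-sound ρ f)))))

 Holds : ∀ {m} → Vec ℤ m → Con m → Set
 Holds ρ p = 0ℤ ≤ ev ρ p

 -- Fourier–Motzkin elimination of the first variable.
 data Sign (m : ℕ) : Set where
  pos neg : ℕ → Con m → Sign m
  nil : Con m → Sign m

 sign : ∀ {m} → Con (suc m) → Sign m
 sign (c , (+ zero) ∷ as) = nil (c , as)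
 sign (c , (+ suc i) ∷ as) = pos i (c , as)
 sign (c , -[1+ j ] ∷ as) = neg j (c , as)

 HoldsS : ∀ {m} → ℤ → Vec ℤ m → Sign m → Set
 HoldsS x ρ (pos i p) = 0ℤ ≤ + suc i * x + ev ρ p
 HoldsS x ρ (neg j p) = 0ℤ ≤ -[1+ j ] * x + ev ρ p
 HoldsS x ρ (nil p) = 0ℤ ≤ ev ρ p

 sign-sound : ∀ {m} x (ρ : Vec ℤ m) p → Holds (x ∷ ρ) p → HoldsS x ρ (sign p)
 sign-sound x ρ (c , (+ zero) ∷ as) h =
  subst (0ℤ ≤_) (cong (λ z → c + z) (trans (cong (_+ dot as ρ) (ℤP.*-zeroˡ x)) (ℤP.+-identityˡ _))) h
 sign-sound x ρ (c , (+ suc i) ∷ as) h = subst (0ℤ ≤_) (swap c (+ suc i) x (dot as ρ)) h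
  where
  swap : ∀ c a x s → c + (a * x + s) ≡ a * x + (c + s)
  swap = solve-∀
 sign-sound x ρ (c , -[1+ j ] ∷ as) h = subst (0ℤ ≤_) (swap c -[1+ j ] x (dot as ρ)) h
  where
  swap : ∀ c a x s → c + (a * x + s) ≡ a * x + (c + s)
  swap = solve-∀

 combine : ∀ {m} → Sign m → Sign m → List (Con m)
 combine (pos i p) (neg j q) = addC (scaleC (+ suc j) p) (scaleC (+ suc i) q) ∷ []
 combine _ _ = []

 nils : ∀ {m} → Sign m → List (Con m)
 nils (nil p) = p ∷ []
 nils _ = []

 nonneg-* : ∀ i {x} → 0ℤ ≤ x → 0ℤ ≤ + suc i * x
 nonneg-* i {x} h = subst (_≤ + suc i * x) (ℤP.*-zeroʳ (+ suc i)) (ℤP.*-monoˡ-≤-nonNeg (+ suc i) h)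

 nonneg-+ : ∀ {x y} → 0ℤ ≤ x → 0ℤ ≤ y → 0ℤ ≤ x + y
 nonneg-+ = ℤP.+-mono-≤

 combine-sound : ∀ {m} x (ρ : Vec ℤ m) s t → HoldsS x ρ s → HoldsS x ρ t → All (Holds ρ) (combine s t)
 combine-sound x ρ (pos i p) (neg j q) hs ht = subst (0ℤ ≤_) eq (nonneg-+ (nonneg-* j hs) (nonneg-* i ht)) ∷ []
  where
  cancel : ∀ a b x s t → a * (b * x + s) + b * (- a * x + t) ≡ a * s + b * t
  cancel = solve-∀
  eq : + suc j * (+ suc i * x + ev ρ p) + + suc i * (-[1+ j ] * x + ev ρ q)
    ≡ ev ρ (addC (scaleC (+ suc j) p) (scaleC (+ suc i) q))
  eq rewrite ev-add ρ (scaleC (+ suc j) p) (scaleC (+ suc i) q)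
       | ev-scale ρ (+ suc j) p | ev-scale ρ (+ suc i) q = cancel (+ suc j) (+ suc i) x (ev ρ p) (ev ρ q)
 combine-sound x ρ (pos _ _) (pos _ _) hs ht = []
 combine-sound x ρ (pos _ _) (nil _) hs ht = []
 combine-sound x ρ (neg _ _) _ hs ht = []
 combine-sound x ρ (nil _) _ hs ht = []

 nils-sound : ∀ {m} x (ρ : Vec ℤ m) s → HoldsS x ρ s → All (Holds ρ) (nils s)
 nils-sound x ρ (pos _ _) h = []
 nils-sound x ρ (neg _ _) h = []
 nils-sound x ρ (nil _) h = h ∷ []

 -- Only two constraints of opposite sign cancel the variable. `combine` accepts them in the order
 -- positive, negative, and each such pair occurs once in that order among the ordered pairs from
 -- `ss`.
 eliminate : ∀ {m} → List (Con (suc m)) → List (Con m)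
 eliminate ps = concatMap nils ss ++ concatMap (λ s → concatMap (combine s) ss) ss
  where ss = map sign ps

 All-concatMap : ∀ {A B : Set} {P : A → Set} {Q : B → Set} (f : A → List B) →
  (∀ a → P a → All Q (f a)) → ∀ {as} → All P as → All Q (concatMap f as)
 All-concatMap f h [] = []
 All-concatMap f h (p ∷ ps) = Allₚ.++⁺ (h _ p) (All-concatMap f h ps)

 eliminate-sound : ∀ {m} x (ρ : Vec ℤ m) ps → All (Holds (x ∷ ρ)) ps → All (Holds ρ) (eliminate ps)
 eliminate-sound x ρ ps hs = Allₚ.++⁺ (All-concatMap nils (nils-sound x ρ) hss)
   (All-concatMap _ (λ s h → All-concatMap (combine s) (λ t → combine-sound x ρ s t h) hss) hss)
  where
  hss : All (HoldsS x ρ) (map sign ps)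
  hss = Allₚ.map⁺ (All.map (λ {p} → sign-sound x ρ p) hs)

 negative : ℤ → Bool
 negative (+ _) = false
 negative -[1+ _ ] = true

 -- Without variables only constants remain, and one negative constant is a contradiction. The
 -- elimination is the rational one, so `false` does not assert that an integer solution exists.
 refute : ∀ {m} → List (Con m) → Bool
 refute {zero} [] = false
 refute {zero} ((c , _) ∷ ps) = negative c ∨ refute ps
 refute {suc m} ps = refute (eliminate ps)

 refute-sound : ∀ {m} (ρ : Vec ℤ m) ps → T (refute ps) → All (Holds ρ) ps → ⊥
 refute-sound [] ((+ n , []) ∷ ps) r (h ∷ hs) = refute-sound [] ps r hs
 refute-sound [] ((-[1+ n ] , []) ∷ ps) r (() ∷ hs)
 refute-sound (x ∷ ρ) ps r hs = refute-sound ρ (eliminate ps) r (eliminate-sound x ρ ps hs)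

 data Form (m : ℕ) : Set where
  _=<_ _<:_ _≐_ : Expr m → Expr m → Form m
  false' : Form m
  _∧'_ _∨'_ _=>_ : Form m → Form m → Form m
  ¬'_ : Form m → Form m

 infix 5 _=<_ _<:_ _≐_
 infix 4 ¬'_
 infixr 3 _∧'_
 infixr 2 _∨'_
 infixr 1 _=>_

 ⟦_⟧ : ∀ {m} → Form m → Vec ℤ m → Set
 ⟦ e =< f ⟧ ρ = ⟦ e ⟧ₑ ρ ≤ ⟦ f ⟧ₑ ρ
 ⟦ e <: f ⟧ ρ = ⟦ e ⟧ₑ ρ < ⟦ f ⟧ₑ ρ
 ⟦ e ≐ f ⟧ ρ = ⟦ e ⟧ₑ ρ ≡ ⟦ f ⟧ₑ ρ
 ⟦ false' ⟧ ρ = ⊥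
 ⟦ φ ∧' ψ ⟧ ρ = ⟦ φ ⟧ ρ × ⟦ ψ ⟧ ρ
 ⟦ φ ∨' ψ ⟧ ρ = ⟦ φ ⟧ ρ ⊎ ⟦ ψ ⟧ ρ
 ⟦ φ => ψ ⟧ ρ = ⟦ φ ⟧ ρ → ⟦ ψ ⟧ ρ
 ⟦ ¬' φ ⟧ ρ = ¬ ⟦ φ ⟧ ρ

 dec : ∀ {m} (φ : Form m) ρ → Dec (⟦ φ ⟧ ρ)
 dec (e =< f) ρ = ⟦ e ⟧ₑ ρ ℤP.≤? ⟦ f ⟧ₑ ρ
 dec (e <: f) ρ = ⟦ e ⟧ₑ ρ ℤP.<? ⟦ f ⟧ₑ ρ
 dec (e ≐ f) ρ = ⟦ e ⟧ₑ ρ ℤP.≟ ⟦ f ⟧ₑ ρ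
 dec false' ρ = no id
 dec (φ ∧' ψ) ρ = dec φ ρ ×-dec dec ψ ρ
 dec (φ ∨' ψ) ρ = dec φ ρ ⊎-dec dec ψ ρ
 dec (φ => ψ) ρ = dec φ ρ →-dec dec ψ ρ
 dec (¬' φ) ρ = ¬? (dec φ ρ)

 DNF : ℕ → Set
 DNF m = List (List (Con m))

 -- Integrality enters here: e < f becomes f - e - 1 ≥ 0, so negated inequalities are again weak
 -- inequalities.
 le lt : ∀ {m} → Expr m → Expr m → Con m
 le e f = norm (f :- e)
 lt e f = norm (f :- e :- con 1ℤ)

 _⊗_ : ∀ {m} → DNF m → DNF m → DNF m
 ps ⊗ qs = concatMap (λ p → map (p ++_) qs) ps

 -- Normal forms of a formula and of its negation, computed together so that implications and
 -- negations just exchange the two.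
 dnf⁺ dnf⁻ : ∀ {m} → Form m → DNF m
 dnf⁺ (e =< f) = (le e f ∷ []) ∷ []
 dnf⁺ (e <: f) = (lt e f ∷ []) ∷ []
 dnf⁺ (e ≐ f) = (le e f ∷ le f e ∷ []) ∷ []
 dnf⁺ false' = []
 dnf⁺ (φ ∧' ψ) = dnf⁺ φ ⊗ dnf⁺ ψ
 dnf⁺ (φ ∨' ψ) = dnf⁺ φ ++ dnf⁺ ψ
 dnf⁺ (φ => ψ) = dnf⁻ φ ++ dnf⁺ ψ
 dnf⁺ (¬' φ) = dnf⁻ φ
 dnf⁻ (e =< f) = (lt f e ∷ []) ∷ []
 dnf⁻ (e <: f) = (le f e ∷ []) ∷ []
 dnf⁻ (e ≐ f) = (lt e f ∷ []) ∷ (lt f e ∷ []) ∷ []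
 dnf⁻ false' = [] ∷ []
 dnf⁻ (φ ∧' ψ) = dnf⁻ φ ++ dnf⁻ ψ
 dnf⁻ (φ ∨' ψ) = dnf⁻ φ ⊗ dnf⁻ ψ
 dnf⁻ (φ => ψ) = dnf⁺ φ ⊗ dnf⁻ ψ
 dnf⁻ (¬' φ) = dnf⁺ φ

 Sat : ∀ {m} → Vec ℤ m → DNF m → Set
 Sat ρ = Any (All (Holds ρ))

 le-sound : ∀ {m} (ρ : Vec ℤ m) e f → ⟦ e =< f ⟧ ρ → Holds ρ (le e f)
 le-sound ρ e f h = subst (0ℤ ≤_) (sym (norm-sound ρ (f :- e))) (ℤP.i≤j⇒0≤j-i h)

 lt-sound : ∀ {m} (ρ : Vec ℤ m) e f → ⟦ e <: f ⟧ ρ → Holds ρ (lt e f)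
 lt-sound ρ e f h = subst (0ℤ ≤_) (trans (shuffle (⟦ e ⟧ₑ ρ) (⟦ f ⟧ₑ ρ)) (sym (norm-sound ρ (f :- e :- con 1ℤ))))
   (ℤP.i≤j⇒0≤j-i (ℤP.i<j⇒suc[i]≤j h))
  where
  shuffle : ∀ a b → b - (1ℤ + a) ≡ b - a - 1ℤ
  shuffle = solve-∀

 ⊗-sound : ∀ {m} (ρ : Vec ℤ m) ps qs → Sat ρ ps → Sat ρ qs → Sat ρ (ps ⊗ qs)
 ⊗-sound ρ (p ∷ ps) qs (here h) hq = Anyₚ.++⁺ˡ (Anyₚ.map⁺ (Any.map (Allₚ.++⁺ h) hq))
 ⊗-sound ρ (p ∷ ps) qs (there h) hq = Anyₚ.++⁺ʳ (map (p ++_) qs) (⊗-sound ρ ps qs h hq)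

 -- The classical case splits behind the two normal forms are justified by `dec`: every formula is
 -- decidable at a given valuation.
 dnf⁺-sound : ∀ {m} (ρ : Vec ℤ m) φ → ⟦ φ ⟧ ρ → Sat ρ (dnf⁺ φ)
 dnf⁻-sound : ∀ {m} (ρ : Vec ℤ m) φ → ¬ ⟦ φ ⟧ ρ → Sat ρ (dnf⁻ φ)
 dnf⁺-sound ρ (e =< f) h = here (le-sound ρ e f h ∷ [])
 dnf⁺-sound ρ (e <: f) h = here (lt-sound ρ e f h ∷ [])
 dnf⁺-sound ρ (e ≐ f) h =
  here (le-sound ρ e f (ℤP.≤-reflexive h) ∷ le-sound ρ f e (ℤP.≤-reflexive (sym h)) ∷ [])
 dnf⁺-sound ρ (φ ∧' ψ) (h , h') = ⊗-sound ρ (dnf⁺ φ) (dnf⁺ ψ) (dnf⁺-sound ρ φ h) (dnf⁺-sound ρ ψ h')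
 dnf⁺-sound ρ (φ ∨' ψ) (inj₁ h) = Anyₚ.++⁺ˡ (dnf⁺-sound ρ φ h)
 dnf⁺-sound ρ (φ ∨' ψ) (inj₂ h) = Anyₚ.++⁺ʳ (dnf⁺ φ) (dnf⁺-sound ρ ψ h)
 dnf⁺-sound ρ (φ => ψ) h with dec φ ρ
 ... | yes p = Anyₚ.++⁺ʳ (dnf⁻ φ) (dnf⁺-sound ρ ψ (h p))
 ... | no ¬p = Anyₚ.++⁺ˡ (dnf⁻-sound ρ φ ¬p)
 dnf⁺-sound ρ (¬' φ) h = dnf⁻-sound ρ φ h
 dnf⁻-sound ρ (e =< f) h = here (lt-sound ρ f e (ℤP.≰⇒> h) ∷ [])
 dnf⁻-sound ρ (e <: f) h = here (le-sound ρ f e (ℤP.≮⇒≥ h) ∷ [])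
 dnf⁻-sound ρ (e ≐ f) h with ℤP.<-cmp (⟦ e ⟧ₑ ρ) (⟦ f ⟧ₑ ρ)
 ... | tri< a _ _ = here (lt-sound ρ e f a ∷ [])
 ... | tri≈ _ b _ = ⊥-elim (h b)
 ... | tri> _ _ c = there (here (lt-sound ρ f e c ∷ []))
 dnf⁻-sound ρ false' h = here []
 dnf⁻-sound ρ (φ ∧' ψ) h with dec φ ρ
 ... | yes p = Anyₚ.++⁺ʳ (dnf⁻ φ) (dnf⁻-sound ρ ψ (λ q → h (p , q)))
 ... | no ¬p = Anyₚ.++⁺ˡ (dnf⁻-sound ρ φ ¬p)
 dnf⁻-sound ρ (φ ∨' ψ) h = ⊗-sound ρ (dnf⁻ φ) (dnf⁻ ψ) (dnf⁻-sound ρ φ (h ∘ inj₁)) (dnf⁻-sound ρ ψ (h ∘ inj₂))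
 dnf⁻-sound ρ (φ => ψ) h with dec φ ρ
 ... | yes p = ⊗-sound ρ (dnf⁺ φ) (dnf⁻ ψ) (dnf⁺-sound ρ φ p) (dnf⁻-sound ρ ψ (λ q → h (λ _ → q)))
 ... | no ¬p = ⊥-elim (h (λ p → ⊥-elim (¬p p)))
 dnf⁻-sound ρ (¬' φ) h with dec φ ρ
 ... | yes p = dnf⁺-sound ρ φ p
 ... | no ¬p = ⊥-elim (h ¬p)

 valid : ∀ {m} → DNF m → Bool
 valid [] = true
 valid (p ∷ ps) = refute p ∧ valid ps

 valid-sound : ∀ {m} (ρ : Vec ℤ m) ps → T (valid ps) → ¬ Sat ρ ps
 valid-sound ρ (p ∷ ps) v (here h) = refute-sound ρ p (proj₁ (Equivalence.to T-∧ v)) h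
 valid-sound ρ (p ∷ ps) v (there h) = valid-sound ρ ps (proj₂ (Equivalence.to (T-∧ {refute p}) v)) h

 form-sound : ∀ {m} (φ : Form m) ρ → T (valid (dnf⁻ φ)) → ⟦ φ ⟧ ρ
 form-sound φ ρ v with dec φ ρ
 ... | yes p = p
 ... | no ¬p = ⊥-elim (valid-sound ρ (dnf⁻ φ) v (dnf⁻-sound ρ φ ¬p))

 Nary : ℕ → Set → Set → Set
 Nary zero A B = B
 Nary (suc m) A B = A → Nary m A B

 apply : ∀ {m} {A B : Set} → Nary m A B → Vec A m → B
 apply f [] = f
 apply f (x ∷ xs) = apply (f x) xs

 vars : ∀ m → Vec (Expr m) m
 vars m = Vec.map var (Vec.allFin m)

 ForAll : ∀ m → (Vec ℤ m → Set) → Set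
 ForAll zero P = P []
 ForAll (suc m) P = ∀ x → ForAll m (λ xs → P (x ∷ xs))

 forAll : ∀ m {P : Vec ℤ m → Set} → (∀ ρ → P ρ) → ForAll m P
 forAll zero h = h []
 forAll (suc m) h = λ x → forAll m (λ ρ → h (x ∷ ρ))

 #0 #1 #2 : ∀ {m} → Expr m
 #0 = con 0ℤ
 #1 = con 1ℤ
 #2 = con (+ 2)

 -- The hidden argument reduces to the unit type once the refutation of the negated formula
 -- evaluates to `true`. The check thus runs during type checking, and a caller supplies only the
 -- terms and the hypotheses.
 lia : ∀ m (φ : Nary m (Expr m) (Form m)) → {T (valid (dnf⁻ (apply φ (vars m))))} →
  ForAll m ⟦ apply φ (vars m) ⟧
 lia m φ {v} = forAll m (λ ρ → form-sound (apply φ (vars m)) ρ v)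

open LinearArithmetic using (con; _:+_; _:-_; _=<_; _<:_; _≐_; false'; _∧'_; _∨'_; _=>_; ¬'_; lia; #0; #1; #2)

-- Ring identities over the rationals

module ℚ-Algebra where

 open import Data.Maybe using (nothing)
 open import Data.Rational using (ℚ; 0ℚ; _+_; _-_; _*_; -_)
 open import Level using (0ℓ)
 open import Tactic.RingSolver using (solve-∀)
 open import Tactic.RingSolver.Core.AlmostCommutativeRing using (AlmostCommutativeRing; fromCommutativeRing)

 ℚ-ring : AlmostCommutativeRing 0ℓ 0ℓ
 ℚ-ring = fromCommutativeRing ℚP.+-*-commutativeRing (λ _ → nothing)

 ℚ-interchange : ∀ a b c d → a + b + (c + d) ≡ a + c + (b + d)
 ℚ-interchange = solve-∀ ℚ-ring

 ℚ-minus-minus : ∀ z o f → z - (- o) * f ≡ z + o * f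
 ℚ-minus-minus = solve-∀ ℚ-ring

 ℚ-split : ∀ r l b c f → r + b * f - (l - c * f) ≡ r - l + f * (b + c)
 ℚ-split = solve-∀ ℚ-ring

 ℚ-collect : ∀ a b h h' g g' → a * h - b * g + (a * h' - b * g') ≡ a * (h + h') + (- b) * (g + g')
 ℚ-collect = solve-∀ ℚ-ring

 ℚ-sub-interchange : ∀ a b c d → a + b - (c + d) ≡ a - c + (b - d)
 ℚ-sub-interchange = solve-∀ ℚ-ring

 ℚ-sub-* : ∀ q a b → q * a - q * b ≡ q * (a - b)
 ℚ-sub-* = solve-∀ ℚ-ring

 ℚ-neg-neg : ∀ q → - (- q) ≡ q
 ℚ-neg-neg = solve-∀ ℚ-ring

open import Defs
open import Algebra.Properties.Group ℚP.+-0-group using (∙-cancelˡ)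
open import Data.Bool.ListAction using (all; any)
import Data.Fin.Induction as FinInd
import Data.Fin.Properties as Finₚ
open import Data.Integer.DivMod using (n%ℕd<d; a≡a%ℕn+[a/ℕn]*n)
open import Data.List using (foldl; foldr; filterᵇ; applyUpTo; upTo; downFrom; replicate)
import Data.List.Properties as Listₚ
open import Data.List.Membership.Propositional using (_∈_; _∉_)
open import Data.List.Membership.Propositional.Properties using (∈-++⁻; ∈-++⁺ˡ; ∈-++⁺ʳ; ∈-map⁺; ∈-map⁻; ∈-upTo⁺; ∈-upTo⁻; ∈-downFrom⁺; ∈-downFrom⁻)
open import Data.List.Relation.Binary.Permutation.Propositional as Perm using (_↭_; ↭-sym; ↭-trans; ↭-refl; prep; ↭-reflexive)
import Data.List.Relation.Binary.Permutation.Propositional.Properties as Permₚ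
import Data.List.Relation.Binary.Permutation.Setoid.Properties as PermSₚ
open import Data.List.Relation.Binary.Sublist.Propositional using (_⊆_; []; _∷_; _∷ʳ_)
import Data.List.Relation.Binary.Sublist.Propositional as Sublist
import Data.List.Relation.Binary.Sublist.Propositional.Properties as Sublistₚ
open import Data.List.Relation.Unary.AllPairs using (AllPairs; []; _∷_)
open import Data.List.Relation.Unary.Unique.Propositional using (Unique)
import Data.List.Relation.Unary.Unique.Propositional.Properties as Uniqueₚ
import Data.Nat.DivMod as ℕ
open import Data.Nat.Induction using (<-wellFounded; <-rec)
open import Data.Nat.ListAction using (sum)
import Data.Nat.Properties as ℕP
open import Data.Product.Properties using (,-injectiveʳ-UIP)
open import Data.Rational as ℚ using (ℚ; 0ℚ; 1ℚ)
open import Data.Vec using (tabulate; toList; _[_]≔_)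
import Data.Vec.Properties as Vecₚ
open import Data.Vec.Relation.Binary.Lex.Strict as Lex using (this; next)
import Data.Vec.Relation.Binary.Pointwise.Inductive as Pointwise
open import Induction.WellFounded using (Acc; acc; WellFounded)
open ℚ-Algebra

module Development (k : ℕ) (1≤k : 1 ℕ.≤ k) where

 open import Data.Integer using (_+_; _*_; -_; _-_; _≤_; _<_)
 open import Data.Integer.Tactic.RingSolver using (solve-∀)
 open import Data.Integer.Properties using (*-zeroˡ; *-identityˡ; neg-distribˡ-*; *-distribʳ-+; *-cancelʳ-≡; +-identityʳ; +-identityˡ; +-injective; +-comm; +-assoc; _<?_; +-monoˡ-<; 0≤i⇒+∣i∣≡i; <-cmp; <-asym; <-trans; <-irrefl; +-monoʳ-<; ≤∧≢⇒<; ≮⇒≥; _≟_; drop‿+≤+; <-≤-trans; ≤-trans; drop‿+<+; <⇒≤; ≰⇒>; _≤?_; ≤-reflexive; ≤-refl; ≤-<-trans; suc-*; *-cancelˡ-≡; *-zeroʳ; +-monoˡ-≤; i*j≡0⇒i≡0∨j≡0; +-monoʳ-≤; <⇒≱)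
 open import Data.Nat.Properties using (m≤m+n; suc-injective; +-suc; m≤n+m; n≤1+n; n<1+n; m<n⇒m<1+n; <⇒≢; <⇒≤pred; m≤m⊔n; m≤n⊔m; m+[n∸m]≡n; ≤-pred; m<m+n; m≤n⇒m≤1+n; m∸n+n≡m)
 open import Data.List.Properties using (++-identityʳ; ++-assoc; length-++)

 -- Integers modulo n

 0≤+ : ∀ {u} → 0ℤ ≤ + u
 0≤+ = +≤+ ℕ.z≤n

 n : ℕ
 n = suc k

 opaque
  -- `N` and its multiples are opaque so that `lia` meets them as atoms; facts about multiples pass
  -- through the lemmas of this block.
  N : ℤ
  N = + n

  N-def : N ≡ + n
  N-def = refl

  infix 8 _·N
  _·N : ℤ → ℤ
  t ·N = t * + n

  ·N-def : ∀ t → t ·N ≡ t * + n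
  ·N-def t = refl

  2≤N : + 2 ≤ N
  2≤N = +≤+ (ℕ.s≤s 1≤k)

  -- The one nonlinear fact about multiples of `N`. It turns congruences into case distinctions
  -- between linear inequalities.
  mult-gap : ∀ t → t ·N ≤ - N ⊎ t ≡ 0ℤ ⊎ N ≤ t ·N
  mult-gap (+ zero) = inj₂ (inj₁ refl)
  mult-gap (+ suc t) = inj₂ (inj₂ (+≤+ (m≤m+n n (t ℕ.* n))))
  mult-gap -[1+ t ] = inj₁ (ℤ.-≤- (m≤m+n k (t ℕ.* n)))

  0·N : 0ℤ ·N ≡ 0ℤ
  0·N = *-zeroˡ (+ n)

  1·N : 1ℤ ·N ≡ N
  1·N = *-identityˡ (+ n)

  -·N : ∀ t → (- t) ·N ≡ - (t ·N)
  -·N t = sym (neg-distribˡ-* t (+ n))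

  +·N : ∀ s t → (s + t) ·N ≡ s ·N + t ·N
  +·N s t = *-distribʳ-+ (+ n) s t

  ·N-injective : ∀ {s t} → s ·N ≡ t ·N → s ≡ t
  ·N-injective {s} {t} = *-cancelʳ-≡ s t (+ n)

 infix 4 _~_ _~/_

 record _~_ (a b : ℤ) : Set where
  constructor winds
  field
   turns : ℤ
   shift : a ≡ b + turns ·N

 _~/_ : ℤ → ℤ → Set
 a ~/ b = ¬ a ~ b

 ~-reflexive : ∀ {a b} → a ≡ b → a ~ b
 ~-reflexive {a} refl = winds 0ℤ $ sym (trans (cong (λ z → a + z) 0·N) (+-identityʳ a))

 ~-refl : ∀ {a} → a ~ a
 ~-refl = ~-reflexive refl

 ~-sym : ∀ {a b} → a ~ b → b ~ a
 ~-sym {a} {b} (winds t e) = winds (- t) $ lia 4 (λ a b s u → a ≐ b :+ s => u ≐ #0 :- s => b ≐ a :+ u) a b (t ·N) ((- t) ·N) e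
  (trans (-·N t) (sym (+-identityˡ _)))

 ~-trans : ∀ {a b c} → a ~ b → b ~ c → a ~ c
 ~-trans {a} {b} {c} (winds t e) (winds s f) = winds (s + t) $
  trans (lia 5 (λ a b c s t → a ≐ b :+ t => b ≐ c :+ s => a ≐ c :+ (s :+ t)) a b c (s ·N) (t ·N) e f)
     (cong (λ z → c + z) (sym (+·N s t)))

 ~-shift : ∀ {a b} d → a ~ b → a + d ~ b + d
 ~-shift {a} {b} d (winds t e) = winds t $ lia 4 (λ a b d s → a ≐ b :+ s => a :+ d ≐ b :+ d :+ s) a b d (t ·N) e

 ~-gap : ∀ {a b} → a ~ b → b - N < a → a < b + N → a ≡ b
 ~-gap {a} {b} (winds t e) l u with mult-gap t
 ... | inj₁ h = ⊥-elim (lia 4 (λ a b s N → a ≐ b :+ s => b :- N <: a => s =< #0 :- N => false') a b (t ·N) N e l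
             -- `- N` is rewritten as `0ℤ - N`, the form an `Expr` denotes, since expressions have
             -- subtraction but no unary minus.
             (subst (t ·N ≤_) (sym (+-identityˡ (- N))) h))
 ... | inj₂ (inj₁ h) = trans e (trans (cong (λ z → b + z) (trans (cong _·N h) 0·N)) (+-identityʳ b))
 ... | inj₂ (inj₂ h) = ⊥-elim (lia 4 (λ a b s N → a ≐ b :+ s => a <: b :+ N => N =< s => false') a b (t ·N) N e u h)

 ~-window : ∀ {a b} s → a ~ b → s ≤ a → a < s + N → s ≤ b → b < s + N → a ≡ b
 ~-window {a} {b} s e h1 h2 h3 h4 = ~-gap e
  (lia 4 (λ a b s N → s =< a => b <: s :+ N => b :- N <: a) a b s N h1 h4)
  (lia 4 (λ a b s N → a <: s :+ N => s =< b => a <: b :+ N) a b s N h2 h3)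

 ~-turn : ∀ {b} t → b + t ·N ~ b
 ~-turn t = winds t refl

 ~-+N : ∀ {a} → a + N ~ a
 ~-+N {a} = winds 1ℤ $ cong (λ z → a + z) (sym 1·N)

 ~--N : ∀ {a} → a - N ~ a
 ~--N {a} = winds (- 1ℤ) $ cong (λ z → a + z) (sym (trans (-·N 1ℤ) (cong -_ 1·N)))

 i~/i+1 : ∀ i → i ~/ i + 1ℤ
 i~/i+1 i h with ~-gap h (lia 2 (λ i N → #2 =< N => i :+ #1 :- N <: i) i N 2≤N)
             (lia 2 (λ i N → #2 =< N => i <: i :+ #1 :+ N) i N 2≤N)
 ... | e = lia 1 (λ i → i ≐ i :+ #1 => false') i e

 res : ℤ → ℕ
 res a = a %ℕ n

 res<n : ∀ a → res a ℕ.< n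
 res<n a = n%ℕd<d a n

 res-split : ∀ a → a ≡ + res a + (a /ℕ n) ·N
 res-split a = trans (a≡a%ℕn+[a/ℕn]*n a n) (cong (λ z → + res a + z) (sym (·N-def (a /ℕ n))))

 res-~ : ∀ a → a ~ + res a
 res-~ a = winds (a /ℕ n) (res-split a)

 res-bounds : ∀ a → 0ℤ ≤ + res a × + res a < 0ℤ + N
 res-bounds a = +≤+ ℕ.z≤n , subst (+ res a <_) (sym (+-identityˡ N)) (subst (+ res a <_) (sym N-def) (+<+ (res<n a)))

 res-cong : ∀ {a b} → a ~ b → res a ≡ res b
 res-cong {a} {b} e = +-injective (~-window 0ℤ (~-trans (~-sym (res-~ a)) (~-trans e (res-~ b)))
  (proj₁ (res-bounds a)) (proj₂ (res-bounds a)) (proj₁ (res-bounds b)) (proj₂ (res-bounds b)))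

 res-inj : ∀ {a b} → res a ≡ res b → a ~ b
 res-inj {a} {b} e = ~-trans (res-~ a) (~-trans (~-reflexive (cong +_ e)) (~-sym (res-~ b)))

 infix 4 _~?_
 _~?_ : ∀ a b → Dec (a ~ b)
 a ~? b = map′ res-inj res-cong (res a ℕP.≟ res b)

 res-small : ∀ {r} → r ℕ.< n → res (+ r) ≡ r
 res-small = ℕ.m<n⇒m%n≡m

 quo-shift : ∀ {a r} t → a ≡ + r + t ·N → r ℕ.< n → res a ≡ r × a /ℕ n ≡ t
 quo-shift {a} {r} t e r<n = e1 , ·N-injective
   (lia 5 (λ a r r' s u → a ≐ r :+ u => a ≐ r' :+ s => r ≐ r' => s ≐ u) a (+ r) (+ res a) ((a /ℕ n) ·N) (t ·N) e (res-split a) (cong +_ (sym e1)))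
  where
  e1 : res a ≡ r
  e1 = trans (res-cong {a} {+ r} (winds t e)) (res-small r<n)

 -- Transpositions of two congruence classes

 opaque
  tr : ℤ → ℤ → ℤ → ℤ
  tr a b m with m ~? a
  ... | yes _ = m + (b - a)
  ... | no _ with m ~? b
  ... | yes _ = m + (a - b)
  ... | no _ = m

  tr-at-a : ∀ {a b m} → m ~ a → tr a b m ≡ m + (b - a)
  tr-at-a {a} {b} {m} h with m ~? a
  ... | yes _ = refl
  ... | no ¬h = ⊥-elim (¬h h)

  tr-at-b : ∀ {a b m} → a ~/ b → m ~ b → tr a b m ≡ m + (a - b)
  tr-at-b {a} {b} {m} ne h with m ~? a
  ... | yes h' = ⊥-elim (ne (~-trans (~-sym h') h))
  ... | no _ with m ~? b
  ... | yes _ = refl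
  ... | no ¬h = ⊥-elim (¬h h)

  tr-off : ∀ {a b m} → m ~/ a → m ~/ b → tr a b m ≡ m
  tr-off {a} {b} {m} h h' with m ~? a
  ... | yes q = ⊥-elim (h q)
  ... | no _ with m ~? b
  ... | yes q = ⊥-elim (h' q)
  ... | no _ = refl

 tr-a : ∀ a b → tr a b a ≡ b
 tr-a a b = trans (tr-at-a {a} {b} ~-refl) (lia 2 (λ a b → a :+ (b :- a) ≐ b) a b)

 tr-b : ∀ {a b} → a ~/ b → tr a b b ≡ a
 tr-b {a} {b} ne = trans (tr-at-b ne ~-refl) (lia 2 (λ a b → b :+ (a :- b) ≐ a) a b)

 data TrView (a b m : ℤ) : Set where
  at-a : m ~ a → tr a b m ≡ m + (b - a) → TrView a b m
  at-b : m ~/ a → m ~ b → tr a b m ≡ m + (a - b) → TrView a b m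
  off : m ~/ a → m ~/ b → tr a b m ≡ m → TrView a b m

 trView : ∀ a b m → TrView a b m
 trView a b m with m ~? a
 ... | yes h = at-a h (tr-at-a h)
 ... | no ¬h with m ~? b
 ... | yes h = at-b ¬h h (tr-at-b (λ e → ¬h (~-trans h (~-sym e))) h)
 ... | no ¬h' = off ¬h ¬h' (tr-off ¬h ¬h')

 ~-move : ∀ {a m} b → m ~ a → m + (b - a) ~ b
 ~-move {a} {m} b (winds t e) = winds t $ lia 4 (λ a b m s → m ≐ a :+ s => m :+ (b :- a) ≐ b :+ s) a b m (t ·N) e

 tr-invol : ∀ {a b} → a ~/ b → ∀ m → tr a b (tr a b m) ≡ m
 tr-invol {a} {b} ne m with trView a b m
 ... | at-a h e = trans (cong (tr a b) e) (trans (tr-at-b ne (~-move b h))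
          (lia 3 (λ a b m → m :+ (b :- a) :+ (a :- b) ≐ m) a b m))
 ... | at-b _ h e = trans (cong (tr a b) e) (trans (tr-at-a (~-move a h))
          (lia 3 (λ a b m → m :+ (a :- b) :+ (b :- a) ≐ m) a b m))
 ... | off _ _ e = trans (cong (tr a b) e) e

 tr-per : ∀ a b m t → tr a b (m + t ·N) ≡ tr a b m + t ·N
 tr-per a b m t with trView a b m
 ... | at-a h e = trans (tr-at-a (~-trans (~-turn t) h)) (trans
    (lia 4 (λ a b m s → m :+ s :+ (b :- a) ≐ m :+ (b :- a) :+ s) a b m (t ·N)) (cong (_+ t ·N) (sym e)))
 ... | at-b ¬h h e = trans (tr-at-b (λ q → ¬h (~-trans h (~-sym q))) (~-trans (~-turn t) h)) (trans
    (lia 4 (λ a b m s → m :+ s :+ (a :- b) ≐ m :+ (a :- b) :+ s) a b m (t ·N)) (cong (_+ t ·N) (sym e)))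
 ... | off h h' e = trans (tr-off (h ∘ ~-trans (~-sym (~-turn t))) (h' ∘ ~-trans (~-sym (~-turn t)))) (cong (_+ t ·N) (sym e))

 tr-comm : ∀ {a b} → a ~/ b → ∀ m → tr a b m ≡ tr b a m
 tr-comm {a} {b} ne m with trView a b m
 ... | at-a h e = trans e (sym (tr-at-b (ne ∘ ~-sym) h))
 ... | at-b _ h e = trans e (sym (tr-at-a h))
 ... | off h h' e = trans e (sym (tr-off h' h))

 tr-lift : ∀ {a b a' b'} t → a ~/ b → a' ≡ a + t ·N → b' ≡ b + t ·N → ∀ m → tr a b m ≡ tr a' b' m
 tr-lift {a} {b} t ne refl refl m with trView a b m
 ... | at-a h e = trans e (sym (trans (tr-at-a (~-trans h (~-sym (~-turn t))))
    (lia 4 (λ a b m s → m :+ (b :+ s :- (a :+ s)) ≐ m :+ (b :- a)) a b m (t ·N))))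
 ... | at-b _ h e = trans e (sym (trans (tr-at-b (λ q → ne (~-trans (~-sym (~-turn t)) (~-trans q (~-turn t)))) (~-trans h (~-sym (~-turn t))))
    (lia 4 (λ a b m s → m :+ (a :+ s :- (b :+ s)) ≐ m :+ (a :- b)) a b m (t ·N))))
 ... | off h h' e = trans e (sym (tr-off (λ q → h (~-trans q (~-turn t))) (λ q → h' (~-trans q (~-turn t)))))

 -- Periodic bijections of the integers

 -- The sum condition of the affine symmetric group is carried separately, as `balance`. The inverse
 -- is stored because left descents are read off from it.
 record AP : Set where
  no-eta-equality
  field
   to fr : ℤ → ℤ
   per : ∀ m t → to (m + t ·N) ≡ to m + t ·N
   to-fr : ∀ m → to (fr m) ≡ m
   fr-to : ∀ m → fr (to m) ≡ m

 open AP public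

 fr-per : ∀ x m t → fr x (m + t ·N) ≡ fr x m + t ·N
 fr-per x m t = trans (cong (λ z → fr x (z + t ·N)) (sym (to-fr x m)))
  (trans (cong (fr x) (sym (per x (fr x m) t))) (fr-to x _))

 infix 4 _≗A_

 record _≗A_ (x y : AP) : Set where
  constructor agree
  field at : ∀ m → to x m ≡ to y m

 open _≗A_ public

 ≗A-refl : ∀ {x} → x ≗A x
 ≗A-refl = agree λ _ → refl

 ≗A-sym : ∀ {x y} → x ≗A y → y ≗A x
 ≗A-sym h = agree λ m → sym (at h m)

 ≗A-trans : ∀ {x y z} → x ≗A y → y ≗A z → x ≗A z
 ≗A-trans h h' = agree λ m → trans (at h m) (at h' m)

 ≗A-fr : ∀ {x y} → x ≗A y → ∀ m → fr x m ≡ fr y m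
 ≗A-fr {x} {y} h m = trans (cong (fr x) (trans (sym (to-fr y m)) (sym (at h (fr y m))))) (fr-to x (fr y m))

 to-inj : ∀ x {a b} → to x a ≡ to x b → a ≡ b
 to-inj x {a} {b} e = trans (sym (fr-to x a)) (trans (cong (fr x) e) (fr-to x b))

 fr-inj : ∀ x {a b} → fr x a ≡ fr x b → a ≡ b
 fr-inj x {a} {b} e = trans (sym (to-fr x a)) (trans (cong (to x) e) (to-fr x b))

 to-~ : ∀ x {a b} → a ~ b → to x a ~ to x b
 to-~ x {b = b} (winds t refl) = winds t (per x b t)

 fr-~ : ∀ x {a b} → a ~ b → fr x a ~ fr x b
 fr-~ x {b = b} (winds t refl) = winds t (fr-per x b t)

 to-~⁻ : ∀ x {a b} → to x a ~ to x b → a ~ b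
 to-~⁻ x {a} {b} h = subst₂ _~_ (fr-to x a) (fr-to x b) (fr-~ x h)

 idA : AP
 idA = record { to = id ; fr = id ; per = λ _ _ → refl ; to-fr = λ _ → refl ; fr-to = λ _ → refl }

 infixl 7 _∘A_
 _∘A_ : AP → AP → AP
 x ∘A y = record
  { to = to x ∘ to y ; fr = fr y ∘ fr x
  ; per = λ m t → trans (cong (to x) (per y m t)) (per x (to y m) t)
  ; to-fr = λ m → trans (cong (to x) (to-fr y (fr x m))) (to-fr x m)
  ; fr-to = λ m → trans (cong (fr y) (fr-to x (to y m))) (fr-to y m) }

 trA : ∀ a b → a ~/ b → AP
 trA a b ne = record { to = tr a b ; fr = tr a b ; per = tr-per a b ; to-fr = tr-invol ne ; fr-to = tr-invol ne }

 s : ℤ → ℤ → ℤ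
 s i = tr i (i + 1ℤ)

 sA : ℤ → AP
 sA i = trA i (i + 1ℤ) (i~/i+1 i)

 infixr 7 _▹_
 _▹_ : ℤ → AP → AP
 i ▹ x = sA i ∘A x

 act : Word → AP → AP
 act ws x = foldr (λ r → + r ▹_) x ws

 act-cong : ∀ ws {x y} → x ≗A y → act ws x ≗A act ws y
 act-cong [] h = h
 act-cong (r ∷ ws) h = agree λ m → cong (s (+ r)) (at (act-cong ws h) m)

 act-++ : ∀ us ws x → act (us ++ ws) x ≡ act us (act ws x)
 act-++ [] ws x = refl
 act-++ (r ∷ us) ws x = cong (+ r ▹_) (act-++ us ws x)

 act-to : ∀ ws x m → to (act ws x) m ≡ to (act ws idA) (to x m)
 act-to [] x m = refl
 act-to (r ∷ ws) x m = cong (s (+ r)) (act-to ws x m)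

 ▹▹ : ∀ i x → i ▹ (i ▹ x) ≗A x
 ▹▹ i x = agree λ m → tr-invol (i~/i+1 i) (to x m)

 ▹-cong : ∀ i {x y} → x ≗A y → i ▹ x ≗A i ▹ y
 ▹-cong i h = agree λ m → cong (s i) (at h m)

 -- Windows and bijections as two views of one element

 ≡ᵇ-true : ∀ {a b} → a ≡ b → (a ℕ.≡ᵇ b) ≡ true
 ≡ᵇ-true {a} refl = lem a
  where
  lem : ∀ a → (a ℕ.≡ᵇ a) ≡ true
  lem zero = refl
  lem (suc a) = lem a

 ≡ᵇ-false : ∀ {a b} → a ≢ b → (a ℕ.≡ᵇ b) ≡ false
 ≡ᵇ-false {zero} {zero} h = ⊥-elim (h refl)
 ≡ᵇ-false {zero} {suc b} h = refl
 ≡ᵇ-false {suc a} {zero} h = refl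
 ≡ᵇ-false {suc a} {suc b} h = ≡ᵇ-false (h ∘ cong suc)

 sgen-s : ∀ r m → sgen k r m ≡ s (+ r) m
 sgen-s r m with trView (+ r) (+ r + 1ℤ) m
 ... | at-a h e rewrite ≡ᵇ-true (res-cong {m} {+ r} h) =
  trans (cong (λ z → m + z) (lia 1 (λ r → #1 ≐ r :+ #1 :- r) (+ r))) (sym e)
 ... | at-b ¬h h e rewrite ≡ᵇ-false (λ q → ¬h (res-inj {m} {+ r} q))
             | ≡ᵇ-true (res-cong {m} {+ suc r} (~-trans h (~-reflexive (+-comm (+ r) 1ℤ)))) =
  trans (cong (λ z → m + z) (lia 1 (λ r → con (- 1ℤ) ≐ r :- (r :+ #1)) (+ r))) (sym e)
 ... | off ¬h ¬h' e rewrite ≡ᵇ-false (λ q → ¬h (res-inj {m} {+ r} q))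
              | ≡ᵇ-false (λ q → ¬h' (~-trans (res-inj {m} {+ suc r} q) (~-reflexive (+-comm 1ℤ (+ r))))) = sym e

 win : AP → Window k
 win x = tabulate (λ j → to x (+ toℕ j))

 evalW-tabulate : ∀ (h : ℤ → ℤ) m → evalW (tabulate {n = n} (λ j → h (+ toℕ j))) m ≡ h (+ res m) + (m /ℕ n) ·N
 evalW-tabulate h m = cong₂ _+_ (trans (Vecₚ.lookup∘tabulate (λ j → h (+ toℕ j)) (fromℕ< (res<n m)))
  (cong (λ r → h (+ r)) (Finₚ.toℕ-fromℕ< (res<n m)))) (sym (·N-def (m /ℕ n)))

 evalW-win : ∀ x m → evalW (win x) m ≡ to x m
 evalW-win x m = trans (evalW-tabulate (to x) m) (trans (sym (per x (+ res m) (m /ℕ n))) (cong (to x) (sym (res-split m))))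

 fromℕ<-res : ∀ (j : Fin n) → fromℕ< (res<n (+ toℕ j)) ≡ j
 fromℕ<-res j = Finₚ.toℕ-injective (trans (Finₚ.toℕ-fromℕ< _) (res-small (Finₚ.toℕ<n j)))

 evalW-def : ∀ (w : Window k) m → evalW w m ≡ lookup w (fromℕ< (res<n m)) + (m /ℕ n) ·N
 evalW-def w m = cong (λ z → lookup w (fromℕ< (res<n m)) + z) (sym (·N-def (m /ℕ n)))

 evalW-lookup : ∀ (w : Window k) j → evalW w (+ toℕ j) ≡ lookup w j
 evalW-lookup w j = trans (evalW-def w (+ toℕ j)) (trans (cong₂ (λ i t → lookup w i + t ·N) (fromℕ<-res j)
   (proj₂ (quo-shift {+ toℕ j} {toℕ j} 0ℤ (sym (trans (cong (λ z → + toℕ j + z) 0·N) (+-identityʳ _))) (Finₚ.toℕ<n j))))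
  (trans (cong (λ z → lookup w j + z) 0·N) (+-identityʳ _)))

 evalW-per : ∀ (w : Window k) m t → evalW w (m + t ·N) ≡ evalW w m + t ·N
 evalW-per w m t = begin
  evalW w (m + t ·N)
   ≡⟨ evalW-def w (m + t ·N) ⟩
  lookup w (fromℕ< (res<n (m + t ·N))) + ((m + t ·N) /ℕ n) ·N
   ≡⟨ cong₂ (λ i q → lookup w i + q ·N) (Finₚ.toℕ-injective (trans (Finₚ.toℕ-fromℕ< _) (trans (proj₁ qs) (sym (Finₚ.toℕ-fromℕ< _))))) (proj₂ qs) ⟩
  lookup w (fromℕ< (res<n m)) + (m /ℕ n + t) ·N
   ≡⟨ cong (λ z → lookup w (fromℕ< (res<n m)) + z) (+·N (m /ℕ n) t) ⟩
  lookup w (fromℕ< (res<n m)) + ((m /ℕ n) ·N + t ·N)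
   ≡⟨ +-assoc (lookup w (fromℕ< (res<n m))) _ _ ⟨
  lookup w (fromℕ< (res<n m)) + (m /ℕ n) ·N + t ·N
   ≡⟨ cong (_+ t ·N) (evalW-def w m) ⟨
  evalW w m + t ·N ∎
  where
  open ≡-Reasoning
  qs : res (m + t ·N) ≡ res m × (m + t ·N) /ℕ n ≡ m /ℕ n + t
  qs = quo-shift (m /ℕ n + t) (trans (lia 4 (λ m r q s → m ≐ r :+ q => m :+ s ≐ r :+ (q :+ s)) m (+ res m) ((m /ℕ n) ·N) (t ·N) (res-split m))
   (cong (λ z → + res m + z) (sym (+·N (m /ℕ n) t)))) (res<n m)

 win-ext : ∀ x (w : Window k) → (∀ m → evalW w m ≡ to x m) → w ≡ win x
 win-ext x w h = trans (sym (Vecₚ.tabulate∘lookup w)) (Vecₚ.tabulate-cong (λ j → trans (sym (evalW-lookup w j)) (h (+ toℕ j))))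

 win-cong : ∀ {x y} → x ≗A y → win x ≡ win y
 win-cong h = Vecₚ.tabulate-cong (λ j → at h (+ toℕ j))

 win-inj : ∀ {x y} → win x ≡ win y → x ≗A y
 win-inj {x} {y} e = agree λ m → trans (sym (evalW-win x m)) (trans (cong (λ w → evalW w m) e) (evalW-win y m))

 evalW-rmul : ∀ (w : Window k) r m → evalW (rmul w r) m ≡ evalW w (s (+ r) m)
 evalW-rmul w r m = trans (evalW-tabulate (λ z → evalW w (sgen k r z)) m)
  (trans (sym (evalW-per w (sgen k r (+ res m)) (m /ℕ n)))
   (cong (evalW w) (trans (cong (_+ (m /ℕ n) ·N) (sgen-s r (+ res m)))
    (trans (sym (tr-per (+ r) (+ r + 1ℤ) (+ res m) (m /ℕ n))) (cong (s (+ r)) (sym (res-split m)))))))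

 evalW-foldl : ∀ ws (w : Window k) m → evalW (foldl rmul w ws) m ≡ evalW w (to (act ws idA) m)
 evalW-foldl [] w m = refl
 evalW-foldl (r ∷ ws) w m = trans (evalW-foldl ws (rmul w r) m) (evalW-rmul w r (to (act ws idA) m))

 foldl-rmul : ∀ x ws → foldl rmul (win x) ws ≡ win (x ∘A act ws idA)
 foldl-rmul x ws = win-ext (x ∘A act ws idA) _ (λ m → trans (evalW-foldl ws (win x) m) (evalW-win x _))

 permOf-act : ∀ ws → permOf k ws ≡ win (act ws idA)
 permOf-act ws = foldl-rmul idA ws

 ⌊⌋-true : ∀ {P : Set} (d : Dec P) → P → ⌊ d ⌋ ≡ true
 ⌊⌋-true (yes _) p = refl
 ⌊⌋-true (no ¬p) p = ⊥-elim (¬p p)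

 ⌊⌋-false : ∀ {P : Set} (d : Dec P) → ¬ P → ⌊ d ⌋ ≡ false
 ⌊⌋-false (yes p) ¬p = ⊥-elim (¬p p)
 ⌊⌋-false (no _) ¬p = refl

 ⌊⌋-cong : ∀ {P Q : Set} (d : Dec P) (e : Dec Q) → (P → Q) → (Q → P) → ⌊ d ⌋ ≡ ⌊ e ⌋
 ⌊⌋-cong d (yes q) f g = ⌊⌋-true d (g q)
 ⌊⌋-cong d (no ¬q) f g = ⌊⌋-false d (¬q ∘ f)

 -- Length as a count of inversions

 ind : Bool → ℕ
 ind b = if b then 1 else 0

 Σ< : ℕ → (ℕ → ℕ) → ℕ
 Σ< zero f = 0
 Σ< (suc m) f = f 0 ℕ.+ Σ< m (f ∘ suc)

 Σ<-cong : ∀ m {f g : ℕ → ℕ} → (∀ i → i ℕ.< m → f i ≡ g i) → Σ< m f ≡ Σ< m g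
 Σ<-cong zero h = refl
 Σ<-cong (suc m) h = cong₂ ℕ._+_ (h 0 (ℕ.s≤s ℕ.z≤n)) (Σ<-cong m (λ i i<m → h (suc i) (ℕ.s≤s i<m)))

 Σ<-zero : ∀ m {f : ℕ → ℕ} → (∀ i → f i ≡ 0) → Σ< m f ≡ 0
 Σ<-zero zero h = refl
 Σ<-zero (suc m) h = cong₂ ℕ._+_ (h 0) (Σ<-zero m (h ∘ suc))

 Σ<-extend : ∀ m e {f : ℕ → ℕ} → (∀ i → m ℕ.≤ i → f i ≡ 0) → Σ< (m ℕ.+ e) f ≡ Σ< m f
 Σ<-extend zero e h = Σ<-zero e (λ i → h i ℕ.z≤n)
 Σ<-extend (suc m) e {f} h = cong (f 0 ℕ.+_) (Σ<-extend m e (λ i m≤i → h (suc i) (ℕ.s≤s m≤i)))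

 Σ<-bump : ∀ m {f g : ℕ → ℕ} i0 → i0 ℕ.< m → g i0 ≡ suc (f i0) →
  (∀ i → i ℕ.< m → i ≢ i0 → g i ≡ f i) → Σ< m g ≡ suc (Σ< m f)
 Σ<-bump (suc m) {f} zero _ e h =
  cong₂ ℕ._+_ e (Σ<-cong m (λ i i<m → h (suc i) (ℕ.s≤s i<m) λ ()))
 Σ<-bump (suc m) {f} {g} (suc i0) (ℕ.s≤s i0<m) e h = trans
  (cong₂ ℕ._+_ (h 0 (ℕ.s≤s ℕ.z≤n) λ ()) (Σ<-bump m i0 i0<m e (λ i i<m ne → h (suc i) (ℕ.s≤s i<m) (ne ∘ suc-injective))))
  (+-suc (f 0) _)

 length-filter-++ : ∀ {A : Set} (P : A → Bool) xs ys →
  length (filterᵇ P (xs ++ ys)) ≡ length (filterᵇ P xs) ℕ.+ length (filterᵇ P ys)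
 length-filter-++ P [] ys = refl
 length-filter-++ P (x ∷ xs) ys with P x
 ... | true = cong suc (length-filter-++ P xs ys)
 ... | false = length-filter-++ P xs ys

 length-filter-map : ∀ {A : Set} (P : A → Bool) (f : ℕ → A) h m →
  length (filterᵇ P (map f (applyUpTo h m))) ≡ Σ< m (λ d → ind (P (f (h d))))
 length-filter-map P f h zero = refl
 length-filter-map P f h (suc m) with P (f (h 0))
 ... | true = cong suc (length-filter-map P f (h ∘ suc) m)
 ... | false = length-filter-map P f (h ∘ suc) m

 length-filter-concatMap : ∀ {A : Set} (P : A → Bool) (g : ℕ → List A) h m →
  length (filterᵇ P (concatMap g (applyUpTo h m))) ≡ Σ< m (λ i → length (filterᵇ P (g (h i))))
 length-filter-concatMap P g h zero = refl
 length-filter-concatMap P g h (suc m) = trans (length-filter-++ P (g (h 0)) _)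
  (cong (length (filterᵇ P (g (h 0))) ℕ.+_) (length-filter-concatMap P g (h ∘ suc) m))

 opaque
  ℓ : AP → ℕ
  ℓ x = len (win x)

  ℓ-def : ∀ x → ℓ x ≡ len (win x)
  ℓ-def x = refl

 inv? : ∀ x i d → Dec (to x (+ (i ℕ.+ suc d)) < to x (+ i))
 inv? x i d = to x (+ (i ℕ.+ suc d)) <? to x (+ i)

 ℓ-upTo : ℕ → AP → ℕ
 ℓ-upTo M x = Σ< n (λ i → Σ< M (λ d → ind ⌊ inv? x i d ⌋))

 range : AP → ℕ
 range x = n ℕ.+ 2 ℕ.* absSum (win x)

 ℓ-sum : ∀ x → ℓ x ≡ ℓ-upTo (range x) x
 ℓ-sum x = trans (ℓ-def x) $ trans (length-filter-concatMap P (λ i → map (λ d → (i , i ℕ.+ suc d)) (upTo (range x))) id n)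
  (Σ<-cong n (λ i _ → trans (length-filter-map P (λ d → (i , i ℕ.+ suc d)) id (range x))
   (Σ<-cong (range x) (λ d _ → cong ind (cong₂ (λ a b → ⌊ a <? b ⌋) (evalW-win x (+ (i ℕ.+ suc d))) (evalW-win x (+ i)))))))
  where
  P : ℕ × ℕ → Bool
  P p = ⌊ evalW (win x) (+ proj₂ p) ℤ.<? evalW (win x) (+ proj₁ p) ⌋

 lookup≤sum : ∀ {m} (v : Vec ℤ m) j → ∣ lookup v j ∣ ℕ.≤ sum (map ∣_∣ (toList v))
 lookup≤sum (a ∷ v) zero = m≤m+n _ _
 lookup≤sum (a ∷ v) (suc j) = ℕP.≤-trans (lookup≤sum v j) (m≤n+m _ _)

 abs-bounds : ∀ i {A} → ∣ i ∣ ℕ.≤ A → i ≤ + A × - (+ A) ≤ i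
 abs-bounds (+ i) {A} h = +≤+ h , lia 2 (λ a i → #0 =< a => #0 =< i => #0 :- a =< i) (+ A) (+ i) 0≤+ 0≤+ ∘≡ +-identityˡ (- (+ A))
  where
  _∘≡_ : ∀ {a b c : ℤ} → a ≤ c → a ≡ b → b ≤ c
  h ∘≡ refl = h
 abs-bounds -[1+ i ] {suc A} (ℕ.s≤s h) = ℤ.-≤+ , ℤ.-≤- h

 to-bounds : ∀ x j → to x (+ res j) ≤ + absSum (win x) × - (+ absSum (win x)) ≤ to x (+ res j)
 to-bounds x j = abs-bounds _ (subst (λ z → ∣ z ∣ ℕ.≤ absSum (win x))
  (trans (Vecₚ.lookup∘tabulate (λ i → to x (+ toℕ i)) (fromℕ< (res<n j))) (cong (λ r → to x (+ r)) (Finₚ.toℕ-fromℕ< (res<n j))))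
  (lookup≤sum (win x) (fromℕ< (res<n j))))

 to-split : ∀ x j → to x j ≡ to x (+ res j) + (j /ℕ n) ·N
 to-split x j = trans (cong (to x) (res-split j)) (per x (+ res j) (j /ℕ n))

 -- Window values lie between -A and A, where A is the absolute sum. A position at least n + 2A
 -- further on has been raised by more than 2A through periodicity, hence exceeds every window
 -- value.
 no-far-inversions : ∀ x i d → i ℕ.< n → range x ℕ.≤ d → ¬ to x (+ (i ℕ.+ suc d)) < to x (+ i)
 no-far-inversions x i d i<n r≤d h =
  lia 10 (λ A N xi xj xr q r i d j → #0 =< A => #0 =< i => N :+ (A :+ A) =< d => j ≐ i :+ (#1 :+ d) => xj <: xi => xi =< A => #0 :- A =< xr =>
    xj ≐ xr :+ q => j ≐ r :+ q => r <: N => false')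
   (+ absSum (win x)) N (to x (+ i)) (to x j) (to x (+ res j)) ((j /ℕ n) ·N) (+ res j) (+ i) (+ d) j
   0≤+ 0≤+ rd refl h
   (subst (λ z → to x (+ z) ≤ + absSum (win x)) (res-small i<n) (proj₁ (to-bounds x (+ i))))
   (subst (λ z → z ≤ to x (+ res j)) (sym (+-identityˡ (- (+ absSum (win x))))) (proj₂ (to-bounds x j)))
   (to-split x j) (res-split j) (subst (+ res j <_) (+-identityˡ N) (proj₂ (res-bounds j)))
  where
  j = + (i ℕ.+ suc d)
  rd : N + (+ absSum (win x) + + absSum (win x)) ≤ + d
  rd = subst (λ z → z + (+ absSum (win x) + + absSum (win x)) ≤ + d) (sym N-def)
   (+≤+ (subst (λ z → n ℕ.+ z ℕ.≤ d) (cong (absSum (win x) ℕ.+_) (ℕP.+-identityʳ _)) r≤d))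

 -- Two permutations have different search ranges; this lets their inversions be counted over a
 -- common one.
 ℓ-stable : ∀ x e → ℓ x ≡ ℓ-upTo (range x ℕ.+ e) x
 ℓ-stable x e = trans (ℓ-sum x) (Σ<-cong n (λ i i<n → sym (Σ<-extend (range x) e
  (λ d r≤d → cong ind (⌊⌋-false (inv? x i d) (no-far-inversions x i d i<n r≤d))))))

 ℓ-cong : ∀ {x y} → x ≗A y → ℓ x ≡ ℓ y
 ℓ-cong {x} {y} h = trans (ℓ-def x) (trans (cong len (win-cong h)) (sym (ℓ-def y)))

 -- A simple reflection moves each value by at most one, so it can reverse only a consecutive pair,
 -- and only one that it exchanges. Every comparison of a permutation with its left multiple rests
 -- on this.
 s-mono : ∀ i {u v} → u < v → s i u < s i v ⊎ (u ~ i × v ≡ u + 1ℤ)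
 s-mono i {u} {v} u<v with trView i (i + 1ℤ) u | trView i (i + 1ℤ) v
 ... | at-a p e | at-a q f = inj₁ (subst₂ _<_ (sym e) (sym f) (+-monoˡ-< _ u<v))
 ... | at-a p e | at-b _ q f = by-gap (~-trans q (~-sym (~-shift 1ℤ p)))
  where
  by-gap : v ~ u + 1ℤ → s i u < s i v ⊎ (u ~ i × v ≡ u + 1ℤ)
  by-gap (winds t g) with mult-gap t
  ... | inj₁ h = ⊥-elim (lia 4 (λ u v t N → v ≐ u :+ #1 :+ t => t =< #0 :- N => #2 =< N => u <: v => false') u v (t ·N) N g
               (subst (t ·N ≤_) (sym (+-identityˡ (- N))) h) 2≤N u<v)
  ... | inj₂ (inj₁ refl) = inj₂ (p , trans g (trans (cong (λ z → u + 1ℤ + z) 0·N) (+-identityʳ _)))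
  ... | inj₂ (inj₂ h) = inj₁ (lia 7 (λ su sv u v t N i → su ≐ u :+ (i :+ #1 :- i) => sv ≐ v :+ (i :- (i :+ #1)) => v ≐ u :+ #1 :+ t => N =< t => #2 =< N => su <: sv)
               (s i u) (s i v) u v (t ·N) N i e f g h 2≤N)
 ... | at-a p e | off _ nq f = inj₁ (lia 5 (λ su sv u v i → su ≐ u :+ (i :+ #1 :- i) => sv ≐ v => u <: v => ¬' v ≐ u :+ #1 => su <: sv)
    (s i u) (s i v) u v i e f u<v (λ h → nq (~-trans (~-reflexive h) (~-shift 1ℤ p))))
 ... | at-b _ p e | at-a q f = inj₁ (lia 5 (λ su sv u v i → su ≐ u :+ (i :- (i :+ #1)) => sv ≐ v :+ (i :+ #1 :- i) => u <: v => su <: sv) (s i u) (s i v) u v i e f u<v)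
 ... | at-b _ p e | at-b _ q f = inj₁ (lia 5 (λ su sv u v i → su ≐ u :+ (i :- (i :+ #1)) => sv ≐ v :+ (i :- (i :+ #1)) => u <: v => su <: sv) (s i u) (s i v) u v i e f u<v)
 ... | at-b _ p e | off _ _ f = inj₁ (lia 5 (λ su sv u v i → su ≐ u :+ (i :- (i :+ #1)) => sv ≐ v => u <: v => su <: sv) (s i u) (s i v) u v i e f u<v)
 ... | off _ _ e | at-a q f = inj₁ (lia 5 (λ su sv u v i → su ≐ u => sv ≐ v :+ (i :+ #1 :- i) => u <: v => su <: sv) (s i u) (s i v) u v i e f u<v)
 ... | off np _ e | at-b _ q f = inj₁ (lia 5 (λ su sv u v i → su ≐ u => sv ≐ v :+ (i :- (i :+ #1)) => u <: v => ¬' v ≐ u :+ #1 => su <: sv)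
    (s i u) (s i v) u v i e f u<v (λ h → np (subst₂ _~_ (cancel h) (back i) (~-shift (- 1ℤ) q))))
  where
  back : ∀ i → i + 1ℤ + - 1ℤ ≡ i
  back = lia 1 (λ i → i :+ #1 :+ con (- 1ℤ) ≐ i)
  cancel : v ≡ u + 1ℤ → v + - 1ℤ ≡ u
  cancel = lia 2 (λ u v → v ≐ u :+ #1 => v :+ con (- 1ℤ) ≐ u) u v
 ... | off _ _ e | off _ _ f = inj₁ (subst₂ _<_ (sym e) (sym f) u<v)

 module Ascent (x : AP) (i : ℤ) (asc : fr x i < fr x (i + 1ℤ)) where

  asc-lift : ∀ {u} → u ~ i → fr x u < fr x (u + 1ℤ)
  asc-lift {u} (winds t refl) = subst₂ _<_ (sym (fr-per x i t))
   (trans (sym (fr-per x (i + 1ℤ) t)) (cong (fr x) (lia 2 (λ i t → i :+ #1 :+ t ≐ i :+ t :+ #1) i (t ·N)))) (+-monoˡ-< (t ·N) asc)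

  a b a0 b0 : ℤ
  a = fr x i
  b = fr x (i + 1ℤ)
  -- The positions of the values i and i + 1 are translated by the quotient of `a`, so that the pair
  -- starts inside the window.
  a0 = + res a
  b0 = b - (a /ℕ n) ·N

  i0 d0 : ℕ
  i0 = res a
  d0 = ∣ b0 - a0 - 1ℤ ∣

  b0≡ : b0 ≡ + (i0 ℕ.+ suc d0)
  b0≡ = lia 3 (λ b a d → d ≐ b :- a :- #1 => b ≐ a :+ (#1 :+ d)) b0 a0 (+ d0) (0≤i⇒+∣i∣≡i
   (lia 4 (λ a b a0 q → a <: b => a ≐ a0 :+ q => #0 =< b :- q :- a0 :- #1) a b a0 ((a /ℕ n) ·N) asc (res-split a)))

  value-a0 : to x a0 ≡ i - (a /ℕ n) ·N
  value-a0 = lia 3 (λ xa i q → i ≐ xa :+ q => xa ≐ i :- q) (to x a0) i ((a /ℕ n) ·N) (trans (sym (to-fr x i)) (to-split x a))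

  value-b0 : to x b0 ≡ to x a0 + 1ℤ
  value-b0 = lia 4 (λ xb xa i q → xa ≐ i :- q => i :+ #1 ≐ xb :+ q => xb ≐ xa :+ #1) (to x b0) (to x a0) i ((a /ℕ n) ·N) value-a0
   (trans (sym (to-fr x (i + 1ℤ))) (trans (cong (to x) (lia 2 (λ b q → b ≐ b :- q :+ q) b ((a /ℕ n) ·N))) (per x b0 (a /ℕ n))))

  value-a0~i : to x a0 ~ i
  value-a0~i = ~-trans (to-~ x (~-sym (res-~ a))) (~-reflexive (to-fr x i))

  x' : AP
  x' = i ▹ x

  inv-same : ∀ j d → j ℕ.< n → ¬ (j ≡ i0 × d ≡ d0) → ⌊ inv? x' j d ⌋ ≡ ⌊ inv? x j d ⌋
  inv-same j d j<n ne with <-cmp (to x (+ (j ℕ.+ suc d))) (to x (+ j))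
  ... | tri< h _ _ with s-mono i h
  ... | inj₁ h' = trans (⌊⌋-true (inv? x' j d) h') (sym (⌊⌋-true (inv? x j d) h))
  ... | inj₂ (p , q) = ⊥-elim (lia 3 (λ j d e → #0 =< d => e ≐ j :+ (#1 :+ d) => e <: j => false') (+ j) (+ d) (+ (j ℕ.+ suc d)) 0≤+ refl
        (subst₂ _<_ (fr-to x _) (trans (cong (fr x) (sym q)) (fr-to x _)) (asc-lift p)))
  inv-same j d j<n ne | tri≈ _ h _ = ⊥-elim (ℕP.m≢1+m+n j (trans (sym (+-injective (to-inj x h))) (+-suc j d)))
  inv-same j d j<n ne | tri> ¬h _ h with s-mono i h
  ... | inj₁ h' = trans (⌊⌋-false (inv? x' j d) (<-asym h')) (sym (⌊⌋-false (inv? x j d) ¬h))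
  ... | inj₂ (p , q) = ⊥-elim (ne (j≡ , d≡))
   where
   j≡ : j ≡ i0
   j≡ = trans (sym (res-small j<n)) (res-cong (~-trans (~-reflexive (sym (fr-to x (+ j)))) (fr-~ x p)))
   d≡ : d ≡ d0
   d≡ = suc-injective (ℕP.+-cancelˡ-≡ i0 _ _ (trans (cong (ℕ._+ suc d) (sym j≡)) (+-injective (trans
    (to-inj x (trans q (trans (cong (λ z → to x (+ z) + 1ℤ) j≡) (sym value-b0)))) b0≡))))

  inv-new : ⌊ inv? x' i0 d0 ⌋ ≡ true
  inv-new = ⌊⌋-true (inv? x' i0 d0) (subst (λ z → to x' z < to x' a0) b0≡
   (subst₂ _<_ (sym (trans (cong (s i) value-b0) (tr-at-b (i~/i+1 i) (~-shift 1ℤ value-a0~i)))) (sym (tr-at-a value-a0~i))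
    (lia 2 (λ v i → v :+ #1 :+ (i :- (i :+ #1)) <: v :+ (i :+ #1 :- i)) (to x a0) i)))

  inv-old : ⌊ inv? x i0 d0 ⌋ ≡ false
  inv-old = ⌊⌋-false (inv? x i0 d0) (λ h → lia 2 (λ xa xb → xb <: xa => xb ≐ xa :+ #1 => false') (to x a0) (to x b0)
   (subst (λ z → to x z < to x a0) (sym b0≡) h) value-b0)

  M e1 e2 : ℕ
  M = range x ℕ.+ range x' ℕ.+ suc d0
  e1 = range x' ℕ.+ suc d0
  e2 = range x ℕ.+ suc d0

  -- All pairs except (`i0`, `d0`) keep their order, so the double sum gains exactly one term.
  ascent : ℓ (i ▹ x) ≡ suc (ℓ x)
  ascent = begin
   ℓ x' ≡⟨ ℓ-stable x' e2 ⟩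
   ℓ-upTo (range x' ℕ.+ e2) x' ≡⟨ cong (λ z → ℓ-upTo z x') (trans (sym (ℕP.+-assoc (range x') (range x) _)) (cong (ℕ._+ suc d0) (ℕP.+-comm (range x') (range x)))) ⟩
   ℓ-upTo M x' ≡⟨ Σ<-bump n i0 (res<n a)
            (Σ<-bump M d0 (m≤n+m (suc d0) (range x ℕ.+ range x')) (trans (cong ind inv-new) (sym (cong (suc ∘ ind) inv-old)))
             (λ d _ d≢ → cong ind (inv-same i0 d (res<n a) (λ (_ , q) → d≢ q))))
            (λ j j<n j≢ → Σ<-cong M (λ d _ → cong ind (inv-same j d j<n (λ (q , _) → j≢ q)))) ⟩
   suc (ℓ-upTo M x) ≡⟨ cong (λ z → suc (ℓ-upTo z x)) (ℕP.+-assoc (range x) (range x') (suc d0)) ⟩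
   suc (ℓ-upTo (range x ℕ.+ e1) x) ≡⟨ cong suc (ℓ-stable x e1) ⟨
   suc (ℓ x) ∎
   where open ≡-Reasoning

 open Ascent using (ascent; asc-lift) public

 s-i : ∀ i → s i i ≡ i + 1ℤ
 s-i i = tr-a i (i + 1ℤ)

 s-i+1 : ∀ i → s i (i + 1ℤ) ≡ i
 s-i+1 i = tr-b (i~/i+1 i)

 descent : ∀ x i → fr x (i + 1ℤ) < fr x i → ℓ x ≡ suc (ℓ (i ▹ x))
 descent x i h = trans (sym (ℓ-cong (▹▹ i x))) (ascent (i ▹ x) i
  (subst₂ _<_ (cong (fr x) (sym (s-i i))) (cong (fr x) (sym (s-i+1 i))) h))

 fr-≢ : ∀ x i → fr x i ≢ fr x (i + 1ℤ)
 fr-≢ x i e = i~/i+1 i (~-reflexive (fr-inj x e))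

 left-step : ∀ x i → ℓ (i ▹ x) ≡ suc (ℓ x) ⊎ ℓ x ≡ suc (ℓ (i ▹ x))
 left-step x i with <-cmp (fr x i) (fr x (i + 1ℤ))
 ... | tri< h _ _ = inj₁ (ascent x i h)
 ... | tri≈ _ h _ = ⊥-elim (fr-≢ x i h)
 ... | tri> _ _ h = inj₂ (descent x i h)

 left-≤ : ∀ x i → ℓ (i ▹ x) ℕ.≤ suc (ℓ x)
 left-≤ x i with left-step x i
 ... | inj₁ h = ℕP.≤-reflexive h
 ... | inj₂ h = ℕP.≤-trans (ℕP.≤-trans (n≤1+n _) (ℕP.≤-reflexive (sym h))) (n≤1+n _)

 Rising : AP → Set
 Rising x = ∀ i → fr x i < fr x (i + 1ℤ)

 find-descent : ∀ x → (Σ ℕ λ i → i ℕ.< n × fr x (+ i + 1ℤ) < fr x (+ i)) ⊎ Rising x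
 find-descent x with Finₚ.any? {n = n} (λ j → fr x (+ toℕ j + 1ℤ) <? fr x (+ toℕ j))
 ... | yes (j , h) = inj₁ (toℕ j , Finₚ.toℕ<n j , h)
 ... | no ¬h = inj₂ rising
  where
  base : ∀ i → fr x (+ res i) < fr x (+ res i + 1ℤ)
  base i with <-cmp (fr x (+ res i)) (fr x (+ res i + 1ℤ))
  ... | tri< h _ _ = h
  ... | tri≈ _ h _ = ⊥-elim (fr-≢ x _ h)
  ... | tri> _ _ h = ⊥-elim (¬h (fromℕ< (res<n i) , subst (λ r → fr x (+ r + 1ℤ) < fr x (+ r)) (sym (Finₚ.toℕ-fromℕ< (res<n i))) h))
  rising : Rising x
  rising i = asc-lift x (+ res i) (base i) (res-~ i)

 -- The induction behind the length theory: remove a left descent until the permutation is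
 -- increasing. It reduces statements on right multiplication to left multiplication.
 left-induction : (P : AP → Set) → (∀ x → Rising x → P x) →
  (∀ x i → i ℕ.< n → fr x (+ i + 1ℤ) < fr x (+ i) → ℓ x ≡ suc (ℓ (+ i ▹ x)) → P (+ i ▹ x) → P x) → ∀ x → P x
 left-induction P base step x = go x (<-wellFounded (ℓ x))
  where
  go : ∀ x → Acc ℕ._<_ (ℓ x) → P x
  go x (acc rec) with find-descent x
  ... | inj₂ r = base x r
  ... | inj₁ (i , i<n , h) = step x i i<n h (descent x (+ i) h) (go (+ i ▹ x) (rec (ℕP.≤-reflexive (sym (descent x (+ i) h)))))

 offset : ∀ {a b} → a < b → Σ ℕ λ d → b ≡ a + + suc d
 offset {a} {b} h = ∣ b - a - 1ℤ ∣ , lia 3 (λ a b d → d ≐ b :- a :- #1 => b ≐ a :+ (#1 :+ d)) a b _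
  (0≤i⇒+∣i∣≡i (lia 2 (λ a b → a <: b => #0 =< b :- a :- #1) a b h))

 fr-mono : ∀ x → Rising x → ∀ {a b} → a < b → fr x a < fr x b
 fr-mono x r {a} h with offset h
 ... | d , refl = go d
  where
  go : ∀ d → fr x a < fr x (a + + suc d)
  go zero = r a
  go (suc d) = <-trans (go d) (subst (λ z → fr x (a + + suc d) < fr x z)
   (lia 2 (λ a d → a :+ (#1 :+ d) :+ #1 ≐ a :+ (#1 :+ (#1 :+ d))) a (+ d)) (r (a + + suc d)))

 to-mono : ∀ x → Rising x → ∀ {a b} → a < b → to x a < to x b
 to-mono x r {a} {b} h with <-cmp (to x a) (to x b)
 ... | tri< p _ _ = p
 ... | tri≈ _ p _ = ⊥-elim (<-irrefl (to-inj x p) h)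
 ... | tri> _ _ p = ⊥-elim (<-asym h (subst₂ _<_ (fr-to x b) (fr-to x a) (fr-mono x r p)))

 -- An increasing bijection of the integers cannot skip a value.
 to-suc : ∀ x → Rising x → ∀ a → to x (a + 1ℤ) ≡ to x a + 1ℤ
 to-suc x r a with <-cmp (to x (a + 1ℤ)) (to x a + 1ℤ)
 ... | tri≈ _ p _ = p
 ... | tri< p _ _ = ⊥-elim (lia 2 (λ u v → v <: u :+ #1 => u <: v => false') (to x a) (to x (a + 1ℤ)) p
            (to-mono x r (lia 1 (λ a → a <: a :+ #1) a)))
 ... | tri> _ _ p = ⊥-elim (lia 2 (λ a v → v <: a :+ #1 => a <: v => false') a (fr x (to x a + 1ℤ))
            (subst (fr x (to x a + 1ℤ) <_) (fr-to x (a + 1ℤ)) (fr-mono x r p))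
            (subst (_< fr x (to x a + 1ℤ)) (fr-to x a) (r (to x a))))

 -- Right multiplication by reflections and covers in Bruhat order

 -- The transposition of the classes of a and b, or the identity when the classes coincide.
 opaque
  swap : ℤ → ℤ → AP
  swap a b with a ~? b
  ... | yes _ = idA
  ... | no ne = trA a b ne

  swap-~ : ∀ {a b} → a ~ b → ∀ m → to (swap a b) m ≡ m
  swap-~ {a} {b} h m with a ~? b
  ... | yes _ = refl
  ... | no ne = ⊥-elim (ne h)

  swap-tr : ∀ {a b} → a ~/ b → ∀ m → to (swap a b) m ≡ tr a b m
  swap-tr {a} {b} h m with a ~? b
  ... | yes p = ⊥-elim (h p)
  ... | no ne = refl

  swap-fr : ∀ a b m → fr (swap a b) m ≡ to (swap a b) m
  swap-fr a b m with a ~? b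
  ... | yes p = refl
  ... | no ne = refl

 infixl 5 _⇌_,_
 _⇌_,_ : AP → ℤ → ℤ → AP
 x ⇌ a , b = x ∘A swap a b

 ⇌-a : ∀ x {a b} → a ~/ b → to (x ⇌ a , b) a ≡ to x b
 ⇌-a x {a} {b} ne = cong (to x) (trans (swap-tr ne a) (tr-a a b))

 ⇌-b : ∀ x {a b} → a ~/ b → to (x ⇌ a , b) b ≡ to x a
 ⇌-b x {a} {b} ne = cong (to x) (trans (swap-tr ne b) (tr-b ne))

 ⇌-off : ∀ x {a b m} → m ~/ a → m ~/ b → to (x ⇌ a , b) m ≡ to x m
 ⇌-off x {a} {b} {m} h h' with a ~? b
 ... | yes p = cong (to x) (swap-~ p m)
 ... | no ne = cong (to x) (trans (swap-tr ne m) (tr-off h h'))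

 swap-comm : ∀ a b m → to (swap a b) m ≡ to (swap b a) m
 swap-comm a b m with a ~? b
 ... | yes p = trans (swap-~ p m) (sym (swap-~ (~-sym p) m))
 ... | no ne = trans (swap-tr ne m) (trans (tr-comm ne m) (sym (swap-tr (ne ∘ ~-sym) m)))

 ⇌-comm : ∀ x a b → x ⇌ a , b ≗A x ⇌ b , a
 ⇌-comm x a b = agree λ m → cong (to x) (swap-comm a b m)

 swap-invol : ∀ a b m → to (swap a b) (to (swap a b) m) ≡ m
 swap-invol a b m = trans (sym (swap-fr a b _)) (fr-to (swap a b) m)

 ⇌⇌ : ∀ x a b → x ⇌ a , b ⇌ a , b ≗A x
 ⇌⇌ x a b = agree λ m → cong (to x) (swap-invol a b m)

 -- The bridge between the two sides: a transposition of positions becomes the transposition of the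
 -- values found there.
 conj : ∀ x {a b} → a ~/ b → ∀ m → to (x ⇌ a , b) m ≡ tr (to x a) (to x b) (to x m)
 conj x {a} {b} ne m = trans (cong (to x) (swap-tr ne m)) (lem (trView a b m))
  where
  lem : TrView a b m → to x (tr a b m) ≡ tr (to x a) (to x b) (to x m)
  lem (at-a (winds t refl) e) = trans (cong (to x) (trans e (lia 3 (λ a b t → a :+ t :+ (b :- a) ≐ b :+ t) a b (t ·N)))) (trans (per x b t)
   (sym (trans (tr-at-a (to-~ x (~-turn t))) (lia 4 (λ xm xa xb t → xm ≐ xa :+ t => xm :+ (xb :- xa) ≐ xb :+ t) _ (to x a) (to x b) (t ·N) (per x a t)))))
  lem (at-b _ (winds t refl) e) = trans (cong (to x) (trans e (lia 3 (λ a b t → b :+ t :+ (a :- b) ≐ a :+ t) a b (t ·N)))) (trans (per x a t)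
   (sym (trans (tr-at-b (ne ∘ to-~⁻ x) (to-~ x (~-turn t))) (lia 4 (λ xm xa xb t → xm ≐ xb :+ t => xm :+ (xa :- xb) ≐ xa :+ t) _ (to x a) (to x b) (t ·N) (per x b t)))))
  lem (off h h' e) = trans (cong (to x) e) (sym (tr-off (h ∘ to-~⁻ x) (h' ∘ to-~⁻ x)))

 s-lift : ∀ {i u} → u ~ i → ∀ m → tr u (u + 1ℤ) m ≡ s i m
 s-lift {i} (winds t refl) m = sym (tr-lift t (i~/i+1 i) refl
  (lia 2 (λ i t → i :+ t :+ #1 ≐ i :+ #1 :+ t) i (t ·N)) m)

 -- Consecutive values are the case in which a right swap is a left multiplication by a letter; it
 -- is also the only case in which covers fail to commute with that letter.
 adjacent-swap : ∀ x {a b i} → to x a ~ i → to x b ≡ to x a + 1ℤ → x ⇌ a , b ≗A i ▹ x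
 adjacent-swap x {a} {b} {i} h e = agree λ m → trans (conj x ne m)
   (trans (cong (λ z → tr (to x a) z (to x m)) e) (s-lift h (to x m)))
  where
  ne : a ~/ b
  ne p = i~/i+1 (to x a) (~-trans (to-~ x p) (~-reflexive e))

 ▹-⇌ : ∀ i x a b → x ⇌ a , b ≗A i ▹ ((i ▹ x) ⇌ a , b)
 ▹-⇌ i x a b = agree λ m → sym (at (▹▹ i x) (to (swap a b) m))

 -- Remove a left descent. Either the two values remain inverted and induction applies, or they are
 -- the consecutive pair which the descent exchanges, and then the swap is the descent itself.
 swap-down : ∀ x {a b} → a < b → to x b < to x a → ℓ (x ⇌ a , b) ℕ.< ℓ x
 swap-down x {a} {b} = left-induction P base step x a b
  where
  P : AP → Set
  P x = ∀ a b → a < b → to x b < to x a → ℓ (x ⇌ a , b) ℕ.< ℓ x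
  base : ∀ x → Rising x → P x
  base x r a b a<b h = ⊥-elim (<-asym h (to-mono x r a<b))
  step : ∀ x i → i ℕ.< n → fr x (+ i + 1ℤ) < fr x (+ i) → ℓ x ≡ suc (ℓ (+ i ▹ x)) → P (+ i ▹ x) → P x
  step x i i<n d e IH a b a<b h with s-mono (+ i) h
  ... | inj₁ h' = begin-strict
    ℓ (x ⇌ a , b) ≡⟨ ℓ-cong (▹-⇌ (+ i) x a b) ⟩
    ℓ (+ i ▹ ((+ i ▹ x) ⇌ a , b)) ≤⟨ left-≤ _ (+ i) ⟩
    suc (ℓ ((+ i ▹ x) ⇌ a , b)) ≤⟨ IH a b a<b h' ⟩
    ℓ (+ i ▹ x) <⟨ n<1+n _ ⟩
    suc (ℓ (+ i ▹ x)) ≡⟨ e ⟨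
    ℓ x ∎
   where open ℕP.≤-Reasoning
  ... | inj₂ (p , q) = begin-strict
    ℓ (x ⇌ a , b) ≡⟨ ℓ-cong (≗A-trans (⇌-comm x a b) (adjacent-swap x p q)) ⟩
    ℓ (+ i ▹ x) <⟨ n<1+n _ ⟩
    suc (ℓ (+ i ▹ x)) ≡⟨ e ⟨
    ℓ x ∎
   where open ℕP.≤-Reasoning

 swap-up : ∀ x {a b} → a < b → a ~/ b → to x a < to x b → ℓ x ℕ.< ℓ (x ⇌ a , b)
 swap-up x {a} {b} a<b ne h = subst (ℕ._< ℓ (x ⇌ a , b)) (ℓ-cong (⇌⇌ x a b))
  (swap-down (x ⇌ a , b) a<b (subst₂ _<_ (sym (⇌-b x ne)) (sym (⇌-a x ne)) h))

 up-ordered : ∀ x {a b} → a < b → ℓ x ℕ.< ℓ (x ⇌ a , b) → to x a < to x b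
 up-ordered x {a} {b} a<b h with <-cmp (to x a) (to x b)
 ... | tri< p _ _ = p
 ... | tri≈ _ p _ = ⊥-elim (<-irrefl (to-inj x p) a<b)
 ... | tri> _ _ p = ⊥-elim (ℕP.<-asym h (swap-down x a<b p))

 down-ordered : ∀ x {a b} → a < b → ℓ (x ⇌ a , b) ℕ.< ℓ x → to x b < to x a
 down-ordered x {a} {b} a<b h with <-cmp (to x a) (to x b) | a ~? b
 ... | tri> _ _ p | _ = p
 ... | tri≈ _ p _ | _ = ⊥-elim (<-irrefl (to-inj x p) a<b)
 ... | tri< p _ _ | no ne = ⊥-elim (ℕP.<-asym h (swap-up x a<b ne p))
 ... | tri< p _ _ | yes q = ⊥-elim (ℕP.<-irrefl (ℓ-cong (agree λ m → cong (to x) (swap-~ q m))) h)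

 -- Left induction leads down to an increasing permutation, where the right multiplication by a
 -- simple reflection is a left one.
 right-≤ : ∀ x p → ℓ (x ⇌ p , p + 1ℤ) ℕ.≤ suc (ℓ x)
 right-≤ x p = left-induction (λ x → ℓ (x ⇌ p , p + 1ℤ) ℕ.≤ suc (ℓ x)) base step x
  where
  base : ∀ x → Rising x → ℓ (x ⇌ p , p + 1ℤ) ℕ.≤ suc (ℓ x)
  base x r = subst (ℕ._≤ suc (ℓ x)) (sym (ℓ-cong (adjacent-swap x ~-refl (to-suc x r p)))) (left-≤ x (to x p))
  step : ∀ x i → i ℕ.< n → _ → ℓ x ≡ suc (ℓ (+ i ▹ x)) → ℓ ((+ i ▹ x) ⇌ p , p + 1ℤ) ℕ.≤ suc (ℓ (+ i ▹ x)) → ℓ (x ⇌ p , p + 1ℤ) ℕ.≤ suc (ℓ x)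
  step x i i<n _ e IH = begin
    ℓ (x ⇌ p , p + 1ℤ) ≡⟨ ℓ-cong (▹-⇌ (+ i) x p (p + 1ℤ)) ⟩
    ℓ (+ i ▹ ((+ i ▹ x) ⇌ p , p + 1ℤ)) ≤⟨ left-≤ _ (+ i) ⟩
    suc (ℓ ((+ i ▹ x) ⇌ p , p + 1ℤ)) ≤⟨ ℕ.s≤s IH ⟩
    suc (suc (ℓ (+ i ▹ x))) ≡⟨ cong suc e ⟨
    suc (ℓ x) ∎
   where open ℕP.≤-Reasoning

 p<p+1 : ∀ p → p < p + 1ℤ
 p<p+1 p = lia 1 (λ a → a <: a :+ #1) p

 right-up : ∀ x p → to x p < to x (p + 1ℤ) → ℓ (x ⇌ p , p + 1ℤ) ≡ suc (ℓ x)
 right-up x p h = ℕP.≤-antisym (right-≤ x p) (swap-up x (p<p+1 p) (i~/i+1 p) h)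

 right-down : ∀ x p → to x (p + 1ℤ) < to x p → ℓ x ≡ suc (ℓ (x ⇌ p , p + 1ℤ))
 right-down x p h = ℕP.≤-antisym (subst (ℕ._≤ suc (ℓ (x ⇌ p , p + 1ℤ))) (ℓ-cong (⇌⇌ x p (p + 1ℤ))) (right-≤ (x ⇌ p , p + 1ℤ) p))
  (swap-down x (p<p+1 p) h)

 tr-conj : ∀ {p q b} → p ~/ q → q ~/ b → p ~/ b → ∀ m → tr p q (tr q b (tr p q m)) ≡ tr p b m
 tr-conj {p} {q} {b} pq qb pb m with trView p q m
 ... | at-a h e = trans (cong (λ z → tr p q (tr q b z)) e) (trans (cong (tr p q) (tr-at-a {q} {b} (~-move q h)))
     (trans (tr-off (λ z → pb (~-trans (~-sym z) (~-move b (~-move q h)))) (λ z → qb (~-trans (~-sym z) (~-move b (~-move q h)))))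
     (trans (lia 4 (λ p q b m → m :+ (q :- p) :+ (b :- q) ≐ m :+ (b :- p)) p q b m) (sym (tr-at-a h)))))
 ... | at-b h' h e = trans (cong (λ z → tr p q (tr q b z)) e) (trans (cong (tr p q) (tr-off {q} {b} (λ z → pq (~-trans (~-sym (~-move p h)) z)) (λ z → pb (~-trans (~-sym (~-move p h)) z))))
     (trans (tr-at-a (~-move p h)) (trans (lia 3 (λ p q m → m :+ (p :- q) :+ (q :- p) ≐ m) p q m) (sym (tr-off h' (λ z → qb (~-trans (~-sym h) z)))))))
 ... | off h h' e = trans (cong (λ z → tr p q (tr q b z)) e) (lem (trView q b m))
  where
  lem : TrView q b m → tr p q (tr q b m) ≡ tr p b m
  lem (at-a z _) = ⊥-elim (h' z)
  lem (at-b _ z f) = trans (cong (tr p q) f) (trans (tr-at-b pq (~-move q z)) (trans (lia 4 (λ p q b m → m :+ (q :- b) :+ (p :- q) ≐ m :+ (p :- b)) p q b m) (sym (tr-at-b pb z))))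
  lem (off z z' f) = trans (cong (tr p q) f) (trans e (sym (tr-off h z')))

 ⇌-conj : ∀ x {p q b} → p ~/ q → q ~/ b → p ~/ b → x ⇌ p , q ⇌ q , b ⇌ p , q ≗A x ⇌ p , b
 ⇌-conj x {p} {q} {b} pq qb pb = agree λ m → cong (to x)
  (trans (swap-tr pq _) (trans (cong (tr p q) (trans (swap-tr qb _) (cong (tr q b) (swap-tr pq m)))) (trans (tr-conj pq qb pb m) (sym (swap-tr pb m)))))

 -- A position in between with a value in between factors the reflection into three
 -- length-increasing swaps, so the length rises by at least three.
 obstructed : ∀ x {p q b} → p < q → q < b → p ~/ q → q ~/ b → p ~/ b → to x p < to x q → to x q < to x b →
  ℓ (x ⇌ p , b) ≢ suc (ℓ x)
 obstructed x {p} {q} {b} p<q q<b pq qb pb h h' e = ℕP.<-irrefl refl (begin-strict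
   suc (ℓ x) ≤⟨ swap-up x p<q pq h ⟩
   ℓ y1 <⟨ swap-up y1 q<b qb (subst₂ _<_ (sym (⇌-b x pq)) (sym (⇌-off x (pb ∘ ~-sym) (qb ∘ ~-sym))) (<-trans h h')) ⟩
   ℓ y2 <⟨ swap-up y2 p<q pq (subst₂ _<_ (sym (trans (⇌-off y1 pq pb) (⇌-a x pq))) (sym (trans (⇌-a y1 qb) (⇌-off x (pb ∘ ~-sym) (qb ∘ ~-sym)))) h') ⟩
   ℓ (y2 ⇌ p , q) ≡⟨ ℓ-cong (⇌-conj x pq qb pb) ⟩
   ℓ (x ⇌ p , b) ≡⟨ e ⟩
   suc (ℓ x) ∎)
  where
  open ℕP.≤-Reasoning
  y1 = x ⇌ p , q
  y2 = y1 ⇌ q , b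

 near-~/ : ∀ {a b} → a < b → b < a + N → a ~/ b
 near-~/ {a} {b} h h' e = <-irrefl (~-gap e (lia 3 (λ a b N → b <: a :+ N => b :- N <: a) a b N h') (lia 3 (λ a b N → a <: b => #2 =< N => a <: b :+ N) a b N h 2≤N)) h

 -- Conjugation by the simple reflection at `a` shortens the reflection by one position. The value
 -- at the next position q is not intermediate, so the two outer swaps of the conjugation change the
 -- length in opposite directions; the inner one is a cover by induction.
 cover-up : ∀ d x a → + suc d < N → to x a < to x (a + + suc d) → (∀ q → a < q → q < a + + suc d → to x a < to x q → to x q < to x (a + + suc d) → ⊥) →
  ℓ (x ⇌ a , a + + suc d) ≡ suc (ℓ x)
 cover-up zero x a d<N h _ = right-up x a h
 cover-up (suc d) x a d<N h hj = lem (<-cmp (to x q) (to x a))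
  where
  e q : ℤ
  e = a + + suc (suc d)
  q = a + 1ℤ
  end≡ : e ≡ q + + suc d
  end≡ = lia 2 (λ a d → a :+ (#2 :+ d) ≐ a :+ #1 :+ (#1 :+ d)) a (+ d)
  q<e : q < e
  q<e = lia 2 (λ a d → #0 =< d => a :+ #1 <: a :+ (#2 :+ d)) a (+ d) 0≤+
  e<a+N : e < a + N
  e<a+N = +-monoʳ-< a d<N
  aq : a ~/ q
  aq = i~/i+1 a
  ae : a ~/ e
  ae = near-~/ (<-trans (p<p+1 a) q<e) e<a+N
  qe : q ~/ e
  qe = near-~/ q<e (lia 3 (λ a e N → e <: a :+ N => e <: a :+ #1 :+ N) a e N e<a+N)
  y1 y2 : AP
  y1 = x ⇌ a , q
  y2 = y1 ⇌ q , e
  y1e : to y1 e ≡ to x e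
  y1e = ⇌-off x (ae ∘ ~-sym) (qe ∘ ~-sym)
  ih : ℓ y2 ≡ suc (ℓ y1)
  ih = subst (λ z → ℓ (y1 ⇌ q , z) ≡ suc (ℓ y1)) (sym end≡) (cover-up d y1 q
   (lia 2 (λ d N → #2 :+ d <: N => #1 :+ d <: N) (+ d) N d<N)
   (subst₂ _<_ (sym (⇌-b x aq)) (trans (sym y1e) (cong (to y1) end≡)) h)
   λ r l u h1 h2 → let off = ⇌-off x (λ w → near-~/ {a} {r} (<-trans (p<p+1 a) l) (<-trans (subst (r <_) (sym end≡) u) e<a+N) (~-sym w)) (λ w → near-~/ {q} {r} l (<-trans (subst (r <_) (sym end≡) u) (lia 3 (λ a e N → e <: a :+ N => e <: a :+ #1 :+ N) a e N e<a+N)) (~-sym w)) in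
    hj r (<-trans (p<p+1 a) l) (subst (r <_) (sym end≡) u) (subst₂ _<_ (⇌-b x aq) off h1) (subst₂ _<_ off (trans (cong (to y1) (sym end≡)) y1e) h2))
  y2a : to y2 a ≡ to x q
  y2a = trans (⇌-off y1 aq ae) (⇌-a x aq)
  y2q : to y2 q ≡ to x e
  y2q = trans (⇌-a y1 qe) y1e
  done : ℓ (y2 ⇌ a , q) ≡ ℓ (x ⇌ a , e)
  done = ℓ-cong (⇌-conj x aq qe ae)
  lem : _ → ℓ (x ⇌ a , e) ≡ suc (ℓ x)
  lem (tri< l _ _) = trans (sym done) (trans (right-up y2 a (subst₂ _<_ (sym y2a) (sym y2q) (<-trans l h))) (cong suc (trans ih (sym (right-down x a l)))))
  lem (tri≈ _ w _) = ⊥-elim (<-irrefl (sym (to-inj x w)) (p<p+1 a))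
  lem (tri> _ _ l) with <-cmp (to x q) (to x e)
  ... | tri< u _ _ = ⊥-elim (hj q (p<p+1 a) q<e l u)
  ... | tri≈ _ w _ = ⊥-elim (<-irrefl (to-inj x w) q<e)
  ... | tri> _ _ u = suc-injective (trans (cong suc (sym done)) (trans (sym (right-down y2 a (subst₂ _<_ (sym y2q) (sym y2a) u))) (trans ih (cong suc (right-up x a l)))))

 drop-one : ∀ d x p → + suc d < N → to x (p + + suc d) < to x p →
  (∀ j → p < j → j < p + + suc d → to x j < to x (p + + suc d)) → ℓ x ≡ suc (ℓ (x ⇌ p , p + + suc d))
 drop-one d x p d<N h hj = trans (sym (ℓ-cong (⇌⇌ x p e))) (cover-up d (x ⇌ p , e) p d<N (subst₂ _<_ (sym (⇌-a x p~/e)) (sym (⇌-b x p~/e)) h)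
   λ q l u h1 _ → <-asym (hj q l u) (subst₂ _<_ (⇌-a x p~/e) (⇌-off x (near-~/ l (<-trans u e<p+N) ∘ ~-sym) (near-~/ u (<-trans e<p+N (+-monoˡ-< N l)))) h1))
  where
  e : ℤ
  e = p + + suc d
  e<p+N : e < p + N
  e<p+N = +-monoʳ-< p d<N
  p~/e : p ~/ e
  p~/e = near-~/ (lia 2 (λ p d → #0 =< d => p <: p :+ (#1 :+ d)) p (+ d) 0≤+) e<p+N

 -- The nilCoxeter algebra acting on coefficient functions

 Fun : Set
 Fun = AP → ℚ

 Ext : Fun → Set
 Ext F = ∀ {x y} → x ≗A y → F x ≡ F y

 Desc : ℤ → AP → Set
 Desc i x = fr x (i + 1ℤ) < fr x i

 desc? : ∀ i x → Dec (Desc i x)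
 desc? i x = fr x (i + 1ℤ) <? fr x i

 -- Left multiplication by 𝐮_i, acting on coefficient functions.
 opaque
  up : ℤ → Fun → Fun
  up i F x = if ⌊ desc? i x ⌋ then F (i ▹ x) else 0ℚ

  up-desc : ∀ {i F x} → Desc i x → up i F x ≡ F (i ▹ x)
  up-desc {i} {F} {x} d = cong (λ b → if b then F (i ▹ x) else 0ℚ) (⌊⌋-true (desc? i x) d)

  up-asc : ∀ {i F x} → ¬ Desc i x → up i F x ≡ 0ℚ
  up-asc {i} {F} {x} d = cong (λ b → if b then F (i ▹ x) else 0ℚ) (⌊⌋-false (desc? i x) d)

 op : Word → Fun → Fun
 op ws F = foldr (λ r → up (+ r)) F ws

 Desc-resp : ∀ {i x y} → x ≗A y → Desc i x → Desc i y
 Desc-resp {i} h = subst₂ ℤ._<_ (≗A-fr h (i + 1ℤ)) (≗A-fr h i)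

 up-ext : ∀ i {F} → Ext F → Ext (up i F)
 up-ext i {F} e {x} {y} h with desc? i x
 ... | yes d = trans (up-desc d) (trans (e (▹-cong i h)) (sym (up-desc (Desc-resp h d))))
 ... | no ¬d = trans (up-asc ¬d) (sym (up-asc (¬d ∘ Desc-resp (≗A-sym h))))

 op-ext : ∀ ws {F} → Ext F → Ext (op ws F)
 op-ext [] e = e
 op-ext (r ∷ ws) e = up-ext (+ r) (op-ext ws e)

 up-cong : ∀ i {F G} x → F (i ▹ x) ≡ G (i ▹ x) → up i F x ≡ up i G x
 up-cong i x h with desc? i x
 ... | yes d = trans (up-desc d) (trans h (sym (up-desc d)))
 ... | no ¬d = trans (up-asc ¬d) (sym (up-asc ¬d))

 op-cong : ∀ ws {F G} → (∀ x → F x ≡ G x) → ∀ x → op ws F x ≡ op ws G x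
 op-cong [] h x = h x
 op-cong (r ∷ ws) h x = up-cong (+ r) x (op-cong ws h (+ r ▹ x))

 op-++ : ∀ us ws F → op (us ++ ws) F ≡ op us (op ws F)
 op-++ [] ws F = refl
 op-++ (r ∷ us) ws F = cong (up (+ r)) (op-++ us ws F)

 sumL : ∀ {A : Set} → (A → ℚ) → List A → ℚ
 sumL f [] = 0ℚ
 sumL f (x ∷ xs) = f x ℚ.+ sumL f xs

 sumL-cong : ∀ {A : Set} {f g : A → ℚ} → (∀ a → f a ≡ g a) → ∀ xs → sumL f xs ≡ sumL g xs
 sumL-cong h [] = refl
 sumL-cong h (x ∷ xs) = cong₂ ℚ._+_ (h x) (sumL-cong h xs)

 sumL-++ : ∀ {A : Set} (f : A → ℚ) xs ys → sumL f (xs ++ ys) ≡ sumL f xs ℚ.+ sumL f ys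
 sumL-++ f [] ys = sym (ℚP.+-identityˡ _)
 sumL-++ f (x ∷ xs) ys = trans (cong (f x ℚ.+_) (sumL-++ f xs ys)) (sym (ℚP.+-assoc (f x) _ _))

 sumL-map : ∀ {A B : Set} (f : B → ℚ) (g : A → B) xs → sumL f (map g xs) ≡ sumL (f ∘ g) xs
 sumL-map f g [] = refl
 sumL-map f g (x ∷ xs) = cong (f (g x) ℚ.+_) (sumL-map f g xs)

 sumL-concatMap : ∀ {A B : Set} (f : B → ℚ) (g : A → List B) xs → sumL f (concatMap g xs) ≡ sumL (sumL f ∘ g) xs
 sumL-concatMap f g [] = refl
 sumL-concatMap f g (x ∷ xs) = trans (sumL-++ f (g x) _) (cong (sumL f (g x) ℚ.+_) (sumL-concatMap f g xs))

 sumL-* : ∀ {A : Set} q (f : A → ℚ) xs → sumL (λ a → q ℚ.* f a) xs ≡ q ℚ.* sumL f xs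
 sumL-* q f [] = sym (ℚP.*-zeroʳ q)
 sumL-* q f (x ∷ xs) = trans (cong (λ z → q ℚ.* f x ℚ.+ z) (sumL-* q f xs)) (sym (ℚP.*-distribˡ-+ q (f x) _))

 sumL-+ : ∀ {A : Set} (f g : A → ℚ) xs → sumL (λ a → f a ℚ.+ g a) xs ≡ sumL f xs ℚ.+ sumL g xs
 sumL-+ f g [] = refl
 sumL-+ f g (x ∷ xs) = trans (cong (λ z → f x ℚ.+ g x ℚ.+ z) (sumL-+ f g xs)) (ℚ-interchange (f x) (g x) (sumL f xs) (sumL g xs))

 sumL-0 : ∀ {A : Set} {f : A → ℚ} → (∀ a → f a ≡ 0ℚ) → ∀ xs → sumL f xs ≡ 0ℚ
 sumL-0 h [] = refl
 sumL-0 h (x ∷ xs) = trans (cong₂ ℚ._+_ (h x) (sumL-0 h xs)) (ℚP.+-identityˡ 0ℚ)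

 up-0 : ∀ i {F} → (∀ y → F y ≡ 0ℚ) → ∀ x → up i F x ≡ 0ℚ
 up-0 i h x with desc? i x
 ... | yes d = trans (up-desc d) (h _)
 ... | no ¬d = up-asc ¬d

 up-+ : ∀ i F G x → up i (λ y → F y ℚ.+ G y) x ≡ up i F x ℚ.+ up i G x
 up-+ i F G x with desc? i x
 ... | yes d = trans (up-desc d) (sym (cong₂ ℚ._+_ (up-desc d) (up-desc d)))
 ... | no ¬d = trans (up-asc ¬d) (sym (trans (cong₂ ℚ._+_ (up-asc ¬d) (up-asc ¬d)) (ℚP.+-identityˡ 0ℚ)))

 up-* : ∀ i q F x → up i (λ y → q ℚ.* F y) x ≡ q ℚ.* up i F x
 up-* i q F x with desc? i x
 ... | yes d = trans (up-desc d) (sym (cong (q ℚ.*_) (up-desc d)))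
 ... | no ¬d = trans (up-asc ¬d) (sym (trans (cong (q ℚ.*_) (up-asc ¬d)) (ℚP.*-zeroʳ q)))

 up-sum : ∀ {A : Set} i (f : A → Fun) xs x → up i (λ y → sumL (λ a → f a y) xs) x ≡ sumL (λ a → up i (f a) x) xs
 up-sum i f [] x = up-0 i (λ _ → refl) x
 up-sum i f (a ∷ xs) x = trans (up-+ i (f a) _ x) (cong (up i (f a) x ℚ.+_) (up-sum i f xs x))

 op-* : ∀ ws q F x → op ws (λ y → q ℚ.* F y) x ≡ q ℚ.* op ws F x
 op-* [] q F x = refl
 op-* (r ∷ ws) q F x = trans (up-cong (+ r) x (op-* ws q F _)) (up-* (+ r) q (op ws F) x)

 op-sum : ∀ {A : Set} ws (f : A → Fun) xs x → op ws (λ y → sumL (λ a → f a y) xs) x ≡ sumL (λ a → op ws (f a) x) xs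
 op-sum [] f xs x = refl
 op-sum (r ∷ ws) f xs x = trans (up-cong (+ r) x (op-sum ws f xs _)) (up-sum (+ r) (λ a → op ws (f a)) xs x)

 -- Left multiplication by an element, on coefficient functions; the coefficient function of the
 -- element itself is `lin e δ`.
 lin : Elem → Fun → Fun
 lin e F x = sumL (λ t → proj₁ t ℚ.* op (proj₂ t) F x) e

 lin-ext : ∀ e {F} → Ext F → Ext (lin e F)
 lin-ext e h p = sumL-cong (λ t → cong (proj₁ t ℚ.*_) (op-ext (proj₂ t) h p)) e

 lin-· : ∀ e f F x → lin (e · f) F x ≡ lin e (lin f F) x
 lin-· e f F x = trans (sumL-concatMap (λ t → proj₁ t ℚ.* op (proj₂ t) F x) _ e) (sumL-cong step e)
  where
  step : ∀ (t : ℚ × Word) → sumL (λ u → proj₁ u ℚ.* op (proj₂ u) F x) (map (λ u → (proj₁ t ℚ.* proj₁ u , proj₂ t ++ proj₂ u)) f)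
     ≡ proj₁ t ℚ.* op (proj₂ t) (lin f F) x
  step (q , ws) = trans (sumL-map (λ t → proj₁ t ℚ.* op (proj₂ t) F x) _ f) (trans
   (sumL-cong (λ u → trans (cong (λ g → q ℚ.* proj₁ u ℚ.* g x) (op-++ ws (proj₂ u) F)) (trans (ℚP.*-assoc q (proj₁ u) _)
    (cong (q ℚ.*_) (sym (op-* ws (proj₁ u) (op (proj₂ u) F) x))))) f)
   (trans (sumL-* q _ f) (cong (q ℚ.*_) (sym (op-sum ws (λ u y → proj₁ u ℚ.* op (proj₂ u) F y) f x)))))

 lin-scale : ∀ q e F x → lin (scaleE q e) F x ≡ q ℚ.* lin e F x
 lin-scale q e F x = trans (sumL-map (λ t → proj₁ t ℚ.* op (proj₂ t) F x) _ e) (trans (sumL-cong (λ t → ℚP.*-assoc q (proj₁ t) _) e) (sumL-* q _ e))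

 lin-one : ∀ F x → lin oneE F x ≡ F x
 lin-one F x = trans (ℚP.+-identityʳ _) (ℚP.*-identityˡ _)

 opaque
  δ : Fun
  δ x = if ⌊ win x ≟W idW ⌋ then 1ℚ else 0ℚ

  δ-id : ∀ {x} → x ≗A idA → δ x ≡ 1ℚ
  δ-id {x} h = cong (λ b → if b then 1ℚ else 0ℚ) (⌊⌋-true (win x ≟W idW) (win-cong h))

  δ-ne : ∀ {x} → ¬ x ≗A idA → δ x ≡ 0ℚ
  δ-ne {x} h = cong (λ b → if b then 1ℚ else 0ℚ) (⌊⌋-false (win x ≟W idW) (h ∘ win-inj))

 _≗A?_ : ∀ x y → Dec (x ≗A y)
 x ≗A? y with win x ≟W win y
 ... | yes e = yes (win-inj e)
 ... | no ne = no (ne ∘ win-cong)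

 δ-ext : Ext δ
 δ-ext {x} {y} h with x ≗A? idA
 ... | yes p = trans (δ-id p) (sym (δ-id (≗A-trans (≗A-sym h) p)))
 ... | no ¬p = trans (δ-ne ¬p) (sym (δ-ne (¬p ∘ ≗A-trans h)))

 ℓ-rising : ∀ x → Rising x → ℓ x ≡ 0
 ℓ-rising x r = trans (ℓ-sum x) (Σ<-zero n (λ i → Σ<-zero (range x) (λ d → cong ind (⌊⌋-false (inv? x i d)
  (<-asym (to-mono x r (lia 2 (λ i d → #0 =< d => i <: i :+ (#1 :+ d)) (+ i) (+ d) 0≤+)))))))

 Rising-id : Rising idA
 Rising-id i = p<p+1 i

 ℓ-act≤ : ∀ ws → ℓ (act ws idA) ℕ.≤ length ws
 ℓ-act≤ [] = ℕP.≤-reflexive (ℓ-rising idA Rising-id)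
 ℓ-act≤ (r ∷ ws) = ℕP.≤-trans (left-≤ (act ws idA) (+ r)) (ℕ.s≤s (ℓ-act≤ ws))

 Reduced : Word → Set
 Reduced ws = ℓ (act ws idA) ≡ length ws

 isReduced-≡ : ∀ ws → isReduced k ws ≡ (ℓ (act ws idA) ℕ.≡ᵇ length ws)
 isReduced-≡ ws = cong (ℕ._≡ᵇ length ws) (trans (cong len (permOf-act ws)) (sym (ℓ-def (act ws idA))))

 if-true : ∀ {a b} → a ≡ true → b ≡ true → (if a ∧ b then 1ℚ else 0ℚ) ≡ 1ℚ
 if-true refl refl = refl

 if-falseˡ : ∀ {a} b → a ≡ false → (if a ∧ b then 1ℚ else 0ℚ) ≡ 0ℚ
 if-falseˡ b refl = refl

 if-falseʳ : ∀ a {b} → b ≡ false → (if a ∧ b then 1ℚ else 0ℚ) ≡ 0ℚ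
 if-falseʳ true refl = refl
 if-falseʳ false refl = refl

 opaque
  -- The coefficient function of a word as the theorem defines it, by reducedness and window; `χ-op`
  -- identifies it with the iterated letters `op ws δ`.
  χ : Word → Fun
  χ ws x = if isReduced k ws ∧ ⌊ permOf k ws ≟W win x ⌋ then 1ℚ else 0ℚ

  χ-def : ∀ ws x → χ ws x ≡ (if isReduced k ws ∧ ⌊ permOf k ws ≟W win x ⌋ then 1ℚ else 0ℚ)
  χ-def ws x = refl

 χ-one : ∀ ws x → Reduced ws → x ≗A act ws idA → χ ws x ≡ 1ℚ
 χ-one ws x r h = trans (χ-def ws x) (if-true (trans (isReduced-≡ ws) (≡ᵇ-true r))
  (⌊⌋-true (permOf k ws ≟W win x) (trans (permOf-act ws) (sym (win-cong h)))))

 χ-zero : ∀ ws x → ¬ (Reduced ws × x ≗A act ws idA) → χ ws x ≡ 0ℚ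
 χ-zero ws x h = lem (ℓ (act ws idA) ℕP.≟ length ws)
  where
  lem : Dec (Reduced ws) → χ ws x ≡ 0ℚ
  lem (no ne) = trans (χ-def ws x) (if-falseˡ ⌊ permOf k ws ≟W win x ⌋ (trans (isReduced-≡ ws) (≡ᵇ-false ne)))
  lem (yes e) = trans (χ-def ws x) (if-falseʳ (isReduced k ws)
   (⌊⌋-false (permOf k ws ≟W win x) (λ p → h (e , win-inj (trans (sym p) (permOf-act ws))))))

 act-∷ : ∀ r ws {x} → x ≗A act (r ∷ ws) idA → + r ▹ x ≗A act ws idA
 act-∷ r ws h = ≗A-trans (▹-cong (+ r) h) (▹▹ (+ r) (act ws idA))

 -- Without the descent, the rest of the word would represent an element longer than the rest of the
 -- word.
 unreduced : ∀ r ws x → ¬ Desc (+ r) x → ¬ (Reduced (r ∷ ws) × x ≗A act (r ∷ ws) idA)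
 unreduced r ws x ¬d (e , h) = ℕP.<-irrefl refl (begin-strict
   length ws <⟨ n<1+n _ ⟩
   suc (length ws) ≡⟨ trans (ℓ-cong h) e ⟨
   ℓ x <⟨ n<1+n _ ⟩
   suc (ℓ x) ≡⟨ ascent x (+ r) (≤∧≢⇒< (≮⇒≥ ¬d) (fr-≢ x (+ r))) ⟨
   ℓ (+ r ▹ x) ≡⟨ ℓ-cong (act-∷ r ws h) ⟩
   ℓ (act ws idA) ≤⟨ ℓ-act≤ ws ⟩
   length ws ∎)
  where open ℕP.≤-Reasoning

 χ-descent : ∀ r ws x → Desc (+ r) x → χ (r ∷ ws) x ≡ χ ws (+ r ▹ x)
 χ-descent r ws x d = lem (x ≗A? act (r ∷ ws) idA) (ℓ (act ws idA) ℕP.≟ length ws)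
  where
  ℓ-eq : x ≗A act (r ∷ ws) idA → ℓ (act (r ∷ ws) idA) ≡ suc (ℓ (act ws idA))
  ℓ-eq h = trans (sym (ℓ-cong h)) (trans (descent x (+ r) d) (cong suc (ℓ-cong (act-∷ r ws h))))
  lem : Dec (x ≗A act (r ∷ ws) idA) → Dec (Reduced ws) → χ (r ∷ ws) x ≡ χ ws (+ r ▹ x)
  lem (no ne) _ = trans (χ-zero (r ∷ ws) x (λ (_ , h) → ne h))
   (sym (χ-zero ws (+ r ▹ x) (λ (_ , h) → ne (≗A-trans (≗A-sym (▹▹ (+ r) x)) (▹-cong (+ r) h)))))
  lem (yes h) (yes e) = trans (χ-one (r ∷ ws) x (trans (ℓ-eq h) (cong suc e)) h) (sym (χ-one ws (+ r ▹ x) e (act-∷ r ws h)))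
  lem (yes h) (no ne) = trans (χ-zero (r ∷ ws) x (λ (e , _) → ne (suc-injective (trans (sym (ℓ-eq h)) e))))
   (sym (χ-zero ws (+ r ▹ x) (λ (e , _) → ne e)))

 χ-[] : ∀ x → Dec (x ≗A idA) → χ [] x ≡ δ x
 χ-[] x (yes p) = trans (χ-one [] x (ℓ-rising idA Rising-id) p) (sym (δ-id p))
 χ-[] x (no ¬p) = trans (χ-zero [] x (λ (_ , p) → ¬p p)) (sym (δ-ne ¬p))

 χ-op : ∀ ws x → χ ws x ≡ op ws δ x
 χ-op [] x = χ-[] x (x ≗A? idA)
 χ-op (r ∷ ws) x with desc? (+ r) x
 ... | no ¬d = trans (χ-zero (r ∷ ws) x (unreduced r ws x ¬d)) (sym (up-asc ¬d))
 ... | yes d = trans (χ-descent r ws x d) (trans (χ-op ws (+ r ▹ x)) (sym (up-desc d)))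

 filter-sum : ∀ (P : ℚ × Word → Bool) e →
  foldr ℚ._+_ 0ℚ (map proj₁ (filterᵇ P e)) ≡ sumL (λ t → proj₁ t ℚ.* (if P t then 1ℚ else 0ℚ)) e
 filter-sum P [] = refl
 filter-sum P (t ∷ e) with P t
 ... | true = cong₂ ℚ._+_ (sym (ℚP.*-identityʳ (proj₁ t))) (filter-sum P e)
 ... | false = trans (filter-sum P e) (sym (trans (cong (ℚ._+ _) (ℚP.*-zeroʳ (proj₁ t))) (ℚP.+-identityˡ _)))

 coeff-χ : ∀ (e : Elem) x → coeff k e (win x) ≡ sumL (λ t → proj₁ t ℚ.* χ (proj₂ t) x) e
 coeff-χ e x = trans (filter-sum (λ t → isReduced k (proj₂ t) ∧ ⌊ permOf k (proj₂ t) ≟W win x ⌋) e)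
  (sumL-cong (λ t → cong (proj₁ t ℚ.*_) (sym (χ-def (proj₂ t) x))) e)

 coeff-lin : ∀ (e : Elem) x → coeff k e (win x) ≡ lin e δ x
 coeff-lin e x = trans (coeff-χ e x) (sumL-cong (λ t → cong (proj₁ t ℚ.*_) (χ-op (proj₂ t) x)) e)

 filter-any : ∀ (P : ℚ × Word → Bool) e →
  (∃ λ t → P t ≡ true) ⊎ foldr ℚ._+_ 0ℚ (map proj₁ (filterᵇ P e)) ≡ 0ℚ
 filter-any P [] = inj₂ refl
 filter-any P (t ∷ e) with P t in eq
 ... | true = inj₁ (t , eq)
 ... | false = filter-any P e

 ∧-trueʳ : ∀ a {b} → a ∧ b ≡ true → b ≡ true
 ∧-trueʳ true e = e

 ⌊⌋-true⁻ : ∀ {P : Set} (d : Dec P) → ⌊ d ⌋ ≡ true → P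
 ⌊⌋-true⁻ (yes p) _ = p

 -- A nonzero coefficient exhibits a word with window w, hence a bijection. Windows of no bijection
 -- are thereby disposed of.
 coeff-AP : ∀ (e : Elem) w → (∃ λ x → w ≡ win x) ⊎ coeff k e w ≡ 0ℚ
 coeff-AP e w with filter-any (λ t → isReduced k (proj₂ t) ∧ ⌊ permOf k (proj₂ t) ≟W w ⌋) e
 ... | inj₂ z = inj₂ z
 ... | inj₁ ((q , ws) , h) = inj₁ (act ws idA ,
   trans (sym (⌊⌋-true⁻ (permOf k ws ≟W w) (∧-trueʳ (isReduced k ws) h))) (permOf-act ws))

 coeff-ext : ∀ (e f : Elem) → (∀ x → lin e δ x ≡ lin f δ x) → ∀ w → coeff k e w ≡ coeff k f w
 coeff-ext e f h w with coeff-AP e w | coeff-AP f w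
 ... | inj₁ (x , refl) | _ = trans (coeff-lin e x) (trans (h x) (sym (coeff-lin f x)))
 ... | inj₂ _ | inj₁ (x , refl) = trans (coeff-lin e x) (trans (h x) (sym (coeff-lin f x)))
 ... | inj₂ p | inj₂ q = trans p (sym q)

 -- Chevalley operators and their commutators with letters

 opaque
  cov : Fun → AP → ℤ → ℤ → ℚ
  cov F y a b = if ⌊ ℓ (y ⇌ a , b) ℕP.≟ suc (ℓ y) ⌋ then F (y ⇌ a , b) else 0ℚ

  cov-yes : ∀ {F y a b} → ℓ (y ⇌ a , b) ≡ suc (ℓ y) → cov F y a b ≡ F (y ⇌ a , b)
  cov-yes {F} {y} {a} {b} h = cong (λ c → if c then F (y ⇌ a , b) else 0ℚ) (⌊⌋-true (ℓ (y ⇌ a , b) ℕP.≟ suc (ℓ y)) h)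

  cov-no : ∀ {F y a b} → ℓ (y ⇌ a , b) ≢ suc (ℓ y) → cov F y a b ≡ 0ℚ
  cov-no {F} {y} {a} {b} h = cong (λ c → if c then F (y ⇌ a , b) else 0ℚ) (⌊⌋-false (ℓ (y ⇌ a , b) ℕP.≟ suc (ℓ y)) h)

 cov-cong : ∀ {F G y a b} → (∀ z → F z ≡ G z) → cov F y a b ≡ cov G y a b
 cov-cong {F} {G} {y} {a} {b} h with ℓ (y ⇌ a , b) ℕP.≟ suc (ℓ y)
 ... | yes e = trans (cov-yes e) (trans (h _) (sym (cov-yes e)))
 ... | no ne = trans (cov-no ne) (sym (cov-no ne))

 up-asc' : ∀ {i F x} → fr x i < fr x (i + 1ℤ) → up i F x ≡ 0ℚ
 up-asc' h = up-asc (<-asym h)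

 suc≢ : ∀ {m} → m ≢ suc m
 suc≢ {m} e = ℕP.<-irrefl e (n<1+n m)

 module _ {F : Fun} (ext : Ext F) (y : AP) (i a b : ℤ) (a<b : a < b) where

  private
   z x : AP
   z = y ⇌ a , b
   x = i ▹ y

   x⇌≗ : x ⇌ a , b ≗A i ▹ z
   x⇌≗ = agree λ _ → refl

   asc⇒ : ∀ w → ¬ Desc i w → ℓ (i ▹ w) ≡ suc (ℓ w)
   asc⇒ w ¬d = ascent w i (≤∧≢⇒< (≮⇒≥ ¬d) (fr-≢ w i))

  -- Here `y ⇌ a , b` is `i ▹ y`, one step up, and the letter i leads back to y. As i is no descent
  -- of y, only one order of the two operations sees this term; `cov-desc` is the mirror case.
  cov-asc : to y a ~ i → to y b ≡ to y a + 1ℤ → cov (up i F) y a b ≡ F y × up i (λ w → cov F w a b) y ≡ 0ℚ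
  cov-asc h e = trans (cov-yes (trans (ℓ-cong z≗) ℓx)) (trans (up-desc dz) (ext (≗A-trans (▹-cong i z≗) (▹▹ i y)))) , up-asc' asc
   where
   z≗ : z ≗A x
   z≗ = adjacent-swap y h e
   asc : fr y i < fr y (i + 1ℤ)
   asc = asc-lift y (to y a) (subst₂ ℤ._<_ (sym (fr-to y a)) (sym (trans (cong (fr y) (sym e)) (fr-to y b))) a<b) (~-sym h)
   ℓx : ℓ x ≡ suc (ℓ y)
   ℓx = ascent y i asc
   dz : Desc i z
   dz with desc? i z
   ... | yes d = d
   ... | no ¬d = ⊥-elim (ℕP.<-irrefl refl (begin-strict
     ℓ y <⟨ n<1+n _ ⟩
     suc (ℓ y) ≡⟨ trans (ℓ-cong z≗) ℓx ⟨
     ℓ z <⟨ n<1+n _ ⟩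
     suc (ℓ z) ≡⟨ asc⇒ z ¬d ⟨
     ℓ (i ▹ z) ≡⟨ ℓ-cong (≗A-trans (▹-cong i z≗) (▹▹ i y)) ⟩
     ℓ y ∎))
    where open ℕP.≤-Reasoning

  cov-desc : to y b ~ i → to y a ≡ to y b + 1ℤ → cov (up i F) y a b ≡ 0ℚ × up i (λ w → cov F w a b) y ≡ F y
  cov-desc h e = cov-no (λ q → suc≢ (trans (sym (ℓ-cong z≗)) (trans q (cong suc ℓy)) ∘≡)) ,
    trans (up-desc d) (trans (cov-yes (trans (ℓ-cong iz≗) ℓy)) (ext iz≗))
   where
   z≗ : z ≗A x
   z≗ = ≗A-trans (⇌-comm y a b) (adjacent-swap y h e)
   iz≗ : x ⇌ a , b ≗A y
   iz≗ = ≗A-trans x⇌≗ (≗A-trans (▹-cong i z≗) (▹▹ i y))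
   d : Desc i y
   d with desc? i y
   ... | yes d = d
   ... | no ¬d = ⊥-elim (<-asym a<b (subst₂ ℤ._<_ (fr-to y b) (trans (cong (fr y) (sym e)) (fr-to y a))
        (asc-lift y i (≤∧≢⇒< (≮⇒≥ ¬d) (fr-≢ y i)) h)))
   ℓy : ℓ y ≡ suc (ℓ x)
   ℓy = descent y i d
   _∘≡ : ℓ x ≡ suc (suc (ℓ x)) → ℓ x ≡ suc (ℓ x)
   q ∘≡ = ⊥-elim (ℕP.<-irrefl q (ℕP.<-trans (n<1+n _) (n<1+n _)))

  -- Both sides are 0 or F at `i ▹ (y ⇌ a , b)`, so the two conditions have to be matched. A
  -- mismatch would, by comparing lengths, make `s i` reverse the order of the values at a and b,
  -- which happens only in the two excluded cases.
  cov-generic : ¬ (to y a ~ i × to y b ≡ to y a + 1ℤ) → ¬ (to y b ~ i × to y a ≡ to y b + 1ℤ) →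
   cov (up i F) y a b ≡ up i (λ w → cov F w a b) y
  cov-generic ¬asc ¬desc = lem (ℓ z ℕP.≟ suc (ℓ y)) (desc? i z) (desc? i y) (ℓ (x ⇌ a , b) ℕP.≟ suc (ℓ x))
   where
   forth : ℓ z ≡ suc (ℓ y) → Desc i z → Desc i y × ℓ (x ⇌ a , b) ≡ suc (ℓ x)
   forth e dz = dy , trans (ℓ-cong x⇌≗) (trans (suc-injective (trans (sym (descent z i dz)) e)) (descent y i dy))
    where
    ℓiz : ℓ (i ▹ z) ≡ ℓ y
    ℓiz = suc-injective (trans (sym (descent z i dz)) e)
    dy : Desc i y
    dy with desc? i y
    ... | yes d = d
    ... | no ¬d with s-mono i (up-ordered y a<b (ℕP.≤-reflexive (sym e)))
    ... | inj₂ p = ⊥-elim (¬asc p)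
    ... | inj₁ h = ⊥-elim (<-asym h (down-ordered x a<b (subst₂ ℕ._<_ (sym (trans (ℓ-cong x⇌≗) ℓiz)) (sym (asc⇒ y ¬d)) (n<1+n _))))
   back : Desc i y → ℓ (x ⇌ a , b) ≡ suc (ℓ x) → ℓ z ≡ suc (ℓ y) × Desc i z
   back dy e = ans (desc? i z)
    where
    ℓiz : ℓ (i ▹ z) ≡ ℓ y
    ℓiz = trans (sym (ℓ-cong x⇌≗)) (trans e (sym (descent y i dy)))
    ans : Dec (Desc i z) → ℓ z ≡ suc (ℓ y) × Desc i z
    ans (yes d) = trans (descent z i d) (cong suc ℓiz) , d
    ans (no ¬d) with s-mono i (down-ordered y a<b (subst₂ ℕ._≤_ refl (trans (sym (asc⇒ z ¬d)) ℓiz) ℕP.≤-refl))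
    ... | inj₂ p = ⊥-elim (¬desc p)
    ... | inj₁ h = ⊥-elim (<-asym h (up-ordered x a<b (ℕP.≤-reflexive (sym e))))
   lem : Dec (ℓ z ≡ suc (ℓ y)) → Dec (Desc i z) → Dec (Desc i y) → Dec (ℓ (x ⇌ a , b) ≡ suc (ℓ x)) →
    cov (up i F) y a b ≡ up i (λ w → cov F w a b) y
   lem (yes e) (yes dz) _ _ = trans (cov-yes e) (trans (up-desc dz) (sym (trans (up-desc (proj₁ (forth e dz))) (trans (cov-yes (proj₂ (forth e dz))) (ext x⇌≗)))))
   lem _ _ (yes dy) (yes e) = trans (cov-yes (proj₁ (back dy e))) (trans (up-desc (proj₂ (back dy e))) (sym (trans (up-desc dy) (trans (cov-yes e) (ext x⇌≗)))))
   lem (no ne) _ (no ¬d) _ = trans (cov-no ne) (sym (up-asc ¬d))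
   lem (no ne) _ (yes d) (no ne') = trans (cov-no ne) (sym (trans (up-desc d) (cov-no ne')))
   lem (yes e) (no ¬z) (no ¬d) _ = trans (trans (cov-yes e) (up-asc ¬z)) (sym (up-asc ¬d))
   lem (yes e) (no ¬z) (yes d) (no ne') = trans (trans (cov-yes e) (up-asc ¬z)) (sym (trans (up-desc d) (cov-no ne')))

 𝟙 : ∀ {P : Set} → Dec P → ℚ
 𝟙 d = if ⌊ d ⌋ then 1ℚ else 0ℚ

 𝟙-yes : ∀ {P : Set} (d : Dec P) → P → 𝟙 d ≡ 1ℚ
 𝟙-yes d p = cong (λ b → if b then 1ℚ else 0ℚ) (⌊⌋-true d p)

 𝟙-no : ∀ {P : Set} (d : Dec P) → ¬ P → 𝟙 d ≡ 0ℚ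
 𝟙-no d p = cong (λ b → if b then 1ℚ else 0ℚ) (⌊⌋-false d p)

 sumTo : ℕ → (ℕ → ℚ) → ℚ
 sumTo zero f = 0ℚ
 sumTo (suc m) f = sumTo m f ℚ.+ f m

 sumTo-cong : ∀ {f g : ℕ → ℚ} m → (∀ i → i ℕ.< m → f i ≡ g i) → sumTo m f ≡ sumTo m g
 sumTo-cong zero h = refl
 sumTo-cong (suc m) h = cong₂ ℚ._+_ (sumTo-cong m (λ i i<m → h i (m<n⇒m<1+n i<m))) (h m (n<1+n m))

 sumTo-zero : ∀ {f : ℕ → ℚ} m → (∀ i → i ℕ.< m → f i ≡ 0ℚ) → sumTo m f ≡ 0ℚ
 sumTo-zero zero h = refl
 sumTo-zero (suc m) h = trans (cong₂ ℚ._+_ (sumTo-zero m (λ i i<m → h i (m<n⇒m<1+n i<m))) (h m (n<1+n m))) (ℚP.+-identityˡ 0ℚ)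

 sumTo-single : ∀ {f : ℕ → ℚ} m i0 → i0 ℕ.< m → (∀ i → i ℕ.< m → i ≢ i0 → f i ≡ 0ℚ) → sumTo m f ≡ f i0
 sumTo-single {f} (suc m) i0 i0<m h with i0 ℕP.≟ m
 ... | yes refl = trans (cong (ℚ._+ f m) (sumTo-zero m (λ i i<m → h i (m<n⇒m<1+n i<m) (<⇒≢ i<m)))) (ℚP.+-identityˡ _)
 ... | no ne = trans (cong₂ ℚ._+_ (sumTo-single m i0 (ℕP.≤∧≢⇒< (<⇒≤pred i0<m) ne) (λ i i<m → h i (m<n⇒m<1+n i<m)))
          (h m (n<1+n m) (ne ∘ sym))) (ℚP.+-identityʳ _)

 sumTo-+ : ∀ (f g : ℕ → ℚ) m → sumTo m (λ i → f i ℚ.+ g i) ≡ sumTo m f ℚ.+ sumTo m g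
 sumTo-+ f g zero = refl
 sumTo-+ f g (suc m) = trans (cong (ℚ._+ (f m ℚ.+ g m)) (sumTo-+ f g m)) (ℚ-interchange (sumTo m f) (sumTo m g) (f m) (g m))

 sumTo-* : ∀ (f : ℕ → ℚ) q m → sumTo m (λ i → q ℚ.* f i) ≡ q ℚ.* sumTo m f
 sumTo-* f q zero = sym (ℚP.*-zeroʳ q)
 sumTo-* f q (suc m) = trans (cong (ℚ._+ q ℚ.* f m) (sumTo-* f q m)) (sym (ℚP.*-distribˡ-+ q (sumTo m f) (f m)))

 -- The Chevalley operator of the finite weight dual to the class of p; the sum is finite for every finitely supported F.
 monk : ℕ → ℤ → Fun → Fun
 monk M p F y = sumTo M (λ d → cov F y p (p + + suc d) ℚ.- cov F y (p - + suc d) p)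

 -- The vanishing of an infinite sum, stated through its truncations; the bound may depend on y and
 -- p, so no support has to be named.
 Ker : Fun → Set
 Ker F = ∀ y p → Σ ℕ λ M0 → ∀ M → M0 ℕ.≤ M → monk M p F y ≡ 0ℚ

 up-map2 : ∀ (f : ℚ → ℚ → ℚ) → f 0ℚ 0ℚ ≡ 0ℚ → ∀ i F G x → up i (λ z → f (F z) (G z)) x ≡ f (up i F x) (up i G x)
 up-map2 f f0 i F G x = lem (desc? i x)
  where
  lem : Dec (Desc i x) → up i (λ z → f (F z) (G z)) x ≡ f (up i F x) (up i G x)
  lem (yes d) = trans (up-desc d) (sym (cong₂ f (up-desc d) (up-desc d)))
  lem (no ¬d) = trans (up-asc ¬d) (sym (trans (cong₂ f (up-asc ¬d) (up-asc ¬d)) f0))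

 up-sumTo : ∀ i (G : ℕ → Fun) m x → up i (λ z → sumTo m (λ d → G d z)) x ≡ sumTo m (λ d → up i (G d) x)
 up-sumTo i G zero x = up-0 i (λ _ → refl) x
 up-sumTo i G (suc m) x = trans (up-+ i (λ z → sumTo m (λ d → G d z)) (G m) x) (cong (ℚ._+ up i (G m) x) (up-sumTo i G m x))

 module Commutator {F : Fun} (ext : Ext F) (y : AP) (i p : ℤ) where

  -- The failure to commute at the pair p, b: it is +1 when `s i` exchanges the value at p with the
  -- next higher one at b, and -1 when with the next lower one. For b to the left of p the sign in
  -- `monk` compensates the change of roles.
  β : ℤ → ℚ
  β b = 𝟙 (to y p ~? i) ℚ.* 𝟙 (to y b ≟ to y p + 1ℤ) ℚ.- 𝟙 (to y p ~? (i + 1ℤ)) ℚ.* 𝟙 (to y b ≟ to y p - 1ℤ)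

  data Position (b : ℤ) : Set where
   above : to y p ~ i → to y b ≡ to y p + 1ℤ → β b ≡ 1ℚ → Position b
   below : to y b ~ i → to y p ≡ to y b + 1ℤ → β b ≡ ℚ.- 1ℚ → Position b
   neither : ¬ (to y p ~ i × to y b ≡ to y p + 1ℤ) → ¬ (to y b ~ i × to y p ≡ to y b + 1ℤ) → β b ≡ 0ℚ → Position b

  position : ∀ b → Position b
  position b = go (to y p ~? i) (to y b ≟ to y p + 1ℤ) (to y p ~? (i + 1ℤ)) (to y b ≟ to y p - 1ℤ) refl
   where
   v w : ℤ
   v = to y p
   w = to y b
   shift-back : w ≡ v - 1ℤ → v ≡ w + 1ℤ
   shift-back = lia 2 (λ v w → w ≐ v :- #1 => v ≐ w :+ #1) v w
   flip' : v ≡ w + 1ℤ → w ≡ v - 1ℤ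
   flip' = lia 2 (λ v w → v ≐ w :+ #1 => w ≐ v :- #1) v w
   unshift : v ~ i + 1ℤ → w ≡ v - 1ℤ → w ~ i
   unshift h e = ~-trans (~-reflexive e) (~-trans (~-shift (- 1ℤ) h) (~-reflexive (lia 1 (λ i → i :+ #1 :+ con (- 1ℤ) ≐ i) i)))
   shift' : w ~ i → v ≡ w + 1ℤ → v ~ i + 1ℤ
   shift' h e = ~-trans (~-reflexive e) (~-shift 1ℤ h)
   go : (d1 : Dec (v ~ i)) (d2 : Dec (w ≡ v + 1ℤ)) (d3 : Dec (v ~ i + 1ℤ)) (d4 : Dec (w ≡ v - 1ℤ)) →
    β b ≡ 𝟙 d1 ℚ.* 𝟙 d2 ℚ.- 𝟙 d3 ℚ.* 𝟙 d4 → Position b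
   go (yes p1) _ (yes p3) _ _ = ⊥-elim (i~/i+1 i (~-trans (~-sym p1) p3))
   go (yes p1) (yes p2) (no _) (yes _) e = above p1 p2 e
   go (yes p1) (yes p2) (no _) (no _) e = above p1 p2 e
   go (no _) (yes _) (yes p3) (yes p4) e = below (unshift p3 p4) (shift-back p4) e
   go (no _) (no _) (yes p3) (yes p4) e = below (unshift p3 p4) (shift-back p4) e
   go (no ¬p) d2 (no ¬q) d4 e = neither (¬p ∘ proj₁) (λ (h , g) → ¬q (shift' h g)) (trans e (lem d2 d4))
    where
    lem : ∀ d2 d4 → 0ℚ ℚ.* 𝟙 {w ≡ v + 1ℤ} d2 ℚ.- 0ℚ ℚ.* 𝟙 {w ≡ v - 1ℤ} d4 ≡ 0ℚ
    lem (yes _) (yes _) = refl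
    lem (yes _) (no _) = refl
    lem (no _) (yes _) = refl
    lem (no _) (no _) = refl
   go (yes _) (no ¬p) (no ¬q) (yes _) e = neither (¬p ∘ proj₂) (λ (h , g) → ¬q (shift' h g)) e
   go (yes _) (no ¬p) (no ¬q) (no _) e = neither (¬p ∘ proj₂) (λ (h , g) → ¬q (shift' h g)) e
   go (no ¬p) (yes _) (yes _) (no ¬q) e = neither (¬p ∘ proj₁) (λ (h , g) → ¬q (flip' g)) e
   go (no ¬p) (no _) (yes _) (no ¬q) e = neither (¬p ∘ proj₁) (λ (h , g) → ¬q (flip' g)) e

  cov-right : ∀ b → p < b → cov (up i F) y p b ≡ up i (λ w → cov F w p b) y ℚ.+ β b ℚ.* F y
  cov-right b p<b with position b
  ... | above h e β≡ = trans (proj₁ c) (sym (trans (cong₂ (λ u v → u ℚ.+ v ℚ.* F y) (proj₂ c) β≡) (simp (F y))))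
   where
   c = cov-asc ext y i p b p<b h e
   simp : ∀ f → 0ℚ ℚ.+ 1ℚ ℚ.* f ≡ f
   simp f = trans (ℚP.+-identityˡ _) (ℚP.*-identityˡ f)
  ... | below h e β≡ = trans (proj₁ c) (sym (trans (cong₂ (λ u v → u ℚ.+ v ℚ.* F y) (proj₂ c) β≡) (simp (F y))))
   where
   c = cov-desc ext y i p b p<b h e
   simp : ∀ f → f ℚ.+ ℚ.- 1ℚ ℚ.* f ≡ 0ℚ
   simp f = trans (cong (f ℚ.+_) (trans (sym (ℚP.neg-distribˡ-* 1ℚ f)) (cong (ℚ.-_) (ℚP.*-identityˡ f)))) (ℚP.+-inverseʳ f)
  ... | neither h h' β≡ = trans (cov-generic ext y i p b p<b h h')
    (sym (trans (cong (λ v → up i (λ w → cov F w p b) y ℚ.+ v ℚ.* F y) β≡) (trans (cong (λ z → up i (λ w → cov F w p b) y ℚ.+ z) (ℚP.*-zeroˡ (F y))) (ℚP.+-identityʳ _))))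

  cov-left : ∀ b → b < p → cov (up i F) y b p ≡ up i (λ w → cov F w b p) y ℚ.- β b ℚ.* F y
  cov-left b b<p with position b
  ... | above h e β≡ = trans (proj₁ c) (sym (trans (cong₂ (λ u v → u ℚ.- v ℚ.* F y) (proj₂ c) β≡) (simp (F y))))
   where
   c = cov-desc ext y i b p b<p h e
   simp : ∀ f → f ℚ.- 1ℚ ℚ.* f ≡ 0ℚ
   simp f = trans (cong (λ z → f ℚ.- z) (ℚP.*-identityˡ f)) (ℚP.+-inverseʳ f)
  ... | below h e β≡ = trans (proj₁ c) (sym (trans (cong₂ (λ u v → u ℚ.- v ℚ.* F y) (proj₂ c) β≡) (trans (ℚ-minus-minus 0ℚ 1ℚ (F y)) (trans (ℚP.+-identityˡ _) (ℚP.*-identityˡ (F y))))))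
   where
   c = cov-asc ext y i b p b<p h e
  ... | neither h h' β≡ = trans (cov-generic ext y i b p b<p h' h)
    (sym (trans (cong (λ v → up i (λ w → cov F w b p) y ℚ.- v ℚ.* F y) β≡) (trans (cong (λ z → up i (λ w → cov F w b p) y ℚ.- z) (ℚP.*-zeroˡ (F y))) (ℚP.+-identityʳ _))))

  hit : ℤ → ℕ → ℚ
  hit c d = 𝟙 (to y (p + + suc d) ≟ c) ℚ.+ 𝟙 (to y (p - + suc d) ≟ c)

  at⇒≡ : ∀ {b c} → to y b ≡ c → b ≡ fr y c
  at⇒≡ {b} refl = sym (fr-to y b)

  -- The value c occupies one position only, on one side of p and at one distance; any truncation
  -- reaching that far counts it once.
  hits : ∀ c → to y p ≢ c → Σ ℕ λ M0 → ∀ M → M0 ℕ.≤ M → sumTo M (hit c) ≡ 1ℚ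
  hits c ne with <-cmp p (fr y c)
  ... | tri≈ _ e _ = ⊥-elim (ne (trans (cong (to y) e) (to-fr y c)))
  ... | tri< p<b _ _ = suc d0 , λ M h → trans (sumTo-single M d0 h (λ d _ → zero-else d)) one
   where
   d0 = proj₁ (offset p<b)
   e0 : fr y c ≡ p + + suc d0
   e0 = proj₂ (offset p<b)
   left-miss : ∀ d → to y (p - + suc d) ≢ c
   left-miss d q = lia 3 (λ p b d → p <: b => p :- (#1 :+ d) ≐ b => #0 =< d => false') p (fr y c) (+ d) p<b (at⇒≡ q) 0≤+
   zero-else : ∀ d → d ≢ d0 → hit c d ≡ 0ℚ
   zero-else d d≢ = cong₂ ℚ._+_ (𝟙-no (to y (p + + suc d) ≟ c) (λ q → d≢ (+-injective (lia 4 (λ p b d e → p :+ (#1 :+ d) ≐ b => b ≐ p :+ (#1 :+ e) => d ≐ e) p (fr y c) (+ d) (+ d0) (at⇒≡ q) e0))))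
                   (𝟙-no (to y (p - + suc d) ≟ c) (left-miss d))
   one : hit c d0 ≡ 1ℚ
   one = cong₂ ℚ._+_ (𝟙-yes (to y (p + + suc d0) ≟ c) (trans (cong (to y) (sym e0)) (to-fr y c))) (𝟙-no (to y (p - + suc d0) ≟ c) (left-miss d0))
  ... | tri> _ _ b<p = suc d0 , λ M h → trans (sumTo-single M d0 h (λ d _ → zero-else d)) one
   where
   d0 = proj₁ (offset b<p)
   e0 : p ≡ fr y c + + suc d0
   e0 = proj₂ (offset b<p)
   e1 : p - + suc d0 ≡ fr y c
   e1 = lia 3 (λ p b d → p ≐ b :+ (#1 :+ d) => p :- (#1 :+ d) ≐ b) p (fr y c) (+ d0) e0
   right-miss : ∀ d → to y (p + + suc d) ≢ c
   right-miss d q = lia 3 (λ p b d → b <: p => p :+ (#1 :+ d) ≐ b => #0 =< d => false') p (fr y c) (+ d) b<p (at⇒≡ q) 0≤+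
   zero-else : ∀ d → d ≢ d0 → hit c d ≡ 0ℚ
   zero-else d d≢ = cong₂ ℚ._+_ (𝟙-no (to y (p + + suc d) ≟ c) (right-miss d))
                   (𝟙-no (to y (p - + suc d) ≟ c) (λ q → d≢ (+-injective (lia 4 (λ p b d e → p :- (#1 :+ d) ≐ b => p :- (#1 :+ e) ≐ b => d ≐ e) p (fr y c) (+ d) (+ d0) (at⇒≡ q) e1))))
   one : hit c d0 ≡ 1ℚ
   one = cong₂ ℚ._+_ (𝟙-no (to y (p + + suc d0) ≟ c) (right-miss d0)) (𝟙-yes (to y (p - + suc d0) ≟ c) (trans (cong (to y) e1) (to-fr y c)))

  weight : ℚ
  weight = 𝟙 (to y p ~? i) ℚ.- 𝟙 (to y p ~? (i + 1ℤ))

  c1 c2 : ℤ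
  c1 = to y p + 1ℤ
  c2 = to y p - 1ℤ

  hits1 : Σ ℕ λ M0 → ∀ M → M0 ℕ.≤ M → sumTo M (hit c1) ≡ 1ℚ
  hits1 = hits c1 (lia 1 (λ v → ¬' v ≐ v :+ #1) (to y p))

  hits2 : Σ ℕ λ M0 → ∀ M → M0 ℕ.≤ M → sumTo M (hit c2) ≡ 1ℚ
  hits2 = hits c2 (lia 1 (λ v → ¬' v ≐ v :- #1) (to y p))

  p-d<p : ∀ d → p - + suc d < p
  p-d<p d = lia 2 (λ p d → #0 =< d => p :- (#1 :+ d) <: p) p (+ d) 0≤+

  p<p+d : ∀ d → p < p + + suc d
  p<p+d d = lia 2 (λ p d → #0 =< d => p <: p :+ (#1 :+ d)) p (+ d) 0≤+

  βs : ℕ → ℚ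
  βs d = β (p + + suc d) ℚ.+ β (p - + suc d)

  term : Fun → ℕ → ℚ
  term G d = cov G y p (p + + suc d) ℚ.- cov G y (p - + suc d) p

  up-term : ∀ d → term (up i F) d ≡ up i (λ z → cov F z p (p + + suc d) ℚ.- cov F z (p - + suc d) p) y ℚ.+ F y ℚ.* βs d
  up-term d = trans (cong₂ ℚ._-_ (cov-right _ (p<p+d d)) (cov-left _ (p-d<p d)))
   (trans (ℚ-split r l (β (p + + suc d)) (β (p - + suc d)) (F y))
    (cong (ℚ._+ F y ℚ.* βs d) (sym (up-map2 ℚ._-_ refl i (λ z → cov F z p (p + + suc d)) (λ z → cov F z (p - + suc d) p) y))))
   where
   r l : ℚ
   r = up i (λ z → cov F z p (p + + suc d)) y
   l = up i (λ z → cov F z (p - + suc d) p) y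

  sum-βs : ∀ M → proj₁ hits1 ℕ.≤ M → proj₁ hits2 ℕ.≤ M → sumTo M βs ≡ weight
  sum-βs M h1 h2 = begin
   sumTo M βs
    ≡⟨ sumTo-cong M (λ d _ → ℚ-collect A B (𝟙 (to y (p + + suc d) ≟ c1)) (𝟙 (to y (p - + suc d) ≟ c1))
       (𝟙 (to y (p + + suc d) ≟ c2)) (𝟙 (to y (p - + suc d) ≟ c2))) ⟩
   sumTo M (λ d → A ℚ.* hit c1 d ℚ.+ (ℚ.- B) ℚ.* hit c2 d)
    ≡⟨ sumTo-+ (λ d → A ℚ.* hit c1 d) (λ d → (ℚ.- B) ℚ.* hit c2 d) M ⟩
   sumTo M (λ d → A ℚ.* hit c1 d) ℚ.+ sumTo M (λ d → (ℚ.- B) ℚ.* hit c2 d)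
    ≡⟨ cong₂ ℚ._+_ (trans (sumTo-* (hit c1) A M) (trans (cong (A ℚ.*_) (proj₂ hits1 M h1)) (ℚP.*-identityʳ A)))
            (trans (sumTo-* (hit c2) (ℚ.- B) M) (trans (cong ((ℚ.- B) ℚ.*_) (proj₂ hits2 M h2)) (ℚP.*-identityʳ (ℚ.- B)))) ⟩
   weight ∎
   where
   open ≡-Reasoning
   A B : ℚ
   A = 𝟙 (to y p ~? i)
   B = 𝟙 (to y p ~? (i + 1ℤ))

  M1 : ℕ
  M1 = proj₁ hits1 ℕ.⊔ proj₁ hits2

  -- Each of the two neighbours of the value at p occurs at exactly one position, so the failures
  -- add up to a number that depends only on i and the class of `to y p`.
  commutator : ∀ M → M1 ℕ.≤ M → monk M p (up i F) y ≡ up i (monk M p F) y ℚ.+ weight ℚ.* F y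
  commutator M h = begin
   monk M p (up i F) y
    ≡⟨ sumTo-cong M (λ d _ → up-term d) ⟩
   sumTo M (λ d → up i (G d) y ℚ.+ F y ℚ.* βs d)
    ≡⟨ sumTo-+ (λ d → up i (G d) y) (λ d → F y ℚ.* βs d) M ⟩
   sumTo M (λ d → up i (G d) y) ℚ.+ sumTo M (λ d → F y ℚ.* βs d)
    ≡⟨ cong₂ ℚ._+_ (sym (up-sumTo i G M y)) (trans (sumTo-* βs (F y) M) (trans (cong (F y ℚ.*_)
       (sum-βs M (ℕP.≤-trans (m≤m⊔n _ _) h) (ℕP.≤-trans (m≤n⊔m (proj₁ hits1) _) h))) (ℚP.*-comm (F y) weight))) ⟩
   up i (monk M p F) y ℚ.+ weight ℚ.* F y ∎
   where
   open ≡-Reasoning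
   G : ℕ → Fun
   G d z = cov F z p (p + + suc d) ℚ.- cov F z (p - + suc d) p

 -- What the Chevalley operator does to 𝐮_w F for F in its kernel: delete one letter of the word, with a sign
 -- depending on where the letters to its left have moved the value v.
 cut : Word → ℤ → Fun → Fun
 cut [] v F y = 0ℚ
 cut (r ∷ ws) v F y = up (+ r) (cut ws (s (+ r) v) F) y ℚ.+ (𝟙 (v ~? + r) ℚ.- 𝟙 (v ~? (+ r + 1ℤ))) ℚ.* op ws F y

 -- The operator is commuted through the word letter by letter. Each letter leaves behind its weight
 -- times the rest, and the term that reaches F vanishes because F is in the kernel.
 monk-op : ∀ {F} → Ext F → Ker F → ∀ ws y p → Σ ℕ λ M0 → ∀ M → M0 ℕ.≤ M → monk M p (op ws F) y ≡ cut ws (to y p) F y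
 monk-op ext ker [] y p = ker y p
 monk-op {F} ext ker (r ∷ ws) y p = M2 ℕ.⊔ M1 , λ M h → trans (commutator M (ℕP.≤-trans (m≤n⊔m M2 M1) h))
   (cong (ℚ._+ weight ℚ.* op ws F y) (up-cong (+ r) y (proj₂ IH M (ℕP.≤-trans (m≤m⊔n M2 M1) h))))
  where
  open Commutator (op-ext ws ext) y (+ r) p
  IH = monk-op ext ker ws (+ r ▹ y) p
  M2 = proj₁ IH

 -- Cyclically decreasing words: the generators lie in the kernel

 module _ {A : Set} where

  choose-⊆ : ∀ r (xs : List A) {D} → D ∈ choose r xs → D ⊆ xs × length D ≡ r
  choose-⊆ zero xs (here refl) = Sublist.minimum xs , refl
  choose-⊆ (suc r) (x ∷ xs) h with ∈-++⁻ (map (x ∷_) (choose r xs)) h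
  ... | inj₂ h' = x ∷ʳ proj₁ (choose-⊆ (suc r) xs h') , proj₂ (choose-⊆ (suc r) xs h')
  ... | inj₁ h' with ∈-map⁻ (x ∷_) h'
  ... | D , h'' , refl = refl ∷ proj₁ (choose-⊆ r xs h'') , cong suc (proj₂ (choose-⊆ r xs h''))

  ⊆-choose : ∀ {D xs : List A} → D ⊆ xs → D ∈ choose (length D) xs
  ⊆-choose {[]} _ = here refl
  ⊆-choose {d ∷ D} (refl ∷ τ) = ∈-++⁺ˡ (∈-map⁺ (d ∷_) (⊆-choose τ))
  ⊆-choose {d ∷ D} (y ∷ʳ τ) = ∈-++⁺ʳ (map (y ∷_) _) (⊆-choose τ)

  sumL-cong∈ : ∀ {f g : A → ℚ} (xs : List A) → (∀ {a} → a ∈ xs → f a ≡ g a) → sumL f xs ≡ sumL g xs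
  sumL-cong∈ [] h = refl
  sumL-cong∈ (x ∷ xs) h = cong₂ ℚ._+_ (h (here refl)) (sumL-cong∈ xs (h ∘ there))

  sumL-choose : (f : List A → ℚ) → ∀ r x xs →
   sumL f (choose (suc r) (x ∷ xs)) ≡ sumL (f ∘ (x ∷_)) (choose r xs) ℚ.+ sumL f (choose (suc r) xs)
  sumL-choose f r x xs = trans (sumL-++ f (map (x ∷_) (choose r xs)) _) (cong (ℚ._+ _) (sumL-map f (x ∷_) (choose r xs)))

  Symmetric' : (List A → ℚ) → Set
  Symmetric' f = ∀ {D E} → D ↭ E → f D ≡ f E

  -- `choose` respects the order of the list, but a symmetric summand does not see it. This permits
  -- rotating the alphabet so that it starts after a chosen letter.
  sumL-choose-↭ : ∀ r {xs ys} {f : List A → ℚ} → Symmetric' f → xs ↭ ys → sumL f (choose r xs) ≡ sumL f (choose r ys)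
  sumL-choose-↭ zero s p = refl
  sumL-choose-↭ (suc r) s Perm.refl = refl
  sumL-choose-↭ (suc r) {f = f} s (prep {xs} {ys} x p) = trans (sumL-choose f r x xs) (trans
   (cong₂ ℚ._+_ (sumL-choose-↭ r (s ∘ prep x) p) (sumL-choose-↭ (suc r) s p)) (sym (sumL-choose f r x ys)))
  sumL-choose-↭ (suc r) s (Perm.trans p q) = trans (sumL-choose-↭ (suc r) s p) (sumL-choose-↭ (suc r) s q)
  sumL-choose-↭ (suc zero) {f = f} s (Perm.swap {xs} {ys} x y p) =
   trans (sumL-choose f 0 x (y ∷ xs)) (trans (cong (sumL (f ∘ (x ∷_)) (choose 0 xs) ℚ.+_) (sumL-choose f 0 y xs))
   (trans (ℚ-swap (sumL (f ∘ (x ∷_)) (choose 0 xs)) (sumL (f ∘ (y ∷_)) (choose 0 ys)) _)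
   (trans (cong (λ z → sumL (f ∘ (y ∷_)) (choose 0 ys) ℚ.+ (sumL (f ∘ (x ∷_)) (choose 0 ys) ℚ.+ z)) (sumL-choose-↭ 1 s p))
   (sym (trans (sumL-choose f 0 y (x ∷ ys)) (cong (sumL (f ∘ (y ∷_)) (choose 0 ys) ℚ.+_) (sumL-choose f 0 x ys)))))))
   where
   ℚ-swap : ∀ a b c → a ℚ.+ (b ℚ.+ c) ≡ b ℚ.+ (a ℚ.+ c)
   ℚ-swap a b c = trans (sym (ℚP.+-assoc a b c)) (trans (cong (ℚ._+ c) (ℚP.+-comm a b)) (ℚP.+-assoc b a c))
  sumL-choose-↭ (suc (suc r)) {f = f} s (Perm.swap {xs} {ys} x y p) =
   trans (twice x y xs) (trans (cong₂ ℚ._+_ (cong₂ ℚ._+_ (sumL-choose-↭ r (s ∘ prep x ∘ prep y) p) (sumL-choose-↭ (suc r) (s ∘ prep x) p))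
                     (cong₂ ℚ._+_ (sumL-choose-↭ (suc r) (s ∘ prep y) p) (sumL-choose-↭ (suc (suc r)) s p)))
   (trans (ℚ-interchange (S (λ D → x ∷ y ∷ D) r ys) (S (x ∷_) (suc r) ys) (S (y ∷_) (suc r) ys) _)
   (trans (cong (λ z → z ℚ.+ S (y ∷_) (suc r) ys ℚ.+ (S (x ∷_) (suc r) ys ℚ.+ S id (suc (suc r)) ys)) (sumL-cong (λ D → s (Perm.swap x y ↭-refl)) (choose r ys)))
   (sym (twice y x ys)))))
   where
   S : (List A → List A) → ℕ → List A → ℚ
   S g r xs = sumL (f ∘ g) (choose r xs)
   twice : ∀ x y xs → S id (suc (suc r)) (x ∷ y ∷ xs) ≡ S (λ D → x ∷ y ∷ D) r xs ℚ.+ S (x ∷_) (suc r) xs ℚ.+ (S (y ∷_) (suc r) xs ℚ.+ S id (suc (suc r)) xs)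
   twice x y xs = trans (sumL-choose f (suc r) x (y ∷ xs)) (cong₂ ℚ._+_ (sumL-choose (f ∘ (x ∷_)) r y xs) (sumL-choose f (suc r) y xs))

 ≡ᵇ-≡ : ∀ {a b} → (a ℕ.≡ᵇ b) ≡ true → a ≡ b
 ≡ᵇ-≡ {a} {b} h = ℕP.≡ᵇ⇒≡ a b (subst T (sym h) _)

 mem-∈ : ∀ {x} D → memℕ x D ≡ true → x ∈ D
 mem-∈ {x} (y ∷ D) h with y ℕ.≡ᵇ x in e
 ... | true = here (sym (≡ᵇ-≡ e))
 ... | false = there (mem-∈ D h)

 ∈-mem : ∀ {x D} → x ∈ D → memℕ x D ≡ true
 ∈-mem {x} {y ∷ D} (here refl) = cong (_∨ memℕ x D) (≡ᵇ-true {x} refl)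
 ∈-mem {x} {y ∷ D} (there h) = trans (cong ((y ℕ.≡ᵇ x) ∨_) (∈-mem h)) (Boolₚ.∨-zeroʳ _)

 ∉-mem : ∀ {x D} → x ∉ D → memℕ x D ≡ false
 ∉-mem {x} {D} h with memℕ x D in e
 ... | false = refl
 ... | true = ⊥-elim (h (mem-∈ D e))

 mem-∉ : ∀ {x D} → memℕ x D ≡ false → x ∉ D
 mem-∉ e h with trans (sym e) (∈-mem h)
 ... | ()

 mem-cong : ∀ {x D E} → (x ∈ D → x ∈ E) → (x ∈ E → x ∈ D) → memℕ x D ≡ memℕ x E
 mem-cong {x} {D} {E} f g with memℕ x E in e
 ... | true = ∈-mem (g (mem-∈ E e))
 ... | false = ∉-mem (mem-∉ e ∘ f)

 filterᵇ-cong : ∀ {A : Set} {P Q : A → Bool} xs → (∀ {x} → x ∈ xs → P x ≡ Q x) → filterᵇ P xs ≡ filterᵇ Q xs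
 filterᵇ-cong [] h = refl
 filterᵇ-cong {P = P} {Q} (x ∷ xs) h with P x | Q x | h (here refl)
 ... | true | .true | refl = cong (x ∷_) (filterᵇ-cong xs (h ∘ there))
 ... | false | .false | refl = filterᵇ-cong xs (h ∘ there)

 filterᵇ-keep : ∀ {A : Set} {P : A → Bool} {x xs} → P x ≡ true → filterᵇ P (x ∷ xs) ≡ x ∷ filterᵇ P xs
 filterᵇ-keep {P = P} {x} h with P x
 filterᵇ-keep refl | true = refl

 filterᵇ-skip : ∀ {A : Set} {P : A → Bool} {x xs} → P x ≡ false → filterᵇ P (x ∷ xs) ≡ filterᵇ P xs
 filterᵇ-skip {P = P} {x} h with P x
 filterᵇ-skip refl | false = refl

 filterᵇ-++ : ∀ {A : Set} (P : A → Bool) xs ys → filterᵇ P (xs ++ ys) ≡ filterᵇ P xs ++ filterᵇ P ys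
 filterᵇ-++ P [] ys = refl
 filterᵇ-++ P (x ∷ xs) ys with P x
 ... | true = cong (x ∷_) (filterᵇ-++ P xs ys)
 ... | false = filterᵇ-++ P xs ys

 ∈-filterᵇ⁻ : ∀ {A : Set} (P : A → Bool) {x} xs → x ∈ filterᵇ P xs → x ∈ xs × P x ≡ true
 ∈-filterᵇ⁻ P (y ∷ xs) h with P y in e
 ∈-filterᵇ⁻ P (y ∷ xs) (here refl) | true = here refl , e
 ∈-filterᵇ⁻ P (y ∷ xs) (there h) | true = there (proj₁ (∈-filterᵇ⁻ P xs h)) , proj₂ (∈-filterᵇ⁻ P xs h)
 ∈-filterᵇ⁻ P (y ∷ xs) h | false = there (proj₁ (∈-filterᵇ⁻ P xs h)) , proj₂ (∈-filterᵇ⁻ P xs h)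

 ∈-filterᵇ⁺ : ∀ {A : Set} (P : A → Bool) {x xs} → x ∈ xs → P x ≡ true → x ∈ filterᵇ P xs
 ∈-filterᵇ⁺ P {x} (here refl) h = subst (x ∈_) (sym (filterᵇ-keep {P = P} h)) (here refl)
 ∈-filterᵇ⁺ P {x} {y ∷ xs} (there h) e with P y
 ... | true = there (∈-filterᵇ⁺ P h e)
 ... | false = ∈-filterᵇ⁺ P h e

 Unique-head : ∀ {A : Set} {x : A} {xs} → Unique (x ∷ xs) → x ∉ xs
 Unique-head (h ∷ _) p = All.lookup h p refl

 Unique-tail : ∀ {A : Set} {x : A} {xs} → Unique (x ∷ xs) → Unique xs
 Unique-tail (_ ∷ u) = u

 filter-members : ∀ {D L} → Unique L → D ⊆ L → filterᵇ (λ x → memℕ x D) L ≡ D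
 filter-members u [] = refl
 filter-members {D} {y ∷ L} u (y ∷ʳ τ) = trans (filterᵇ-skip {P = λ x → memℕ x D} {y} {L} (∉-mem (λ h → Unique-head u (Sublist.lookup τ h))))
  (filter-members (Unique-tail u) τ)
 filter-members {x ∷ D} {.x ∷ L} u (refl ∷ τ) = trans (filterᵇ-keep {P = λ z → memℕ z (x ∷ D)} {x} {L} (∈-mem {x} {x ∷ D} (here refl)))
  (cong (x ∷_) (trans (filterᵇ-cong L (λ {z} z∈L → mem-cong {z} {x ∷ D} {D} (λ { (here refl) → ⊥-elim (Unique-head u z∈L) ; (there h) → h }) there))
   (filter-members (Unique-tail u) τ)))

 missing : ∀ {A : Set} {D L : List A} → Unique L → D ⊆ L → length D ℕ.< length L → ∃ λ x → x ∈ L × x ∉ D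
 missing u (y ∷ʳ τ) _ = y , here refl , (λ h → Unique-head u (Sublist.lookup τ h))
 missing u (refl ∷ τ) (ℕ.s≤s h) with missing (Unique-tail u) τ h
 ... | x , p , q = x , there p , λ { (here refl) → Unique-head u p ; (there r) → q r }

 least : List ℕ → ℕ
 least D = headOr 0 (filterᵇ (λ x → not (memℕ x D)) (upTo (suc k)))

 headOr-∈ : ∀ {d x} xs → x ∈ xs → headOr d xs ∈ xs
 headOr-∈ (x ∷ xs) _ = here refl

 not-true : ∀ {b} → not b ≡ true → b ≡ false
 not-true {false} _ = refl

 least-spec : ∀ {D x} → x ℕ.< n → x ∉ D → least D ℕ.< n × least D ∉ D
 least-spec {D} {x} x<n x∉D = ∈-upTo⁻ (proj₁ spec) , mem-∉ (not-true (proj₂ spec))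
  where
  spec : least D ∈ upTo n × not (memℕ (least D) D) ≡ true
  spec = ∈-filterᵇ⁻ (λ x → not (memℕ x D)) (upTo n) (headOr-∈ (filterᵇ (λ x → not (memℕ x D)) (upTo n)) (∈-filterᵇ⁺ (λ x → not (memℕ x D)) (∈-upTo⁺ x<n) (cong not (∉-mem x∉D))))

 -- The letters a + l, ..., a + 1 modulo n, in the order of a cyclically decreasing word.
 seg : ℕ → ℕ → List ℕ
 seg a l = map (λ t → (a ℕ.+ suc t) ℕ.% n) (downFrom l)

 seg-split : ∀ a l1 l2 → seg a (l2 ℕ.+ suc l1) ≡ seg (a ℕ.+ suc l1) l2 ++ (a ℕ.+ suc l1) ℕ.% n ∷ seg a l1
 seg-split a l1 zero = refl
 seg-split a l1 (suc l2) = cong₂ _∷_ (cong (ℕ._% n) (trans (cong (a ℕ.+_) (trans (cong suc (ℕP.+-comm l2 (suc l1))) (sym (+-suc (suc l1) l2)))) (sym (ℕP.+-assoc a (suc l1) (suc l2)))))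
  (seg-split a l1 l2)

 ~⇒% : ∀ {a b} → + a ~ + b → a ℕ.% n ≡ b ℕ.% n
 ~⇒% {a} {b} = res-cong {+ a} {+ b}

 %-~ : ∀ a → + (a ℕ.% n) ~ + a
 %-~ a = ~-sym (res-~ (+ a))

 %-+ : ∀ a b → (a ℕ.% n ℕ.+ b) ℕ.% n ≡ (a ℕ.+ b) ℕ.% n
 %-+ a b = ~⇒% {a ℕ.% n ℕ.+ b} {a ℕ.+ b} (~-shift (+ b) (%-~ a))

 seg-% : ∀ a l → seg (a ℕ.% n) l ≡ seg a l
 seg-% a l = Listₚ.map-cong (λ t → %-+ a (suc t)) (downFrom l)

 -- Two cuts a ≠ v of the circle ℤ/n: the letters strictly between them on either side.
 record Arcs (a v : ℕ) : Set where
  field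
   l1 l2 : ℕ
   total : l1 ℕ.+ suc l2 ≡ k
   v≡ : v ≡ (a ℕ.+ suc l1) ℕ.% n
   a≡ : a ≡ (v ℕ.+ suc l2) ℕ.% n
   seg-a : seg a k ≡ seg v l2 ++ v ∷ seg a l1
   seg-v : seg v k ≡ seg a l1 ++ a ∷ seg v l2

 cut-arcs : ∀ {a v} → a ℕ.< n → v ℕ.< n → a ≢ v → Arcs a v
 cut-arcs {a} {v} a<n v<n a≢v = record
  { l1 = l1 ; l2 = l2 ; total = total ; v≡ = v≡ ; a≡ = a≡
  ; seg-a = trans (cong (seg a) (sym total')) (trans (seg-split a l1 l2)
    (cong₂ (λ A x → A ++ x ∷ seg a l1) (trans (sym (seg-% (a ℕ.+ suc l1) l2)) (cong (λ x → seg x l2) (sym v≡))) (sym v≡)))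
  ; seg-v = trans (cong (seg v) (sym total)) (trans (seg-split v l2 l1)
    (cong₂ (λ A x → A ++ x ∷ seg v l2) (trans (sym (seg-% (v ℕ.+ suc l2) l1)) (cong (λ x → seg x l1) (sym a≡))) (sym a≡))) }
  where
  choice : Σ ℕ λ l1 → Σ ℕ λ l2 → l1 ℕ.+ suc l2 ≡ k × v ≡ (a ℕ.+ suc l1) ℕ.% n
  choice with ℕP.<-cmp a v
  ... | tri≈ _ e _ = ⊥-elim (a≢v e)
  ... | tri< a<v _ _ = v ℕ.∸ suc a , k ℕ.∸ suc (v ℕ.∸ suc a) , trans (+-suc l _) (m+[n∸m]≡n {suc l} {k} l<k) ,
    trans (sym (res-small v<n)) (cong (ℕ._% n) (sym (trans (+-suc a l) (m+[n∸m]≡n a<v))))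
   where
   l = v ℕ.∸ suc a
   l<k : l ℕ.< k
   l<k = ℕP.≤-trans (ℕP.≤-trans (ℕP.+-monoˡ-≤ l (ℕ.s≤s (ℕ.z≤n {a}))) (ℕP.≤-reflexive (m+[n∸m]≡n a<v))) (<⇒≤pred v<n)
  ... | tri> _ _ v<a = l , k ℕ.∸ suc l , trans (+-suc l _) (m+[n∸m]≡n {suc l} {k} l<k) ,
    trans (sym (res-small v<n)) (sym (~⇒% {a ℕ.+ suc l} {v} (~-trans (~-reflexive (trans (cong +_ eq) (cong (λ z → + v + z) (sym N-def)))) ~-+N)))
   where
   l = v ℕ.+ (n ℕ.∸ suc a)
   eq : a ℕ.+ suc l ≡ v ℕ.+ n
   eq = trans (+-suc a l) (trans (cong suc (trans (sym (ℕP.+-assoc a v _)) (trans (cong (ℕ._+ (n ℕ.∸ suc a)) (ℕP.+-comm a v)) (ℕP.+-assoc v a _))))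
      (trans (sym (+-suc v _)) (cong (v ℕ.+_) (m+[n∸m]≡n a<n))))
   l<k : l ℕ.< k
   l<k = ℕP.+-cancelˡ-≤ (suc v) (suc l) k (ℕP.≤-trans (ℕP.+-monoˡ-≤ (suc l) v<a) (ℕP.≤-trans (ℕP.≤-reflexive eq) (ℕP.≤-reflexive (+-suc v k))))
  l1 = proj₁ choice
  l2 = proj₁ (proj₂ choice)
  total : l1 ℕ.+ suc l2 ≡ k
  total = proj₁ (proj₂ (proj₂ choice))
  total' : l2 ℕ.+ suc l1 ≡ k
  total' = trans (ℕP.+-comm l2 (suc l1)) (trans (sym (+-suc l1 l2)) total)
  v≡ : v ≡ (a ℕ.+ suc l1) ℕ.% n
  v≡ = proj₂ (proj₂ (proj₂ choice))
  a≡ : a ≡ (v ℕ.+ suc l2) ℕ.% n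
  a≡ = trans (sym (res-small a<n)) (sym (trans (cong (λ z → (z ℕ.+ suc l2) ℕ.% n) v≡) (trans (%-+ (a ℕ.+ suc l1) (suc l2))
   (~⇒% {a ℕ.+ suc l1 ℕ.+ suc l2} {a} (~-trans (~-reflexive (trans (cong +_ (trans (ℕP.+-assoc a (suc l1) (suc l2)) (cong (a ℕ.+_) (cong suc total)))) (cong (λ z → + a + z) (sym N-def)))) ~-+N)))))

 -- The letter r neither moves v nor gives it a weight.
 Avoid : ℤ → ℕ → Set
 Avoid v r = v ~/ + r × v ~/ + r + 1ℤ

 op-0 : ∀ ws {F} → (∀ y → F y ≡ 0ℚ) → ∀ y → op ws F y ≡ 0ℚ
 op-0 [] h y = h y
 op-0 (r ∷ ws) h y = up-0 (+ r) (op-0 ws h) y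

 no-weight : ∀ {v r} → Avoid v r → ∀ q → (𝟙 (v ~? + r) ℚ.- 𝟙 (v ~? (+ r + 1ℤ))) ℚ.* q ≡ 0ℚ
 no-weight {v} {r} (a , b) q = trans (cong₂ (λ x y → (x ℚ.- y) ℚ.* q) (𝟙-no (v ~? + r) a) (𝟙-no (v ~? (+ r + 1ℤ)) b)) (ℚP.*-zeroˡ q)

 cut-avoid-++ : ∀ A ws v F y → All (Avoid v) A → cut (A ++ ws) v F y ≡ op A (cut ws v F) y
 cut-avoid-++ [] ws v F y _ = refl
 cut-avoid-++ (r ∷ A) ws v F y (h ∷ hs) = trans (cong (up (+ r) (cut (A ++ ws) (s (+ r) v) F) y ℚ.+_) (no-weight h _))
  (trans (ℚP.+-identityʳ _) (trans (cong (λ u → up (+ r) (cut (A ++ ws) u F) y) (tr-off (proj₁ h) (proj₂ h)))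
   (up-cong (+ r) y (cut-avoid-++ A ws v F (+ r ▹ y) hs))))

 cut-avoid : ∀ A v F y → All (Avoid v) A → cut A v F y ≡ 0ℚ
 cut-avoid A v F y h = trans (cong (λ ws → cut ws v F y) (sym (++-identityʳ A)))
  (trans (cut-avoid-++ A [] v F y h) (op-0 A (λ _ → refl) y))

 -- Only r meets the moving value: A leaves v alone, r raises it to v + 1 with weight +1, and B
 -- leaves v + 1 alone.
 cut-hit : ∀ A r B v F y → All (Avoid v) A → v ~ + r → All (Avoid (v + 1ℤ)) B → cut (A ++ r ∷ B) v F y ≡ op (A ++ B) F y
 cut-hit A r B v F y hA hr hB = trans (cut-avoid-++ A (r ∷ B) v F y hA) (trans (op-cong A hit y) (sym (cong (λ g → g y) (op-++ A B F))))
  where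
  sv : s (+ r) v ≡ v + 1ℤ
  sv = trans (tr-at-a hr) (cong (λ z → v + z) (lia 1 (λ r → r :+ #1 :- r ≐ #1) (+ r)))
  hit : ∀ z → cut (r ∷ B) v F z ≡ op B F z
  hit z = trans (cong₂ ℚ._+_ (up-0 (+ r) (λ z → trans (cong (λ u → cut B u F z) sv) (cut-avoid B (v + 1ℤ) F z hB)) z)
    (trans (cong₂ (λ a b → (a ℚ.- b) ℚ.* op B F z) (𝟙-yes (v ~? + r) hr) (𝟙-no (v ~? (+ r + 1ℤ)) (λ q → i~/i+1 (+ r) (~-trans (~-sym hr) q))))
     (ℚP.*-identityˡ (op B F z)))) (ℚP.+-identityˡ _)

 ∈-seg : ∀ {a l x} → x ∈ seg a l → Σ ℕ λ t → t ℕ.< l × x ≡ (a ℕ.+ suc t) ℕ.% n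
 ∈-seg {a} h with ∈-map⁻ (λ t → (a ℕ.+ suc t) ℕ.% n) h
 ... | t , t∈ , e = t , ∈-downFrom⁻ t∈ , e

 small-~/ : ∀ {v x} d → 0ℤ < d → d < N → v ~ x + d → v ~/ x
 small-~/ {v} {x} d d>0 d<N h q = <-irrefl (~-gap (~-trans (~-sym q) h)
  (lia 3 (λ x d N → d <: N => x :+ d :- N <: x) x d N d<N) (lia 3 (λ x d N → #0 <: d => d <: N => x <: x :+ d :+ N) x d N d>0 d<N))
  (lia 2 (λ x d → #0 <: d => x <: x :+ d) x d d>0)

 avoid-by : ∀ {v r} d → v ~ + r + + (2 ℕ.+ d) → d ℕ.< k ℕ.∸ 1 → Avoid v r
 avoid-by {v} {r} d h d<k = small-~/ (+ (2 ℕ.+ d)) (+<+ (ℕ.s≤s ℕ.z≤n)) (subst (+ (2 ℕ.+ d) ℤ.<_) (sym N-def) (+<+ (ℕ.s≤s d+1<k))) h ,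
   small-~/ (+ (1 ℕ.+ d)) (+<+ (ℕ.s≤s ℕ.z≤n)) (subst (+ (1 ℕ.+ d) ℤ.<_) (sym N-def) (+<+ (m<n⇒m<1+n d+1<k)))
    (~-trans h (~-reflexive (lia 2 (λ r d → r :+ (#2 :+ d) ≐ r :+ #1 :+ (#1 :+ d)) (+ r) (+ d))))
  where
  d+1<k : suc d ℕ.< k
  d+1<k = ℕP.<-≤-trans (ℕ.s≤s d<k) (ℕP.≤-reflexive (m+[n∸m]≡n 1≤k))

 -- x and v are given by offsets from a common base.
 avoid-offset : ∀ {v b t u} → v ~ b + + u → ∀ {x} → + x ~ b + + t → 2 ℕ.+ t ℕ.≤ u → u ℕ.≤ t ℕ.+ k → Avoid v x
 avoid-offset {v} {b} {t} {u} hv {x} hx h1 h2 = avoid-by (u ℕ.∸ (2 ℕ.+ t)) (~-trans hv (~-trans (~-reflexive eq) (~-sym (~-shift (+ (2 ℕ.+ d)) hx)))) d<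
  where
  d = u ℕ.∸ (2 ℕ.+ t)
  u≡ : (2 ℕ.+ t) ℕ.+ d ≡ u
  u≡ = m+[n∸m]≡n h1
  eq : b + + u ≡ b + + t + + (2 ℕ.+ d)
  eq = trans (cong (λ z → b + + z) (sym u≡)) (lia 3 (λ b t d → b :+ (#2 :+ t :+ d) ≐ b :+ t :+ (#2 :+ d)) b (+ t) (+ d))
  d< : d ℕ.< k ℕ.∸ 1
  d< = ℕP.+-cancelˡ-≤ (suc t) _ _ (ℕP.≤-trans (ℕP.≤-reflexive (trans (+-suc (suc t) d) u≡)) (ℕP.≤-trans h2 (ℕP.≤-reflexive (sym (trans (cong suc (sym refl)) (trans (sym (+-suc t (k ℕ.∸ 1))) (cong (t ℕ.+_) (m+[n∸m]≡n 1≤k))))))))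

 seg-~ : ∀ a t → + ((a ℕ.+ suc t) ℕ.% n) ~ + a + + suc t
 seg-~ a t = %-~ (a ℕ.+ suc t)

 ℚ-neg : ∀ q → ℚ.- q ≡ (ℚ.- 1ℚ) ℚ.* q
 ℚ-neg q = trans (cong ℚ.-_ (sym (ℚP.*-identityˡ q))) (ℚP.neg-distribˡ-* 1ℚ q)

 -- Telescoping over an arc ending just below the value v.
 cut-arc : ∀ {F} l a v j → v ~ + a + + suc l → l ℕ.≤ k → j ℕ.< l → ∀ y →
  sumL (λ D → cut D v F y) (choose (suc j) (seg a l)) ≡ ℚ.- sumL (λ D → op D F y) (choose j (seg a l))
 cut-arc {F} (suc l) a v j hv l<k j<l y = begin
   sumL (λ D → cut D v F y) (choose (suc j) (x ∷ L))
    ≡⟨ sumL-choose (λ D → cut D v F y) j x L ⟩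
   sumL (λ D → cut (x ∷ D) v F y) (choose j L) ℚ.+ sumL (λ D → cut D v F y) (choose (suc j) L)
    -- Subsets without the top letter x do not touch v and contribute 0. Those with x lower the
    -- value to v - 1, which lies just above the remaining arc.
    ≡⟨ cong₂ ℚ._+_ (sumL-cong head (choose j L)) (trans (sumL-cong∈ (choose (suc j) L) (λ {D} h → cut-avoid D v F y (avoids D h))) (sumL-0 (λ _ → refl) (choose (suc j) L))) ⟩
   sumL (λ D → up (+ x) (cut D v' F) y ℚ.+ (ℚ.- 1ℚ) ℚ.* op D F y) (choose j L) ℚ.+ 0ℚ
    ≡⟨ ℚP.+-identityʳ _ ⟩
   sumL (λ D → up (+ x) (cut D v' F) y ℚ.+ (ℚ.- 1ℚ) ℚ.* op D F y) (choose j L)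
    ≡⟨ sumL-+ (λ D → up (+ x) (cut D v' F) y) (λ D → (ℚ.- 1ℚ) ℚ.* op D F y) (choose j L) ⟩
   sumL (λ D → up (+ x) (cut D v' F) y) (choose j L) ℚ.+ sumL (λ D → (ℚ.- 1ℚ) ℚ.* op D F y) (choose j L)
    ≡⟨ cong₂ ℚ._+_ (sym (up-sum (+ x) (λ D → cut D v' F) (choose j L) y)) (trans (sumL-* (ℚ.- 1ℚ) (λ D → op D F y) (choose j L)) (sym (ℚ-neg (sumL (λ D → op D F y) (choose j L))))) ⟩
   up (+ x) (λ z → sumL (λ D → cut D v' F z) (choose j L)) y ℚ.- sumL (λ D → op D F y) (choose j L)
    ≡⟨ rest j j<l ⟩
   ℚ.- sumL (λ D → op D F y) (choose j (x ∷ L)) ∎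
  where
  open ≡-Reasoning
  L = seg a l
  x = (a ℕ.+ suc l) ℕ.% n
  v' = v - 1ℤ
  vx : v ~ + x + 1ℤ
  vx = ~-trans hv (~-trans (~-reflexive (lia 2 (λ a l → a :+ (#2 :+ l) ≐ a :+ (#1 :+ l) :+ #1) (+ a) (+ l))) (~-sym (~-shift 1ℤ (seg-~ a l))))
  v'~ : v' ~ + a + + suc l
  v'~ = ~-trans (~-shift (- 1ℤ) hv) (~-reflexive (lia 2 (λ a l → a :+ (#2 :+ l) :+ con (- 1ℤ) ≐ a :+ (#1 :+ l)) (+ a) (+ l)))
  v~/x : v ~/ + x
  v~/x q = i~/i+1 (+ x) (~-trans (~-sym q) vx)
  sv : s (+ x) v ≡ v'
  sv = trans (tr-at-b (i~/i+1 (+ x)) vx) (lia 2 (λ v x → v :+ (x :- (x :+ #1)) ≐ v :- #1) v (+ x))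
  head : ∀ D → cut (x ∷ D) v F y ≡ up (+ x) (cut D v' F) y ℚ.+ (ℚ.- 1ℚ) ℚ.* op D F y
  head D = cong₂ ℚ._+_ (cong (λ u → up (+ x) (cut D u F) y) sv)
   (cong₂ (λ a b → (a ℚ.- b) ℚ.* op D F y) (𝟙-no (v ~? + x) v~/x) (𝟙-yes (v ~? (+ x + 1ℤ)) vx))
  avoids : ∀ D → D ∈ choose (suc j) L → All (Avoid v) D
  avoids D h = All.tabulate λ {z} z∈D → lem z (∈-seg {a} {l} {z} (Sublist.lookup (proj₁ (choose-⊆ (suc j) L h)) z∈D))
   where
   lem : ∀ z → Σ ℕ (λ t → t ℕ.< l × z ≡ (a ℕ.+ suc t) ℕ.% n) → Avoid v z
   lem z (t , t<l , refl) = avoid-offset {b = + a} {suc t} {suc (suc l)} hv (seg-~ a t) (ℕ.s≤s (ℕ.s≤s t<l))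
    (ℕP.≤-trans (ℕ.s≤s l<k) (ℕP.≤-trans (ℕP.≤-reflexive (sym (ℕP.+-comm k 1))) (ℕP.≤-trans (ℕP.+-monoʳ-≤ k (ℕ.s≤s (ℕ.z≤n {t}))) (ℕP.≤-reflexive (ℕP.+-comm k (suc t))))))
  rest : ∀ j → j ℕ.< suc l → up (+ x) (λ z → sumL (λ D → cut D v' F z) (choose j L)) y ℚ.- sumL (λ D → op D F y) (choose j L)
     ≡ ℚ.- sumL (λ D → op D F y) (choose j (x ∷ L))
  rest zero _ = trans (cong (ℚ._- _) (up-0 (+ x) (λ _ → refl) y)) (ℚP.+-identityˡ _)
  rest (suc j) (ℕ.s≤s j<l) = begin
   up (+ x) (λ z → sumL (λ D → cut D v' F z) (choose (suc j) L)) y ℚ.- S (suc j)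
    ≡⟨ cong (ℚ._- S (suc j)) (trans (up-cong (+ x) y (trans (cut-arc l a v' j v'~ (ℕP.<⇒≤ l<k) j<l (+ x ▹ y)) (ℚ-neg (sumL (λ D → op D F (+ x ▹ y)) (choose j L)))))
       (trans (up-* (+ x) (ℚ.- 1ℚ) (λ z → sumL (λ D → op D F z) (choose j L)) y) (trans (sym (ℚ-neg (up (+ x) (λ z → sumL (λ D → op D F z) (choose j L)) y))) (cong ℚ.-_ (up-sum (+ x) (λ D → op D F) (choose j L) y))))) ⟩
   ℚ.- sumL (λ D → op (x ∷ D) F y) (choose j L) ℚ.- S (suc j)
    ≡⟨ ℚP.neg-distrib-+ (sumL (λ D → op (x ∷ D) F y) (choose j L)) (S (suc j)) ⟨
   ℚ.- (sumL (λ D → op (x ∷ D) F y) (choose j L) ℚ.+ S (suc j))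
    ≡⟨ cong ℚ.-_ (sumL-choose (λ D → op D F y) j x L) ⟨
   ℚ.- sumL (λ D → op D F y) (choose (suc j) (x ∷ L)) ∎
   where
   S : ℕ → ℚ
   S j = sumL (λ D → op D F y) (choose j L)

 Far : ℤ → ℤ → Set
 Far i j = i ~/ j × i ~/ j + 1ℤ × j ~/ i + 1ℤ

 Far-sym : ∀ {i j} → Far i j → Far j i
 Far-sym (a , b , c) = a ∘ ~-sym , c , b

 unshift : ∀ {i j} → i + 1ℤ ~ j + 1ℤ → i ~ j
 unshift {i} {j} h = subst₂ _~_ (back i) (back j) (~-shift (- 1ℤ) h)
  where
  back : ∀ i → i + 1ℤ + - 1ℤ ≡ i
  back = lia 1 (λ i → i :+ #1 :+ con (- 1ℤ) ≐ i)

 s-far : ∀ {i j} → Far i j → s i j ≡ j × s i (j + 1ℤ) ≡ j + 1ℤ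
 s-far (a , b , c) = tr-off (a ∘ ~-sym) c , tr-off (b ∘ ~-sym) (a ∘ ~-sym ∘ unshift)

 s-comm : ∀ {i j} → Far i j → ∀ m → s i (s j m) ≡ s j (s i m)
 s-comm {i} {j} h m = trans (cong (s i) (sym (swap-tr (i~/i+1 j) m)))
  (trans (conj (sA i) (i~/i+1 j) m) (cong₂ (λ a b → tr a b (s i m)) (proj₁ (s-far h)) (proj₂ (s-far h))))

 Desc-far : ∀ {i j} y → Far i j → Desc j (i ▹ y) → Desc j y
 Desc-far y h = subst₂ ℤ._<_ (cong (fr y) (proj₂ (s-far h))) (cong (fr y) (proj₁ (s-far h)))

 Desc-far⁻ : ∀ {i j} y → Far i j → Desc j y → Desc j (i ▹ y)
 Desc-far⁻ y h = subst₂ ℤ._<_ (cong (fr y) (sym (proj₂ (s-far h)))) (cong (fr y) (sym (proj₁ (s-far h))))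

 -- Neither reflection touches the two values that the other letter tests for a descent.
 up-comm : ∀ {F} → Ext F → ∀ {i j} → Far i j → ∀ y → up i (up j F) y ≡ up j (up i F) y
 up-comm {F} ext {i} {j} h y = lem (desc? i y) (desc? j y)
  where
  lem : Dec (Desc i y) → Dec (Desc j y) → up i (up j F) y ≡ up j (up i F) y
  lem (yes p) (yes q) = trans (up-desc p) (trans (up-desc (Desc-far⁻ y h q)) (trans (ext (agree λ m → sym (s-comm h (to y m))))
   (sym (trans (up-desc q) (up-desc (Desc-far⁻ y (Far-sym h) p))))))
  lem (yes p) (no ¬q) = trans (up-desc p) (trans (up-asc (¬q ∘ Desc-far y h)) (sym (up-asc ¬q)))
  lem (no ¬p) (yes q) = trans (up-asc ¬p) (sym (trans (up-desc q) (up-asc (¬p ∘ Desc-far y (Far-sym h)))))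
  lem (no ¬p) (no ¬q) = trans (up-asc ¬p) (sym (up-asc ¬q))

 FarLetters : ℕ → ℕ → Set
 FarLetters r q = Far (+ r) (+ q)

 op-move : ∀ {F} → Ext F → ∀ r B ws → All (FarLetters r) B → ∀ y → op (r ∷ B ++ ws) F y ≡ op (B ++ r ∷ ws) F y
 op-move ext r [] ws _ y = refl
 op-move ext r (b ∷ B) ws (h ∷ hs) y = trans (up-comm (op-ext (B ++ ws) ext) h y) (up-cong (+ b) y (op-move ext r B ws hs (+ b ▹ y)))

 op-comm : ∀ {F} → Ext F → ∀ A B → All (λ r → All (FarLetters r) B) A → ∀ y → op (A ++ B) F y ≡ op (B ++ A) F y
 op-comm {F} ext [] B _ y = cong (λ ws → op ws F y) (sym (++-identityʳ B))
 op-comm {F} ext (r ∷ A) B (h ∷ hs) y = trans (up-cong (+ r) y (op-comm ext A B hs (+ r ▹ y))) (op-move ext r B A h y)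

 All-⊆ : ∀ {A : Set} {P : A → Set} {xs ys : List A} → xs ⊆ ys → All P ys → All P xs
 All-⊆ τ h = All.tabulate (λ p → All.lookup h (Sublist.lookup τ p))

 filterᵇ-⊆ : ∀ {A : Set} (P : A → Bool) xs → filterᵇ P xs ⊆ xs
 filterᵇ-⊆ P [] = []
 filterᵇ-⊆ P (x ∷ xs) with P x
 ... | true = refl ∷ filterᵇ-⊆ P xs
 ... | false = x ∷ʳ filterᵇ-⊆ P xs

 module Arc' {a v : ℕ} (arc : Arcs a v) where
  open Arcs arc public

  A B : List ℕ
  A = seg v l2
  B = seg a l1

  v~ : + v ~ + a + + suc l1
  v~ = ~-trans (~-reflexive (cong +_ v≡)) (%-~ (a ℕ.+ suc l1))

  A~ : ∀ {x} → x ∈ A → Σ ℕ λ t → t ℕ.< l2 × + x ~ + a + + (suc l1 ℕ.+ suc t)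
  A~ {x} h with ∈-seg {v} {l2} h
  ... | t , t<l , refl = t , t<l , ~-trans (seg-~ v t) (~-trans (~-shift (+ suc t) v~) (~-reflexive (+-assoc (+ a) (+ suc l1) (+ suc t))))

  B~ : ∀ {x} → x ∈ B → Σ ℕ λ t → t ℕ.< l1 × + x ~ + a + + suc t
  B~ {x} h with ∈-seg {a} {l1} h
  ... | t , t<l , refl = t , t<l , seg-~ a t

  private
   k≡ : + l1 + (1ℤ + + l2) ≡ + k
   k≡ = cong +_ total

  avoid-A : All (Avoid (+ v)) A
  avoid-A = All.tabulate lem
   where
   lem : ∀ {x} → x ∈ A → Avoid (+ v) x
   lem {x} h with A~ h
   ... | t , t<l , e = avoid-offset {b = + a} {suc l1 ℕ.+ suc t} {suc l1 ℕ.+ n}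
    (~-trans v~ (~-trans (~-sym ~-+N) (~-reflexive (trans (cong (λ z → + a + + suc l1 + z) N-def) (+-assoc (+ a) (+ suc l1) (+ n)))))) e
    (drop‿+≤+ (lia 4 (λ l m t k → l :+ (#1 :+ m) ≐ k => t <: m => #0 =< l => #2 :+ (#1 :+ l :+ (#1 :+ t)) =< #1 :+ l :+ (#1 :+ k)) (+ l1) (+ l2) (+ t) (+ k) k≡ (+<+ t<l) 0≤+))
    (drop‿+≤+ (lia 3 (λ l t k → #0 =< t => #1 :+ l :+ (#1 :+ k) =< #1 :+ l :+ (#1 :+ t) :+ k) (+ l1) (+ t) (+ k) 0≤+))

  avoid-B : All (Avoid (+ v + 1ℤ)) B
  avoid-B = All.tabulate lem
   where
   lem : ∀ {x} → x ∈ B → Avoid (+ v + 1ℤ) x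
   lem {x} h with B~ h
   ... | t , t<l , e = avoid-offset {b = + a} {suc t} {suc (suc l1)}
    (~-trans (~-shift 1ℤ v~) (~-reflexive (lia 2 (λ a l → a :+ (#1 :+ l) :+ #1 ≐ a :+ (#2 :+ l)) (+ a) (+ l1)))) e
    (ℕ.s≤s (ℕ.s≤s t<l))
    (drop‿+≤+ (lia 4 (λ l m t k → l :+ (#1 :+ m) ≐ k => #0 =< m => #0 =< t => #2 :+ l =< #1 :+ t :+ k) (+ l1) (+ l2) (+ t) (+ k) k≡ 0≤+ 0≤+))

  far-AB : All (λ r → All (FarLetters r) B) A
  far-AB = All.tabulate λ p → All.tabulate λ q → lem (A~ p) (B~ q)
   where
   lem : ∀ {x y} → Σ ℕ (λ t → t ℕ.< l2 × + x ~ + a + + (suc l1 ℕ.+ suc t)) → Σ ℕ (λ t → t ℕ.< l1 × + y ~ + a + + suc t) → FarLetters x y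
   lem {x} {y} (t , t<l2 , ex) (u , u<l1 , ey) = proj₁ xy , proj₂ xy , λ q → proj₂ yx (~-trans q ~-refl)
    where
    xy : Avoid (+ x) y
    xy = avoid-offset {b = + a} {suc u} {suc l1 ℕ.+ suc t} ex ey
     (drop‿+≤+ (lia 3 (λ l t u → u <: l => #0 =< t => #2 :+ (#1 :+ u) =< #1 :+ l :+ (#1 :+ t)) (+ l1) (+ t) (+ u) (+<+ u<l1) 0≤+))
     (drop‿+≤+ (lia 5 (λ l m t u k → l :+ (#1 :+ m) ≐ k => t <: m => #0 =< u => #1 :+ l :+ (#1 :+ t) =< #1 :+ u :+ k) (+ l1) (+ l2) (+ t) (+ u) (+ k) k≡ (+<+ t<l2) 0≤+))
    yx : Avoid (+ y) x
    yx = avoid-offset {b = + a} {suc l1 ℕ.+ suc t} {suc u ℕ.+ n}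
     (~-trans ey (~-trans (~-sym ~-+N) (~-reflexive (trans (cong (λ z → + a + + suc u + z) N-def) (+-assoc (+ a) (+ suc u) (+ n)))))) ex
     (drop‿+≤+ (lia 5 (λ l m t u k → l :+ (#1 :+ m) ≐ k => t <: m => #0 =< u => #2 :+ (#1 :+ l :+ (#1 :+ t)) =< #1 :+ u :+ (#1 :+ k)) (+ l1) (+ l2) (+ t) (+ u) (+ k) k≡ (+<+ t<l2) 0≤+))
     (drop‿+≤+ (lia 4 (λ l t u k → u <: l => #0 =< t => #1 :+ u :+ (#1 :+ k) =< #1 :+ l :+ (#1 :+ t) :+ k) (+ l1) (+ t) (+ u) (+ k) (+<+ u<l1) 0≤+))

 upTo-↭-seg : ∀ {v} → v ℕ.< n → upTo n ↭ v ∷ seg v k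
 upTo-↭-seg {v} v<n = ↭-trans up-k (lem (k ℕP.≟ v))
  where
  seg-k : seg k k ≡ downFrom k
  seg-k = trans (map-cong∈ (downFrom k) (λ {t} h → trans (cong (ℕ._% n) (+-suc k t)) (trans (cong (ℕ._% n) (ℕP.+-comm n t)) (trans
    (~⇒% {t ℕ.+ n} {t} (~-trans (~-reflexive (cong (λ z → + t + z) (sym N-def))) ~-+N)) (res-small (m<n⇒m<1+n (∈-downFrom⁻ h))))))) (Listₚ.map-id (downFrom k))
   where
   map-cong∈ : ∀ {f g : ℕ → ℕ} xs → (∀ {x} → x ∈ xs → f x ≡ g x) → map f xs ≡ map g xs
   map-cong∈ [] h = refl
   map-cong∈ (x ∷ xs) h = cong₂ _∷_ (h (here refl)) (map-cong∈ xs (h ∘ there))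
  up-k : upTo n ↭ k ∷ seg k k
  up-k = ↭-trans (↭-sym (Permₚ.↭-reverse (upTo n))) (↭-reflexive (trans (Listₚ.reverse-upTo n) (cong (k ∷_) (sym seg-k))))
  lem : Dec (k ≡ v) → k ∷ seg k k ↭ v ∷ seg v k
  lem (yes refl) = ↭-refl
  lem (no ne) = ↭-trans (↭-reflexive (cong (k ∷_) seg-a)) (↭-trans (Permₚ.++-comm (k ∷ seg v l2) (v ∷ seg k l1)) (↭-reflexive (cong (v ∷_) (sym seg-v))))
   where open Arcs (cut-arcs (n<1+n k) v<n ne)

 seg-unique : ∀ {v} → v ℕ.< n → Unique (v ∷ seg v k)
 seg-unique v<n = PermSₚ.Unique-resp-↭ (setoid ℕ) (Perm.↭⇒↭ₛ (upTo-↭-seg v<n)) (Uniqueₚ.upTo⁺ n)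

 seg<n : ∀ {v x} → x ∈ seg v k → x ℕ.< n
 seg<n {v} h with ∈-seg {v} {k} h
 ... | t , _ , refl = ℕ.m%n<n (v ℕ.+ suc t) n

 wordD-sym : ∀ {D E} → D ↭ E → wordD k D ≡ wordD k E
 wordD-sym {D} {E} p = trans (filterᵇ-cong (seg (least D) k) (λ {x} _ → m x)) (cong (λ a → filterᵇ (λ x → memℕ x E) (seg a k))
   (cong (headOr 0) (filterᵇ-cong (upTo (suc k)) (λ {x} _ → cong not (m x)))))
  where
  m : ∀ x → memℕ x D ≡ memℕ x E
  m x = mem-cong {x} {D} {E} (Permₚ.∈-resp-↭ p) (Permₚ.∈-resp-↭ (↭-sym p))

 -- `wordD` opens the circle at the least missing letter. Opening it at another missing letter v
 -- exchanges the two arcs between the cuts, and their letters commute.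
 wordD-op : ∀ {F} → Ext F → ∀ {v D} → v ℕ.< n → D ⊆ seg v k → ∀ y → op (wordD k D) F y ≡ op D F y
 wordD-op {F} ext {v} {D} v<n τ y = lem (least D ℕP.≟ v)
  where
  u : Unique (v ∷ seg v k)
  u = seg-unique v<n
  v∉D : v ∉ D
  v∉D h = Unique-head u (Sublist.lookup τ h)
  spec = least-spec {D} v<n v∉D
  f : List ℕ → List ℕ
  f = filterᵇ (λ x → memℕ x D)
  D≡ : f (seg v k) ≡ D
  D≡ = filter-members (Unique-tail u) τ
  lem : Dec (least D ≡ v) → op (wordD k D) F y ≡ op D F y
  lem (yes e) = cong (λ ws → op ws F y) (trans (cong (λ a → f (seg a k)) e) D≡)
  lem (no ne) = trans (cong (λ ws → op ws F y) (trans (cong f seg-a) (trans (filterᵇ-++ (λ x → memℕ x D) A (v ∷ B)) (cong (f A ++_) (filterᵇ-skip {P = λ x → memℕ x D} {v} {B} (∉-mem v∉D))))))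
   (trans (op-comm ext (f A) (f B) (All.map (All-⊆ (filterᵇ-⊆ (λ x → memℕ x D) B)) (All-⊆ (filterᵇ-⊆ (λ x → memℕ x D) A) far-AB)) y)
    (cong (λ ws → op ws F y) (trans (sym (trans (cong f seg-v) (trans (filterᵇ-++ (λ x → memℕ x D) B (least D ∷ A)) (cong (f B ++_) (filterᵇ-skip {P = λ x → memℕ x D} {least D} {A} (∉-mem (proj₂ spec))))))) D≡)))
   where open Arc' (cut-arcs (proj₁ spec) v<n ne)

 record Split (v : ℕ) (D : List ℕ) : Set where
  field
   A B : List ℕ
   word≡ : wordD k (v ∷ D) ≡ A ++ v ∷ B
   rot≡ : B ++ A ≡ D
   avoid-A : All (Avoid (+ v)) A
   avoid-B : All (Avoid (+ v + 1ℤ)) B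
   far-AB : All (λ r → All (FarLetters r) B) A

 -- By its size D leaves out some letter other than v. Opening the circle there places v between two
 -- arcs whose letters commute.
 wordD-split : ∀ {v D} → v ℕ.< n → D ⊆ seg v k → length D ℕ.< k → Split v D
 wordD-split {v} {D} v<n τ D<k = record
  { A = g Arc.A ; B = g Arc.B
  ; word≡ = trans (cong f Arc.seg-a) (trans (filterᵇ-++ (λ x → memℕ x (v ∷ D)) Arc.A (v ∷ Arc.B)) (cong₂ _++_ (f≡g Arc.A A-in)
    (trans (filterᵇ-keep {P = λ x → memℕ x (v ∷ D)} {v} {Arc.B} (∈-mem {v} {v ∷ D} (here refl))) (cong (v ∷_) (f≡g Arc.B B-in)))))
  ; rot≡ = trans (sym (trans (cong g Arc.seg-v) (trans (filterᵇ-++ (λ x → memℕ x D) Arc.B (a ∷ Arc.A)) (cong (g Arc.B ++_)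
    (filterᵇ-skip {P = λ x → memℕ x D} {a} {Arc.A} (∉-mem (λ h → proj₂ spec (there h)))))))) (filter-members (Unique-tail u) τ)
  ; avoid-A = All-⊆ (filterᵇ-⊆ (λ x → memℕ x D) Arc.A) Arc.avoid-A
  ; avoid-B = All-⊆ (filterᵇ-⊆ (λ x → memℕ x D) Arc.B) Arc.avoid-B
  ; far-AB = All.map (All-⊆ (filterᵇ-⊆ (λ x → memℕ x D) Arc.B)) (All-⊆ (filterᵇ-⊆ (λ x → memℕ x D) Arc.A) Arc.far-AB) }
  where
  u : Unique (v ∷ seg v k)
  u = seg-unique v<n
  len-seg : length (seg v k) ≡ k
  len-seg = trans (Listₚ.length-map _ (downFrom k)) (Listₚ.length-downFrom k)
  m = missing (Unique-tail u) τ (subst (length D ℕ.<_) (sym len-seg) D<k)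
  a : ℕ
  a = least (v ∷ D)
  spec : a ℕ.< n × a ∉ v ∷ D
  spec = least-spec {v ∷ D} {proj₁ m} (seg<n {v} (proj₁ (proj₂ m))) (λ { (here e) → Unique-head u (subst (_∈ seg v k) e (proj₁ (proj₂ m))) ; (there h) → proj₂ (proj₂ m) h })
  f g : List ℕ → List ℕ
  f = filterᵇ (λ x → memℕ x (v ∷ D))
  g = filterᵇ (λ x → memℕ x D)
  module Arc = Arc' (cut-arcs (proj₁ spec) v<n (λ e → proj₂ spec (here e)))
  f≡g : ∀ xs → (∀ {x} → x ∈ xs → x ∈ seg v k) → f xs ≡ g xs
  f≡g xs h = filterᵇ-cong xs (λ {x} x∈ → mem-cong {x} {v ∷ D} {D} (λ { (here refl) → ⊥-elim (Unique-head u (h x∈)) ; (there p) → p }) there)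
  A-in : ∀ {x} → x ∈ Arc.A → x ∈ seg v k
  A-in {x} p = subst (x ∈_) (sym Arc.seg-v) (∈-++⁺ʳ Arc.B (there p))
  B-in : ∀ {x} → x ∈ Arc.B → x ∈ seg v k
  B-in {x} p = subst (x ∈_) (sym Arc.seg-v) (∈-++⁺ˡ p)

 wordD-cut : ∀ {F} → Ext F → ∀ {v D} → v ℕ.< n → D ⊆ seg v k → length D ℕ.< k → ∀ y → cut (wordD k (v ∷ D)) (+ v) F y ≡ op D F y
 wordD-cut {F} ext {v} {D} v<n τ D<k y =
   trans (cong (λ ws → cut ws (+ v) F y) word≡) (trans (cut-hit A v B (+ v) F y avoid-A ~-refl avoid-B)
    (trans (op-comm ext A B far-AB y) (cong (λ ws → op ws F y) rot≡)))
  where open Split (wordD-split v<n τ D<k)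

 cov-+ : ∀ F G y a b → cov (λ z → F z ℚ.+ G z) y a b ≡ cov F y a b ℚ.+ cov G y a b
 cov-+ F G y a b = lem (ℓ (y ⇌ a , b) ℕP.≟ suc (ℓ y))
  where
  lem : Dec (ℓ (y ⇌ a , b) ≡ suc (ℓ y)) → cov (λ z → F z ℚ.+ G z) y a b ≡ cov F y a b ℚ.+ cov G y a b
  lem (yes e) = trans (cov-yes e) (sym (cong₂ ℚ._+_ (cov-yes e) (cov-yes e)))
  lem (no ne) = trans (cov-no ne) (sym (cong₂ ℚ._+_ (cov-no ne) (cov-no ne)))

 cov-* : ∀ q F y a b → cov (λ z → q ℚ.* F z) y a b ≡ q ℚ.* cov F y a b
 cov-* q F y a b = lem (ℓ (y ⇌ a , b) ℕP.≟ suc (ℓ y))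
  where
  lem : Dec (ℓ (y ⇌ a , b) ≡ suc (ℓ y)) → cov (λ z → q ℚ.* F z) y a b ≡ q ℚ.* cov F y a b
  lem (yes e) = trans (cov-yes e) (sym (cong (q ℚ.*_) (cov-yes e)))
  lem (no ne) = trans (cov-no ne) (sym (trans (cong (q ℚ.*_) (cov-no ne)) (ℚP.*-zeroʳ q)))

 cov-0 : ∀ {F} y a b → (∀ z → F z ≡ 0ℚ) → cov F y a b ≡ 0ℚ
 cov-0 {F} y a b h = lem (ℓ (y ⇌ a , b) ℕP.≟ suc (ℓ y))
  where
  lem : Dec (ℓ (y ⇌ a , b) ≡ suc (ℓ y)) → cov F y a b ≡ 0ℚ
  lem (yes e) = trans (cov-yes e) (h _)
  lem (no ne) = cov-no ne

 monk-cong : ∀ M p {F G} y → (∀ z → F z ≡ G z) → monk M p F y ≡ monk M p G y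
 monk-cong M p y h = sumTo-cong M (λ d _ → cong₂ ℚ._-_ (cov-cong h) (cov-cong h))

 monk-+ : ∀ M p F G y → monk M p (λ z → F z ℚ.+ G z) y ≡ monk M p F y ℚ.+ monk M p G y
 monk-+ M p F G y = trans (sumTo-cong M (λ d _ → trans (cong₂ ℚ._-_ (cov-+ F G y _ _) (cov-+ F G y _ _))
   (ℚ-sub-interchange (cov F y p (p + + suc d)) (cov G y p (p + + suc d)) (cov F y (p - + suc d) p) (cov G y (p - + suc d) p))))
  (sumTo-+ (λ d → cov F y p (p + + suc d) ℚ.- cov F y (p - + suc d) p) _ M)

 monk-* : ∀ M p q F y → monk M p (λ z → q ℚ.* F z) y ≡ q ℚ.* monk M p F y
 monk-* M p q F y = trans (sumTo-cong M (λ d _ → trans (cong₂ ℚ._-_ (cov-* q F y _ _) (cov-* q F y _ _))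
   (ℚ-sub-* q (cov F y p (p + + suc d)) (cov F y (p - + suc d) p))))
  (sumTo-* (λ d → cov F y p (p + + suc d) ℚ.- cov F y (p - + suc d) p) q M)

 monk-0 : ∀ M p {F} y → (∀ z → F z ≡ 0ℚ) → monk M p F y ≡ 0ℚ
 monk-0 M p y h = sumTo-zero M (λ d _ → cong₂ ℚ._-_ (cov-0 y p _ h) (cov-0 y _ p h))

 monk-sum : ∀ {A : Set} M p (f : A → Fun) xs y → monk M p (λ z → sumL (λ a → f a z) xs) y ≡ sumL (λ a → monk M p (f a) y) xs
 monk-sum M p f [] y = monk-0 M p y (λ _ → refl)
 monk-sum M p f (x ∷ xs) y = trans (monk-+ M p (f x) _ y) (cong (monk M p (f x) y ℚ.+_) (monk-sum M p f xs y))

 eventually : ∀ {A : Set} (P : A → ℕ → Set) → (∀ a → Σ ℕ λ M0 → ∀ M → M0 ℕ.≤ M → P a M) →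
  ∀ xs → Σ ℕ λ M0 → ∀ M → M0 ℕ.≤ M → ∀ {a} → a ∈ xs → P a M
 eventually P h [] = 0 , λ _ _ ()
 eventually P h (x ∷ xs) = M1 ℕ.⊔ M2 , λ { M le (here refl) → proj₂ (h x) M (ℕP.≤-trans (m≤m⊔n M1 M2) le)
                     ; M le (there p) → proj₂ (eventually P h xs) M (ℕP.≤-trans (m≤n⊔m M1 M2) le) p }
  where
  M1 = proj₁ (h x)
  M2 = proj₁ (eventually P h xs)

 lin-hE : ∀ r F y → lin (hE k r) F y ≡ sumL (λ D → op (wordD k D) F y) (choose r (upTo n))
 lin-hE r F y = trans (sumL-map (λ t → proj₁ t ℚ.* op (proj₂ t) F y) (λ D → (1ℚ , wordD k D)) (choose r (upTo (suc k)))) (sumL-cong (λ D → ℚP.*-identityˡ _) (choose r (upTo n)))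

 cut-~ : ∀ ws {v w} F y → v ~ w → cut ws v F y ≡ cut ws w F y
 cut-~ [] F y h = refl
 cut-~ (r ∷ ws) {v} {w} F y h = cong₂ ℚ._+_ (up-cong (+ r) y (cut-~ ws F (+ r ▹ y) (to-~ (sA (+ r)) h)))
  (cong₂ (λ a b → (a ℚ.- b) ℚ.* op ws F y) (same (+ r)) (same (+ r + 1ℤ)))
  where
  same : ∀ i → 𝟙 (v ~? i) ≡ 𝟙 (w ~? i)
  same i = cong (λ b → if b then 1ℚ else 0ℚ) (⌊⌋-cong (v ~? i) (w ~? i) (~-trans (~-sym h)) (~-trans h))

 -- Let v be the class of the value at p. Subsets containing v contribute the products of their
 -- other j letters; subsets without v telescope to minus the same sum.
 h-kernel : ∀ {F} → Ext F → Ker F → ∀ j → j ℕ.< k → Ker (lin (hE k (suc j)) F)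
 h-kernel {F} ext ker j j<k y p = M1 ℕ.⊔ M2 , λ M le → begin
   monk M p (lin (hE k (suc j)) F) y
    ≡⟨ monk-cong M p y (lin-hE (suc j) F) ⟩
   monk M p (λ z → sumL (λ D → op (wordD k D) F z) (choose (suc j) (upTo n))) y
    ≡⟨ monk-sum M p (λ D → op (wordD k D) F) (choose (suc j) (upTo n)) y ⟩
   sumL (f M) (choose (suc j) (upTo n))
    ≡⟨ sumL-choose-↭ (suc j) (λ q → cong (λ ws → monk M p (op ws F) y) (wordD-sym q)) (upTo-↭-seg v<n) ⟩
   sumL (f M) (choose (suc j) (v ∷ L))
    ≡⟨ sumL-choose (f M) j v L ⟩
   sumL (λ D → f M (v ∷ D)) (choose j L) ℚ.+ sumL (f M) (choose (suc j) L)
    ≡⟨ cong₂ ℚ._+_ (sumL-cong∈ (choose j L) (λ {D} h → trans (proj₂ ev1 M (ℕP.≤-trans (m≤m⊔n M1 M2) le) h) (trans (cut-~ (wordD k (v ∷ D)) F y v~)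
        (wordD-cut ext v<n (proj₁ (choose-⊆ j L h)) (subst (ℕ._< k) (sym (proj₂ (choose-⊆ j L h))) j<k) y))))
       (trans (sumL-cong∈ (choose (suc j) L) (λ {D} h → trans (monk-cong M p y (wordD-op ext v<n (proj₁ (choose-⊆ (suc j) L h))))
        (trans (proj₂ ev2 M (ℕP.≤-trans (m≤n⊔m M1 M2) le) h) (cut-~ D F y v~'')))) (cut-arc k v v' j ~-refl ℕP.≤-refl j<k y)) ⟩
   sumL (λ D → op D F y) (choose j L) ℚ.- sumL (λ D → op D F y) (choose j L)
    ≡⟨ ℚP.+-inverseʳ (sumL (λ D → op D F y) (choose j L)) ⟩
   0ℚ ∎
  where
  open ≡-Reasoning
  v : ℕ
  v = res (to y p)
  v<n : v ℕ.< n
  v<n = res<n (to y p)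
  v~ : to y p ~ + v
  v~ = res-~ (to y p)
  -- The representative one turn above v lies just above the arc v + 1, ..., v + k, as `cut-arc`
  -- asks.
  v' : ℤ
  v' = + v + + suc k
  v~'' : to y p ~ v'
  v~'' = ~-trans v~ (~-trans (~-sym ~-+N) (~-reflexive (cong (λ z → + v + z) N-def)))
  L : List ℕ
  L = seg v k
  f : ℕ → List ℕ → ℚ
  f M D = monk M p (op (wordD k D) F) y
  ev1 = eventually (λ D M → f M (v ∷ D) ≡ cut (wordD k (v ∷ D)) (to y p) F y) (λ D → monk-op ext ker (wordD k (v ∷ D)) y p) (choose j L)
  ev2 = eventually (λ D M → monk M p (op D F) y ≡ cut D (to y p) F y) (λ D → monk-op ext ker D y p) (choose (suc j) L)
  M1 = proj₁ ev1
  M2 = proj₁ ev2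

 -- The identity has length 0, so it covers nothing.
 Ker-δ : Ker δ
 Ker-δ y p = 0 , λ M _ → sumTo-zero M (λ d _ → cong₂ ℚ._-_ (none p (p + + suc d)) (none (p - + suc d) p))
  where
  none : ∀ a b → cov δ y a b ≡ 0ℚ
  none a b = lem (ℓ (y ⇌ a , b) ℕP.≟ suc (ℓ y))
   where
   lem : Dec (ℓ (y ⇌ a , b) ≡ suc (ℓ y)) → cov δ y a b ≡ 0ℚ
   lem (no ne) = cov-no ne
   lem (yes e) = trans (cov-yes e) (δ-ne (λ h → absurd (trans (sym e) (trans (ℓ-cong h) (ℓ-rising idA Rising-id)))))
    where
    absurd : ∀ {m} → suc m ≢ 0
    absurd ()

 Ker-cong : ∀ {F G} → (∀ y → F y ≡ G y) → Ker F → Ker G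
 Ker-cong h ker y p = proj₁ (ker y p) , λ M le → trans (monk-cong M p y (sym ∘ h)) (proj₂ (ker y p) M le)

 Ker-+ : ∀ {F G} → Ker F → Ker G → Ker (λ y → F y ℚ.+ G y)
 Ker-+ {F} {G} kF kG y p = M1 ℕ.⊔ M2 , λ M le → trans (monk-+ M p F G y) (cong₂ ℚ._+_
   (proj₂ (kF y p) M (ℕP.≤-trans (m≤m⊔n M1 M2) le)) (proj₂ (kG y p) M (ℕP.≤-trans (m≤n⊔m M1 M2) le)))
  where
  M1 = proj₁ (kF y p)
  M2 = proj₁ (kG y p)

 Ker-* : ∀ q {F} → Ker F → Ker (λ y → q ℚ.* F y)
 Ker-* q {F} kF y p = proj₁ (kF y p) , λ M le → trans (monk-* M p q F y) (trans (cong (q ℚ.*_) (proj₂ (kF y p) M le)) (ℚP.*-zeroʳ q))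

 hs-elem : List (Fin k) → Elem
 hs-elem js = prodE (map (λ j → hE k (suc (toℕ j))) js)

 Ker-prod : ∀ (js : List (Fin k)) → Ker (lin (hs-elem js) δ)
 Ker-prod [] = Ker-cong (sym ∘ lin-one δ) Ker-δ
 Ker-prod (j ∷ js) = Ker-cong (sym ∘ lin-· (hE k (suc (toℕ j))) (hs-elem js) δ)
  (h-kernel (lin-ext (hs-elem js) δ-ext) (Ker-prod js) (toℕ j) (Finₚ.toℕ<n j))

 lin-++ : ∀ e f F x → lin (e ++ f) F x ≡ lin e F x ℚ.+ lin f F x
 lin-++ e f F x = sumL-++ (λ t → proj₁ t ℚ.* op (proj₂ t) F x) e f

 lin-evalPoly : ∀ (P : Poly k) x → lin (evalPoly k P) δ x ≡ sumL (λ t → proj₁ t ℚ.* lin (hs-elem (proj₂ t)) δ x) P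
 lin-evalPoly [] x = refl
 lin-evalPoly (t ∷ P) x = trans (lin-++ (scaleE (proj₁ t) (hs-elem (proj₂ t))) (evalPoly k P) δ x)
  (cong₂ ℚ._+_ (lin-scale (proj₁ t) (hs-elem (proj₂ t)) δ x) (lin-evalPoly P x))

 -- One half of the description of 𝔹 as a kernel; the other half is `ker-InB`.
 Ker-poly : ∀ (P : Poly k) → Ker (lin (evalPoly k P) δ)
 Ker-poly P = Ker-cong (sym ∘ lin-evalPoly P) (go P)
  where
  go : ∀ P → Ker (λ x → sumL (λ t → proj₁ t ℚ.* lin (hs-elem (proj₂ t)) δ x) P)
  go [] y p = 0 , λ M _ → monk-0 M p y (λ _ → refl)
  go (t ∷ P) = Ker-+ (Ker-* (proj₁ t) (Ker-prod (proj₂ t))) (go P)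

 -- Transitions: kernel elements are determined on increasing permutations

 -- Minimal coset representatives: increasing on the positions 1, …, n.
 Increasing : AP → Set
 Increasing x = ∀ {a b} → 1ℤ ≤ a → a < b → b ≤ N → to x a < to x b

 sumZ : ℕ → (ℕ → ℤ) → ℤ
 sumZ zero f = 0ℤ
 sumZ (suc m) f = sumZ m f + f m

 sumZ-cong : ∀ m {f g : ℕ → ℤ} → (∀ i → i ℕ.< m → f i ≡ g i) → sumZ m f ≡ sumZ m g
 sumZ-cong zero h = refl
 sumZ-cong (suc m) h = cong₂ _+_ (sumZ-cong m (λ i i<m → h i (m<n⇒m<1+n i<m))) (h m (n<1+n m))

 sumZ-change : ∀ m {f g : ℕ → ℤ} i → i ℕ.< m → (∀ j → j ℕ.< m → j ≢ i → f j ≡ g j) → sumZ m f + g i ≡ sumZ m g + f i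
 sumZ-change (suc m) {f} {g} i i<m h with i ℕP.≟ m
 ... | yes refl = lia 4 (λ a b f g → a ≐ b => a :+ f :+ g ≐ b :+ g :+ f) (sumZ i f) (sumZ i g) (f i) (g i) (sumZ-cong i (λ j j<i → h j (m<n⇒m<1+n j<i) (<⇒≢ j<i)))
 ... | no ne = lia 6 (λ a b f g x y → a :+ x ≐ b :+ y => f ≐ g => a :+ f :+ x ≐ b :+ g :+ y) (sumZ m f) (sumZ m g) (f m) (g m) (g i) (f i)
   (sumZ-change m i (ℕP.≤∧≢⇒< (<⇒≤pred i<m) ne) (λ j j<m → h j (m<n⇒m<1+n j<m))) (h m (n<1+n m) (ne ∘ sym))

 sumZ-change2 : ∀ m {f g : ℕ → ℤ} i j → i ℕ.< m → j ℕ.< m → i ≢ j → (∀ l → l ℕ.< m → l ≢ i → l ≢ j → f l ≡ g l) →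
  sumZ m f + (g i + g j) ≡ sumZ m g + (f i + f j)
 sumZ-change2 m {f} {g} i j i<m j<m i≢j h = lia 7 (λ F G H fi fj gi gj → F :+ gi ≐ H :+ fi => H :+ gj ≐ G :+ fj => F :+ (gi :+ gj) ≐ G :+ (fi :+ fj))
   (sumZ m f) (sumZ m g) (sumZ m h') (f i) (f j) (g i) (g j)
   (trans (cong (λ z → sumZ m f + z) (sym at-i)) (sumZ-change m i i<m (λ l _ l≢ → sym (off-i l l≢))))
   (trans (sumZ-change m {h'} {g} j j<m near) (cong (λ z → sumZ m g + z) (off-i j (i≢j ∘ sym))))
  where
  h' : ℕ → ℤ
  h' l with l ℕP.≟ i
  ... | yes _ = g l
  ... | no _ = f l
  at-i : h' i ≡ g i
  at-i with i ℕP.≟ i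
  ... | yes _ = refl
  ... | no ne = ⊥-elim (ne refl)
  off-i : ∀ l → l ≢ i → h' l ≡ f l
  off-i l ne with l ℕP.≟ i
  ... | yes e = ⊥-elim (ne e)
  ... | no _ = refl
  near : ∀ l → l ℕ.< m → l ≢ j → h' l ≡ g l
  near l l<m l≢j with l ℕP.≟ i
  ... | yes _ = refl
  ... | no ne = h l l<m ne l≢j

 pos : ℕ → ℤ
 pos i = + suc i

 -- A swap inside the window leaves this sum of squares unchanged, while a length-increasing swap
 -- with a position outside the window raises it.
 Q : AP → ℤ
 Q x = sumZ n (λ i → to x (pos i) * to x (pos i))

 lex : AP → Vec ℤ n
 lex x = tabulate (λ i → to x (pos (toℕ i)))

 _<ₗ_ : Vec ℤ n → Vec ℤ n → Set
 _<ₗ_ = Lex.Lex-< _≡_ _<_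

 infix 4 _≺A_
 -- The order along which a transition moves upwards: by `Q`, with ties broken by the window read
 -- from the left.
 _≺A_ : AP → AP → Set
 x ≺A y = Q x < Q y ⊎ (Q x ≡ Q y × lex x <ₗ lex y)

 <ₗ-trans : ∀ {u v w} → u <ₗ v → v <ₗ w → u <ₗ w
 <ₗ-trans = Lex.<-trans (IsEquivalence.isPartialEquivalence isEquivalence) (resp₂ _<_) <-trans

 <ₗ-irrefl : ∀ {u} → ¬ u <ₗ u
 <ₗ-irrefl = Lex.<-irrefl (λ e h → <-irrefl e h) (Pointwise.refl refl)

 ≺A-trans : ∀ {x y z} → x ≺A y → y ≺A z → x ≺A z
 ≺A-trans (inj₁ h) (inj₁ g) = inj₁ (<-trans h g)
 ≺A-trans {x} (inj₁ h) (inj₂ (e , _)) = inj₁ (subst (Q x <_) e h)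
 ≺A-trans {z = z} (inj₂ (e , _)) (inj₁ g) = inj₁ (subst (_< Q z) (sym e) g)
 ≺A-trans (inj₂ (e , h)) (inj₂ (e' , h')) = inj₂ (trans e e' , <ₗ-trans h h')

 ≺A-irrefl : ∀ {x} → ¬ x ≺A x
 ≺A-irrefl (inj₁ h) = <-irrefl refl h
 ≺A-irrefl (inj₂ (_ , h)) = <ₗ-irrefl h

 Q-cong : ∀ {x y} → x ≗A y → Q x ≡ Q y
 Q-cong h = sumZ-cong n (λ i _ → cong₂ _*_ (at h (pos i)) (at h (pos i)))

 ≺A-resp : ∀ {x y z} → x ≺A y → y ≗A z → x ≺A z
 ≺A-resp {x} (inj₁ h) e = inj₁ (subst (Q x <_) (Q-cong e) h)
 ≺A-resp {x} {y} {z} (inj₂ (q , h)) e = inj₂ (trans q (Q-cong e) , subst (lex x <ₗ_) (tabulate-≡ e) h)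
  where
  open import Data.Vec.Properties using (tabulate-cong)
  tabulate-≡ : y ≗A z → lex y ≡ lex z
  tabulate-≡ e = tabulate-cong (λ i → at e (pos (toℕ i)))

 lex-at : ∀ {m} {f g : Fin m → ℤ} (i : Fin m) → (∀ j → j Fin.< i → f j ≡ g j) → f i < g i → Lex.Lex-< _≡_ _<_ (tabulate f) (tabulate g)
 lex-at zero h l = this l refl
 lex-at (suc i) h l = next (h zero (ℕ.s≤s ℕ.z≤n)) (lex-at i (λ j j<i → h (suc j) (ℕ.s≤s j<i)) l)

 data Largest (P : ℕ → Set) (m : ℕ) : Set where
  none : (∀ j → j ℕ.< m → ¬ P j) → Largest P m
  found : ∀ j → j ℕ.< m → P j → (∀ i → j ℕ.< i → i ℕ.< m → ¬ P i) → Largest P m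

 largest : ∀ {P : ℕ → Set} → (∀ j → Dec (P j)) → ∀ m → Largest P m
 largest d zero = none λ _ ()
 largest {P} d (suc m) with d m
 ... | yes p = found m (n<1+n m) p (λ i m<i i<sm → ⊥-elim (ℕP.<⇒≱ m<i (<⇒≤pred i<sm)))
 ... | no ¬p with largest d m
 ... | none h = none λ j j<sm → below j (ℕP.m≤n⇒m<n∨m≡n (<⇒≤pred j<sm)) h
  where
  below : ∀ j → j ℕ.< m ⊎ j ≡ m → (∀ j → j ℕ.< m → ¬ P j) → ¬ P j
  below j (inj₁ l) h = h j l
  below j (inj₂ refl) h = ¬p
 ... | found j j<m p h = found j (m<n⇒m<1+n j<m) p λ i j<i i<sm → above i j<i (ℕP.m≤n⇒m<n∨m≡n (<⇒≤pred i<sm))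
  where
  above : ∀ i → j ℕ.< i → i ℕ.< m ⊎ i ≡ m → ¬ P i
  above i j<i (inj₁ l) = h i j<i l
  above i j<i (inj₂ refl) = ¬p

 rising-chain : ∀ x {lo hi} → (∀ i → lo ≤ i → i < hi → to x i < to x (i + 1ℤ)) → ∀ {a b} → lo ≤ a → a < b → b ≤ hi → to x a < to x b
 rising-chain x {lo} {hi} h {a} la a<b b≤hi with offset a<b
 ... | d , refl = go d b≤hi
  where
  go : ∀ d → a + + suc d ≤ hi → to x a < to x (a + + suc d)
  go zero le = h a la (<-≤-trans (p<p+1 a) le)
  go (suc d) le = <-trans (go d (lia 3 (λ a d h → a :+ (#1 :+ (#1 :+ d)) =< h => a :+ (#1 :+ d) =< h) a (+ d) hi le))
   (subst (λ z → to x (a + + suc d) < to x z) (lia 2 (λ a d → a :+ (#1 :+ d) :+ #1 ≐ a :+ (#1 :+ (#1 :+ d))) a (+ d))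
    (h (a + + suc d) (lia 3 (λ a d l → l =< a => #0 =< d => l =< a :+ (#1 :+ d)) a (+ d) lo la 0≤+)
     (lia 3 (λ a d h → a :+ (#1 :+ (#1 :+ d)) =< h => a :+ (#1 :+ d) <: h) a (+ d) hi le)))

 record Reduced-pos (b : ℤ) : Set where
  field
   i : ℕ
   i<n : i ℕ.< n
   t : ℤ
   b≡ : b ≡ pos i + t ·N

 reduce-pos : ∀ b → Reduced-pos b
 reduce-pos b = record { i = res (b - 1ℤ) ; i<n = res<n (b - 1ℤ) ; t = (b - 1ℤ) ℤ./ℕ n
  ; b≡ = lia 3 (λ b r q → b :- #1 ≐ r :+ q => b ≐ #1 :+ r :+ q) b (+ res (b - 1ℤ)) (((b - 1ℤ) ℤ./ℕ n) ·N) (res-split (b - 1ℤ)) }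

 square-shift : ∀ u v t → (v + t) * (v + t) + (u - t) * (u - t) ≡ u * u + v * v + (t + t) * (v + t - u)
 square-shift = solve-∀

 ⇌-at-b : ∀ x {a b m} t → a ~/ b → m + t ·N ≡ b → to (x ⇌ a , b) m ≡ to x a - t ·N
 ⇌-at-b x {a} {b} {m} t ne refl = trans (cong (to x) (trans (swap-tr ne m) (trans (tr-at-b ne (~-sym (~-turn t)))
   (lia 3 (λ a m t → m :+ (a :- (m :+ t)) ≐ a :- t) a m (t ·N)))))
  (lia 3 (λ xat xa t → xa ≐ xat :+ t => xat ≐ xa :- t) (to x (a - t ·N)) (to x a) (t ·N)
   (trans (cong (to x) (lia 2 (λ a t → a ≐ a :- t :+ t) a (t ·N))) (per x (a - t ·N) t)))

 Q-swap : ∀ y i j → i ℕ.< n → j ℕ.< n → ∀ t → pos i ~/ pos j + t ·N →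
  Q (y ⇌ pos i , pos j + t ·N) ≡ Q y + (t ·N + t ·N) * (to y (pos j + t ·N) - to y (pos i))
 Q-swap y i j i<n j<n t ne = lia 8 (λ Qw Qy a b c d e f → Qy :+ (a :+ b) ≐ Qw :+ (c :+ d) => a :+ b ≐ c :+ d :+ e => e ≐ f => Qw ≐ Qy :+ f)
   (Q w) (Q y) (wi * wi) (wj * wj) (yi * yi) (yj * yj) ((τ + τ) * (yj + τ - yi)) ((τ + τ) * (to y b - yi))
   (sumZ-change2 n i j i<n j<n i≢j (λ l l<n l≢i l≢j → sym (cong (λ z → z * z) (⇌-off y (far l l<n i i<n l≢i) (λ q → far l l<n j j<n l≢j (~-trans q (~-turn t)))))))
   (trans (cong₂ (λ u v → u * u + v * v) (trans (⇌-a y ne) (per y (pos j) t)) (⇌-at-b y t ne refl)) (square-shift yi yj τ))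
   (cong (λ z → (τ + τ) * (z - yi)) (sym (per y (pos j) t)))
  where
  τ b : ℤ
  τ = t ·N
  b = pos j + τ
  w = y ⇌ pos i , b
  wi wj yi yj : ℤ
  wi = to w (pos i)
  wj = to w (pos j)
  yi = to y (pos i)
  yj = to y (pos j)
  i≢j : i ≢ j
  i≢j refl = ne (~-sym (~-turn t))
  far : ∀ l → l ℕ.< n → ∀ m → m ℕ.< n → l ≢ m → pos l ~/ pos m
  far l l<n m m<n l≢m h = l≢m (suc-injective (+-injective (~-window 1ℤ h (+≤+ (ℕ.s≤s ℕ.z≤n)) (in-win l<n) (+≤+ (ℕ.s≤s ℕ.z≤n)) (in-win m<n))))
   where
   in-win : ∀ {l} → l ℕ.< n → pos l < 1ℤ + N
   in-win l<n = subst (λ z → _ < 1ℤ + z) (sym N-def) (+<+ (ℕ.s≤s l<n))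

 Q-swap0 : ∀ y i j → i ℕ.< n → j ℕ.< n → pos i ~/ pos j → Q (y ⇌ pos i , pos j) ≡ Q y
 Q-swap0 y i j i<n j<n ne = trans (cong (λ z → Q (y ⇌ pos i , z)) (sym j≡)) (trans (Q-swap y i j i<n j<n 0ℤ (ne ∘ (λ h → ~-trans h (~-turn 0ℤ))))
   (trans (cong (λ z → Q y + (z + z) * (to y (pos j + 0ℤ ·N) - to y (pos i))) 0·N) (trans (cong (λ z → Q y + z) (*-zeroˡ (to y (pos j + 0ℤ ·N) - to y (pos i)))) (+-identityʳ (Q y)))))
  where
  j≡ : pos j + 0ℤ ·N ≡ pos j
  j≡ = trans (cong (λ z → pos j + z) 0·N) (+-identityʳ (pos j))

 pos*pos : ∀ {a b} → 0ℤ < a → 0ℤ < b → 0ℤ < a * b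
 pos*pos {+ zero} (+<+ ()) _
 pos*pos {+ suc a} {+ zero} _ (+<+ ())
 pos*pos {+ suc a} {+ suc b} _ _ = +<+ (ℕ.s≤s ℕ.z≤n)

 neg*neg : ∀ {a b} → a < 0ℤ → b < 0ℤ → 0ℤ < a * b
 neg*neg {+ a} (+<+ ()) _
 neg*neg { -[1+ a ]} {+ b} _ (+<+ ())
 neg*neg { -[1+ a ]} { -[1+ b ]} _ _ = +<+ (ℕ.s≤s ℕ.z≤n)

 1≤⇒pos : ∀ {a} → 1ℤ ≤ a → Σ ℕ λ i → a ≡ pos i
 1≤⇒pos {+ suc i} _ = i , refl
 1≤⇒pos {+ zero} (+≤+ ())

 pos≤N : ∀ {i} → i ℕ.< n → pos i ≤ N
 pos≤N i<n = subst (_ ≤_) (sym N-def) (+≤+ i<n)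

 pos≤N⁻ : ∀ {i} → pos i ≤ N → i ℕ.< n
 pos≤N⁻ {i} h = drop‿+≤+ (subst (pos i ≤_) N-def h)

 above-cases : ∀ {a b : ℤ} → ¬ a < b → a ≢ b → b < a
 above-cases ¬a ne = ≤∧≢⇒< (≮⇒≥ ¬a) (ne ∘ sym)

 shift-sign⁺ : ∀ {b i} t → i ℕ.< n → b ≡ pos i + t ·N → N < b → 0ℤ < t ·N
 shift-sign⁺ {b} {i} t i<n e h = lia 4 (λ b i t N → b ≐ i :+ t => N <: b => i =< N => #0 <: t) b (pos i) (t ·N) N e h (pos≤N i<n)

 shift-sign⁻ : ∀ {b i} t → b ≡ pos i + t ·N → b < 1ℤ → t ·N < 0ℤ
 shift-sign⁻ {b} {i} t e h = lia 3 (λ b i t → b ≐ #1 :+ i :+ t => b <: #1 => #0 =< i => t <: #0) b (+ i) (t ·N) e h 0≤+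

 cov-zero : ∀ {F y a b} → (ℓ (y ⇌ a , b) ≡ suc (ℓ y) → F (y ⇌ a , b) ≡ 0ℚ) → cov F y a b ≡ 0ℚ
 cov-zero {F} {y} {a} {b} h = lem (ℓ (y ⇌ a , b) ℕP.≟ suc (ℓ y))
  where
  lem : Dec (ℓ (y ⇌ a , b) ≡ suc (ℓ y)) → cov F y a b ≡ 0ℚ
  lem (yes e) = trans (cov-yes e) (h e)
  lem (no ne) = cov-no ne

 cover-~/ : ∀ {y a b} → ℓ (y ⇌ a , b) ≡ suc (ℓ y) → a ~/ b
 cover-~/ {y} e h = suc≢ (trans (sym (ℓ-cong (agree λ m → cong (to y) (swap-~ h m)))) e)

 -- The Lascoux-Schützenberger transition. With p the last descent in the window and q the last
 -- window position holding a value below that of p, the kernel equation at `x ⇌ p , q` and p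
 -- contains F x; its other terms belong to swaps that are no covers or to elements above x.
 module Transition {F : Fun} (ext : Ext F) (ker : Ker F) (x : AP) (IH : ∀ z → x ≺A z → F z ≡ 0ℚ)
  (j : ℕ) (j<k : j ℕ.< k) (desc : to x (pos (suc j)) < to x (pos j))
  (last : ∀ i → j ℕ.< i → i ℕ.< k → ¬ to x (pos (suc i)) < to x (pos i)) where

  p : ℤ
  p = pos j

  rising-after : ∀ {a b} → p + 1ℤ ≤ a → a < b → b ≤ N → to x a < to x b
  rising-after = rising-chain x step
   where
   step : ∀ i → p + 1ℤ ≤ i → i < N → to x i < to x (i + 1ℤ)
   step i p<i i<N with 1≤⇒pos (≤-trans (+≤+ (ℕ.s≤s ℕ.z≤n)) p<i)
   ... | i' , refl = subst (λ z → to x (pos i') < to x z) (cong +_ (cong suc (ℕP.+-comm 1 i')))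
      (above-cases (last i' (ℕP.≤-trans (ℕP.≤-reflexive (ℕP.+-comm 1 j)) (≤-pred (drop‿+≤+ p<i))) (≤-pred (drop‿+<+ (subst (pos i' <_) N-def i<N))))
       (λ e → ℕP.1+n≢n (suc-injective (+-injective (to-inj x e)))))

  module _ (d0 : ℕ) (d0<k-j : d0 ℕ.< k ℕ.∸ j) (below : to x (p + + suc d0) < to x p)
       (max : ∀ d → d0 ℕ.< d → d ℕ.< k ℕ.∸ j → ¬ to x (p + + suc d) < to x p) where

   j+d<n : ∀ {d} → d ℕ.< k ℕ.∸ j → j ℕ.+ suc d ℕ.< n
   j+d<n h = ℕ.s≤s (ℕP.≤-trans (ℕP.+-monoʳ-≤ j h) (ℕP.≤-reflexive (m+[n∸m]≡n (ℕP.<⇒≤ j<k))))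

   j<n : j ℕ.< n
   j<n = m<n⇒m<1+n j<k

   is : ℕ
   is = j ℕ.+ suc d0

   q : ℤ
   q = pos is

   is<n : is ℕ.< n
   is<n = j+d<n d0<k-j

   p<q : p < q
   p<q = +<+ (ℕ.s≤s (m<m+n j (ℕ.s≤s ℕ.z≤n)))

   window-~/ : ∀ {a b} → 1ℤ ≤ a → a < b → b ≤ N → a ~/ b
   window-~/ {a} {b} h1 h2 h3 = near-~/ h2 (lia 3 (λ a b N → #1 =< a => b =< N => b <: a :+ N) a b N h1 h3)

   1≤p : 1ℤ ≤ p
   1≤p = +≤+ (ℕ.s≤s ℕ.z≤n)

   p~/q : p ~/ q
   p~/q = window-~/ 1≤p p<q (pos≤N is<n)

   y : AP
   y = x ⇌ p , q

   yp : to y p ≡ to x q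
   yp = ⇌-a x p~/q

   yq : to y q ≡ to x p
   yq = ⇌-b x p~/q

   yp<yq : to y p < to y q
   yp<yq = subst₂ _<_ (sym yp) (sym yq) below

   ℓxy : ℓ x ≡ suc (ℓ y)
   ℓxy = drop-one d0 x p (lia 3 (λ p d N → #1 =< p => p :+ (#1 :+ d) =< N => #1 :+ d <: N) p (+ d0) N 1≤p (pos≤N is<n)) below
    (λ b p<b b<q → rising-after (lia 2 (λ p b → p <: b => p :+ #1 =< b) p b p<b) b<q (pos≤N is<n))

   Qy : Q y ≡ Q x
   Qy = Q-swap0 x j is j<n is<n p~/q

   main-term : cov F y p q ≡ F x
   main-term = trans (cov-yes (trans (ℓ-cong (⇌⇌ x p q)) ℓxy)) (ext (⇌⇌ x p q))

   bigger : ∀ b i → i ℕ.< n → ∀ t → b ≡ pos i + t ·N → p ~/ b → 0ℤ < (t ·N + t ·N) * (to y b - to y p) → F (y ⇌ p , b) ≡ 0ℚ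
   bigger b i i<n t refl ne h = IH _ (inj₁ (subst₂ _<_ Qy (sym (Q-swap y j i j<n i<n t ne))
    (lia 2 (λ q e → #0 <: e => q <: q :+ e) (Q y) _ h)))

   y-off : ∀ {b} → b ~/ p → b ~/ q → to y b ≡ to x b
   y-off = ⇌-off x

   -- Between p and q the values lie below the new value at p; window positions after q are
   -- obstructed by q; positions beyond the window raise `Q`.
   right : ∀ d → d ≢ d0 → cov F y p (p + + suc d) ≡ 0ℚ
   right d d≢ = cov-zero λ e → go e (up-ordered y p<b (ℕP.≤-reflexive (sym e))) (d ℕP.<? k ℕ.∸ j) (ℕP.<-cmp d d0)
    where
    b : ℤ
    b = p + + suc d
    p<b : p < b
    p<b = +<+ (ℕ.s≤s (m<m+n j (ℕ.s≤s ℕ.z≤n)))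
    go : ℓ (y ⇌ p , b) ≡ suc (ℓ y) → to y p < to y b → Dec (d ℕ.< k ℕ.∸ j) → _ → F (y ⇌ p , b) ≡ 0ℚ
    go e h (yes d<) (tri< d<d0 _ _) = ⊥-elim (<-asym h (subst₂ _<_ (sym (y-off (p~/b ∘ ~-sym) (window-~/ (≤-trans 1≤p (<⇒≤ p<b)) b<q (pos≤N is<n)))) (sym yp)
      (rising-after (lia 2 (λ p b → p <: b => p :+ #1 =< b) p b p<b) b<q (pos≤N is<n))))
     where
     b<q : b < q
     b<q = +<+ (ℕ.s≤s (ℕP.+-monoʳ-< j (ℕ.s≤s d<d0)))
     p~/b : p ~/ b
     p~/b = window-~/ 1≤p p<b (pos≤N (j+d<n d<))
    go e h (yes d<) (tri≈ _ d≡ _) = ⊥-elim (d≢ d≡)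
    go e h (yes d<) (tri> _ _ d0<d) = ⊥-elim (obstructed y p<q q<b p~/q q~/b p~/b yp<yq
      (subst₂ _<_ (sym yq) (sym (y-off (p~/b ∘ ~-sym) (q~/b ∘ ~-sym))) (above-cases (max d d0<d d<) (λ eq → p~/b (~-reflexive (sym (to-inj x eq)))))) e)
     where
     q<b : q < b
     q<b = +<+ (ℕ.s≤s (ℕP.+-monoʳ-< j (ℕ.s≤s d0<d)))
     b≤N : b ≤ N
     b≤N = pos≤N (j+d<n d<)
     p~/b : p ~/ b
     p~/b = window-~/ 1≤p p<b b≤N
     q~/b : q ~/ b
     q~/b = window-~/ (≤-trans 1≤p (<⇒≤ p<q)) q<b b≤N
    go e h (no d≮) _ = bigger b i i<n t b≡ (cover-~/ e) (pos*pos (lia 1 (λ t → #0 <: t => #0 <: t :+ t) (t ·N) (shift-sign⁺ t i<n b≡ N<b))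
      (lia 2 (λ u v → u <: v => #0 <: v :- u) (to y p) (to y b) h))
     where
     open Reduced-pos (reduce-pos b)
     N<b : N < b
     N<b = ≰⇒> λ b≤N → d≮ (ℕP.+-cancelˡ-≤ j (suc d) _ (ℕP.≤-trans (≤-pred (pos≤N⁻ {j ℕ.+ suc d} b≤N)) (ℕP.≤-reflexive (sym (m+[n∸m]≡n (ℕP.<⇒≤ j<k))))))

   -- A window position before p keeps `Q` and makes the first changed entry larger; a position
   -- before the window raises `Q`.
   left : ∀ d → cov F y (p - + suc d) p ≡ 0ℚ
   left d = cov-zero λ e → go e (up-ordered y b<p (ℕP.≤-reflexive (sym e))) (1ℤ ≤? b)
    where
    b : ℤ
    b = p - + suc d
    b<p : b < p
    b<p = lia 2 (λ p d → #0 =< d => p :- (#1 :+ d) <: p) p (+ d) 0≤+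
    go : ℓ (y ⇌ b , p) ≡ suc (ℓ y) → to y b < to y p → Dec (1ℤ ≤ b) → F (y ⇌ b , p) ≡ 0ℚ
    go e h (no b<1) = trans (ext (⇌-comm y b p)) (bigger b i i<n t b≡ (cover-~/ e ∘ ~-sym)
      (neg*neg (lia 1 (λ t → t <: #0 => t :+ t <: #0) (t ·N) (shift-sign⁻ t b≡ (≰⇒> b<1))) (lia 2 (λ u v → v <: u => v :- u <: #0) (to y p) (to y b) h)))
     where open Reduced-pos (reduce-pos b)
    go e h (yes 1≤b) = IH _ (inj₂ (trans (sym Qy) (sym Qw) , lex-at ib same higher))
     where
     ip = 1≤⇒pos 1≤b
     i : ℕ
     i = proj₁ ip
     b≡ : b ≡ pos i
     b≡ = proj₂ ip
     b~/p : b ~/ p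
     b~/p = cover-~/ e
     i<j : i ℕ.< j
     i<j = ≤-pred (drop‿+<+ (subst (_< p) b≡ b<p))
     i<n : i ℕ.< n
     i<n = ℕP.<-trans i<j j<n
     Qw : Q (y ⇌ b , p) ≡ Q y
     Qw = trans (cong (λ z → Q (y ⇌ z , p)) b≡) (Q-swap0 y i j i<n j<n (subst (_~/ p) b≡ b~/p))
     ib : Fin n
     ib = fromℕ< i<n
     toℕ-ib : toℕ ib ≡ i
     toℕ-ib = Finₚ.toℕ-fromℕ< i<n
     b~/q : b ~/ q
     b~/q = window-~/ 1≤b (<-trans b<p p<q) (pos≤N is<n)
     same : ∀ l → l Fin.< ib → to x (pos (toℕ l)) ≡ to (y ⇌ b , p) (pos (toℕ l))
     same l l<ib = sym (trans (⇌-off y (window-~/ 1≤l l<b (≤-trans (<⇒≤ b<p) (pos≤N j<n))) (window-~/ 1≤l (<-trans l<b b<p) (pos≤N j<n)))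
       (y-off (window-~/ 1≤l (<-trans l<b b<p) (pos≤N j<n)) (window-~/ 1≤l (<-trans l<b (<-trans b<p p<q)) (pos≤N is<n))))
      where
      1≤l : 1ℤ ≤ pos (toℕ l)
      1≤l = +≤+ (ℕ.s≤s ℕ.z≤n)
      l<b : pos (toℕ l) < b
      l<b = subst (pos (toℕ l) <_) (sym b≡) (+<+ (ℕ.s≤s (subst (toℕ l ℕ.<_) toℕ-ib l<ib)))
     higher : to x (pos (toℕ ib)) < to (y ⇌ b , p) (pos (toℕ ib))
     higher = subst (λ z → to x z < to (y ⇌ b , p) z) (trans b≡ (cong pos (sym toℕ-ib)))
      (subst₂ _<_ (y-off b~/p b~/q) (sym (⇌-a y b~/p)) h)

   vanishes : F x ≡ 0ℚ
   vanishes = begin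
    F x ≡⟨ main-term ⟨
    cov F y p q ≡⟨ ℚP.+-identityʳ _ ⟨
    cov F y p q ℚ.- 0ℚ ≡⟨ cong (λ z → cov F y p q ℚ.- z) (left d0) ⟨
    term d0 ≡⟨ sumTo-single M d0 (m≤n⊔m M0 (suc d0)) (λ d _ d≢ → cong₂ ℚ._-_ (right d d≢) (left d)) ⟨
    monk M p F y ≡⟨ proj₂ (ker y p) M (m≤m⊔n M0 (suc d0)) ⟩
    0ℚ ∎
    where
    open ≡-Reasoning
    M0 M : ℕ
    M0 = proj₁ (ker y p)
    M = M0 ℕ.⊔ suc d0
    term : ℕ → ℚ
    term d = cov F y p (p + + suc d) ℚ.- cov F y (p - + suc d) p

 vanish-step : ∀ {F} → Ext F → Ker F → (∀ x → Increasing x → F x ≡ 0ℚ) → ∀ x → (∀ z → x ≺A z → F z ≡ 0ℚ) → F x ≡ 0ℚ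
 vanish-step {F} ext ker inc x IH = outer (largest (λ j → to x (pos (suc j)) <? to x (pos j)) k)
  where
  outer : Largest (λ j → to x (pos (suc j)) < to x (pos j)) k → F x ≡ 0ℚ
  outer (none h) = inc x (rising-chain x step)
   where
   step : ∀ i → 1ℤ ≤ i → i < N → to x i < to x (i + 1ℤ)
   step i 1≤i i<N with 1≤⇒pos 1≤i
   ... | i' , refl = subst (λ z → to x (pos i') < to x z) (cong +_ (cong suc (ℕP.+-comm 1 i')))
      (above-cases (h i' (≤-pred (drop‿+<+ (subst (pos i' <_) N-def i<N)))) (λ e → ℕP.1+n≢n (suc-injective (+-injective (to-inj x e)))))
  outer (found j j<k desc last) = inner (largest (λ d → to x (pos j + + suc d) <? to x (pos j)) (k ℕ.∸ j))
   where
   inner : Largest (λ d → to x (pos j + + suc d) < to x (pos j)) (k ℕ.∸ j) → F x ≡ 0ℚ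
   inner (none h) = ⊥-elim (h 0 (ℕP.m<n⇒0<n∸m j<k) (subst (λ z → to x z < to x (pos j)) (cong +_ (cong suc (ℕP.+-comm 1 j))) desc))
   inner (found d d< b m) = Transition.vanishes ext ker x IH j j<k desc last d d< b m

 Supported : Fun → List AP → Set
 Supported F S = ∀ x → F x ≢ 0ℚ → Σ (Fin (length S)) λ i → x ≗A List.lookup S i

 -- The values of F are supported on a finite list, where the reverse of the strict order is well
 -- founded.
 vanish : ∀ {F} → Ext F → Ker F → ∀ S → Supported F S → (∀ x → Increasing x → F x ≡ 0ℚ) → ∀ x → F x ≡ 0ℚ
 vanish {F} ext ker S supp inc x with F x ℚP.≟ 0ℚ
 ... | yes e = e
 ... | no ne = ⊥-elim (ne (trans (ext (proj₂ (supp x ne))) (go (proj₁ (supp x ne)) (wf _))))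
  where
  _⊏_ : Fin (length S) → Fin (length S) → Set
  i ⊏ j = List.lookup S i ≺A List.lookup S j
  spo : IsStrictPartialOrder _≡_ _⊏_
  spo = record { isEquivalence = isEquivalence ; irrefl = λ { {i} refl h → ≺A-irrefl {List.lookup S i} h } ; trans = λ {i} {j} {l} → ≺A-trans {List.lookup S i} {List.lookup S j} {List.lookup S l}
         ; <-resp-≈ = (λ { refl h → h }) , (λ { refl h → h }) }
  wf : WellFounded (flip _⊏_)
  wf = FinInd.spo-noetherian spo
  go : ∀ i → Acc (flip _⊏_) i → F (List.lookup S i) ≡ 0ℚ
  go i (acc rec) = vanish-step ext ker inc (List.lookup S i) IH
   where
   IH : ∀ z → List.lookup S i ≺A z → F z ≡ 0ℚ
   IH z h with F z ℚP.≟ 0ℚ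
   ... | yes e = e
   ... | no ne' = trans (ext (proj₂ (supp z ne'))) (go (proj₁ (supp z ne')) (rec (≺A-resp {List.lookup S i} h (proj₂ (supp z ne')))))

 op-support : ∀ ws x → op ws δ x ≢ 0ℚ → Reduced ws × x ≗A act ws idA
 op-support ws x ne = lem (ℓ (act ws idA) ℕP.≟ length ws) (x ≗A? act ws idA)
  where
  lem : Dec (Reduced ws) → Dec (x ≗A act ws idA) → Reduced ws × x ≗A act ws idA
  lem (yes r) (yes h) = r , h
  lem (no ¬r) _ = ⊥-elim (ne (trans (sym (χ-op ws x)) (χ-zero ws x (¬r ∘ proj₁))))
  lem _ (no ¬h) = ⊥-elim (ne (trans (sym (χ-op ws x)) (χ-zero ws x (¬h ∘ proj₂))))

 elemAPs : Elem → List AP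
 elemAPs = map (λ t → act (proj₂ t) idA)

 lin-supported : ∀ e → Supported (lin e δ) (elemAPs e)
 lin-supported [] x ne = ⊥-elim (ne refl)
 lin-supported ((q , ws) ∷ e) x ne = lem (op ws δ x ℚP.≟ 0ℚ)
  where
  lem : Dec (op ws δ x ≡ 0ℚ) → Σ (Fin (suc (length (elemAPs e)))) λ i → x ≗A List.lookup (act ws idA ∷ elemAPs e) i
  lem (no ne') = zero , proj₂ (op-support ws x ne')
  lem (yes z) with lin-supported e x (λ z' → ne (trans (cong₂ ℚ._+_ (trans (cong (q ℚ.*_) z) (ℚP.*-zeroʳ q)) z') (ℚP.+-identityˡ 0ℚ)))
  ... | i , h = suc i , h

 -- Low letters and the triangularity of the generators

 strip : Word → AP → AP
 strip [] y = y
 strip (r ∷ ws) y = strip ws (+ r ▹ y)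

 -- Each letter is a left descent at the moment it is stripped, which is exactly when the word
 -- contributes a coefficient at y.
 Valid : Word → AP → Set
 Valid [] y = ⊤
 Valid (r ∷ ws) y = Desc (+ r) y × Valid ws (+ r ▹ y)

 valid? : ∀ ws y → Dec (Valid ws y)
 valid? [] y = yes tt
 valid? (r ∷ ws) y = desc? (+ r) y ×-dec valid? ws (+ r ▹ y)

 op-valid : ∀ ws {F y} → Valid ws y → op ws F y ≡ F (strip ws y)
 op-valid [] _ = refl
 op-valid (r ∷ ws) (d , v) = trans (up-desc d) (op-valid ws v)

 op-invalid : ∀ ws {F y} → ¬ Valid ws y → op ws F y ≡ 0ℚ
 op-invalid [] ¬v = ⊥-elim (¬v tt)
 op-invalid (r ∷ ws) {F} {y} ¬v = lem (desc? (+ r) y)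
  where
  lem : Dec (Desc (+ r) y) → op (r ∷ ws) F y ≡ 0ℚ
  lem (yes d) = trans (up-desc d) (op-invalid ws (λ v → ¬v (d , v)))
  lem (no ¬d) = up-asc ¬d

 walk : Word → ℤ → ℤ
 walk [] v = v
 walk (r ∷ ws) v = walk ws (s (+ r) v)

 strip-walk : ∀ ws y m → to (strip ws y) m ≡ walk ws (to y m)
 strip-walk [] y m = refl
 strip-walk (r ∷ ws) y m = strip-walk ws (+ r ▹ y) m

 walk-inj : ∀ ws {u v} → walk ws u ≡ walk ws v → u ≡ v
 walk-inj [] e = e
 walk-inj (r ∷ ws) e = to-inj (sA (+ r)) (walk-inj ws e)

 walk-avoid : ∀ A B {v} → All (Avoid v) A → walk (A ++ B) v ≡ walk B v
 walk-avoid [] B _ = refl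
 walk-avoid (r ∷ A) B (h ∷ hs) = trans (cong (walk (A ++ B)) (tr-off (proj₁ h) (proj₂ h))) (walk-avoid A B hs)

 walk-hit : ∀ A r B {v} → All (Avoid v) A → v ~ + r → All (Avoid (v + 1ℤ)) B → walk (A ++ r ∷ B) v ≡ v + 1ℤ
 walk-hit A r B {v} hA hr hB = trans (walk-avoid A (r ∷ B) hA) (trans (cong (walk B)
   (trans (tr-at-a hr) (cong (λ z → v + z) (lia 1 (λ r → r :+ #1 :- r ≐ #1) (+ r)))))
  (trans (cong (λ ws → walk ws (v + 1ℤ)) (sym (++-identityʳ B))) (walk-avoid B [] hB)))

 strip-inj : ∀ ws {x y} → strip ws x ≗A strip ws y → x ≗A y
 strip-inj ws {x} {y} h = agree λ m → walk-inj ws (trans (sym (strip-walk ws x m)) (trans (at h m) (strip-walk ws y m)))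

 strip-ℓ : ∀ ws {y} → Valid ws y → ℓ y ≡ length ws ℕ.+ ℓ (strip ws y)
 strip-ℓ [] _ = refl
 strip-ℓ (r ∷ ws) (d , v) = trans (descent _ (+ r) d) (cong suc (strip-ℓ ws v))

 Desc-~ : ∀ {i j} y → i ~ j → Desc j y → Desc i y
 Desc-~ {j = j} y (winds t refl) d = subst₂ _<_ (sym (trans (cong (fr y) (lia 2 (λ j t → j :+ t :+ #1 ≐ j :+ #1 :+ t) j (t ·N))) (fr-per y (j + 1ℤ) t)))
  (sym (fr-per y j t)) (+-monoˡ-< (t ·N) d)

 Increasing-▹ : ∀ {y i} → Increasing y → Desc i y → Increasing (i ▹ y)
 Increasing-▹ {y} {i} inc d {a} {b} 1≤a a<b b≤N with s-mono i (inc 1≤a a<b b≤N)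
 ... | inj₁ h = h
 ... | inj₂ (p , q) = ⊥-elim (<-asym a<b (subst₂ _<_ (trans (cong (fr y) (sym q)) (fr-to y b)) (fr-to y a) (Desc-~ y p d)))

 Increasing-strip : ∀ ws {y} → Increasing y → Valid ws y → Increasing (strip ws y)
 Increasing-strip [] inc _ = inc
 Increasing-strip (r ∷ ws) {y} inc (d , v) = Increasing-strip ws {+ r ▹ y} (Increasing-▹ {y} {+ r} inc d) v

 increasing? : ∀ y → Dec (Increasing y)
 increasing? y = lem (largest (λ j → to y (pos (suc j)) <? to y (pos j)) k)
  where
  lem : Largest (λ j → to y (pos (suc j)) < to y (pos j)) k → Dec (Increasing y)
  lem (found j j<k d _) = no λ inc → <-asym d (inc (+≤+ (ℕ.s≤s ℕ.z≤n)) (+<+ (n<1+n _)) (pos≤N (ℕ.s≤s j<k)))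
  lem (none h) = yes (rising-chain y step)
   where
   step : ∀ i → 1ℤ ≤ i → i < N → to y i < to y (i + 1ℤ)
   step i 1≤i i<N with 1≤⇒pos 1≤i
   ... | i' , refl = subst (λ z → to y (pos i') < to y z) (cong +_ (cong suc (ℕP.+-comm 1 i')))
      (above-cases (h i' (≤-pred (drop‿+<+ (subst (pos i' <_) N-def i<N)))) (λ e → ℕP.1+n≢n (suc-injective (+-injective (to-inj y e)))))

 pos-inj : ∀ {l m} → l ℕ.< n → m ℕ.< n → pos l ~ pos m → l ≡ m
 pos-inj l<n m<n h = suc-injective (+-injective (~-window 1ℤ h (+≤+ (ℕ.s≤s ℕ.z≤n)) (in-win l<n) (+≤+ (ℕ.s≤s ℕ.z≤n)) (in-win m<n)))
  where
  in-win : ∀ {l} → l ℕ.< n → pos l < 1ℤ + N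
  in-win l<n = subst (λ z → _ < 1ℤ + z) (sym N-def) (+<+ (ℕ.s≤s l<n))

 N≡pos : N ≡ pos k
 N≡pos = N-def

 -- The window value of y in the class of d.
 module _ (y : AP) (d : ℤ) where
  open Reduced-pos (reduce-pos (fr y d)) renaming (i to ix; i<n to ix<n; t to turns'; b≡ to fr≡) public

  V : ℤ
  V = d - turns' ·N

  V≡ : V ≡ to y (pos ix)
  V≡ = lia 3 (λ d v t → d ≐ v :+ t => d :- t ≐ v) d (to y (pos ix)) (turns' ·N) (trans (sym (to-fr y d)) (trans (cong (to y) fr≡) (per y (pos ix) turns')))

 V-unique : ∀ y {d i} → i ℕ.< n → d ~ to y (pos i) → V y d ≡ to y (pos i)
 V-unique y {d} {i} i<n h = trans (V≡ y d) (cong (λ j → to y (pos j)) (pos-inj (ix<n y d) i<n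
  (~-trans (~-sym (~-turn (turns' y d))) (~-trans (~-reflexive (sym (fr≡ y d))) (~-trans (fr-~ y h) (~-reflexive (fr-to y (pos i))))))))

 V-cong : ∀ y {d e} → d ~ e → V y d ≡ V y e
 V-cong y {d} {e} h = trans (V-unique y (ix<n y e) (~-trans h (~-trans (~-trans (~-sym (~-turn (- turns' y e))) (~-reflexive (cong (λ z → e + z) (-·N (turns' y e))))) (~-reflexive (V≡ y e))))) (sym (V≡ y e))

 -- The class has its window value more than N below the largest one, `to y N`. For increasing y
 -- these classes are the letters available to a cyclically decreasing word stripped from y.
 record Low (y : AP) (d : ℤ) : Set where
  constructor low
  field is-low : V y d < to y N - N

 open Low

 low? : ∀ y d → Dec (Low y d)
 low? y d = map′ low is-low (V y d <? to y N - N)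

 Low-cong : ∀ y {d e} → d ~ e → Low y d → Low y e
 Low-cong y h (low l) = low (subst (_< to y N - N) (V-cong y h) l)

 top-value : ∀ y {d} → d ~ to y N → V y d ≡ to y N
 top-value y h = trans (V-unique y (n<1+n k) (~-trans h (~-reflexive (cong (to y) N≡pos)))) (cong (to y) (sym N≡pos))

 top-high : ∀ y {d} → d ~ to y N → ¬ Low y d
 top-high y {d} h l = lia 3 (λ v t N → v ≐ t => v <: t :- N => #2 =< N => false') (V y d) (to y N) N (top-value y h) (is-low l) 2≤N

 ≤top : ∀ {y} → Increasing y → ∀ {i} → i ℕ.< n → to y (pos i) ≤ to y N
 ≤top {y} inc {i} i<n with i ℕP.≟ k
 ... | yes refl = ≤-reflexive (cong (to y) (sym N≡pos))
 ... | no ne = <⇒≤ (inc (+≤+ (ℕ.s≤s ℕ.z≤n)) (subst (pos i <_) (sym N≡pos) (+<+ (ℕ.s≤s (ℕP.≤∧≢⇒< (<⇒≤pred i<n) ne)))) ≤-refl)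

 turn-cmp : ∀ t u → t ·N + N ≤ u ·N ⊎ t ≡ u ⊎ u ·N + N ≤ t ·N
 turn-cmp t u with mult-gap (t - u)
 ... | inj₁ h = inj₁ (lia 4 (λ d t u N → d ≐ t :- u => d =< #0 :- N => t :+ N =< u) ((t - u) ·N) (t ·N) (u ·N) N diff (subst ((t - u) ·N ≤_) (sym (+-identityˡ (- N))) h))
  where
  diff : (t - u) ·N ≡ t ·N - u ·N
  diff = trans (+·N t (- u)) (cong (λ z → t ·N + z) (-·N u))
 ... | inj₂ (inj₁ h) = inj₂ (inj₁ (lia 2 (λ t u → t :- u ≐ #0 => t ≐ u) t u h))
 ... | inj₂ (inj₂ h) = inj₂ (inj₂ (lia 4 (λ d t u N → d ≐ t :- u => N =< d => u :+ N =< t) ((t - u) ·N) (t ·N) (u ·N) N diff h))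
  where
  diff : (t - u) ·N ≡ t ·N - u ·N
  diff = trans (+·N t (- u)) (cong (λ z → t ·N + z) (-·N u))

 1≤pos : ∀ {i} → 1ℤ ≤ pos i
 1≤pos = +≤+ (ℕ.s≤s ℕ.z≤n)

 -- If d + 1 sits before d, the increase on the window forces d into a later period, so its window
 -- value is at least N + 1 below that of d + 1.
 desc-low : ∀ {y} → Increasing y → ∀ {d} → Desc d y → Low y d
 desc-low {y} inc {d} h with turn-cmp (turns' y d) (turns' y (d + 1ℤ))
 ... | inj₁ le = ⊥-elim (lia 7 (λ a b t u N f g → t :+ N =< u => g <: f => f ≐ a :+ t => g ≐ b :+ u => a =< N => #1 =< b => false')
    (pos (ix y d)) (pos (ix y (d + 1ℤ))) (turns' y d ·N) (turns' y (d + 1ℤ) ·N) N (fr y d) (fr y (d + 1ℤ)) le h (fr≡ y d) (fr≡ y (d + 1ℤ)) (pos≤N (ix<n y d)) 1≤pos)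
 ... | inj₂ (inj₁ e) = ⊥-elim (<-asym (inc 1≤pos
     (lia 6 (λ a b t u f g → g <: f => f ≐ a :+ t => g ≐ b :+ u => t ≐ u => b <: a) (pos (ix y d)) (pos (ix y (d + 1ℤ))) (turns' y d ·N) (turns' y (d + 1ℤ) ·N) (fr y d) (fr y (d + 1ℤ))
      h (fr≡ y d) (fr≡ y (d + 1ℤ)) (cong _·N e)) (pos≤N (ix<n y d)))
    (lia 5 (λ d t u a b → d :- t ≐ a => d :+ #1 :- u ≐ b => t ≐ u => a <: b) d (turns' y d ·N) (turns' y (d + 1ℤ) ·N) _ _ (V≡ y d) (V≡ y (d + 1ℤ)) (cong _·N e)))
 ... | inj₂ (inj₂ le) = low $ lia 6 (λ d t u b top N → u :+ N =< t => d :+ #1 :- u ≐ b => b =< top => d :- t <: top :- N)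
    d (turns' y d ·N) (turns' y (d + 1ℤ) ·N) (to y (pos (ix y (d + 1ℤ)))) (to y N) N le (V≡ y (d + 1ℤ)) (≤top {y} inc (ix<n y (d + 1ℤ)))

 -- Let e be the high value congruent to the top that lies N below it, translated by the turns of d.
 -- It exceeds d, so it cannot lie inside the block; e = u contradicts the assumed turns, and u < e
 -- would make u low.
 block-turns : ∀ {y d u} → Low y d → ¬ Low y u → (∀ e → d < e → e < u → Low y e) → ¬ turns' y d ·N ≤ turns' y u ·N
 block-turns {y} {d} {u} ld hu between le = lem (<-cmp e u)
  where
  M e : ℤ
  M = to y N - N
  e = M + turns' y d ·N
  e~ : e ~ to y N
  e~ = ~-trans (~-turn (turns' y d)) ~--N
  d<e : d < e
  d<e = lia 3 (λ d t m → d :- t <: m => d <: m :+ t) d (turns' y d ·N) M (is-low ld)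
  lem : _ → ⊥
  lem (tri< e<u _ _) = top-high y e~ (between e d<e e<u)
  lem (tri≈ _ e≡u _) = lia 6 (λ v m t w e N → v ≐ m :+ N => v ≐ e :- w => e ≐ m :+ t => t =< w => #2 =< N => false')
   (V y u) M (turns' y d ·N) (turns' y u ·N) u N (trans (top-value y (subst (_~ to y N) e≡u e~)) (lia 2 (λ t N → t ≐ t :- N :+ N) (to y N) N)) refl (sym e≡u) le 2≤N
  lem (tri> _ _ u<e) = hu (low $ lia 4 (λ u w m t → u <: m :+ t => t =< w => u :- w <: m) u (turns' y u ·N) M (turns' y d ·N) u<e le)

 -- A low value below a block of low values capped by a high one sits at a larger position than the cap.
 block-descent : ∀ {y} → Increasing y → ∀ {d u} → d < u → Low y d → ¬ Low y u → (∀ e → d < e → e < u → Low y e) → fr y u < fr y d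
 block-descent {y} inc {d} {u} d<u ld hu between with turn-cmp (turns' y d) (turns' y u)
 ... | inj₂ (inj₂ le) = lia 7 (λ a b t w N f g → w :+ N =< t => f ≐ a :+ t => g ≐ b :+ w => #1 =< a => b =< N => g <: f)
    (pos (ix y d)) (pos (ix y u)) (turns' y d ·N) (turns' y u ·N) N (fr y d) (fr y u) le (fr≡ y d) (fr≡ y u) 1≤pos (pos≤N (ix<n y u))
 ... | inj₁ le = ⊥-elim (block-turns {y} {d} {u} ld hu between (lia 3 (λ t w N → t :+ N =< w => #2 =< N => t =< w) (turns' y d ·N) (turns' y u ·N) N le 2≤N))
 ... | inj₂ (inj₁ eq) = ⊥-elim (block-turns {y} {d} {u} ld hu between (≤-reflexive (cong _·N eq)))

 V-▹ : ∀ i y {d} → d ~/ i → d ~/ i + 1ℤ → V (i ▹ y) d ≡ V y d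
 V-▹ i y {d} h h' = cong (λ f → d - Reduced-pos.t (reduce-pos f) ·N) (cong (fr y) (tr-off h h'))

 Low-▹ : ∀ {i} y {d} → Low y i → d ~/ i → d ~/ i + 1ℤ → Low (i ▹ y) d → Low y d
 Low-▹ {i} y {d} li h h' l = low $ lia 5 (λ v v' t t' N → v' ≐ v => v' <: t' :- N => t' =< t => v <: t :- N) (V y d) (V (i ▹ y) d) (to y N) (to (i ▹ y) N) N (V-▹ i y h h') (is-low l) (top-down (trView i (i + 1ℤ) (to y N)))
  where
  top-down : TrView i (i + 1ℤ) (to y N) → s i (to y N) ≤ to y N
  top-down (at-a p _) = ⊥-elim (top-high y (~-sym p) li)
  top-down (at-b _ _ e) = lia 3 (λ s v i → s ≐ v :+ (i :- (i :+ #1)) => s =< v) (s i (to y N)) (to y N) i e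
  top-down (off _ _ e) = ≤-reflexive e

 -- What a later letter d satisfies in a cyclically decreasing word: stripping r leaves the class of
 -- d untouched.
 After : ℕ → ℕ → Set
 After r d = + d ~/ + r × + d ~/ + r + 1ℤ

 AllPairs-⊆ : ∀ {A : Set} {R : A → A → Set} {xs ys : List A} → xs ⊆ ys → AllPairs R ys → AllPairs R xs
 AllPairs-⊆ [] [] = []
 AllPairs-⊆ (y ∷ʳ τ) (_ ∷ ps) = AllPairs-⊆ τ ps
 AllPairs-⊆ (refl ∷ τ) (p ∷ ps) = All-⊆ τ p ∷ AllPairs-⊆ τ ps

 seg-after : ∀ a l → l ℕ.≤ k → AllPairs After (seg a l)
 seg-after a zero _ = []
 seg-after a (suc l) l<k = All.tabulate (λ {d} h → lem d (∈-seg {a} {l} {d} h)) ∷ seg-after a l (ℕP.<⇒≤ l<k)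
  where
  x : ℕ
  x = (a ℕ.+ suc l) ℕ.% n
  lem : ∀ d → Σ ℕ (λ t → t ℕ.< l × d ≡ (a ℕ.+ suc t) ℕ.% n) → After x d
  lem d (t , t<l , refl) = (λ q → small-~/ {+ x} {+ d} (+ e) (+<+ e>0) e<N x~ (~-sym q)) , (λ q → small-~/ {+ x + 1ℤ} {+ d} (+ suc e) (+<+ (ℕ.s≤s ℕ.z≤n)) se<N x+1~ (~-sym q))
   where
   e : ℕ
   e = l ℕ.∸ t
   t+e : t ℕ.+ e ≡ l
   t+e = m+[n∸m]≡n (ℕP.<⇒≤ t<l)
   e>0 : 0 ℕ.< e
   e>0 = ℕP.m<n⇒0<n∸m t<l
   e≤l : e ℕ.≤ l
   e≤l = ℕP.m∸n≤m l t
   e<N : + e < N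
   e<N = subst (+ e <_) (sym N-def) (+<+ (ℕ.s≤s (ℕP.≤-trans e≤l (ℕP.<⇒≤ l<k))))
   se<N : + suc e < N
   se<N = subst (+ suc e <_) (sym N-def) (+<+ (ℕ.s≤s (ℕP.≤-trans (ℕ.s≤s e≤l) l<k)))
   x~ : + x ~ + d + + e
   x~ = ~-trans (seg-~ a l) (~-trans (~-reflexive (cong (λ z → + (a ℕ.+ suc z)) (sym t+e)))
    (~-trans (~-reflexive (lia 3 (λ a t e → a :+ (#1 :+ (t :+ e)) ≐ a :+ (#1 :+ t) :+ e) (+ a) (+ t) (+ e))) (~-sym (~-shift (+ e) (seg-~ a t)))))
   x+1~ : + x + 1ℤ ~ + d + + suc e
   x+1~ = ~-trans (~-shift 1ℤ x~) (~-reflexive (lia 2 (λ d e → d :+ e :+ #1 ≐ d :+ (#1 :+ e)) (+ d) (+ e)))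

 wordD-after : ∀ D → AllPairs After (wordD k D)
 wordD-after D = AllPairs-⊆ (filterᵇ-⊆ (λ x → memℕ x D) (seg (least D) k)) (seg-after (least D) k ℕP.≤-refl)

 -- The first letter is a descent, hence low. Stripping it creates no low class among the later
 -- letters, so lowness after the step comes from lowness in y.
 valid-low : ∀ ws {y} → Increasing y → AllPairs After ws → Valid ws y → All (λ d → Low y (+ d)) ws
 valid-low [] inc _ _ = []
 valid-low (r ∷ ws) {y} inc (p ∷ ps) (d , v) = lr ∷ All.zipWith (λ {x} (q , l) → Low-▹ {+ r} y {+ x} lr (proj₁ q) (proj₂ q) l)
   (p , valid-low ws {+ r ▹ y} (Increasing-▹ {y} {+ r} inc d) ps v)
  where
  lr : Low y (+ r)
  lr = desc-low inc d

 ⊆-≡ : ∀ {A : Set} {xs ys : List A} → xs ⊆ ys → length xs ≡ length ys → xs ≡ ys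
 ⊆-≡ [] _ = refl
 ⊆-≡ (y ∷ʳ τ) e = ⊥-elim (ℕP.<-irrefl e (ℕ.s≤s (Sublistₚ.length-mono-≤ τ)))
 ⊆-≡ (refl ∷ τ) e = cong (_ ∷_) (⊆-≡ τ (suc-injective e))

 ⊆-filter : ∀ {A : Set} {P : A → Bool} {xs ys : List A} → xs ⊆ ys → All (λ x → P x ≡ true) xs → xs ⊆ filterᵇ P ys
 ⊆-filter [] _ = []
 ⊆-filter {P = P} (y ∷ʳ τ) h with P y
 ... | true = y ∷ʳ ⊆-filter τ h
 ... | false = ⊆-filter τ h
 ⊆-filter {P = P} (_∷_ {x} {xs} {_} {ys} refl τ) (p ∷ h) = subst (x ∷ xs ⊆_) (sym (filterᵇ-keep {P = P} {x} {ys} p)) (refl ∷ ⊆-filter τ h)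

 wordD-↭ : ∀ {D} → D ⊆ upTo n → length D ℕ.≤ k → wordD k D ↭ D
 wordD-↭ {D} τ le = ↭-sym (↭-trans (↭-reflexive (sym (filter-members (Uniqueₚ.upTo⁺ n) τ)))
   (↭-trans (Permₚ.filter-↭ (λ x → T? (memℕ x D)) (upTo-↭-seg (proj₁ spec))) (↭-reflexive (filterᵇ-skip {P = λ x → memℕ x D} {a} {seg a k} (∉-mem (proj₂ spec))))))
  where
  a : ℕ
  a = least D
  m = missing (Uniqueₚ.upTo⁺ n) τ (ℕP.≤-trans (ℕ.s≤s le) (ℕP.≤-reflexive (sym (Listₚ.length-upTo n))))
  spec : a ℕ.< n × a ∉ D
  spec = least-spec (∈-upTo⁻ (proj₁ (proj₂ m))) (proj₂ (proj₂ m))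

 lowL : AP → List ℕ
 lowL y = filterᵇ (λ x → ⌊ low? y (+ x) ⌋) (upTo n)

 lowL-⊆ : ∀ y → lowL y ⊆ upTo n
 lowL-⊆ y = filterᵇ-⊆ (λ x → ⌊ low? y (+ x) ⌋) (upTo n)

 ∈-lowL⁻ : ∀ y {x} → x ∈ lowL y → x ℕ.< n × Low y (+ x)
 ∈-lowL⁻ y {x} h = ∈-upTo⁻ (proj₁ p) , ⌊⌋-true⁻ (low? y (+ x)) (proj₂ p)
  where p = ∈-filterᵇ⁻ (λ x → ⌊ low? y (+ x) ⌋) (upTo n) h

 ∈-lowL⁺ : ∀ y {x} → x ℕ.< n → Low y (+ x) → x ∈ lowL y
 ∈-lowL⁺ y {x} x<n l = ∈-filterᵇ⁺ (λ x → ⌊ low? y (+ x) ⌋) (∈-upTo⁺ x<n) (⌊⌋-true (low? y (+ x)) l)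

 topℕ : AP → ℕ
 topℕ y = res (to y N)

 top∉lowL : ∀ y → topℕ y ∉ lowL y
 top∉lowL y h = top-high y (~-sym (res-~ (to y N))) (proj₂ (∈-lowL⁻ y h))

 |lowL|≤k : ∀ y → length (lowL y) ℕ.≤ k
 |lowL|≤k y = ≤-pred (ℕP.≤∧≢⇒< (ℕP.≤-trans (Sublistₚ.length-mono-≤ (lowL-⊆ y)) (ℕP.≤-reflexive (Listₚ.length-upTo n)))
  (λ e → top∉lowL y (subst (topℕ y ∈_) (sym (⊆-≡ (lowL-⊆ y) (trans e (sym (Listₚ.length-upTo n))))) (∈-upTo⁺ (res<n (to y N))))))

 low-word : AP → Word
 low-word y = wordD k (lowL y)

 -- Invariant of the descending scan: u is the high value capping the current block of low ones; the
 -- letters stripped so far have carried its position down to the value a + l + 1; the values not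
 -- yet scanned have not moved.
 scan-low : ∀ y → Increasing y → ∀ a l y' u → l ℕ.≤ k → + a + + suc l ≤ u → fr y' (+ a + + suc l) ≡ fr y u → ¬ Low y u →
  (∀ e → + a + + suc l ≤ e → e < u → Low y e) → (∀ e → + a < e → e < + a + + suc l → fr y' e ≡ fr y e) →
  Valid (filterᵇ (λ x → memℕ x (lowL y)) (seg a l)) y'
 scan-low y inc a zero y' u _ _ _ _ _ _ = tt
 scan-low y inc a (suc l) y' u l<k d<u at-u hu bl same = lem (low? y d)
  where
  x : ℕ
  x = (a ℕ.+ suc l) ℕ.% n
  d : ℤ
  d = + a + + suc l
  x~d : + x ~ d
  x~d = seg-~ a l
  d+1 : d + 1ℤ ≡ + a + + suc (suc l)
  d+1 = lia 2 (λ a l → a :+ (#1 :+ l) :+ #1 ≐ a :+ (#2 :+ l)) (+ a) (+ l)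
  a<d : + a < d
  a<d = +<+ (m<m+n a (ℕ.s≤s ℕ.z≤n))
  d<d+1 : d < + a + + suc (suc l)
  d<d+1 = subst (d <_) d+1 (p<p+1 d)
  P : ℕ → Bool
  P x = memℕ x (lowL y)
  lem : Dec (Low y d) → Valid (filterᵇ P (seg a (suc l))) y'
  lem (no ¬l) = subst (λ ws → Valid ws y') (sym (filterᵇ-skip {P = P} {x} {seg a l} (∉-mem (λ h → ¬l (Low-cong y x~d (proj₂ (∈-lowL⁻ y h)))))))
   (scan-low y inc a l y' d (ℕP.<⇒≤ l<k) ≤-refl (same d a<d d<d+1) ¬l (λ e h h' → ⊥-elim (<-irrefl refl (≤-<-trans h h'))) (λ e h h' → same e h (<-trans h' d<d+1)))
  lem (yes ld) = subst (λ ws → Valid ws y') (sym (filterᵇ-keep {P = P} {x} {seg a l} (∈-mem (∈-lowL⁺ y (ℕ.m%n<n (a ℕ.+ suc l) n) (Low-cong y (~-sym x~d) ld)))))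
   (Desc-~ y' x~d (subst₂ _<_ (sym (trans (cong (fr y') d+1) at-u)) (sym (same d a<d d<d+1)) (block-descent {y} inc {d} {u} (<-≤-trans d<d+1 d<u) ld hu (λ e h → bl e (subst (_≤ e) d+1 (lia 2 (λ d e → d <: e => d :+ #1 =< e) d e h)))))
   , scan-low y inc a l (+ x ▹ y') u (ℕP.<⇒≤ l<k) (<⇒≤ (<-≤-trans d<d+1 d<u)) (trans (cong (fr y') moved) at-u) hu bl' same')
   where
   moved : s (+ x) d ≡ + a + + suc (suc l)
   moved = trans (tr-at-a (~-sym x~d)) (trans (cong (λ z → d + z) (lia 1 (λ x → x :+ #1 :- x ≐ #1) (+ x))) d+1)
   bl' : ∀ e → d ≤ e → e < u → Low y e
   bl' e h h' with <-cmp d e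
   ... | tri< d<e _ _ = bl e (subst (_≤ e) d+1 (lia 2 (λ d e → d <: e => d :+ #1 =< e) d e d<e)) h'
   ... | tri≈ _ refl _ = ld
   ... | tri> ¬p _ e<d = ⊥-elim (<-irrefl refl (≤-<-trans h e<d))
   same' : ∀ e → + a < e → e < d → fr (+ x ▹ y') e ≡ fr y e
   same' e h h' = trans (cong (fr y') (tr-off (λ q → near-~/ h' d<e+N (~-trans q x~d)) (λ q → near-~/ (<-trans h' (p<p+1 d)) d1<e+N (~-trans q (~-shift 1ℤ x~d))))) (same e h (<-trans h' d<d+1))
    where
    l<N : + suc l + 1ℤ ≤ N
    l<N = subst (+ suc l + 1ℤ ≤_) (sym N-def) (+≤+ (ℕP.≤-trans (ℕP.≤-reflexive (ℕP.+-comm (suc l) 1)) (ℕ.s≤s l<k)))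
    d<e+N : d < e + N
    d<e+N = lia 4 (λ a l e N → l :+ #1 =< N => a <: e => a :+ l <: e :+ N) (+ a) (+ suc l) e N l<N h
    d1<e+N : d + 1ℤ < e + N
    d1<e+N = lia 4 (λ a l e N → l :+ #1 =< N => a <: e => a :+ l :+ #1 <: e :+ N) (+ a) (+ suc l) e N l<N h

 low-valid : ∀ y → Increasing y → Valid (low-word y) y
 low-valid y inc = scan-low y inc a k y (+ a + + suc k) ℕP.≤-refl ≤-refl refl
   (λ l → proj₂ spec (∈-lowL⁺ y (proj₁ spec) (Low-cong y (~-trans (~-reflexive (cong (λ z → + a + z) (sym N-def))) ~-+N) l)))
   (λ e h h' → ⊥-elim (<-irrefl refl (≤-<-trans h h'))) (λ _ _ _ → refl)
  where
  a : ℕ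
  a = least (lowL y)
  spec : a ℕ.< n × a ∉ lowL y
  spec = least-spec (res<n (to y N)) (top∉lowL y)

 tl : AP → AP
 tl y = strip (low-word y) y

 Increasing-tl : ∀ {y} → Increasing y → Increasing (tl y)
 Increasing-tl {y} inc = Increasing-strip (low-word y) {y} inc (low-valid y inc)

 ℓ-tl : ∀ {y} → Increasing y → ℓ y ≡ length (lowL y) ℕ.+ ℓ (tl y)
 ℓ-tl {y} inc = trans (strip-ℓ (low-word y) (low-valid y inc)) (cong (ℕ._+ ℓ (tl y)) (Permₚ.↭-length (wordD-↭ (lowL-⊆ y) (|lowL|≤k y))))

 valid-⊆-lowL : ∀ {y D r} → Increasing y → D ∈ choose r (upTo n) → r ℕ.≤ k → Valid (wordD k D) y → D ⊆ lowL y
 valid-⊆-lowL {y} {D} {r} inc h r≤k v = ⊆-filter (proj₁ (choose-⊆ r (upTo n) h)) (All.map (λ {x} l → ⌊⌋-true (low? y (+ x)) l)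
   (Permₚ.All-resp-↭ (wordD-↭ (proj₁ (choose-⊆ r (upTo n) h)) (subst (ℕ._≤ k) (sym (proj₂ (choose-⊆ r (upTo n) h))) r≤k)) (valid-low (wordD k D) {y} inc (wordD-after D) v)))

 h-below : ∀ {F y} r → r ℕ.≤ k → Increasing y → length (lowL y) ℕ.< r → lin (hE k r) F y ≡ 0ℚ
 h-below {F} {y} r r≤k inc lt = trans (lin-hE r F y) (trans (sumL-cong∈ (choose r (upTo n)) (λ {D} h → op-invalid (wordD k D) (bad D h))) (sumL-0 {f = λ _ → 0ℚ} (λ _ → refl) (choose r (upTo n))))
  where
  bad : ∀ D → D ∈ choose r (upTo n) → ¬ Valid (wordD k D) y
  bad D h v = ℕP.<⇒≱ lt (ℕP.≤-trans (ℕP.≤-reflexive (sym (proj₂ (choose-⊆ r (upTo n) h)))) (Sublistₚ.length-mono-≤ (valid-⊆-lowL {y} inc h r≤k v)))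

 choose-unique : ∀ {A : Set} r {xs : List A} → Unique xs → Unique (choose r xs)
 choose-unique zero _ = [] ∷ []
 choose-unique (suc r) [] = []
 choose-unique (suc r) {x ∷ xs} u@(_ ∷ u') = Uniqueₚ.++⁺ (Uniqueₚ.map⁺ Listₚ.∷-injectiveʳ (choose-unique r u')) (choose-unique (suc r) u') disjoint
  where
  disjoint : ∀ {D} → ¬ (D ∈ map (x ∷_) (choose r xs) × D ∈ choose (suc r) xs)
  disjoint (p , q) with ∈-map⁻ (x ∷_) p
  ... | D , _ , refl = Unique-head u (Sublist.lookup (proj₁ (choose-⊆ (suc r) xs q)) (here refl))

 sumL-single : ∀ {A : Set} {f : A → ℚ} {xs : List A} {a} → Unique xs → a ∈ xs → (∀ {b} → b ∈ xs → b ≢ a → f b ≡ 0ℚ) → sumL f xs ≡ f a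
 sumL-single {f = f} {x ∷ xs} u (here refl) h = trans (cong (f x ℚ.+_) (trans (sumL-cong∈ xs (λ p → h (there p) (λ { refl → Unique-head u p }))) (sumL-0 {f = λ _ → 0ℚ} (λ _ → refl) xs))) (ℚP.+-identityʳ (f x))
 sumL-single {f = f} {x ∷ xs} {a} u (there q) h = trans (cong₂ ℚ._+_ (h (here refl) (λ { refl → Unique-head u q })) (sumL-single (Unique-tail u) q (λ p → h (there p)))) (ℚP.+-identityˡ (f a))

 -- A subset with a valid word consists of low letters, so among subsets of this size only `lowL y`
 -- contributes.
 h-at : ∀ {F y} → Increasing y → lin (hE k (length (lowL y))) F y ≡ F (tl y)
 h-at {F} {y} inc = trans (lin-hE r F y) (trans (sumL-single (choose-unique r (Uniqueₚ.upTo⁺ n)) (⊆-choose (lowL-⊆ y)) others) (op-valid (low-word y) (low-valid y inc)))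
  where
  r : ℕ
  r = length (lowL y)
  others : ∀ {D} → D ∈ choose r (upTo n) → D ≢ lowL y → op (wordD k D) F y ≡ 0ℚ
  others {D} h ne = op-invalid (wordD k D) λ v → ne (⊆-≡ (valid-⊆-lowL {y} inc h (|lowL|≤k y) v) (proj₂ (choose-⊆ r (upTo n) h)))

 -- The letter of d + 1, if present, comes before the letter of d, so the value d is raised once and
 -- then stays. Hence the low values of y can be recovered from `tl y`.
 low-shift : ∀ y {d} → Low y d → walk (low-word y) d ≡ d + 1ℤ
 low-shift y {d} ld = trans (cong (λ ws → walk ws d) (trans (wordD-sym perm) word≡))
   (walk-hit A v B (All.map (Avoid-~ (res-~ d)) avoid-A) (res-~ d) (All.map (Avoid-~ (~-shift 1ℤ (res-~ d))) avoid-B))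
  where
  v : ℕ
  v = res d
  v<n : v ℕ.< n
  v<n = res<n d
  D : List ℕ
  D = filterᵇ (λ x → memℕ x (lowL y)) (seg v k)
  v∈ : v ∈ lowL y
  v∈ = ∈-lowL⁺ y v<n (Low-cong y (res-~ d) ld)
  perm : lowL y ↭ v ∷ D
  perm = ↭-trans (↭-reflexive (sym (filter-members (Uniqueₚ.upTo⁺ n) (lowL-⊆ y)))) (↭-trans (Permₚ.filter-↭ (λ x → T? (memℕ x (lowL y))) (upTo-↭-seg v<n))
   (↭-reflexive (filterᵇ-keep {P = λ x → memℕ x (lowL y)} {v} {seg v k} (∈-mem v∈))))
  Avoid-~ : ∀ {u w r} → u ~ w → Avoid w r → Avoid u r
  Avoid-~ h (p , q) = p ∘ ~-trans (~-sym h) , q ∘ ~-trans (~-sym h)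
  open Split (wordD-split v<n (filterᵇ-⊆ (λ x → memℕ x (lowL y)) (seg v k))
   (ℕP.≤-trans (ℕP.≤-reflexive (sym (Permₚ.↭-length perm))) (|lowL|≤k y)))

 LowAt : AP → ℕ → Set
 LowAt y i = to y (pos i) < to y N - N

 low-at : ∀ y {i} → i ℕ.< n → LowAt y i → Low y (to y (pos i))
 low-at y i<n h = low (subst (_< to y N - N) (sym (V-unique y i<n ~-refl)) h)

 LowAt-≤ : ∀ {y} → Increasing y → ∀ {i j} → i ℕ.≤ j → j ℕ.< n → LowAt y j → LowAt y i
 LowAt-≤ {y} inc {i} {j} i≤j j<n h with ℕP.m≤n⇒m<n∨m≡n i≤j
 ... | inj₂ refl = h
 ... | inj₁ i<j = <-trans (inc 1≤pos (+<+ (ℕ.s≤s i<j)) (pos≤N j<n)) h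

 -- The low positions of an increasing permutation form an initial segment, and initial segments are
 -- nested.
 lowAt-total : ∀ {y z} → Increasing y → Increasing z →
  (∀ {i} → i ℕ.< n → LowAt y i → LowAt z i) ⊎ (∀ {i} → i ℕ.< n → LowAt z i → LowAt y i)
 lowAt-total {y} {z} iy iz = lem (largest (λ i → to y (pos i) <? to y N - N) n) (largest (λ i → to z (pos i) <? to z N - N) n)
  where
  bound : ∀ {P : ℕ → Set} {i j} → (∀ l → i ℕ.< l → l ℕ.< n → ¬ P l) → j ℕ.< n → P j → j ℕ.≤ i
  bound h j<n p = ℕP.≮⇒≥ (λ i<j → h _ i<j j<n p)
  lem : Largest (LowAt y) n → Largest (LowAt z) n → _
  lem (none h) _ = inj₁ λ {i} i<n l → ⊥-elim (h i i<n l)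
  lem _ (none h) = inj₂ λ {i} i<n l → ⊥-elim (h i i<n l)
  lem (found i i<n p h) (found j j<n q g) with ℕP.≤-total i j
  ... | inj₁ i≤j = inj₁ λ l<n l → LowAt-≤ {z} iz (ℕP.≤-trans (bound {LowAt y} h l<n l) i≤j) j<n q
  ... | inj₂ j≤i = inj₂ λ l<n l → LowAt-≤ {y} iy (ℕP.≤-trans (bound {LowAt z} g l<n l) j≤i) i<n p

 lowL-mono : ∀ {y z} → tl y ≗A tl z → (∀ {i} → i ℕ.< n → LowAt y i → LowAt z i) → lowL y ⊆ lowL z
 lowL-mono {y} {z} e h = ⊆-filter (lowL-⊆ y) (All.tabulate λ {x} p → ⌊⌋-true (low? z (+ x)) (lem x (proj₂ (∈-lowL⁻ y p))))
  where
  lem : ∀ x → Low y (+ x) → Low z (+ x)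
  lem x l = Low-cong z (~-trans (~-reflexive values) (~-trans (~-reflexive (sym (V≡ y (+ x)))) x~)) (low-at z i<n (h i<n at-y))
   where
   i : ℕ
   i = ix y (+ x)
   i<n : i ℕ.< n
   i<n = ix<n y (+ x)
   at-y : LowAt y i
   at-y = subst (_< to y N - N) (V≡ y (+ x)) (is-low l)
   x~ : V y (+ x) ~ + x
   x~ = ~-trans (~-reflexive (cong (λ t → + x + t) (sym (-·N (turns' y (+ x)))))) (~-turn (- turns' y (+ x)))
   values : to z (pos i) ≡ to y (pos i)
   values = lia 2 (λ a b → a :+ #1 ≐ b :+ #1 => b ≐ a) (to y (pos i)) (to z (pos i)) (trans (sym (low-shift y (low-at y i<n at-y)))
    (trans (sym (strip-walk (low-word y) y (pos i))) (trans (at e (pos i)) (trans (strip-walk (low-word z) z (pos i)) (low-shift z (low-at z i<n (h i<n at-y)))))))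

 -- One set of low positions contains the other, and on the smaller set `low-shift` recovers equal
 -- values. The sets of low letters are then nested, and equal because they have the same size.
 tl-injective : ∀ {y z} → Increasing y → Increasing z → length (lowL y) ≡ length (lowL z) → tl y ≗A tl z → y ≗A z
 tl-injective {y} {z} iy iz el e = strip-inj (low-word y) (≗A-trans e (agree λ m → cong (λ D → to (strip (wordD k D) z) m) (sym same)))
  where
  same : lowL y ≡ lowL z
  same with lowAt-total {y} {z} iy iz
  ... | inj₁ h = ⊆-≡ (lowL-mono {y} {z} e h) el
  ... | inj₂ h = sym (⊆-≡ (lowL-mono {z} {y} (≗A-sym e) h) (sym el))

 -- The window sum; prescribing its value at the identity cuts the affine symmetric group out of
 -- `AP`.
 balance : AP → ℤ
 balance x = sumZ n (λ i → to x (pos i))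

 balance-cong : ∀ {x y} → x ≗A y → balance x ≡ balance y
 balance-cong h = sumZ-cong n (λ i _ → at h (pos i))

 balance-tr : ∀ {i e} (ne : i ~/ e) x → balance (trA i e ne ∘A x) ≡ balance x
 balance-tr {i} {e} ne x = lia 7 (λ f g a b a' b' d → f :+ (a' :+ b') ≐ g :+ (a :+ b) => a' ≐ a :+ d => b' ≐ b :- d => g ≐ f) (balance x) (balance (trA i e ne ∘A x)) (to x (pos l)) (to x (pos m)) (tr i e (to x (pos l))) (tr i e (to x (pos m))) (e - i)
   (sumZ-change2 n l m (ix<n x i) (ix<n x e) l≢m (λ j j<n j≢l j≢m → sym (tr-off (λ q → j≢l (pos-inj j<n (ix<n x i) (to-~⁻ x (~-trans q (~-sym l~)))))
     (λ q → j≢m (pos-inj j<n (ix<n x e) (to-~⁻ x (~-trans q (~-sym m~))))))))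
   (tr-at-a l~)
   (trans (tr-at-b ne m~) (lia 3 (λ v i e → v :+ (i :- e) ≐ v :- (e :- i)) (to x (pos m)) i e))
  where
  l m : ℕ
  l = ix x i
  m = ix x e
  class : ∀ d → to x (pos (ix x d)) ~ d
  class d = ~-trans (~-reflexive (sym (V≡ x d))) (~-trans (~-reflexive (cong (λ t → d + t) (sym (-·N (turns' x d))))) (~-turn (- turns' x d)))
  l~ : to x (pos l) ~ i
  l~ = class i
  m~ : to x (pos m) ~ e
  m~ = class e
  l≢m : l ≢ m
  l≢m q = ne (~-trans (~-sym l~) (~-trans (~-reflexive (cong (λ z → to x (pos z)) q)) m~))

 balance-▹ : ∀ i x → balance (i ▹ x) ≡ balance x
 balance-▹ i = balance-tr (i~/i+1 i)

 balance-⇌ : ∀ x {a b} → a ~/ b → balance (x ⇌ a , b) ≡ balance x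
 balance-⇌ x {a} {b} ne = trans (balance-cong {x ⇌ a , b} {trA (to x a) (to x b) (ne ∘ to-~⁻ x) ∘A x} (agree (conj x ne))) (balance-tr (ne ∘ to-~⁻ x) x)

 balance-strip : ∀ ws x → balance (strip ws x) ≡ balance x
 balance-strip [] x = refl
 balance-strip (r ∷ ws) x = trans (balance-strip ws (+ r ▹ x)) (balance-▹ (+ r) x)

 balance-act : ∀ ws → balance (act ws idA) ≡ balance idA
 balance-act [] = refl
 balance-act (r ∷ ws) = trans (balance-▹ (+ r) (act ws idA)) (balance-act ws)

 sumZ-shift : ∀ m c (g : ℕ → ℤ) → sumZ m (λ i → c + g i) ≡ + m * c + sumZ m g
 sumZ-shift zero c g = sym (trans (cong (_+ 0ℤ) (*-zeroˡ c)) refl)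
 sumZ-shift (suc m) c g = trans (cong (_+ (c + g m)) (sumZ-shift m c g)) (lia 5 (λ mc smc c s g → smc ≐ c :+ mc => mc :+ s :+ (c :+ g) ≐ smc :+ (s :+ g)) (+ m * c) (+ suc m * c) c (sumZ m g) (g m) (suc-* (+ m) c))

 -- An increasing bijection is a translation by some c, and equal window sums give n · c = 0.
 rising-id : ∀ x → Rising x → balance x ≡ balance idA → x ≗A idA
 rising-id x r e = agree λ m → trans (cong (to x) (Reduced-pos.b≡ (reduce-pos m))) (trans (per x _ _) (trans (cong (_+ Reduced-pos.t (reduce-pos m) ·N) (trans (linear (Reduced-pos.i (reduce-pos m)))
   (trans (cong (_+ pos (Reduced-pos.i (reduce-pos m))) c≡0) (+-identityˡ (pos (Reduced-pos.i (reduce-pos m))))))) (sym (Reduced-pos.b≡ (reduce-pos m)))))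
  where
  c : ℤ
  c = to x 0ℤ
  linear : ∀ i → to x (pos i) ≡ c + pos i
  linear zero = to-suc x r 0ℤ
  linear (suc i) = trans (cong (λ z → to x (+ z)) (ℕP.+-comm 1 (suc i))) (trans (to-suc x r (pos i)) (lia 3 (λ x c p → x ≐ c :+ (#1 :+ p) => x :+ #1 ≐ c :+ (#2 :+ p)) (to x (pos i)) c (+ i) (linear i)))
  nc : + n * c ≡ 0ℤ
  nc = lia 3 (λ nc b b' → b' ≐ nc :+ b => b' ≐ b => nc ≐ #0) (+ n * c) (balance idA) (balance x) (trans (sumZ-cong n (λ i _ → linear i)) (sumZ-shift n c pos)) e
  c≡0 : c ≡ 0ℤ
  c≡0 = *-cancelˡ-≡ (+ n) c 0ℤ (trans nc (sym (*-zeroʳ (+ n))))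

 pv : Poly k → Fun
 pv P x = sumL (λ t → proj₁ t ℚ.* lin (hs-elem (proj₂ t)) δ x) P

 pv-ext : ∀ P → Ext (pv P)
 pv-ext P h = sumL-cong (λ t → cong (proj₁ t ℚ.*_) (lin-ext (hs-elem (proj₂ t)) δ-ext h)) P

 h-poly : Fin k → Poly k → Poly k
 h-poly j = map (λ t → proj₁ t , j ∷ proj₂ t)

 pv-h : ∀ j P x → pv (h-poly j P) x ≡ lin (hE k (suc (toℕ j))) (pv P) x
 pv-h j P x = trans (sumL-map (λ t → proj₁ t ℚ.* lin (hs-elem (proj₂ t)) δ x) (λ t → proj₁ t , j ∷ proj₂ t) P)
  (trans (sumL-cong (λ t → trans (cong (proj₁ t ℚ.*_) (lin-· H (hs-elem (proj₂ t)) δ x)) (sym (lin-q (proj₁ t) (lin (hs-elem (proj₂ t)) δ)))) P) (sym (lin-sum H P)))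
  where
  H : Elem
  H = hE k (suc (toℕ j))
  lin-q : ∀ q F → lin H (λ y → q ℚ.* F y) x ≡ q ℚ.* lin H F x
  lin-q q F = trans (sumL-cong (λ u → trans (cong (proj₁ u ℚ.*_) (op-* (proj₂ u) q F x)) (swap* (proj₁ u) q (op (proj₂ u) F x))) H) (sumL-* q (λ u → proj₁ u ℚ.* op (proj₂ u) F x) H)
   where
   swap* : ∀ a b c → a ℚ.* (b ℚ.* c) ≡ b ℚ.* (a ℚ.* c)
   swap* a b c = trans (sym (ℚP.*-assoc a b c)) (trans (cong (ℚ._* c) (ℚP.*-comm a b)) (ℚP.*-assoc b a c))
  lin-sum : ∀ e P → lin e (pv P) x ≡ sumL (λ t → lin e (λ y → proj₁ t ℚ.* lin (hs-elem (proj₂ t)) δ y) x) P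
  lin-sum [] P = sym (sumL-0 {f = λ _ → 0ℚ} (λ _ → refl) P)
  lin-sum (u ∷ e) P = trans (cong₂ ℚ._+_ (trans (cong (proj₁ u ℚ.*_) (op-sum (proj₂ u) G P x)) (sym (sumL-* (proj₁ u) (λ t → op (proj₂ u) (G t) x) P))) (lin-sum e P))
   (sym (sumL-+ (λ t → proj₁ u ℚ.* op (proj₂ u) (G t) x) (λ t → lin e (G t) x) P))
   where
   G : ℚ × List (Fin k) → Fun
   G t y = proj₁ t ℚ.* lin (hs-elem (proj₂ t)) δ y

 scaleP : ℚ → Poly k → Poly k
 scaleP q = map (λ t → q ℚ.* proj₁ t , proj₂ t)

 pv-scale : ∀ q P x → pv (scaleP q P) x ≡ q ℚ.* pv P x
 pv-scale q P x = trans (sumL-map (λ t → proj₁ t ℚ.* lin (hs-elem (proj₂ t)) δ x) (λ t → q ℚ.* proj₁ t , proj₂ t) P)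
  (trans (sumL-cong (λ t → ℚP.*-assoc q (proj₁ t) (lin (hs-elem (proj₂ t)) δ x)) P) (sumL-* q (λ t → proj₁ t ℚ.* lin (hs-elem (proj₂ t)) δ x) P))

 -- F is represented by a polynomial in the 𝐡_r on minimal coset representatives.
 Rep : Fun → Set
 Rep F = Σ (Poly k) λ P → ∀ x → Increasing x → pv P x ≡ F x

 point : AP → Fun
 point x y = 𝟙 (y ≗A? x)

 point-ext : ∀ x → Ext (point x)
 point-ext x {y} {z} h = cong (λ b → if b then 1ℚ else 0ℚ) (⌊⌋-cong (y ≗A? x) (z ≗A? x) (≗A-trans (≗A-sym h)) (≗A-trans h))

 Covers : Fun → List AP → Set
 Covers F S = ∀ x → Increasing x → F x ≢ 0ℚ → Σ (Fin (length S)) λ i → x ≗A List.lookup S i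

 -- The listed values are subtracted one point at a time. Representatives are requested only for
 -- points where F is nonzero, which is what allows the inductive call in `point-rep`.
 rep-list : ∀ {F} → Ext F → ∀ S → Covers F S → (∀ x → Increasing x → F x ≢ 0ℚ → Rep (point x)) → Rep F
 rep-list {F} ext [] cov _ = [] , λ x inc → sym (zero' x inc (F x ℚP.≟ 0ℚ))
  where
  zero' : ∀ x → Increasing x → Dec (F x ≡ 0ℚ) → F x ≡ 0ℚ
  zero' x inc (yes e) = e
  zero' x inc (no ne) with proj₁ (cov x inc ne)
  ... | ()
 rep-list {F} ext (a ∷ S) cov reps = lem (increasing? a) (F a ℚP.≟ 0ℚ)
  where
  skip : (∀ x → Increasing x → F x ≢ 0ℚ → ¬ x ≗A a) → Covers F S
  skip ne x inc nz with cov x inc nz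
  ... | Fin.zero , h = ⊥-elim (ne x inc nz h)
  ... | Fin.suc i , h = i , h
  lem : Dec (Increasing a) → Dec (F a ≡ 0ℚ) → Rep F
  lem (no ¬inc) _ = rep-list ext S (skip λ x inc _ h → ¬inc λ {u} {v} p q r → subst₂ _<_ (at h u) (at h v) (inc p q r)) reps
  lem (yes _) (yes z) = rep-list ext S (skip λ x _ nz h → nz (trans (ext h) z)) reps
  lem (yes inca) (no nz) = scaleP c (proj₁ R) ++ proj₁ R' , λ x inc → trans (sumL-++ (λ t → proj₁ t ℚ.* lin (hs-elem (proj₂ t)) δ x) (scaleP c (proj₁ R)) (proj₁ R'))
    (trans (cong₂ ℚ._+_ (trans (pv-scale c (proj₁ R) x) (cong (c ℚ.*_) (proj₂ R x inc))) (proj₂ R' x inc)) (restore (c ℚ.* point a x) (F x)))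
   where
   c : ℚ
   c = F a
   R : Rep (point a)
   R = reps a inca nz
   G : Fun
   G x = F x ℚ.- c ℚ.* point a x
   restore : ∀ u v → u ℚ.+ (v ℚ.- u) ≡ v
   restore u v = trans (cong (u ℚ.+_) (ℚP.+-comm v (ℚ.- u))) (trans (sym (ℚP.+-assoc u (ℚ.- u) v)) (trans (cong (ℚ._+ v) (ℚP.+-inverseʳ u)) (ℚP.+-identityˡ v)))
   G-ext : Ext G
   G-ext h = cong₂ (λ u v → u ℚ.- c ℚ.* v) (ext h) (point-ext a h)
   G-a : ∀ x → x ≗A a → G x ≡ 0ℚ
   G-a x h = trans (cong₂ (λ u v → u ℚ.- c ℚ.* v) (ext h) (𝟙-yes (x ≗A? a) h)) (trans (cong (λ z → c ℚ.- z) (ℚP.*-identityʳ c)) (ℚP.+-inverseʳ c))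
   G-else : ∀ x → ¬ x ≗A a → G x ≡ F x
   G-else x h = trans (cong (λ v → F x ℚ.- c ℚ.* v) (𝟙-no (x ≗A? a) h)) (trans (cong (λ z → F x ℚ.- z) (ℚP.*-zeroʳ c)) (ℚP.+-identityʳ (F x)))
   G-nz : ∀ x → G x ≢ 0ℚ → F x ≢ 0ℚ × ¬ x ≗A a
   G-nz x nz = (λ e → nz (trans (G-else x ¬h) e)) , ¬h
    where
    ¬h : ¬ x ≗A a
    ¬h h = nz (G-a x h)
   covG : Covers G S
   covG x inc nz with cov x inc (proj₁ (G-nz x nz))
   ... | Fin.zero , h = ⊥-elim (proj₂ (G-nz x nz) h)
   ... | Fin.suc i , h = i , h
   R' : Rep G
   R' = rep-list G-ext S covG (λ x inc nz → reps x inc (proj₁ (G-nz x nz)))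

 Balanced : AP → Set
 Balanced x = balance x ≡ balance idA

 sumL-nonzero : ∀ {A : Set} (f : A → ℚ) xs → sumL f xs ≢ 0ℚ → Σ A λ a → a ∈ xs × f a ≢ 0ℚ
 sumL-nonzero f [] nz = ⊥-elim (nz refl)
 sumL-nonzero f (x ∷ xs) nz = lem (f x ℚP.≟ 0ℚ)
  where
  lem : Dec (f x ≡ 0ℚ) → Σ _ λ a → a ∈ x ∷ xs × f a ≢ 0ℚ
  lem (no ne) = x , here refl , ne
  lem (yes e) with sumL-nonzero f xs (λ z → nz (trans (cong₂ ℚ._+_ e z) (ℚP.+-identityˡ 0ℚ)))
  ... | a , p , q = a , there p , q

 op-nonzero : ∀ ws {F y} → op ws F y ≢ 0ℚ → Valid ws y × F (strip ws y) ≢ 0ℚ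
 op-nonzero ws {F} {y} nz = lem (valid? ws y)
  where
  lem : Dec (Valid ws y) → Valid ws y × F (strip ws y) ≢ 0ℚ
  lem (yes v) = v , λ z → nz (trans (op-valid ws v) z)
  lem (no ¬v) = ⊥-elim (nz (op-invalid ws ¬v))

 point-≢0 : ∀ {x y} → point x y ≢ 0ℚ → y ≗A x
 point-≢0 {x} {y} nz = lem (y ≗A? x)
  where
  lem : Dec (y ≗A x) → y ≗A x
  lem (yes h) = h
  lem (no ¬h) = ⊥-elim (nz (𝟙-no (y ≗A? x) ¬h))

 pv-δ : ∀ P x → pv P x ≡ lin (evalPoly k P) δ x
 pv-δ P x = sym (lin-evalPoly P x)

 -- A polynomial for `point (tl x)` is multiplied by 𝐡_r, with r the number of low letters of x. On
 -- increasing y the product is 0 below r low letters and the point function of x at exactly r; what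
 -- remains has the length of x and more low letters.
 module PointStep (x : AP) (inc : Increasing x) (bal : Balanced x) (Z : Rep (point (tl x)))
  (P : Poly k) (G-h : ∀ y → pv P y ≡ lin (hE k (length (lowL x))) (pv (proj₁ Z)) y)
  (IH : ∀ y → Increasing y → Balanced y → ℓ y ≡ ℓ x → length (lowL x) ℕ.< length (lowL y) → Rep (point y)) where

  G F : Fun
  G = pv P
  F y = G y ℚ.- point x y

  F-ext : Ext F
  F-ext h = cong₂ ℚ._-_ (pv-ext P h) (point-ext x h)

  G-below : ∀ y → Increasing y → length (lowL y) ℕ.< length (lowL x) → G y ≡ 0ℚ
  G-below y iy lt = trans (G-h y) (h-below (length (lowL x)) (|lowL|≤k x) iy lt)

  G-at : ∀ y → Increasing y → length (lowL y) ≡ length (lowL x) → G y ≡ point (tl x) (tl y)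
  G-at y iy e = trans (G-h y) (trans (cong (λ r → lin (hE k r) (pv (proj₁ Z)) y) (sym e)) (trans (h-at iy) (proj₂ Z (tl y) (Increasing-tl {y} iy))))

  not-x : ∀ y → F y ≢ 0ℚ → ¬ y ≗A x
  not-x y nz h = nz (trans (F-ext h) (trans (cong₂ ℚ._-_ (trans (G-at x inc refl) (𝟙-yes (tl x ≗A? tl x) ≗A-refl)) (𝟙-yes (x ≗A? x) ≗A-refl)) (ℚP.+-inverseʳ 1ℚ)))

  G-nz : ∀ y → F y ≢ 0ℚ → G y ≢ 0ℚ
  G-nz y nz z = nz (trans (cong₂ ℚ._-_ z (𝟙-no (y ≗A? x) (not-x y nz))) (ℚP.+-inverseʳ 0ℚ))

  higher : ∀ y → Increasing y → F y ≢ 0ℚ → length (lowL x) ℕ.< length (lowL y)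
  higher y iy nz with ℕP.<-cmp (length (lowL x)) (length (lowL y))
  ... | tri< h _ _ = h
  ... | tri≈ _ e _ = ⊥-elim (not-x y nz (tl-injective {y} {x} iy inc (sym e) (point-≢0 (λ z → G-nz y nz (trans (G-at y iy (sym e)) z)))))
  ... | tri> _ _ h = ⊥-elim (G-nz y nz (G-below y iy h))

  lift : ∀ y → Increasing y → (Σ Word λ D → D ∈ choose (length (lowL x)) (upTo n) × op (wordD k D) (pv (proj₁ Z)) y ≢ 0ℚ) → ℓ y ≡ ℓ x × Balanced y
  lift y iy (D , D∈ , nz') = trans (strip-ℓ (wordD k D) v) (trans (cong₂ ℕ._+_ lenD (ℓ-cong st)) (sym (ℓ-tl {x} inc))) ,
    trans (sym (balance-strip (wordD k D) y)) (trans (balance-cong st) (trans (balance-strip (low-word x) x) bal))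
   where
   r : ℕ
   r = length (lowL x)
   v : Valid (wordD k D) y
   v = proj₁ (op-nonzero (wordD k D) nz')
   st : strip (wordD k D) y ≗A tl x
   st = point-≢0 (λ z → proj₂ (op-nonzero (wordD k D) nz') (trans (proj₂ Z _ (Increasing-strip (wordD k D) {y} iy v)) z))
   lenD : length (wordD k D) ≡ r
   lenD = trans (Permₚ.↭-length (wordD-↭ (proj₁ (choose-⊆ r (upTo n) D∈)) (subst (ℕ._≤ k) (sym (proj₂ (choose-⊆ r (upTo n) D∈))) (|lowL|≤k x)))) (proj₂ (choose-⊆ r (upTo n) D∈))

  same-length : ∀ y → Increasing y → F y ≢ 0ℚ → ℓ y ≡ ℓ x × Balanced y
  same-length y iy nz = lift y iy (sumL-nonzero (λ D → op (wordD k D) (pv (proj₁ Z)) y) (choose r (upTo n)) (λ z → G-nz y nz (trans (G-h y) (trans (lin-hE r (pv (proj₁ Z)) y) z))))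
   where
   r : ℕ
   r = length (lowL x)

  covers : Covers F (x ∷ elemAPs (evalPoly k P))
  covers y iy nz = step (lin-supported (evalPoly k P) y (λ z → G-nz y nz (trans (pv-δ P y) z)))
   where
   step : (Σ (Fin (length (elemAPs (evalPoly k P)))) λ i → y ≗A List.lookup (elemAPs (evalPoly k P)) i) → Σ (Fin (suc (length (elemAPs (evalPoly k P))))) λ i → y ≗A List.lookup (x ∷ elemAPs (evalPoly k P)) i
   step (i , h) = Fin.suc i , h

  F-rep : Rep F
  F-rep = rep-list F-ext (x ∷ elemAPs (evalPoly k P)) covers (λ y iy nz → IH y iy (proj₂ (same-length y iy nz)) (proj₁ (same-length y iy nz)) (higher y iy nz))

  rep : Rep (point x)
  rep = P ++ scaleP (ℚ.- 1ℚ) (proj₁ F-rep) , λ y iy → trans (sumL-++ (λ t → proj₁ t ℚ.* lin (hs-elem (proj₂ t)) δ y) P (scaleP (ℚ.- 1ℚ) (proj₁ F-rep)))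
    (trans (cong (G y ℚ.+_) (trans (pv-scale (ℚ.- 1ℚ) (proj₁ F-rep) y) (trans (cong ((ℚ.- 1ℚ) ℚ.*_) (proj₂ F-rep y iy)) (sym (ℚ-neg (F y))))))
     (cancel (G y) (point x y)))
   where
   cancel : ∀ g q → g ℚ.- (g ℚ.- q) ≡ q
   cancel g q = trans (cong (g ℚ.+_) (trans (ℚP.neg-distrib-+ g (ℚ.- q)) (cong (λ z → ℚ.- g ℚ.+ z) (ℚ-neg-neg q)))) (trans (sym (ℚP.+-assoc g (ℚ.- g) q)) (trans (cong (ℚ._+ q) (ℚP.+-inverseʳ g)) (ℚP.+-identityˡ q)))

 h-poly-length : ∀ L r' → L ≡ suc r' → L ℕ.≤ k → ∀ Q → Σ (Poly k) λ P → ∀ y → pv P y ≡ lin (hE k L) (pv Q) y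
 h-poly-length L r' e L≤k Q = h-poly j Q , λ y → trans (pv-h j Q y) (cong (λ r → lin (hE k r) (pv Q) y) (trans (cong suc (Finₚ.toℕ-fromℕ< r'<k)) (sym e)))
  where
  r'<k : r' ℕ.< k
  r'<k = subst (ℕ._≤ k) e L≤k
  j : Fin k
  j = fromℕ< r'<k

 -- Lexicographic induction: on the length, and within one length upwards on the number of low
 -- letters. That number is at most k, and m bounds the distance left.
 point-rep : ∀ x → Increasing x → Balanced x → Rep (point x)
 point-rep x inc bal = go (ℓ x) (<-wellFounded (ℓ x)) k x refl inc bal (m≤m+n k _)
  where
  go : ∀ L → Acc ℕ._<_ L → ∀ m x → ℓ x ≡ L → Increasing x → Balanced x → k ℕ.≤ m ℕ.+ length (lowL x) → Rep (point x)
  go L (acc rec) = level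
   where
   level : ∀ m x → ℓ x ≡ L → Increasing x → Balanced x → k ℕ.≤ m ℕ.+ length (lowL x) → Rep (point x)
   level m x ℓx inc bal fuel = lem (find-descent x)
    where
    lem : (Σ ℕ λ i → i ℕ.< n × Desc (+ i) x) ⊎ Rising x → Rep (point x)
    lem (inj₂ rise) = (1ℚ , []) ∷ [] , λ y _ → trans (ℚP.+-identityʳ _) (trans (ℚP.*-identityˡ _) (trans (lin-one δ y) (δ-point y (y ≗A? x))))
     where
     x≗id : x ≗A idA
     x≗id = rising-id x rise bal
     δ-point : ∀ y → Dec (y ≗A x) → δ y ≡ point x y
     δ-point y (yes h) = trans (δ-id (≗A-trans h x≗id)) (sym (𝟙-yes (y ≗A? x) h))
     δ-point y (no ¬h) = trans (δ-ne (λ p → ¬h (≗A-trans p (≗A-sym x≗id)))) (sym (𝟙-no (y ≗A? x) ¬h))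
    -- A descent is a low letter, so the number of low letters is positive and the corresponding 𝐡_r
    -- is one of the generators.
    lem (inj₁ (d , d<n , desc)) = with-length (length (lowL x)) refl
     where
     d∈ : d ∈ lowL x
     d∈ = ∈-lowL⁺ x d<n (desc-low {x} inc desc)
     with-length : ∀ r → length (lowL x) ≡ r → Rep (point x)
     with-length zero e = ⊥-elim (empty (lowL x) d∈ e)
      where
      empty : ∀ (xs : List ℕ) → d ∈ xs → length xs ≢ 0
      empty (_ ∷ _) _ ()
     with-length (suc r') e = PointStep.rep x inc bal Z (proj₁ hZ) (proj₂ hZ) (λ y iy by ℓy h → inner m fuel y iy by ℓy h)
      where
      smaller : ℓ (tl x) ℕ.< L
      smaller = subst (ℓ (tl x) ℕ.<_) ℓx (subst (ℓ (tl x) ℕ.<_) (sym (ℓ-tl {x} inc)) (subst (λ r → ℓ (tl x) ℕ.< r ℕ.+ ℓ (tl x)) (sym e) (ℕ.s≤s (m≤n+m _ r'))))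
      Z : Rep (point (tl x))
      Z = go (ℓ (tl x)) (rec smaller) k (tl x) refl (Increasing-tl {x} inc) (trans (balance-strip (low-word x) x) bal) (m≤m+n k _)
      hZ : Σ (Poly k) λ P → ∀ y → pv P y ≡ lin (hE k (length (lowL x))) (pv (proj₁ Z)) y
      hZ = h-poly-length (length (lowL x)) r' e (|lowL|≤k x) (proj₁ Z)
      inner : ∀ m → k ℕ.≤ m ℕ.+ length (lowL x) → ∀ y → Increasing y → Balanced y → ℓ y ≡ ℓ x → length (lowL x) ℕ.< length (lowL y) → Rep (point y)
      inner zero f y iy by ℓy h = ⊥-elim (ℕP.<⇒≱ (ℕP.≤-<-trans f h) (|lowL|≤k y))
      inner (suc m) f y iy by ℓy h = level m y (trans ℓy ℓx) iy by (ℕP.≤-trans f (ℕP.≤-trans (ℕP.≤-reflexive (sym (+-suc m _))) (ℕP.+-monoʳ-≤ m h)))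

 ker-rep : ∀ e → Rep (lin e δ)
 ker-rep e = rep-list (lin-ext e δ-ext) (elemAPs e) (λ x _ → lin-supported e x) λ x inc nz → point-rep x inc (balanced e x nz)
  where
  balanced : ∀ e x → lin e δ x ≢ 0ℚ → Balanced x
  balanced e x nz with sumL-nonzero (λ t → proj₁ t ℚ.* op (proj₂ t) δ x) e nz
  ... | (q , ws) , _ , nz' = trans (balance-cong (proj₂ (op-support ws x λ z → nz' (trans (cong (q ℚ.*_) z) (ℚP.*-zeroʳ q))))) (balance-act ws)

 -- Take a polynomial agreeing with e on increasing permutations. The difference lies in the kernel
 -- and vanishes there, hence everywhere.
 ker-InB : ∀ e → Ker (lin e δ) → InB k e
 ker-InB e ker = P , coeff-ext (evalPoly k P) e equal
  where
  P : Poly k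
  P = proj₁ (ker-rep e)
  f : Elem
  f = evalPoly k P ++ scaleE (ℚ.- 1ℚ) e
  lin-f : ∀ x → lin f δ x ≡ lin (evalPoly k P) δ x ℚ.+ (ℚ.- 1ℚ) ℚ.* lin e δ x
  lin-f x = trans (lin-++ (evalPoly k P) (scaleE (ℚ.- 1ℚ) e) δ x) (cong (lin (evalPoly k P) δ x ℚ.+_) (lin-scale (ℚ.- 1ℚ) e δ x))
  minus : ∀ u v → u ℚ.+ (ℚ.- 1ℚ) ℚ.* v ≡ u ℚ.- v
  minus u v = cong (u ℚ.+_) (sym (ℚ-neg v))
  cancel : ∀ u v w → w ≡ u ℚ.+ (ℚ.- 1ℚ) ℚ.* v → w ≡ 0ℚ → u ≡ v
  cancel u v w e z = trans (sym (ℚP.+-identityʳ u)) (trans (cong (u ℚ.+_) (sym (ℚP.+-inverseˡ v)))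
   (trans (sym (ℚP.+-assoc u (ℚ.- v) v)) (trans (cong (ℚ._+ v) (trans (sym (minus u v)) (trans (sym e) z))) (ℚP.+-identityˡ v))))
  zero' : ∀ x → lin f δ x ≡ 0ℚ
  zero' = vanish (lin-ext f δ-ext) (Ker-cong (sym ∘ lin-f) (Ker-+ (Ker-poly P) (Ker-* (ℚ.- 1ℚ) ker))) (elemAPs f) (lin-supported f)
   (λ x inc → trans (lin-f x) (trans (minus (lin (evalPoly k P) δ x) (lin e δ x)) (trans (cong (ℚ._- lin e δ x) (trans (sym (pv-δ P x)) (proj₂ (ker-rep e) x inc))) (ℚP.+-inverseʳ (lin e δ x)))))
  equal : ∀ x → lin (evalPoly k P) δ x ≡ lin e δ x
  equal x = cancel (lin (evalPoly k P) δ x) (lin e δ x) (lin f δ x) (lin-f x) (zero' x)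

 -- Sorting words acting on one-line notation

 -- A stretch of the one-line notation of the inverse: the values σ, σ + 1, ... sit at the listed
 -- positions. Left multiplication by a letter exchanges neighbours in it.
 Win : ℤ → List ℤ → AP → Set
 Win σ [] x = ⊤
 Win σ (e ∷ es) x = fr x σ ≡ e × Win (σ + 1ℤ) es x

 Win-≡ : ∀ {σ σ' es x} → σ ≡ σ' → Win σ es x → Win σ' es x
 Win-≡ refl w = w

 private
  next-index : ∀ σ l → σ + 1ℤ + + l ≡ σ + + suc l
  next-index σ l = lia 2 (λ σ l → σ :+ #1 :+ l ≐ σ :+ (#1 :+ l)) σ (+ l)

 Win-split : ∀ {σ x} us {vs} → Win σ (us ++ vs) x → Win σ us x × Win (σ + + length us) vs x
 Win-split {σ} [] w = tt , Win-≡ (sym (+-identityʳ σ)) w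
 Win-split {σ} {x} (u ∷ us) {vs} (e , w) = (e , proj₁ (Win-split us w)) , Win-≡ {es = vs} {x} (next-index σ (length us)) (proj₂ (Win-split us w))

 Win-join : ∀ {σ x} us {vs} → Win σ us x → Win (σ + + length us) vs x → Win σ (us ++ vs) x
 Win-join {σ} [] _ w = Win-≡ (+-identityʳ σ) w
 Win-join {σ} {x} (u ∷ us) {vs} (e , v) w = e , Win-join us v (Win-≡ {es = vs} {x} (sym (next-index σ (length us))) w)

 Win-turn : ∀ {σ x} es → Win σ es x → Win (σ - N) (map (_- N) es) x
 Win-turn [] _ = tt
 Win-turn {σ} {x} (e ∷ es) (q , w) = trans (cong (fr x) (cong (λ z → σ + z) N⁻)) (trans (fr-per x σ (- 1ℤ)) (cong₂ _+_ q (sym N⁻))) ,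
   Win-≡ {es = map (_- N) es} {x} (lia 2 (λ σ N → σ :+ #1 :- N ≐ σ :- N :+ #1) σ N) (Win-turn es w)
  where
  N⁻ : - N ≡ (- 1ℤ) ·N
  N⁻ = sym (trans (-·N 1ℤ) (cong -_ 1·N))

 -- A full period may be cut elsewhere: its tail moves to the front, lowered by N.
 Win-rotate : ∀ {σ x} us vs → length us ℕ.+ length vs ≡ n → Win σ (us ++ vs) x → Win (σ - + length vs) (map (_- N) vs ++ us) x
 Win-rotate {σ} {x} us vs len w = Win-join (map (_- N) vs)
   (Win-≡ {es = map (_- N) vs} {x} (lia 4 (λ σ u v N → u :+ v ≐ N => σ :+ u :- N ≐ σ :- v) σ (+ length us) (+ length vs) N (trans (cong +_ len) (sym N-def))) (Win-turn vs (proj₂ (Win-split us w))))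
   (Win-≡ {es = us} {x} (trans (lia 2 (λ σ v → σ ≐ σ :- v :+ v) σ (+ length vs)) (cong (λ l → σ - + length vs + + l) (sym (Listₚ.length-map (_- N) vs)))) (proj₁ (Win-split us w)))

 Win-off : ∀ {σ x i} es → (∀ q → σ ≤ q → q < σ + + length es → q ~/ i × q ~/ i + 1ℤ) → Win σ es x → Win σ es (i ▹ x)
 Win-off [] _ _ = tt
 Win-off {σ} {x} {i} (e ∷ es) h (q , w) = trans (cong (fr x) (tr-off (proj₁ (h σ ≤-refl lt)) (proj₂ (h σ ≤-refl lt)))) q ,
   Win-off es (λ p l u → h p (lia 2 (λ σ p → σ :+ #1 =< p => σ =< p) σ p l) (subst (p <_) (next-index σ (length es)) u)) w
  where
  lt : σ < σ + + suc (length es)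
  lt = lia 2 (λ σ l → #0 =< l => σ <: σ :+ (#1 :+ l)) σ (+ length es) 0≤+

 window-~/ : ∀ {a b} → b - N < a → a < b + N → a ≢ b → a ~/ b
 window-~/ l u ne h = ne (~-gap h l u)

 Win-swap : ∀ {σ x a b vs} us → Win σ (us ++ a ∷ b ∷ vs) x → length us ℕ.+ (2 ℕ.+ length vs) ≡ n → ∀ {i} → i ~ σ + + length us →
  Win σ (us ++ b ∷ a ∷ vs) (i ▹ x) × (a < b → ℓ (i ▹ x) ≡ suc (ℓ x))
 Win-swap {σ} {x} {a} {b} {vs} us w len {i} i~ = Win-join us
    (Win-off us (λ q l u → (λ e → left q l u 0ℤ (inj₁ refl) (~-trans e (~-trans i~ (~-reflexive (sym (+-identityʳ ρ)))))) , (λ e → left q l u 1ℤ (inj₂ refl) (~-trans e (~-shift 1ℤ i~)))) (proj₁ (Win-split us w)))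
    (trans (cong (fr x) (at-ρ)) (proj₁ (proj₂ (proj₂ (Win-split us w)))) , trans (cong (fr x) at-ρ+1) (proj₁ (proj₂ (Win-split us w))) ,
     Win-off vs (λ q l u → (λ e → right q l u 0ℤ (inj₁ refl) (~-trans e (~-trans i~ (~-reflexive (sym (+-identityʳ ρ)))))) , (λ e → right q l u 1ℤ (inj₂ refl) (~-trans e (~-shift 1ℤ i~)))) (proj₂ (proj₂ (proj₂ (Win-split us w))))) ,
   λ a<b → ascent x i (Ascent.asc-lift x ρ (subst₂ _<_ (sym (proj₁ (proj₂ (Win-split us w)))) (sym (proj₁ (proj₂ (proj₂ (Win-split us w))))) a<b) i~)
  where
  ρ : ℤ
  ρ = σ + + length us
  len' : + length us + (+ 2 + + length vs) ≡ N
  len' = trans (cong +_ len) (sym N-def)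
  at-ρ : s i ρ ≡ ρ + 1ℤ
  at-ρ = trans (tr-at-a (~-sym i~)) (lia 2 (λ i ρ → ρ :+ (i :+ #1 :- i) ≐ ρ :+ #1) i ρ)
  at-ρ+1 : s i (ρ + 1ℤ) ≡ ρ
  at-ρ+1 = trans (tr-at-b (i~/i+1 i) (~-shift 1ℤ (~-sym i~))) (lia 2 (λ i ρ → ρ :+ #1 :+ (i :- (i :+ #1)) ≐ ρ) i ρ)
  left : ∀ q → σ ≤ q → q < σ + + length us → ∀ d → d ≡ 0ℤ ⊎ d ≡ 1ℤ → q ~/ ρ + d
  left q l u d h = window-~/
    (lia 6 (λ σ q u v d N → u :+ (#2 :+ v) ≐ N => #0 =< v => σ =< q => (d ≐ #0 ∨' d ≐ #1) => σ :+ u :+ d :- N <: q) σ q (+ length us) (+ length vs) d N len' 0≤+ l h)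
    (lia 5 (λ σ q u d N → q <: σ :+ u => #2 =< N => (d ≐ #0 ∨' d ≐ #1) => q <: σ :+ u :+ d :+ N) σ q (+ length us) d N u 2≤N h)
    (λ e → lia 4 (λ σ q u d → q <: σ :+ u => (d ≐ #0 ∨' d ≐ #1) => q ≐ σ :+ u :+ d => false') σ q (+ length us) d u h e)
  right : ∀ q → ρ + 1ℤ + 1ℤ ≤ q → q < ρ + 1ℤ + 1ℤ + + length vs → ∀ d → d ≡ 0ℤ ⊎ d ≡ 1ℤ → q ~/ ρ + d
  right q l u d h = window-~/
    (lia 4 (λ ρ q d N → #2 =< N => ρ :+ #1 :+ #1 =< q => (d ≐ #0 ∨' d ≐ #1) => ρ :+ d :- N <: q) ρ q d N 2≤N l h)
    (lia 6 (λ ρ q u v d N → u :+ (#2 :+ v) ≐ N => #0 =< u => q <: ρ :+ #1 :+ #1 :+ v => (d ≐ #0 ∨' d ≐ #1) => q <: ρ :+ d :+ N) ρ q (+ length us) (+ length vs) d N len' 0≤+ u h)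
    (λ e → lia 3 (λ ρ q d → ρ :+ #1 :+ #1 =< q => (d ≐ #0 ∨' d ≐ #1) => q ≐ ρ :+ d => false') ρ q d l h e)

 -- Registers are indexed from right to left.
 regs : ∀ {j} → Vec ℤ j → List ℤ → List ℤ
 regs [] rest = rest
 regs (r ∷ τ) rest = regs τ (r ∷ rest)

 rev : ∀ {j} → Vec ℤ j → List ℤ
 rev [] = []
 rev (r ∷ τ) = rev τ ++ [ r ]

 regs-++ : ∀ {j} (τ : Vec ℤ j) rest → regs τ rest ≡ rev τ ++ rest
 regs-++ [] rest = refl
 regs-++ (r ∷ τ) rest = trans (regs-++ τ (r ∷ rest)) (sym (++-assoc (rev τ) [ r ] rest))

 length-rev : ∀ {j} (τ : Vec ℤ j) → length (rev τ) ≡ j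
 length-rev [] = refl
 length-rev (r ∷ τ) = trans (length-++ (rev τ)) (trans (ℕP.+-comm _ 1) (cong suc (length-rev τ)))

 regs-∷ʳ : ∀ {j} (τ : Vec ℤ j) e rest → regs (τ Vec.∷ʳ e) rest ≡ e ∷ regs τ rest
 regs-∷ʳ [] e rest = refl
 regs-∷ʳ (r ∷ τ) e rest = regs-∷ʳ τ e (r ∷ rest)

 Asc : Word → AP → Set
 Asc ws x = ℓ (act ws x) ≡ length ws ℕ.+ ℓ x

 Asc-++ : ∀ us ws {x} → Asc us (act ws x) → Asc ws x → Asc (us ++ ws) x
 Asc-++ us ws {x} a b = trans (cong ℓ (act-++ us ws x)) (trans a (trans (cong (length us ℕ.+_) b)
  (trans (sym (ℕP.+-assoc (length us) (length ws) (ℓ x))) (cong (ℕ._+ ℓ x) (sym (length-++ us))))))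

 Asc-∷ : ∀ {r ws x} → ℓ (+ r ▹ act ws x) ≡ suc (ℓ (act ws x)) → Asc ws x → Asc (r ∷ ws) x
 Asc-∷ h a = trans h (cong suc a)

 regs-swap : ∀ {σ x a b vs} us {j} (τ : Vec ℤ j) → Win σ (us ++ regs τ (a ∷ b ∷ vs)) x → length us ℕ.+ (j ℕ.+ (2 ℕ.+ length vs)) ≡ n →
  ∀ ρ → ρ ≡ σ + + length us + + j → Win σ (us ++ regs τ (b ∷ a ∷ vs)) (+ res ρ ▹ x) × (a < b → ℓ (+ res ρ ▹ x) ≡ suc (ℓ x))
 regs-swap {σ} {x} {a} {b} {vs} us {j} τ w len ρ ρ≡ = subst (λ l → Win σ l (+ res ρ ▹ x)) (sym (reshape (b ∷ a ∷ vs))) (proj₁ sw) , proj₂ sw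
  where
  reshape : ∀ X → us ++ regs τ X ≡ (us ++ rev τ) ++ X
  reshape X = trans (cong (us ++_) (regs-++ τ X)) (sym (++-assoc us (rev τ) X))
  len'' : length (us ++ rev τ) ≡ length us ℕ.+ j
  len'' = trans (length-++ us) (cong (length us ℕ.+_) (length-rev τ))
  sw : Win σ ((us ++ rev τ) ++ b ∷ a ∷ vs) (+ res ρ ▹ x) × (a < b → ℓ (+ res ρ ▹ x) ≡ suc (ℓ x))
  sw = Win-swap (us ++ rev τ) (subst (λ l → Win σ l x) (reshape (a ∷ b ∷ vs)) w)
   (trans (cong (ℕ._+ (2 ℕ.+ length vs)) len'') (trans (ℕP.+-assoc (length us) j _) len))
   (~-trans (~-sym (res-~ ρ)) (~-reflexive (trans ρ≡ (trans (+-assoc σ (+ length us) (+ j)) (cong (λ l → σ + + l) (sym len''))))))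

 -- A word acts from its right end, so the letters ρ, ..., ρ + j - 1 are applied in this order and
 -- carry the entry at ρ to the right past j neighbours.
 sweepW : ℤ → ℕ → Word
 sweepW ρ zero = []
 sweepW ρ (suc j) = res (ρ + + j) ∷ sweepW ρ j

 -- A sweep with one letter left out, corresponding to the cell removed from a row: the carried
 -- entry stays in register b and the former content of that register travels on.
 skipW : ℤ → ∀ {j} → Fin j → Word
 skipW ρ {suc j} zero = sweepW ρ j
 skipW ρ {suc j} (suc b) = res (ρ + + j) ∷ skipW ρ b

 private
  len-shift : ∀ u j v → u ℕ.+ (suc j ℕ.+ suc v) ≡ u ℕ.+ (j ℕ.+ (2 ℕ.+ v))
  len-shift u j v = cong (u ℕ.+_) (sym (+-suc j (suc v)))

 sweep : ∀ {σ x e vs} us {j} (τ : Vec ℤ j) → Win σ (us ++ e ∷ regs τ vs) x → length us ℕ.+ (j ℕ.+ suc (length vs)) ≡ n →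
  (∀ b → e < lookup τ b) → ∀ ρ → ρ ≡ σ + + length us →
  Win σ (us ++ regs τ (e ∷ vs)) (act (sweepW ρ j) x) × Asc (sweepW ρ j) x
 sweep us [] w len asc ρ ρ≡ = w , refl
 sweep {σ} {x} {e} {vs} us {suc j} (r ∷ τ) w len asc ρ ρ≡ = proj₁ sw , Asc-∷ {ws = sweepW ρ j} (proj₂ sw (asc zero)) (proj₂ ih)
  where
  ih : Win σ (us ++ regs τ (e ∷ r ∷ vs)) (act (sweepW ρ j) x) × Asc (sweepW ρ j) x
  ih = sweep us τ w (trans (sym (len-shift (length us) j (length vs))) len) (asc ∘ suc) ρ ρ≡
  sw = regs-swap us τ (proj₁ ih) (trans (sym (len-shift (length us) j (length vs))) len) (ρ + + j) (cong (_+ + j) ρ≡)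

 -- Older registers are passed by e, which is smaller than all contents; newer ones are passed by
 -- the former content of b, smaller by the hypothesis on newer registers. So every letter applied
 -- lengthens.
 skip : ∀ {σ x e vs} us {j} (τ : Vec ℤ j) (b : Fin j) → Win σ (us ++ e ∷ regs τ vs) x → length us ℕ.+ (j ℕ.+ suc (length vs)) ≡ n →
  (∀ b → e < lookup τ b) → (∀ b' → b' Fin.< b → lookup τ b < lookup τ b') → ∀ ρ → ρ ≡ σ + + length us →
  Win σ (us ++ regs (τ [ b ]≔ e) (lookup τ b ∷ vs)) (act (skipW ρ b) x) × Asc (skipW ρ b) x
 skip {vs = vs} us {suc j} (r ∷ τ) zero w len asc new ρ ρ≡ = sweep us τ w (trans (sym (len-shift (length us) j (length vs))) len) (asc ∘ suc) ρ ρ≡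
 skip {σ} {x} {e} {vs} us {suc j} (r ∷ τ) (suc b) w len asc new ρ ρ≡ = proj₁ sw , Asc-∷ {ws = skipW ρ b} (proj₂ sw (new zero (ℕ.s≤s ℕ.z≤n))) (proj₂ ih)
  where
  len1 = trans (sym (len-shift (length us) j (length vs))) len
  ih : Win σ (us ++ regs (τ [ b ]≔ e) (lookup τ b ∷ r ∷ vs)) (act (skipW ρ b) x) × Asc (skipW ρ b) x
  ih = skip us τ b w len1 (asc ∘ suc) (λ b' lt → new (suc b') (ℕ.s≤s lt)) ρ ρ≡
  sw = regs-swap us (τ [ b ]≔ e) (proj₁ ih) len1 (ρ + + j) (cong (_+ + j) ρ≡)

 -- Configurations and the permutations they encode

 -- A configuration of t slots, read from left to right; j of them are holes. Holes are numbered from the most recent one.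
 data Conf : ℕ → ℕ → Set where
  ε : Conf 0 0
  hole : ∀ {t j} → Conf t j → Conf (suc t) (suc j)
  free : ∀ {t j} → Conf t j → Conf (suc t) j
  att : ∀ {t j} → Conf t j → Fin j → Conf (suc t) j

 -- A hole is open until a slot is attached to an older one.
 Open : ∀ {t j} → Conf t j → Fin j → Set
 Open (hole C) zero = ⊤
 Open (hole C) (suc b) = Open C b
 Open (free C) b = Open C b
 Open (att C a) b = a Fin.≤ b × Open C b

 -- Attaching only to open holes is the local form of noncrossing; `nc-clear` and `clear-nc`
 -- identify it with (C2).
 NC : ∀ {t j} → Conf t j → Set
 NC ε = ⊤
 NC (hole C) = NC C
 NC (free C) = NC C
 NC (att C b) = NC C × Open C b

 -- The slot at which the chain hanging on hole b ends so far; the next slot attached to b is joined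
 -- to it.
 top : ∀ {t j} → Conf t j → Fin j → ℕ
 top (hole {t} C) zero = t
 top (hole C) (suc b) = top C b
 top (free C) b = top C b
 top (att {t} C a) b with a Fin.≟ b
 ... | yes _ = t
 ... | no _ = top C b

 hol : ∀ {t j} → Conf t j → Fin j → ℕ
 hol (hole {t} C) zero = t
 hol (hole C) (suc b) = hol C b
 hol (free C) b = hol C b
 hol (att C a) b = hol C b

 data Arc : ∀ {t j} → Conf t j → ℕ → ℕ → Set where
  here : ∀ {t j} {C : Conf t j} {b} → Arc (att C b) (top C b) t
  holeᵃ : ∀ {t j} {C : Conf t j} {u v} → Arc C u v → Arc (hole C) u v
  freeᵃ : ∀ {t j} {C : Conf t j} {u v} → Arc C u v → Arc (free C) u v
  attᵃ : ∀ {t j} {C : Conf t j} {b u v} → Arc C u v → Arc (att C b) u v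

 data Free : ∀ {t j} → Conf t j → ℕ → Set where
  here : ∀ {t j} {C : Conf t j} → Free (free C) t
  holeᶠ : ∀ {t j} {C : Conf t j} {v} → Free C v → Free (hole C) v
  freeᶠ : ∀ {t j} {C : Conf t j} {v} → Free C v → Free (free C) v
  attᶠ : ∀ {t j} {C : Conf t j} {b v} → Free C v → Free (att C b) v

 np : ∀ {t j} → Conf t j → ℕ
 np ε = 0
 np (hole C) = np C
 np (free C) = suc (np C)
 np (att C _) = suc (np C)

 np+j : ∀ {t j} (C : Conf t j) → np C ℕ.+ j ≡ t
 np+j ε = refl
 np+j (hole {t} {j} C) = trans (+-suc (np C) j) (cong suc (np+j C))
 np+j (free C) = cong suc (np+j C)
 np+j (att C _) = cong suc (np+j C)

 parts : (ℕ → ℤ) → ∀ {t j} → Conf t j → List ℤ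
 parts lab ε = []
 parts lab (hole C) = parts lab C
 parts lab (free {t} C) = parts lab C ++ [ lab t ]
 parts lab (att {t} C _) = parts lab C ++ [ lab t ]

 length-parts : ∀ lab {t j} (C : Conf t j) → length (parts lab C) ≡ np C
 length-parts lab ε = refl
 length-parts lab (hole C) = length-parts lab C
 length-parts lab (free {t} C) = trans (length-++ (parts lab C)) (trans (ℕP.+-comm _ 1) (cong suc (length-parts lab C)))
 length-parts lab (att {t} C _) = trans (length-++ (parts lab C)) (trans (ℕP.+-comm _ 1) (cong suc (length-parts lab C)))

 holes : (ℕ → ℤ) → ∀ {t j} → Conf t j → Vec ℤ j
 holes lab ε = []
 holes lab (hole {t} C) = lab t ∷ holes lab C
 holes lab (free C) = holes lab C
 holes lab (att C _) = holes lab C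

 lookup-holes : ∀ lab {t j} (C : Conf t j) b → lookup (holes lab C) b ≡ lab (hol C b)
 lookup-holes lab (hole C) zero = refl
 lookup-holes lab (hole C) (suc b) = lookup-holes lab C b
 lookup-holes lab (free C) b = lookup-holes lab C b
 lookup-holes lab (att C _) b = lookup-holes lab C b

 -- The one-line notation left by `botW`, with τ the current contents of the registers; `values`
 -- reads the permutation off it.
 final : (ℕ → ℤ) → ∀ {t j} → Conf t j → Vec ℤ j → List ℤ → List ℤ
 final lab ε [] rest = rest
 final lab (hole C) (r ∷ τ) rest = final lab C τ (r ∷ rest)
 final lab (free {t} C) τ rest = final lab C τ (lab t ∷ rest)
 final lab (att {t} C b) τ rest = final lab C (τ [ b ]≔ lab t) (lookup τ b ∷ rest)

 -- The rows of λ without the removed cells: a particle with j holes to its left is a row of length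
 -- j.
 botW : ℤ → ∀ {t j} → Conf t j → Word
 botW σ ε = []
 botW σ (hole C) = botW σ C
 botW σ (free {j = j} C) = botW σ C ++ sweepW (σ + + np C) j
 botW σ (att C b) = botW σ C ++ skipW (σ + + np C) b

 -- The rows of the rectangle outside λ; h counts the holes to the right of the part of the
 -- configuration still to be read.
 topW : ℤ → ∀ {t j} → Conf t j → ℕ → Word
 topW s ε h = []
 topW s (hole C) h = topW s C (suc h)
 topW s (free {t} C) h = topW s C h ++ sweepW (s + + t) h
 topW s (att {t} C _) h = topW s C h ++ sweepW (s + + t) h

 hol<t : ∀ {t j} (C : Conf t j) b → hol C b ℕ.< t
 hol<t (hole C) zero = n<1+n _
 hol<t (hole C) (suc b) = m<n⇒m<1+n (hol<t C b)
 hol<t (free C) b = m<n⇒m<1+n (hol<t C b)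
 hol<t (att C _) b = m<n⇒m<1+n (hol<t C b)

 top<t : ∀ {t j} (C : Conf t j) b → top C b ℕ.< t
 top<t (hole C) zero = n<1+n _
 top<t (hole C) (suc b) = m<n⇒m<1+n (top<t C b)
 top<t (free C) b = m<n⇒m<1+n (top<t C b)
 top<t (att C a) b with a Fin.≟ b
 ... | yes _ = n<1+n _
 ... | no _ = m<n⇒m<1+n (top<t C b)

 hol≤top : ∀ {t j} (C : Conf t j) b → hol C b ℕ.≤ top C b
 hol≤top (hole C) zero = ℕP.≤-refl
 hol≤top (hole C) (suc b) = hol≤top C b
 hol≤top (free C) b = hol≤top C b
 hol≤top (att C a) b with a Fin.≟ b
 ... | yes _ = ℕP.<⇒≤ (hol<t C b)
 ... | no _ = hol≤top C b

 hol-mono : ∀ {t j} (C : Conf t j) {b b'} → b' Fin.< b → hol C b ℕ.< hol C b'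
 hol-mono (hole C) {suc b} {zero} _ = hol<t C b
 hol-mono (hole C) {suc b} {suc b'} (ℕ.s≤s lt) = hol-mono C lt
 hol-mono (free C) lt = hol-mono C lt
 hol-mono (att C _) lt = hol-mono C lt

 module _ (lab : ℕ → ℤ) (mono : ∀ {u v} → u ℕ.< v → lab u < lab v) where

  Below : ∀ {j} → ℕ → Vec ℤ j → Set
  Below t τ = ∀ b u → u ℕ.< t → lab u < lookup τ b

  -- If the newer hole b' is open in C, no remaining slot is attached to an older hole, so the order
  -- of the two contents is never tested. Otherwise the newer register must hold the larger content.
  Inv : ∀ {t j} → Conf t j → Vec ℤ j → Set
  Inv C τ = ∀ {b b'} → b' Fin.< b → lookup τ b < lookup τ b' ⊎ Open C b'

  private
   len-free : ∀ p j v → suc p ℕ.+ (j ℕ.+ v) ≡ p ℕ.+ (j ℕ.+ suc v)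
   len-free p j v = trans (sym (+-suc p (j ℕ.+ v))) (cong (p ℕ.+_) (sym (+-suc j v)))

  -- Slots are treated from the last to the first. Each particle carries a label below every
  -- register content (`Below`), and an attachment meets larger contents in the newer registers
  -- (`Inv`), so every letter lengthens.
  bottom : ∀ {σ x t j} (C : Conf t j) τ rest → NC C → Win σ (parts lab C ++ regs τ rest) x → np C ℕ.+ (j ℕ.+ length rest) ≡ n →
   Below t τ → Inv C τ → Win σ (final lab C τ rest) (act (botW σ C) x) × Asc (botW σ C) x
  bottom ε [] rest nc w len bel inv = w , refl
  bottom {j = suc j} (hole C) (r ∷ τ) rest nc w len bel inv = bottom C τ (r ∷ rest) nc w (trans (cong (np C ℕ.+_) (+-suc j (length rest))) len)
   (λ b u u< → bel (suc b) u (m<n⇒m<1+n u<)) (λ lt → inv (ℕ.s≤s lt))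
  bottom {σ} {x} {j = j} (free {t} C) τ rest nc w len bel inv =
    subst (Win σ (final lab C τ (lab t ∷ rest))) (sym (act-++ (botW σ C) (sweepW (σ + + np C) j) x)) (proj₁ ih) , Asc-++ (botW σ C) (sweepW (σ + + np C) j) (proj₂ ih) (proj₂ sw)
   where
   len' : np C ℕ.+ (j ℕ.+ suc (length rest)) ≡ n
   len' = trans (sym (len-free (np C) j (length rest))) len
   sw = sweep (parts lab C) τ (subst (λ l → Win σ l x) (++-assoc (parts lab C) [ lab t ] (regs τ rest)) w)
    (trans (cong (ℕ._+ (j ℕ.+ suc (length rest))) (length-parts lab C)) len') (λ b → bel b t (n<1+n t)) (σ + + np C) (cong (λ l → σ + + l) (sym (length-parts lab C)))
   ih = bottom C τ (lab t ∷ rest) nc (proj₁ sw) len' (λ b u u< → bel b u (m<n⇒m<1+n u<)) inv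
  bottom {σ} {x} {j = j} (att {t} C b) τ rest (nc , op) w len bel inv =
    subst (Win σ (final lab C (τ [ b ]≔ lab t) (lookup τ b ∷ rest))) (sym (act-++ (botW σ C) (skipW (σ + + np C) b) x)) (proj₁ ih) , Asc-++ (botW σ C) (skipW (σ + + np C) b) (proj₂ ih) (proj₂ sw)
   where
   len' : np C ℕ.+ (j ℕ.+ suc (length rest)) ≡ n
   len' = trans (sym (len-free (np C) j (length rest))) len
   newer : ∀ b' → b' Fin.< b → lookup τ b < lookup τ b'
   newer b' lt with inv lt
   ... | inj₁ h = h
   ... | inj₂ (h , _) = ⊥-elim (ℕP.<⇒≱ lt h)
   sw = skip (parts lab C) τ b (subst (λ l → Win σ l x) (++-assoc (parts lab C) [ lab t ] (regs τ rest)) w)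
    (trans (cong (ℕ._+ (j ℕ.+ suc (length rest))) (length-parts lab C)) len') (λ b → bel b t (n<1+n t)) newer (σ + + np C) (cong (λ l → σ + + l) (sym (length-parts lab C)))
   τ' : Vec ℤ j
   τ' = τ [ b ]≔ lab t
   bel' : Below t τ'
   bel' b1 u u< with b1 Fin.≟ b
   ... | yes refl = subst (lab u <_) (sym (Vecₚ.lookup∘updateAt b τ)) (mono u<)
   ... | no ne = subst (lab u <_) (sym (Vecₚ.lookup∘updateAt′ b1 b ne τ)) (bel b1 u (m<n⇒m<1+n u<))
   inv' : Inv C τ'
   inv' {b1} {b2} lt with b1 Fin.≟ b | b2 Fin.≟ b
   ... | yes refl | yes refl = ⊥-elim (ℕP.<-irrefl refl lt)
   ... | yes refl | no ne = inj₁ (subst₂ _<_ (sym (Vecₚ.lookup∘updateAt b τ)) (sym (Vecₚ.lookup∘updateAt′ b2 b ne τ)) (bel b2 t (n<1+n t)))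
   ... | no ne | yes refl = inj₂ op
   ... | no ne | no ne' with inv lt
   ... | inj₁ h = inj₁ (subst₂ _<_ (sym (Vecₚ.lookup∘updateAt′ b1 b ne τ)) (sym (Vecₚ.lookup∘updateAt′ b2 b ne' τ)) h)
   ... | inj₂ (_ , o) = inj₂ o
   ih = bottom C τ' (lookup τ b ∷ rest) nc (proj₁ sw) len' bel' inv'

  labs : ℕ → List ℤ
  labs zero = []
  labs (suc t) = labs t ++ [ lab t ]

  length-labs : ∀ t → length (labs t) ≡ t
  length-labs zero = refl
  length-labs (suc t) = trans (length-++ (labs t)) (trans (ℕP.+-comm _ 1) (cong suc (length-labs t)))

  below-∷ʳ : ∀ t {j} (τ : Vec ℤ j) → Below (suc t) τ → Below t (τ Vec.∷ʳ lab t)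
  below-∷ʳ t [] bel zero u u< = mono u<
  below-∷ʳ t (r ∷ τ) bel zero u u< = bel zero u (m<n⇒m<1+n u<)
  below-∷ʳ t (r ∷ τ) bel (suc b) u u< = below-∷ʳ t τ (bel ∘ suc) b u u<

  -- Each particle moves to the right past the later holes, whose labels are larger, until all holes
  -- stand in front of all particles.
  phase1 : ∀ {s x t j h} (C : Conf t j) (hs : Vec ℤ h) rest → Win s (labs t ++ regs hs rest) x → t ℕ.+ (h ℕ.+ length rest) ≡ n → Below t hs →
   Win s (regs (holes lab C) (regs hs (parts lab C ++ rest))) (act (topW s C h) x) × Asc (topW s C h) x
  private
   particle : ∀ {s x t j h} (C : Conf t j) (hs : Vec ℤ h) rest → Win s (labs (suc t) ++ regs hs rest) x → suc t ℕ.+ (h ℕ.+ length rest) ≡ n → Below (suc t) hs →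
    Win s (regs (holes lab C) (regs hs ((parts lab C ++ [ lab t ]) ++ rest))) (act (topW s C h ++ sweepW (s + + t) h) x) × Asc (topW s C h ++ sweepW (s + + t) h) x
   particle {s} {x} {t} {h = h} C hs rest w len bel =
     subst₂ (Win s) (cong (λ l → regs (holes lab C) (regs hs l)) (sym (++-assoc (parts lab C) [ lab t ] rest))) (sym (act-++ (topW s C h) (sweepW (s + + t) h) x)) (proj₁ ih) ,
     Asc-++ (topW s C h) (sweepW (s + + t) h) (proj₂ ih) (proj₂ sw)
    where
    len' : t ℕ.+ (h ℕ.+ suc (length rest)) ≡ n
    len' = trans (sym (len-free t h (length rest))) len
    sw = sweep (labs t) hs (subst (λ l → Win s l x) (++-assoc (labs t) [ lab t ] (regs hs rest)) w)
     (trans (cong (ℕ._+ (h ℕ.+ suc (length rest))) (length-labs t)) len') (λ b → bel b t (n<1+n t)) (s + + t) (cong (λ l → s + + l) (sym (length-labs t)))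
    ih = phase1 C hs (lab t ∷ rest) (proj₁ sw) len' (λ b u u< → bel b u (m<n⇒m<1+n u<))
  phase1 ε hs rest w len bel = w , refl
  phase1 {s} {x} {h = h} (hole {t} C) hs rest w len bel =
    subst (λ l → Win s (regs (holes lab C) l) (act (topW s C (suc h)) x)) (regs-∷ʳ hs (lab t) (parts lab C ++ rest)) (proj₁ ih) , proj₂ ih
   where
   ih = phase1 C (hs Vec.∷ʳ lab t) rest (subst (λ l → Win s l x) (trans (++-assoc (labs t) [ lab t ] (regs hs rest)) (cong (labs t ++_) (sym (regs-∷ʳ hs (lab t) rest)))) w)
    (trans (+-suc t (h ℕ.+ length rest)) len) (below-∷ʳ t hs bel)
  phase1 (free C) hs rest w len bel = particle C hs rest w len bel
  phase1 (att C _) hs rest w len bel = particle C hs rest w len bel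

  record Values {t j} (σ : ℤ) (C : Conf t j) (τ : Vec ℤ j) (x : AP) : Set where
   field
    at-top : ∀ b → fr x (σ + + top C b) ≡ lookup τ b
    at-free : ∀ {v} → Free C v → fr x (σ + + v) ≡ lab v
    at-arc : ∀ {u v} → Arc C u v → fr x (σ + + u) ≡ lab v
  open Values public

  values : ∀ {σ x t j} (C : Conf t j) τ rest → Win σ (final lab C τ rest) x → Values σ C τ x × Win (σ + + t) rest x
  values {σ} {x} ε [] rest w = record { at-top = λ () ; at-free = λ () ; at-arc = λ () } , Win-≡ {es = rest} {x} (sym (+-identityʳ σ)) w
  values {σ} {x} (hole {t} C) (r ∷ τ) rest w with values C τ (r ∷ rest) w
  ... | vals , e , w' = record { at-top = λ { zero → e ; (suc b) → at-top vals b } ; at-free = λ { (holeᶠ f) → at-free vals f } ; at-arc = λ { (holeᵃ a) → at-arc vals a } } ,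
   Win-≡ {es = rest} {x} (lia 2 (λ σ t → σ :+ t :+ #1 ≐ σ :+ (#1 :+ t)) σ (+ t)) w'
  values {σ} {x} (free {t} C) τ rest w with values C τ (lab t ∷ rest) w
  ... | vals , e , w' = record { at-top = at-top vals ; at-free = λ { here → e ; (freeᶠ f) → at-free vals f } ; at-arc = λ { (freeᵃ a) → at-arc vals a } } ,
   Win-≡ {es = rest} {x} (lia 2 (λ σ t → σ :+ t :+ #1 ≐ σ :+ (#1 :+ t)) σ (+ t)) w'
  values {σ} {x} (att {t} C b) τ rest w with values C (τ [ b ]≔ lab t) (lookup τ b ∷ rest) w
  ... | vals , e , w' = record { at-top = tops ; at-free = λ { (attᶠ f) → at-free vals f } ; at-arc = λ { here → trans (at-top vals b) (Vecₚ.lookup∘updateAt b τ) ; (attᵃ a) → at-arc vals a } } ,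
    Win-≡ {es = rest} {x} (lia 2 (λ σ t → σ :+ t :+ #1 ≐ σ :+ (#1 :+ t)) σ (+ t)) w'
   where
   tops : ∀ b1 → fr x (σ + + top (att C b) b1) ≡ lookup τ b1
   tops b1 with b Fin.≟ b1
   ... | yes refl = e
   ... | no ne = trans (at-top vals b1) (Vecₚ.lookup∘updateAt′ b1 b (ne ∘ sym) τ)

 -- Between the two phases the period is cut anew so that the particles come first, lowered by N;
 -- this is the shift of s by the number of particles.
 wordC : ℤ → ∀ {t j} → Conf t j → Word
 wordC s C = botW (s - + np C) C ++ topW s C 0

 permC : ℤ → ∀ {t j} → Conf t j → AP
 permC s C = act (wordC s C) idA

 parts-turn : ∀ lab {t j} (C : Conf t j) → map (_- N) (parts lab C) ≡ parts (λ u → lab u - N) C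
 parts-turn lab ε = refl
 parts-turn lab (hole C) = parts-turn lab C
 parts-turn lab (free {t} C) = trans (Listₚ.map-++ (_- N) (parts lab C) [ lab t ]) (cong (_++ [ lab t - N ]) (parts-turn lab C))
 parts-turn lab (att {t} C _) = trans (Listₚ.map-++ (_- N) (parts lab C) [ lab t ]) (cong (_++ [ lab t - N ]) (parts-turn lab C))

 module Config (s : ℤ) {j : ℕ} (C : Conf n j) (nc : NC C) where

  lab lab⁻ : ℕ → ℤ
  lab u = s + + u
  lab⁻ u = lab u - N

  mono : ∀ {u v} → u ℕ.< v → lab u < lab v
  mono lt = +-monoʳ-< s (+<+ lt)

  mono⁻ : ∀ {u v} → u ℕ.< v → lab⁻ u < lab⁻ v
  mono⁻ {u} {v} lt = +-monoˡ-< (- N) (mono lt)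

  private
   σ : ℤ
   σ = s - + np C
   H : Vec ℤ j
   H = holes lab C

   start : ∀ t → Win s (labs lab mono t) idA
   start zero = tt
   start (suc t) = Win-join (labs lab mono t) (start t) (cong (λ l → s + + l) (length-labs lab mono t) , tt)

   p1 : Win s (regs H (parts lab C ++ [])) (act (topW s C 0) idA) × Asc (topW s C 0) idA
   p1 = phase1 lab mono C [] [] (subst (λ l → Win s l idA) (sym (++-identityʳ (labs lab mono n))) (start n)) (ℕP.+-identityʳ n) (λ ())

   rot : Win σ (parts lab⁻ C ++ regs H []) (act (topW s C 0) idA)
   rot = subst₂ (λ a l → Win a l (act (topW s C 0) idA)) (cong (λ l → s - + l) (length-parts lab C))
    (cong₂ _++_ (parts-turn lab C) (sym (trans (regs-++ H []) (++-identityʳ (rev H)))))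
    (Win-rotate (rev H) (parts lab C) (trans (cong₂ ℕ._+_ (length-rev H) (length-parts lab C)) (trans (ℕP.+-comm j (np C)) (np+j C)))
     (subst (λ l → Win s l (act (topW s C 0) idA)) (trans (cong (regs H) (++-identityʳ (parts lab C))) (regs-++ H (parts lab C))) (proj₁ p1)))

   p2 : Win σ (final lab⁻ C H []) (act (botW σ C) (act (topW s C 0) idA)) × Asc (botW σ C) (act (topW s C 0) idA)
   p2 = bottom lab⁻ mono⁻ C H [] nc rot (trans (cong (np C ℕ.+_) (ℕP.+-identityʳ j)) (np+j C))
    (λ b u u<n → subst (lab⁻ u <_) (sym (lookup-holes lab C b)) (lia 5 (λ s u h N n → u <: n => N ≐ n => #0 =< h => s :+ u :- N <: s :+ h) s (+ u) (+ hol C b) N (+ n) (+<+ u<n) N-def 0≤+))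
    (λ {b} {b'} lt → inj₁ (subst₂ _<_ (sym (lookup-holes lab C b)) (sym (lookup-holes lab C b')) (mono (hol-mono C lt))))

   vals : Values lab⁻ mono⁻ σ C H (permC s C)
   vals = proj₁ (values lab⁻ mono⁻ C H [] (subst (Win σ (final lab⁻ C H [])) (sym (act-++ (botW σ C) (topW s C 0) idA)) (proj₁ p2)))

  ascending : Asc (wordC s C) idA
  ascending = Asc-++ (botW σ C) (topW s C 0) (proj₂ p2) (proj₂ p1)

  private
   to-value : ∀ {u v} → fr (permC s C) (σ + + u) ≡ v → to (permC s C) v ≡ σ + + u
   to-value e = trans (cong (to (permC s C)) (sym e)) (to-fr (permC s C) _)
   lift : ∀ {u v} → fr (permC s C) (σ + + u) ≡ lab⁻ v → to (permC s C) (lab v) ≡ s + + u - + np C + N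
   lift {u} {v} e = trans (cong (to (permC s C)) (trans (lia 2 (λ l N → l ≐ l :- N :+ N) (lab v) N) (cong (λ z → lab⁻ v + z) (sym 1·N))))
    (trans (per (permC s C) (lab⁻ v) 1ℤ) (trans (cong₂ _+_ (to-value e) 1·N) (lia 4 (λ s u p N → s :- p :+ u :+ N ≐ s :+ u :- p :+ N) s (+ u) (+ np C) N)))

  perm-free : ∀ {v} → Free C v → to (permC s C) (lab v) ≡ lab v - + np C + N
  perm-free {v} f = lift (at-free vals f)

  perm-arc : ∀ {u v} → Arc C u v → to (permC s C) (lab v) ≡ lab u - + np C + N
  perm-arc {u} a = lift (at-arc vals a)

  perm-hole : ∀ b → to (permC s C) (lab (hol C b)) ≡ lab (top C b) - + np C
  perm-hole b = trans (to-value (trans (at-top vals b) (lookup-holes lab C b))) (lia 3 (λ s u p → s :- p :+ u ≐ s :+ u :- p) s (+ top C b) (+ np C))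

 -- Noncrossing permutations and their decoding

 g : ℤ → AP → ℤ → ℤ
 g κ y q = to y q + κ

 record Near (κ : ℤ) (y : AP) : Set where
  constructor near
  field
   lo : ∀ q → q - N ≤ g κ y q
   hi : ∀ q → g κ y q ≤ q
   uncrossed : ∀ {e f} → e - N ≤ g κ y f → g κ y f < g κ y e → g κ y e < f → f < e → ⊥
 open Near public

 g-per : ∀ κ y q t → g κ y (q + t ·N) ≡ g κ y q + t ·N
 g-per κ y q t = trans (cong (_+ κ) (per y q t)) (lia 3 (λ a t κ → a :+ t :+ κ ≐ a :+ κ :+ t) (to y q) (t ·N) κ)

 g-inj : ∀ κ y {a b} → g κ y a ≡ g κ y b → a ≡ b
 g-inj κ y {a} {b} e = to-inj y (lia 3 (λ a b κ → a :+ κ ≐ b :+ κ => a ≐ b) (to y a) (to y b) κ e)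

 g-+N : ∀ κ y q → g κ y (q + N) ≡ g κ y q + N
 g-+N κ y q = trans (cong (λ z → g κ y (q + z)) (sym 1·N)) (trans (g-per κ y q 1ℤ) (cong (λ z → g κ y q + z) 1·N))

 arc<t : ∀ {t j} {C : Conf t j} {u v} → Arc C u v → v ℕ.< t
 arc<t here = n<1+n _
 arc<t (holeᵃ a) = m<n⇒m<1+n (arc<t a)
 arc<t (freeᵃ a) = m<n⇒m<1+n (arc<t a)
 arc<t (attᵃ a) = m<n⇒m<1+n (arc<t a)

 arc-< : ∀ {t j} {C : Conf t j} {u v} → Arc C u v → u ℕ.< v
 arc-< (here {C = C} {b}) = top<t C b
 arc-< (holeᵃ a) = arc-< a
 arc-< (freeᵃ a) = arc-< a
 arc-< (attᵃ a) = arc-< a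

 top-att : ∀ {t j} (C : Conf t j) {a b} → a ≢ b → top (att C a) b ≡ top C b
 top-att C {a} {b} ne with a Fin.≟ b
 ... | yes e = ⊥-elim (ne e)
 ... | no _ = refl

 top-att-≡ : ∀ {t j} (C : Conf t j) a → top (att C a) a ≡ t
 top-att-≡ C a with a Fin.≟ a
 ... | yes _ = refl
 ... | no ne = ⊥-elim (ne refl)

 hol-anti : ∀ {t j} (C : Conf t j) {b b'} → b' Fin.≤ b → hol C b ℕ.≤ hol C b'
 hol-anti C {b} {b'} le with b Fin.≟ b'
 ... | yes refl = ℕP.≤-refl
 ... | no ne = ℕP.<⇒≤ (hol-mono C (ℕP.≤∧≢⇒< le (λ e → ne (Finₚ.toℕ-injective (sym e)))))

 -- The newer hole is still open, so the older chain has not been extended since it was opened.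
 open-top : ∀ {t j} (C : Conf t j) {b b'} → b' Fin.< b → Open C b' → top C b ℕ.< hol C b'
 open-top (hole C) {suc b} {zero} _ _ = top<t C b
 open-top (hole C) {suc b} {suc b'} (ℕ.s≤s lt) o = open-top C lt o
 open-top (free C) lt o = open-top C lt o
 open-top (att C a) {b} {b'} lt (le , o) = subst (ℕ._< hol C b') (sym (top-att C (λ e → ℕP.<⇒≱ lt (subst (Fin._≤ b') e le)))) (open-top C lt o)

 top-inj : ∀ {t j} (C : Conf t j) {b b'} → top C b ≡ top C b' → b ≡ b'
 top-inj (hole C) {zero} {zero} e = refl
 top-inj (hole C) {zero} {suc b'} e = ⊥-elim (ℕP.<-irrefl (sym e) (top<t C b'))
 top-inj (hole C) {suc b} {zero} e = ⊥-elim (ℕP.<-irrefl e (top<t C b))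
 top-inj (hole C) {suc b} {suc b'} e = cong suc (top-inj C e)
 top-inj (free C) e = top-inj C e
 top-inj (att C a) {b} {b'} e with a Fin.≟ b | a Fin.≟ b'
 ... | yes refl | yes refl = refl
 ... | yes refl | no _ = ⊥-elim (ℕP.<-irrefl (sym e) (top<t C b'))
 ... | no _ | yes refl = ⊥-elim (ℕP.<-irrefl e (top<t C b))
 ... | no _ | no _ = top-inj C e

 -- `NC` constrains one attachment at a time. This and the next lemmas turn it into statements on
 -- pairs, one for each way in which two ordinary arcs, or wrap-around arcs from a hole to the end
 -- of its chain one period lower, could cross.
 open-arc : ∀ {t j} {C : Conf t j} {b u v} → NC C → Open C b → Arc C u v → u ℕ.< top C b → top C b ℕ.< v → ⊥
 open-arc {C = hole C} {zero} nc o (holeᵃ a) _ l = ℕP.<-asym l (arc<t a)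
 open-arc {C = hole C} {suc b} nc o (holeᵃ a) = open-arc nc o a
 open-arc {C = free C} nc o (freeᵃ a) = open-arc nc o a
 open-arc {C = att C a} {b} (nc , oa) (le , o) ar l l' with a Fin.≟ b
 open-arc {C = att C a} {b} (nc , oa) (le , o) ar l l' | yes _ = ℕP.<⇒≱ l' (<⇒≤pred (arc<t ar))
 open-arc {C = att C a} {b} (nc , oa) (le , o) here l l' | no ne =
  ℕP.<⇒≱ l (ℕP.≤-trans (ℕP.<⇒≤ (open-top C (ℕP.≤∧≢⇒< le (ne ∘ Finₚ.toℕ-injective)) oa)) (hol≤top C a))
 open-arc {C = att C a} {b} (nc , oa) (le , o) (attᵃ ar) l l' | no ne = open-arc nc o ar l l'

 arc-arc : ∀ {t j} {C : Conf t j} {u v u' v'} → NC C → Arc C u v → Arc C u' v' → u ℕ.< u' → u' ℕ.< v → v ℕ.< v' → ⊥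
 arc-arc nc (holeᵃ a) (holeᵃ b) = arc-arc nc a b
 arc-arc nc (freeᵃ a) (freeᵃ b) = arc-arc nc a b
 arc-arc nc here here _ _ l = ℕP.<-irrefl refl l
 arc-arc nc here (attᵃ b) _ _ l = ℕP.<-asym l (arc<t b)
 arc-arc (nc , o) (attᵃ a) here l l' _ = open-arc nc o a l l'
 arc-arc (nc , _) (attᵃ a) (attᵃ b) = arc-arc nc a b

 open-hole : ∀ {t j} {C : Conf t j} {b u v} → Open C b → Arc C u v → u ℕ.< hol C b → hol C b ℕ.< v → ⊥
 open-hole {C = hole C} {zero} o (holeᵃ a) _ l = ℕP.<-asym l (arc<t a)
 open-hole {C = hole C} {suc b} o (holeᵃ a) = open-hole o a
 open-hole {C = free C} o (freeᵃ a) = open-hole o a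
 open-hole {C = att C a} (le , o) here l _ = ℕP.<⇒≱ l (ℕP.≤-trans (hol-anti C le) (hol≤top C a))
 open-hole {C = att C a} (le , o) (attᵃ ar) = open-hole o ar

 arc-hole : ∀ {t j} {C : Conf t j} {b u v} → NC C → Arc C u v → u ℕ.< hol C b → hol C b ℕ.< v → v ℕ.≤ top C b → ⊥
 arc-hole {C = hole C} {zero} nc (holeᵃ a) _ l _ = ℕP.<-asym l (arc<t a)
 arc-hole {C = hole C} {suc b} nc (holeᵃ a) = arc-hole nc a
 arc-hole {C = free C} nc (freeᵃ a) = arc-hole nc a
 arc-hole {C = att C a} {b} (nc , o) ar l l' l'' with a Fin.≟ b
 arc-hole {C = att C a} (nc , o) here l l' l'' | yes refl = ℕP.<⇒≱ l (hol≤top C a)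
 arc-hole {C = att C a} (nc , o) (attᵃ ar) l l' l'' | yes refl = open-hole o ar l l'
 arc-hole {C = att C a} {b} (nc , o) here l l' l'' | no ne = ℕP.<⇒≱ (top<t C b) l''
 arc-hole {C = att C a} (nc , o) (attᵃ ar) l l' l'' | no ne = arc-hole nc ar l l' l''

 hole-hole : ∀ {t j} {C : Conf t j} {b b'} → NC C → b' Fin.< b → hol C b' ℕ.≤ top C b → top C b ℕ.< top C b' → ⊥
 hole-hole {C = hole C} {suc b} {zero} nc _ l _ = ℕP.<⇒≱ (top<t C b) l
 hole-hole {C = hole C} {suc b} {suc b'} nc (ℕ.s≤s lt) = hole-hole {C = C} nc lt
 hole-hole {C = free C} nc lt = hole-hole {C = C} nc lt
 hole-hole {C = att C a} {b} {b'} (nc , o) lt l l' with a Fin.≟ b | a Fin.≟ b'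
 ... | yes refl | yes refl = ℕP.<-irrefl refl l'
 ... | yes refl | no _ = ℕP.<-asym l' (top<t C b')
 ... | no _ | yes refl = ℕP.<⇒≱ (open-top C lt o) l
 ... | no _ | no _ = hole-hole {C = C} nc lt l l'

 arc-top : ∀ {t j} {C : Conf t j} {b u v} → NC C → Arc C u v → hol C b ℕ.≤ u → u ℕ.< top C b → top C b ℕ.< v → ⊥
 arc-top {C = hole C} {zero} nc (holeᵃ a) _ _ l = ℕP.<-asym l (arc<t a)
 arc-top {C = hole C} {suc b} nc (holeᵃ a) = arc-top nc a
 arc-top {C = free C} nc (freeᵃ a) = arc-top nc a
 arc-top {C = att C a} {b} (nc , o) ar l l' l'' with a Fin.≟ b
 arc-top {C = att C a} (nc , o) ar l l' l'' | yes refl = ℕP.<⇒≱ l'' (<⇒≤pred (arc<t ar))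
 arc-top {C = att C a} {b} (nc , o) here l l' l'' | no ne with ℕP.<-cmp (toℕ a) (toℕ b)
 ... | tri< lt _ _ = ℕP.<⇒≱ (ℕP.<-trans l' (open-top C lt o)) (hol≤top C a)
 ... | tri≈ _ e _ = ne (Finₚ.toℕ-injective e)
 ... | tri> _ _ gt = hole-hole {C = C} nc gt l l'
 arc-top {C = att C a} (nc , o) (attᵃ ar) l l' l'' | no ne = arc-top nc ar l l' l''

 data SlotView {t j} (C : Conf t j) (v : ℕ) : Set where
  isFree : Free C v → SlotView C v
  isArc : ∀ u → Arc C u v → SlotView C v
  isHole : ∀ b → hol C b ≡ v → SlotView C v

 slotView : ∀ {t j} (C : Conf t j) v → v ℕ.< t → SlotView C v
 slotView (hole {t} C) v lt with v ℕP.≟ t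
 ... | yes refl = isHole zero refl
 ... | no ne with slotView C v (ℕP.≤∧≢⇒< (<⇒≤pred lt) ne)
 ... | isFree f = isFree (holeᶠ f)
 ... | isArc u a = isArc u (holeᵃ a)
 ... | isHole b e = isHole (suc b) e
 slotView (free {t} C) v lt with v ℕP.≟ t
 ... | yes refl = isFree here
 ... | no ne with slotView C v (ℕP.≤∧≢⇒< (<⇒≤pred lt) ne)
 ... | isFree f = isFree (freeᶠ f)
 ... | isArc u a = isArc u (freeᵃ a)
 ... | isHole b e = isHole b e
 slotView (att {t} C c) v lt with v ℕP.≟ t
 ... | yes refl = isArc (top C c) here
 ... | no ne with slotView C v (ℕP.≤∧≢⇒< (<⇒≤pred lt) ne)
 ... | isFree f = isFree (attᶠ f)
 ... | isArc u a = isArc u (attᵃ a)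
 ... | isHole b e = isHole b e

 data SourceView {t j} (C : Conf t j) (u : ℕ) : Set where
  isFree : Free C u → SourceView C u
  isArc : ∀ v → Arc C u v → SourceView C u
  isTop : ∀ b → top C b ≡ u → SourceView C u

 sourceView : ∀ {t j} (C : Conf t j) u → u ℕ.< t → SourceView C u
 sourceView (hole {t} C) u lt with u ℕP.≟ t
 ... | yes refl = isTop zero refl
 ... | no ne with sourceView C u (ℕP.≤∧≢⇒< (<⇒≤pred lt) ne)
 ... | isFree f = isFree (holeᶠ f)
 ... | isArc v a = isArc v (holeᵃ a)
 ... | isTop b e = isTop (suc b) e
 sourceView (free {t} C) u lt with u ℕP.≟ t
 ... | yes refl = isFree here
 ... | no ne with sourceView C u (ℕP.≤∧≢⇒< (<⇒≤pred lt) ne)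
 ... | isFree f = isFree (freeᶠ f)
 ... | isArc v a = isArc v (freeᵃ a)
 ... | isTop b e = isTop b e
 sourceView (att {t} C c) u lt with u ℕP.≟ t
 ... | yes refl = isTop c (top-att-≡ C c)
 ... | no ne with sourceView C u (ℕP.≤∧≢⇒< (<⇒≤pred lt) ne)
 ... | isFree f = isFree (attᶠ f)
 ... | isArc v a = isArc v (attᵃ a)
 ... | isTop b e with c Fin.≟ b
 ... | yes refl = isArc t (subst (λ z → Arc (att C c) z t) e here)
 ... | no ne' = isTop b (trans (top-att C ne') e)

 record Slot (s q : ℤ) : Set where
  constructor slot
  field
   v : ℕ
   v<n : v ℕ.< n
   t : ℤ
   q≡ : q ≡ s + + v + t ·N

 toSlot : ∀ s q → Slot s q
 toSlot s q = slot (res (q - s)) (res<n (q - s)) ((q - s) ℤ./ℕ n) (lia 4 (λ q s r t → q :- s ≐ r :+ t => q ≐ s :+ r :+ t) q s (+ res (q - s)) (((q - s) ℤ./ℕ n) ·N) (res-split (q - s)))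

 natural : ∀ {z} → 0ℤ ≤ z → Σ ℕ λ u → z ≡ + u
 natural {z} h = ℤ.∣ z ∣ , sym (0≤i⇒+∣i∣≡i h)

 inWindow : ∀ s q → s ≤ q → q < s + N → Σ ℕ λ u → u ℕ.< n × q ≡ s + + u
 inWindow s q l h with natural {q - s} (lia 2 (λ s q → s =< q => #0 =< q :- s) s q l)
 ... | u , e = u , drop‿+<+ (subst₂ _<_ e N-def (lia 3 (λ s q N → q <: s :+ N => q :- s <: N) s q N h)) , lia 3 (λ s q u → q :- s ≐ u => q ≐ s :+ u) s q (+ u) e

 -- A crossing is translated until e lies in the window. Then f lies in the window as well or
 -- exactly one period below it; these are the cases `same` and `apart`.
 module Uncrossed (s : ℤ) {j : ℕ} (C : Conf n j) (nc : NC C) (κ : ℤ) (y : AP)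
  (g-free : ∀ {v} → Free C v → g κ y (s + + v) ≡ s + + v)
  (g-arc : ∀ {u v} → Arc C u v → g κ y (s + + v) ≡ s + + u)
  (g-hole : ∀ b → g κ y (s + + hol C b) ≡ s + + top C b - N) where

  private
   lab : ℕ → ℤ
   lab u = s + + u

   mono : ∀ {u v} → u ℕ.< v → lab u < lab v
   mono lt = +-monoʳ-< s (+<+ lt)

  private
   <N : ∀ {v} → v ℕ.< n → + v < N
   <N lt = subst (_ <_) (sym N-def) (+<+ lt)

   bounds : ∀ v → v ℕ.< n → lab v - N ≤ g κ y (lab v) × g κ y (lab v) ≤ lab v
   bounds v lt with slotView C v lt
   ... | isFree f = lia 3 (λ a b N → b ≐ a => #2 =< N => a :- N =< b) (lab v) (g κ y (lab v)) N (g-free f) 2≤N , ≤-reflexive (g-free f)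
   ... | isArc u a = lia 5 (λ s u v b N → b ≐ s :+ u => v <: N => #0 =< u => s :+ v :- N =< b) s (+ u) (+ v) (g κ y (lab v)) N (g-arc a) (<N lt) 0≤+ ,
            lia 4 (λ s u v b → b ≐ s :+ u => u <: v => b =< s :+ v) s (+ u) (+ v) (g κ y (lab v)) (g-arc a) (+<+ (arc-< a))
   ... | isHole b refl = lia 5 (λ s h t b N → b ≐ s :+ t :- N => h =< t => s :+ h :- N =< b) s (+ v) (+ top C b) (g κ y (lab v)) N (g-hole b) (+≤+ (hol≤top C b)) ,
              lia 5 (λ s h t b N → b ≐ s :+ t :- N => t <: N => #0 =< h => b =< s :+ h) s (+ v) (+ top C b) (g κ y (lab v)) N (g-hole b) (<N (top<t C b)) 0≤+

   <-slot : ∀ {u v} → lab u < lab v → u ℕ.< v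
   <-slot {u} {v} h = drop‿+<+ (lia 3 (λ s u v → s :+ u <: s :+ v => u <: v) s (+ u) (+ v) h)

   ≤-slot : ∀ {u v} → lab u ≤ lab v → u ℕ.≤ v
   ≤-slot {u} {v} h = drop‿+≤+ (lia 3 (λ s u v → s :+ u =< s :+ v => u =< v) s (+ u) (+ v) h)

   ge : ℕ → ℤ
   ge v = g κ y (lab v)

   same : ∀ u v → u ℕ.< n → v ℕ.< n → lab v - N ≤ ge u → ge u < ge v → ge v < lab u → lab u < lab v → ⊥
   same u v u<n v<n h1 h2 h3 h4 with slotView C u u<n | slotView C v v<n
   ... | isFree f | _ = lia 3 (λ a b c → a ≐ c => a <: b => b <: c => false') (ge u) (ge v) (lab u) (g-free f) h2 h3
   ... | _ | isFree f = lia 3 (λ a b c → a ≐ b => a <: c => c <: b => false') (ge v) (lab v) (lab u) (g-free f) h3 h4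
   ... | isArc u' a | isArc v' b = arc-arc nc a b (<-slot (subst₂ _<_ (g-arc a) (g-arc b) h2)) (<-slot (subst (_< lab u) (g-arc b) h3)) (<-slot h4)
   ... | isArc u' a | isHole b refl = lia 6 (λ s u t a b N → a ≐ s :+ u => b ≐ s :+ t :- N => a <: b => #0 =< u => t <: N => false') s (+ u') (+ top C b) (ge u) (ge v) N (g-arc a) (g-hole b) h2 0≤+ (<N (top<t C b))
   ... | isHole b refl | isArc v' a = arc-hole nc a (<-slot (subst (_< lab u) (g-arc a) h3)) (<-slot h4)
      (≤-slot (lia 4 (λ v t a N → a ≐ t :- N => v :- N =< a => v =< t) (lab v) (lab (top C b)) (ge u) N (g-hole b) h1))
   ... | isHole b refl | isHole b' refl = lem (ℕP.<-cmp (toℕ b') (toℕ b))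
    where
    lem : _ → ⊥
    lem (tri< lt _ _) = hole-hole {C = C} nc lt (≤-slot (lia 4 (λ v t a N → a ≐ t :- N => v :- N =< a => v =< t) (lab v) (lab (top C b)) (ge u) N (g-hole b) h1))
     (<-slot (lia 5 (λ t t' a b N → a ≐ t :- N => b ≐ t' :- N => a <: b => t <: t') (lab (top C b)) (lab (top C b')) (ge u) (ge v) N (g-hole b) (g-hole b') h2))
    lem (tri≈ _ e _) = <-irrefl (cong (λ b → lab (hol C b)) (sym (Finₚ.toℕ-injective e))) h4
    lem (tri> _ _ gt) = <-asym h4 (mono (hol-mono C gt))

   apart : ∀ u v → u ℕ.< n → v ℕ.< n → lab v ≤ ge u → ge u < ge v + N → ge v + N < lab u → lab v < lab u → ⊥
   apart u v u<n v<n h1 h2 h3 h4 with slotView C u u<n | slotView C v v<n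
   ... | isFree f | _ = lia 4 (λ a b c N → a ≐ c => a <: b :+ N => b :+ N <: c => false') (ge u) (ge v) (lab u) N (g-free f) h2 h3
   ... | _ | isFree f = lia 6 (λ s b c u v N → b ≐ s :+ v => b :+ N <: s :+ u => #0 =< v => u <: N => false') s (ge v) (ge v) (+ u) (+ v) N (g-free f) h3 0≤+ (<N u<n)
   ... | _ | isArc v' a = lia 5 (λ s b u v N → b ≐ s :+ v => b :+ N <: s :+ u => #0 =< v => u <: N => false') s (ge v) (+ u) (+ v') N (g-arc a) h3 0≤+ (<N u<n)
   ... | isHole b refl | isHole b' _ = lia 6 (λ s a v t b N → a ≐ s :+ t :- N => s :+ v =< a => #0 =< v => t <: N => false') s (ge u) (+ v) (+ top C b) 0ℤ N (g-hole b) h1 0≤+ (<N (top<t C b))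
   ... | isArc u' a | isHole b refl = arc-top nc a (≤-slot (subst (lab v ≤_) (g-arc a) h1))
    (<-slot (lia 5 (λ t b a u' N → b ≐ t :- N => a ≐ u' => a <: b :+ N => u' <: t) (lab (top C b)) (ge v) (ge u) (lab u') N (g-hole b) (g-arc a) h2))
    (<-slot (lia 4 (λ t b u N → b ≐ t :- N => b :+ N <: u => t <: u) (lab (top C b)) (ge v) (lab u) N (g-hole b) h3))

   at-window : ∀ v → v ℕ.< n → ∀ f → lab v - N ≤ g κ y f → g κ y f ≤ f → g κ y f < ge v → ge v < f → f < lab v → ⊥
   at-window v v<n f h1 h₀ h2 h3 h4 with s ≤? f
   ... | yes le with inWindow s f le (lia 4 (λ s f v N → f <: s :+ v => v <: N => f <: s :+ N) s f (+ v) N h4 (<N v<n))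
   ... | u , u<n , refl = same u v u<n v<n h1 h2 h3 h4
   at-window v v<n f h1 h₀ h2 h3 h4 | no nle with inWindow s (f + N) (lia 5 (λ s f a v N → s :+ v :- N =< a => a =< f => #0 =< v => s =< f :+ N) s f (g κ y f) (+ v) N h1 h₀ 0≤+) (+-monoˡ-< N (≰⇒> nle))
   ... | u , u<n , e = apart u v u<n v<n
     (lia 4 (λ v a b N → b ≐ a :+ N => v :- N =< a => v =< b) (lab v) (g κ y f) (ge u) N gu h1)
     (lia 4 (λ v a b N → b ≐ a :+ N => a <: v => b <: v :+ N) (ge v) (g κ y f) (ge u) N gu h2)
     (lia 4 (λ v f u N → f :+ N ≐ u => v <: f => v :+ N <: u) (ge v) f (lab u) N e h3)
     (lia 5 (λ v a f u N → f :+ N ≐ u => v :- N =< a => a <: f => v <: u) (lab v) (g κ y f) f (lab u) N e h1 (<-trans h2 h3))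
    where
    gu : ge u ≡ g κ y f + N
    gu = trans (cong (g κ y) (sym e)) (g-+N κ y f)

  near-conf : Near κ y
  near-conf = near (λ q → proj₁ (bound q)) (λ q → proj₂ (bound q)) unc
   where
   bound : ∀ q → q - N ≤ g κ y q × g κ y q ≤ q
   bound q with toSlot s q
   ... | slot v v<n t refl = lia 4 (λ a b t N → a :- N =< b => a :+ t :- N =< b :+ t) (lab v) (ge v) (t ·N) N (proj₁ (bounds v v<n)) ∙ g-per κ y (lab v) t ,
     subst (_≤ lab v + t ·N) (sym (g-per κ y (lab v) t)) (+-monoˡ-≤ (t ·N) (proj₂ (bounds v v<n)))
    where
    _∙_ : ∀ {a b c} → a ≤ b → c ≡ b → a ≤ c
    h ∙ e = subst (_ ≤_) (sym e) h
   unc : ∀ {e f} → e - N ≤ g κ y f → g κ y f < g κ y e → g κ y e < f → f < e → ⊥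
   unc {e} {f} h1 h2 h3 h4 with toSlot s e
   ... | slot v v<n t refl = at-window v v<n (f + (- t) ·N)
     (lia 6 (λ v N gf' gf t u → gf' ≐ gf :+ u => u ≐ #0 :- t => v :+ t :- N =< gf => v :- N =< gf') (lab v) N (g κ y f') (g κ y f) (t ·N) ((- t) ·N) gf −t h1)
     (proj₂ (bound f'))
     (lia 6 (λ ge ge' gf' gf t u → gf' ≐ gf :+ u => u ≐ #0 :- t => ge' ≐ ge :+ t => gf <: ge' => gf' <: ge) (ge v) (g κ y (lab v + t ·N)) (g κ y f') (g κ y f) (t ·N) ((- t) ·N) gf −t (g-per κ y (lab v) t) h2)
     (lia 5 (λ ge ge' f t u → u ≐ #0 :- t => ge' ≐ ge :+ t => ge' <: f => ge <: f :+ u) (ge v) (g κ y (lab v + t ·N)) f (t ·N) ((- t) ·N) −t (g-per κ y (lab v) t) h3)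
     (lia 4 (λ v f t u → u ≐ #0 :- t => f <: v :+ t => f :+ u <: v) (lab v) f (t ·N) ((- t) ·N) −t h4)
    where
    f' : ℤ
    f' = f + (- t) ·N
    gf : g κ y f' ≡ g κ y f + (- t) ·N
    gf = g-per κ y f (- t)
    −t : (- t) ·N ≡ 0ℤ - t ·N
    −t = trans (-·N t) (sym (+-identityˡ _))

 module Encode (s : ℤ) {j : ℕ} (C : Conf n j) (nc : NC C) where
  open Config s C nc

  κ : ℤ
  κ = + np C - N

  y : AP
  y = permC s C

  g-free : ∀ {v} → Free C v → g κ y (lab v) ≡ lab v
  g-free {v} f = trans (cong (_+ κ) (perm-free f)) (lia 3 (λ l p N → l :- p :+ N :+ (p :- N) ≐ l) (lab v) (+ np C) N)

  g-arc : ∀ {u v} → Arc C u v → g κ y (lab v) ≡ lab u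
  g-arc {u} a = trans (cong (_+ κ) (perm-arc a)) (lia 3 (λ l p N → l :- p :+ N :+ (p :- N) ≐ l) (lab u) (+ np C) N)

  g-hole : ∀ b → g κ y (lab (hol C b)) ≡ lab (top C b) - N
  g-hole b = trans (cong (_+ κ) (perm-hole b)) (lia 3 (λ l p N → l :- p :+ (p :- N) ≐ l :- N) (lab (top C b)) (+ np C) N)

  near-permC : Near κ y
  near-permC = Uncrossed.near-conf s C nc κ y g-free g-arc g-hole

 hol-top : ∀ {t j} (C : Conf t j) {d b} → hol C d ≡ top C b → d ≡ b
 hol-top (hole C) {zero} {zero} e = refl
 hol-top (hole C) {zero} {suc b} e = ⊥-elim (ℕP.<-irrefl (sym e) (top<t C b))
 hol-top (hole C) {suc d} {zero} e = ⊥-elim (ℕP.<-irrefl e (hol<t C d))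
 hol-top (hole C) {suc d} {suc b} e = cong suc (hol-top C e)
 hol-top (free C) e = hol-top C e
 hol-top (att C a) {d} {b} e with a Fin.≟ b
 ... | yes refl = ⊥-elim (ℕP.<-irrefl e (hol<t C d))
 ... | no _ = hol-top C e

 hol-inj : ∀ {t j} (C : Conf t j) {b d} → hol C b ≡ hol C d → b ≡ d
 hol-inj C {b} {d} e with ℕP.<-cmp (toℕ b) (toℕ d)
 ... | tri< lt _ _ = ⊥-elim (ℕP.<-irrefl (sym e) (hol-mono C lt))
 ... | tri≈ _ q _ = Finₚ.toℕ-injective q
 ... | tri> _ _ gt = ⊥-elim (ℕP.<-irrefl e (hol-mono C gt))

 -- The chain of the older hole b starts below hole d and ends above it without meeting it, so one
 -- of its arcs passes over d.
 arc-over : ∀ {t j} (C : Conf t j) {d b} → d Fin.< b → hol C d ℕ.< top C b →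
  Σ ℕ λ u → Σ ℕ λ v → Arc C u v × u ℕ.< hol C d × hol C d ℕ.< v × v ℕ.≤ top C b
 arc-over (hole C) {zero} {suc b} _ l = ⊥-elim (ℕP.<-asym l (top<t C b))
 arc-over (hole C) {suc d} {suc b} (ℕ.s≤s lt) l with arc-over C lt l
 ... | u , v , a , r = u , v , holeᵃ a , r
 arc-over (free C) lt l with arc-over C lt l
 ... | u , v , a , r = u , v , freeᵃ a , r
 arc-over (att {t} C a) {d} {b} lt l with a Fin.≟ b
 ... | no ne with arc-over C lt l
 ... | u , v , ar , r = u , v , attᵃ ar , r
 arc-over (att {t} C a) {d} {b} lt l | yes refl with ℕP.<-cmp (hol C d) (top C a)
 ... | tri≈ _ e _ = ⊥-elim (ℕP.<-irrefl (cong toℕ (hol-top C e)) lt)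
 ... | tri> _ _ gt = top C a , t , here , gt , l , ℕP.≤-refl
 ... | tri< l' _ _ with arc-over C lt l'
 ... | u , v , ar , h1 , h2 , h3 = u , v , attᵃ ar , h1 , h2 , ℕP.≤-trans h3 (ℕP.<⇒≤ (top<t C a))

 -- If π d were smaller than d, induction would make it a fixed point of π, against injectivity.
 decreasing-injection : ∀ {j} (π : Fin j → Fin j) → (∀ d → π d Fin.≤ d) → (∀ {a b} → π a ≡ π b → a ≡ b) → ∀ d → π d ≡ d
 decreasing-injection {j} π le inj d = <-rec (λ m → ∀ d → toℕ d ≡ m → π d ≡ d) go (toℕ d) d refl
  where
  go : ∀ m → (∀ {m'} → m' ℕ.< m → ∀ d → toℕ d ≡ m' → π d ≡ d) → ∀ d → toℕ d ≡ m → π d ≡ d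
  go m rec d refl with π d Fin.≟ d
  ... | yes e = e
  ... | no ne = inj (rec (ℕP.≤∧≢⇒< (le d) (ne ∘ Finₚ.toℕ-injective)) (π d) refl)

 zero-factor : ∀ c → + n * c ≡ 0ℤ → c ≡ 0ℤ
 zero-factor c e with i*j≡0⇒i≡0∨j≡0 (+ n) e
 ... | inj₁ ()
 ... | inj₂ z = z

 record Decoded (s κ : ℤ) (y : AP) : Set where
  field
   {j} : ℕ
   C : Conf n j
   nc : NC C
   perm≗ : y ≗A permC s C
   κ≡ : κ ≡ + np C - N

 module Decoding (s κ : ℤ) (y : AP) (S : Near κ y) where

  private
   G : ℤ → ℤ
   G = g κ y
   lab : ℕ → ℤ
   lab u = s + + u

   lab-< : ∀ {u v} → u ℕ.< v → lab u < lab v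
   lab-< lt = +-monoʳ-< s (+<+ lt)

   lab-≤ : ∀ {u v} → u ℕ.≤ v → lab u ≤ lab v
   lab-≤ le = +-monoʳ-≤ s (+≤+ le)

   lab-inj : ∀ {u v} → lab u ≡ lab v → u ≡ v
   lab-inj {u} {v} e = +-injective (lia 3 (λ s u v → s :+ u ≐ s :+ v => u ≐ v) s (+ u) (+ v) e)

   s≤lab : ∀ u → s ≤ lab u
   s≤lab u = lia 2 (λ s u → #0 =< u => s =< s :+ u) s (+ u) 0≤+

   lab<end : ∀ {u} → u ℕ.< n → lab u < s + N
   lab<end lt = +-monoʳ-< s (subst (_ <_) (sym N-def) (+<+ lt))

   ArcsOf : ∀ {t j} → Conf t j → Set
   ArcsOf C = ∀ {u v} → Arc C u v → G (lab v) ≡ lab u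

  -- If a slot after hole b were attached to an older hole, its arc would cross the arc from q to
  -- the chain of b.
  target-open : ∀ {t j} (C : Conf t j) → NC C → ArcsOf C → ∀ q b → lab t ≤ q → q - N ≤ s → G q ≡ lab (top C b) → Open C b
  target-open (hole {t} C) nc arcs q zero le w e = tt
  target-open (hole {t} C) nc arcs q (suc b) le w e = target-open C nc (arcs ∘ holeᵃ) q b (≤-trans (lab-≤ (n≤1+n t)) le) w e
  target-open (free {t} C) nc arcs q b le w e = target-open C nc (arcs ∘ freeᵃ) q b (≤-trans (lab-≤ (n≤1+n t)) le) w e
  target-open (att {t} C a) (nc , oa) arcs q b le w e = lem (a Fin.≟ b)
   where
   lem : Dec (a ≡ b) → Open (att C a) b
   lem (yes refl) = ℕP.≤-refl , oa
   lem (no ne) = cmp (ℕP.<-cmp (toℕ a) (toℕ b)) , o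
    where
    e' : G q ≡ lab (top C b)
    e' = trans e (cong lab (top-att C ne))
    o : Open C b
    o = target-open C nc (arcs ∘ attᵃ) q b (≤-trans (lab-≤ (n≤1+n t)) le) w e'
    cmp : _ → a Fin.≤ b
    cmp (tri< lt _ _) = ℕP.<⇒≤ lt
    cmp (tri≈ _ q _) = ℕP.≤-reflexive q
    cmp (tri> _ _ gt) = ⊥-elim (uncrossed S {q} {lab t}
     (subst (q - N ≤_) (sym (arcs here)) (≤-trans w (s≤lab (top C a))))
     (subst₂ _<_ (sym (arcs here)) (sym e') (lab-< (ℕP.<-≤-trans (open-top C gt o) (hol≤top C b))))
     (subst (_< lab t) (sym e') (lab-< (top<t C b)))
     (<-≤-trans (lab-< (n<1+n t)) le))

  record Scan (t : ℕ) : Set where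
   field
    {j} : ℕ
    C : Conf t j
    nc : NC C
    frees : ∀ {v} → Free C v → G (lab v) ≡ lab v
    arcs : ArcsOf C
    gaps : ∀ b → G (lab (hol C b)) < s
  open Scan public

  -- Slot t is free, a hole or attached according to whether G fixes it, sends it below the window,
  -- or sends it to an earlier slot. In the last case injectivity leaves only the end of a chain as
  -- the target.
  scan : ∀ t → t ℕ.≤ n → Scan t
  scan zero _ = record { C = ε ; nc = tt ; frees = λ () ; arcs = λ () ; gaps = λ () }
  scan (suc t) lt = lem (G (lab t) ≟ lab t) (G (lab t) <? s)
   where
   P : Scan t
   P = scan t (ℕP.<⇒≤ lt)
   lem : Dec (G (lab t) ≡ lab t) → Dec (G (lab t) < s) → Scan (suc t)
   lem (yes e) _ = record { C = free (C P) ; nc = nc P ; frees = λ { here → e ; (freeᶠ f) → frees P f } ; arcs = λ { (freeᵃ a) → arcs P a } ; gaps = gaps P }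
   lem (no _) (yes h) = record { C = hole (C P) ; nc = nc P ; frees = λ { (holeᶠ f) → frees P f } ; arcs = λ { (holeᵃ a) → arcs P a } ; gaps = λ { zero → h ; (suc b) → gaps P b } }
   lem (no ne) (no nh) = source (inWindow s (G (lab t)) (≮⇒≥ nh) (≤-<-trans (hi S (lab t)) (lab<end lt)))
    where
    source : (Σ ℕ λ u → u ℕ.< n × G (lab t) ≡ lab u) → Scan (suc t)
    source (u , _ , e) = view (sourceView (C P) u u<t)
     where
     u<t : u ℕ.< t
     u<t = drop‿+<+ (lia 4 (λ s u t a → a ≐ s :+ u => a =< s :+ t => ¬' (a ≐ s :+ t) => u <: t) s (+ u) (+ t) (G (lab t)) e (hi S (lab t)) ne)
     view : SourceView (C P) u → Scan (suc t)
     view (isFree f) = ⊥-elim (ℕP.<-irrefl (lab-inj (g-inj κ y (trans (frees P f) (sym e)))) u<t)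
     view (isArc v a) = ⊥-elim (ℕP.<-irrefl (lab-inj (g-inj κ y (trans (arcs P a) (sym e)))) (arc<t a))
     view (isTop b q) = record { C = att (C P) b ; nc = nc P , target-open (C P) (nc P) (arcs P) (lab t) b ≤-refl
        (lia 3 (λ s e N → e <: s :+ N => e :- N =< s) s (lab t) N (lab<end lt)) (trans e (cong lab (sym q)))
      ; frees = λ { (attᶠ f) → frees P f } ; arcs = λ { here → trans e (cong lab (sym q)) ; (attᵃ a) → arcs P a } ; gaps = gaps P }

  P : Scan n
  P = scan n ℕP.≤-refl

  K : Conf n (j P)
  K = C P

  private

   match : ∀ d → Σ (Fin (j P)) λ b → G (lab (hol K d)) ≡ lab (top K b) - N
   match d = source (inWindow s (G h + N) (lia 4 (λ s h a N → h :- N =< a => s =< h => s =< a :+ N) s h (G h) N (lo S h) (s≤lab (hol K d))) (+-monoˡ-< N (gaps P d)))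
    where
    h : ℤ
    h = lab (hol K d)
    source : (Σ ℕ λ u → u ℕ.< n × G h + N ≡ lab u) → Σ (Fin (j P)) λ b → G h ≡ lab (top K b) - N
    source (u , u<n , e) = view (sourceView K u u<n)
     where
     far : ∀ {v} → v ℕ.< n → G (lab v) ≢ lab u
     far {v} lt q = lia 4 (λ s v h N → v <: s :+ N => s =< h => v ≐ h :+ N => false') s (lab v) h N (lab<end lt) (s≤lab (hol K d)) (g-inj κ y (trans q (trans (sym e) (sym (g-+N κ y h)))))
     view : SourceView K u → Σ (Fin (j P)) λ b → G h ≡ lab (top K b) - N
     view (isFree f) = ⊥-elim (far u<n (frees P f))
     view (isArc v a) = ⊥-elim (far (arc<t a) (arcs P a))
     view (isTop b refl) = b , lia 3 (λ a t N → a :+ N ≐ t => a ≐ t :- N) (G h) (lab (top K b)) N e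

   π : Fin (j P) → Fin (j P)
   π d = proj₁ (match d)

   -- If hole d wrapped around to the chain of an older hole, an arc of that chain would pass over d
   -- and cross the wrap-around arc.
   π-≤ : ∀ d → π d Fin.≤ d
   π-≤ d = ℕP.≮⇒≥ λ lt → older lt (arc-over K lt (ℕP.≤∧≢⇒< h≤ (λ e → ℕP.<-irrefl (cong toℕ (hol-top K e)) lt)))
    where
    h : ℤ
    h = lab (hol K d)
    h≤ : hol K d ℕ.≤ top K (π d)
    h≤ = drop‿+≤+ (lia 5 (λ s a b t N → b ≐ s :+ t :- N => s :+ a :- N =< b => a =< t) s (+ hol K d) (G h) (+ top K (π d)) N (proj₂ (match d)) (lo S h))
    older : d Fin.< π d → (Σ ℕ λ u → Σ ℕ λ v → Arc K u v × u ℕ.< hol K d × hol K d ℕ.< v × v ℕ.≤ top K (π d)) → ⊥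
    older lt (u , v , a , l1 , l2 , l3) = uncrossed S {lab v} {h}
     (lia 4 (λ v t b N → b ≐ t :- N => v =< t => v :- N =< b) (lab v) (lab (top K (π d))) (G h) N (proj₂ (match d)) (lab-≤ l3))
     (subst (G h <_) (sym (arcs P a)) (<-≤-trans (gaps P d) (s≤lab u)))
     (subst (_< h) (sym (arcs P a)) (lab-< l1)) (lab-< l2)

   π-inj : ∀ {a b} → π a ≡ π b → a ≡ b
   π-inj {a} {b} e = hol-inj K (lab-inj (g-inj κ y (trans (proj₂ (match a)) (trans (cong (λ b → lab (top K b) - N) e) (sym (proj₂ (match b)))))))

  holes-match : ∀ d → g κ y (s + + hol K d) ≡ s + + top K d - N
  holes-match d = trans (proj₂ (match d)) (cong (λ b → lab (top K b) - N) (decreasing-injection π π-≤ (λ {a} {b} → π-inj {a} {b}) d))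

  private
   κ' : ℤ
   κ' = + np K - N
   y' : AP
   y' = permC s K
   module E = Encode s K (nc P)

   agree-slot : ∀ v → v ℕ.< n → G (lab v) ≡ g κ' y' (lab v)
   agree-slot v lt with slotView K v lt
   ... | isFree f = trans (frees P f) (sym (E.g-free f))
   ... | isArc u a = trans (arcs P a) (sym (E.g-arc a))
   ... | isHole b refl = trans (holes-match b) (sym (E.g-hole b))

   agree-g : ∀ q → G q ≡ g κ' y' q
   agree-g q with toSlot s q
   ... | slot v v<n t refl = trans (g-per κ y (lab v) t) (trans (cong (_+ t ·N) (agree-slot v v<n)) (sym (g-per κ' y' (lab v) t)))

   agree-to : ∀ q → to y q ≡ (κ' - κ) + to y' q
   agree-to q = lia 4 (λ a b κ κ' → a :+ κ ≐ b :+ κ' => a ≐ κ' :- κ :+ b) (to y q) (to y' q) κ κ' (agree-g q)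

  -- The permutation and the decoded one differ by a constant. Equal window sums make it 0, and this
  -- also fixes the number of particles in terms of κ.
  decoded : Balanced y → Decoded s κ y
  decoded bal = record { C = K ; nc = nc P ; perm≗ = agree λ q → trans (agree-to q) (trans (cong (_+ to y' q) zero') (+-identityˡ (to y' q)))
    ; κ≡ = lia 2 (λ a b → b :- a ≐ #0 => a ≐ b) κ κ' zero' }
   where
   nc≡0 : + n * (κ' - κ) ≡ 0ℤ
   nc≡0 = lia 3 (λ nc b b' → b' ≐ nc :+ b => b' ≐ b => nc ≐ #0) (+ n * (κ' - κ)) (balance y') (balance y)
    (trans (sumZ-cong n (λ i _ → agree-to (pos i))) (sumZ-shift n (κ' - κ) (λ i → to y' (pos i))))
    (trans bal (sym (balance-act (wordC s K))))
   zero' : κ' - κ ≡ 0ℤ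
   zero' = zero-factor (κ' - κ) nc≡0

 -- Exchanging a cover to the right for a cover from the left

 -- Redirecting the three classes of V 0, V 1, V 2 to U 0, U 1, U 2 preserves noncrossingness if the new arcs cross neither
 -- the remaining old ones nor the translates of each other.
 module Redirect (G G'' : ℤ → ℤ) (per1 : ∀ q t → G (q + t ·N) ≡ G q + t ·N) (per2 : ∀ q t → G'' (q + t ·N) ≡ G'' q + t ·N)
  (lo1 : ∀ q → q - N ≤ G q) (hi1 : ∀ q → G q ≤ q) (unc : ∀ e f → e - N ≤ G f → G f < G e → G e < f → f < e → ⊥)
  (U V : Fin 3 → ℤ) (new : ∀ i → G'' (V i) ≡ U i) (old : ∀ q → (∀ i → q ~/ V i) → G'' q ≡ G q)
  (loU : ∀ i → V i - N ≤ U i) (hiU : ∀ i → U i ≤ V i)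
  (in1 : ∀ i q → (∀ j → q ~/ V j) → V i - N ≤ G q → G q < U i → U i < q → q < V i → ⊥)
  (in2 : ∀ i q → (∀ j → q ~/ V j) → q - N ≤ U i → U i < G q → G q < V i → V i < q → ⊥)
  (pair : ∀ i j τ → (τ ≤ 0ℤ - N ⊎ τ ≡ 0ℤ ⊎ N ≤ τ) → V i - N ≤ U j + τ → U j + τ < U i → U i < V j + τ → V j + τ < V i → ⊥) where

  data Kind (q : ℤ) : Set where
   isNew : ∀ i t → q ≡ V i + t ·N → Kind q
   isOld : (∀ i → q ~/ V i) → Kind q

  kind : ∀ q → Kind q
  kind q with q ~? V zero | q ~? V (suc zero) | q ~? V (suc (suc zero))
  ... | yes (winds t e) | _ | _ = isNew zero t e
  ... | _ | yes (winds t e) | _ = isNew (suc zero) t e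
  ... | _ | _ | yes (winds t e) = isNew (suc (suc zero)) t e
  ... | no a | no b | no c = isOld λ { zero → a ; (suc zero) → b ; (suc (suc zero)) → c }

  value : ∀ {q} i t → q ≡ V i + t ·N → G'' q ≡ U i + t ·N
  value i t refl = trans (per2 (V i) t) (cong (_+ t ·N) (new i))

  lo2 : ∀ q → q - N ≤ G'' q
  lo2 q with kind q
  ... | isOld ne = subst (q - N ≤_) (sym (old q ne)) (lo1 q)
  ... | isNew i t e = lia 6 (λ q v t g u N → q ≐ v :+ t => g ≐ u :+ t => v :- N =< u => q :- N =< g) q (V i) (t ·N) (G'' q) (U i) N e (value i t e) (loU i)

  hi2 : ∀ q → G'' q ≤ q
  hi2 q with kind q
  ... | isOld ne = subst (_≤ q) (sym (old q ne)) (hi1 q)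
  ... | isNew i t e = lia 5 (λ q v t g u → q ≐ v :+ t => g ≐ u :+ t => u =< v => g =< q) q (V i) (t ·N) (G'' q) (U i) e (value i t e) (hiU i)

  private
   −· : ∀ t → (- t) ·N ≡ 0ℤ - t ·N
   −· t = trans (-·N t) (sym (+-identityˡ _))
   other : ∀ {q} t → (∀ i → q ~/ V i) → ∀ i → q + t ·N ~/ V i
   other t ne i e = ne i (~-trans (~-sym (~-turn t)) e)
   gap : ∀ t → t ·N ≤ 0ℤ - N ⊎ t ·N ≡ 0ℤ ⊎ N ≤ t ·N
   gap t with mult-gap t
   ... | inj₁ h = inj₁ (subst (t ·N ≤_) (sym (+-identityˡ (- N))) h)
   ... | inj₂ (inj₁ refl) = inj₂ (inj₁ 0·N)
   ... | inj₂ (inj₂ h) = inj₂ (inj₂ h)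

   -- The crossing pattern is invariant under translation.
   move : ∀ t {e f ge gf} → e - N ≤ gf → gf < ge → ge < f → f < e → (e + t - N ≤ gf + t × gf + t < ge + t) × ge + t < f + t × f + t < e + t
   move t {e} {f} {ge} {gf} h1 h2 h3 h4 = (lia 4 (λ e gf t N → e :- N =< gf => e :+ t :- N =< gf :+ t) e gf t N h1 , +-monoˡ-< t h2) , +-monoˡ-< t h3 , +-monoˡ-< t h4
   lower : ∀ {u u' v v'} → u ≡ u' → v ≡ v' → u - N ≤ v → u' - N ≤ v'
   lower refl refl h = h
   back : ∀ {q v} t → q ≡ v + t ·N → q + (- t) ·N ≡ v
   back {q} {v} t e = lia 4 (λ q v t m → q ≐ v :+ t => m ≐ #0 :- t => q :+ m ≐ v) q v (t ·N) ((- t) ·N) e (−· t)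

  unc2 : ∀ e f → e - N ≤ G'' f → G'' f < G'' e → G'' e < f → f < e → ⊥
  unc2 e f h1 h2 h3 h4 with kind e | kind f
  ... | isOld ne | isOld nf = unc e f (subst (e - N ≤_) (old f nf) h1) (subst₂ _<_ (old f nf) (old e ne) h2) (subst (_< f) (old e ne) h3) h4
  ... | isNew i t qe | isOld nf with move ((- t) ·N) {e} {f} {G'' e} {G'' f} h1 h2 h3 h4
  ... | (a , b) , c , d = in1 i (f + (- t) ·N) (other (- t) nf) (lower (back {v = V i} t qe) gf a) (subst₂ _<_ gf (back t (value i t qe)) b) (subst (_< f + (- t) ·N) (back t (value i t qe)) c) (subst (f + (- t) ·N <_) (back t qe) d)
   where gf = trans (cong (_+ (- t) ·N) (old f nf)) (sym (per1 f (- t)))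
  unc2 e f h1 h2 h3 h4 | isOld ne | isNew i t qf with move ((- t) ·N) {e} {f} {G'' e} {G'' f} h1 h2 h3 h4
  ... | (a , b) , c , d = in2 i (e + (- t) ·N) (other (- t) ne) (subst (e + (- t) ·N - N ≤_) (back t (value i t qf)) a) (subst₂ _<_ (back t (value i t qf)) ge b) (subst₂ _<_ ge (back t qf) c) (subst (_< e + (- t) ·N) (back t qf) d)
   where ge = trans (cong (_+ (- t) ·N) (old e ne)) (sym (per1 e (- t)))
  unc2 e f h1 h2 h3 h4 | isNew i t qe | isNew j t' qf with move ((- t) ·N) {e} {f} {G'' e} {G'' f} h1 h2 h3 h4
  ... | (a , b) , c , d = pair i j ((t' + - t) ·N) (gap (t' + - t)) (lower (back {v = V i} t qe) gf a) (subst₂ _<_ gf ge b) (subst₂ _<_ ge ff c) (subst₂ _<_ ff (back t qe) d)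
   where
   ge = back t (value i t qe)
   merge : ∀ v → v + t' ·N + (- t) ·N ≡ v + (t' + - t) ·N
   merge v = trans (+-assoc v (t' ·N) ((- t) ·N)) (cong (λ z → v + z) (sym (+·N t' (- t))))
   gf = trans (cong (_+ (- t) ·N) (value j t' qf)) (merge (U j))
   ff = trans (cong (_+ (- t) ·N) qf) (merge (V j))

 module Descent (G : ℤ → ℤ) (per1 : ∀ q → G (q + N) ≡ G q + N) (inj : ∀ {a b} → G a ≡ G b → a ≡ b)
  (lo1 : ∀ q → q - N ≤ G q) (hi1 : ∀ q → G q ≤ q) (unc : ∀ e f → e - N ≤ G f → G f < G e → G e < f → f < e → ⊥) where

  -- A chain of arcs followed downwards. By `merged1` and `merged2` it can be treated as one long
  -- arc that crosses no arc of G.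
  data Down : ℤ → ℤ → Set where
   one : ∀ {v u} → G v ≡ u → u < v → Down v u
   more : ∀ {v w u} → G v ≡ w → w < v → Down w u → Down v u

  Down-< : ∀ {v u} → Down v u → u < v
  Down-< (one _ l) = l
  Down-< (more _ l d) = <-trans (Down-< d) l

  Down-first : ∀ {v u} → Down v u → u ≤ G v
  Down-first (one e _) = ≤-reflexive (sym e)
  Down-first (more e _ d) = subst (_ ≤_) (sym e) (<⇒≤ (Down-< d))

  Down-last : ∀ {v u} → Down v u → Σ ℤ λ w → w ≤ v × G w ≡ u
  Down-last {v} (one e _) = v , ≤-refl , e
  Down-last (more e l d) with Down-last d
  ... | w , le , q = w , ≤-trans le (<⇒≤ l) , q

  Down-trans : ∀ {v w u} → Down v w → Down w u → Down v u
  Down-trans (one e l) d = more e l d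
  Down-trans (more e l c) d = more e l (Down-trans c d)

  -- Along a chain G only descends, so it steps from above x to at most x only once.
  Down-unique : ∀ {x v u u'} → Down v u → Down v u' → x < u → x < u' → G u ≤ x → G u' ≤ x → u ≡ u'
  Down-unique (one e _) (one e' _) _ _ _ _ = trans (sym e) e'
  Down-unique (one refl _) (more refl _ d) _ h g _ = ⊥-elim (<⇒≱ h (≤-trans (Down-first d) g))
  Down-unique (more refl _ d) (one refl _) h _ _ g = ⊥-elim (<⇒≱ h (≤-trans (Down-first d) g))
  Down-unique (more refl _ d) (more refl _ d') h h' g g' = Down-unique d d' h h' g g'

  Down-moves : ∀ {v u} → Down v u → G v < v
  Down-moves (one refl l) = l
  Down-moves (more refl l _) = l

  merged1 : ∀ {v u} → Down v u → ∀ q → v - N ≤ G q → G q < u → u < q → q < v → ⊥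
  merged1 {v} (one refl _) q h1 h2 h3 h4 = unc v q h1 h2 h3 h4
  merged1 {v} {u} (more {w = w} refl l d) q h1 h2 h3 h4 with <-cmp q w
  ... | tri< q<w _ _ = merged1 d q (lia 4 (λ v w a N → w <: v => v :- N =< a => w :- N =< a) v w (G q) N l h1) h2 h3 q<w
  ... | tri≈ _ refl _ = <⇒≱ h2 (Down-first d)
  ... | tri> _ _ w<q = unc v q h1 (<-trans h2 (Down-< d)) w<q h4

  merged2 : ∀ {v u} → Down v u → ∀ q → q - N ≤ u → u < G q → G q < v → v < q → ⊥
  merged2 {v} (one refl _) q h1 h2 h3 h4 = unc q v h1 h2 h3 h4
  merged2 {v} (more {w = w} refl l d) q h1 h2 h3 h4 with <-cmp (G q) w
  ... | tri< a _ _ = merged2 d q h1 h2 a (<-trans l h4)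
  ... | tri≈ _ e _ = <-irrefl (sym (inj e)) h4
  ... | tri> _ _ a = unc q v (≤-trans h1 (<⇒≤ (Down-< d))) a h3 h4

  Over : ℤ → ℤ → ℤ → Set
  Over v u x = Σ ℤ λ r → u ≤ G r × G r < x × x < r × r ≤ v

  over : ∀ {v u x} → Down v u → u < x → x < v → Over v u x ⊎ (Down v x × Down x u)
  over {v} (one e l) h h' = inj₁ (v , ≤-reflexive (sym e) , subst (_< _) (sym e) h , h' , ≤-refl)
  over {v} {x = x} (more {w = w} refl l d) h h' with <-cmp x w
  ... | tri≈ _ refl _ = inj₂ (one refl l , d)
  ... | tri> _ _ w<x = inj₁ (v , <⇒≤ (Down-< d) , w<x , h' , ≤-refl)
  ... | tri< x<w _ _ with over d h x<w
  ... | inj₁ (r , a , b , c , e) = inj₁ (r , a , b , c , ≤-trans e (<⇒≤ l))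
  ... | inj₂ (d' , d'') = inj₂ (more refl l d' , d'')

  module Colours (s : ℤ) where

   top-down : ∀ {t j} (C : Conf t j) → (∀ {u v} → Arc C u v → G (s + + v) ≡ s + + u) → ∀ b → top C b ≡ hol C b ⊎ Down (s + + top C b) (s + + hol C b)
   top-down (hole C) arcs zero = inj₁ refl
   top-down (hole C) arcs (suc b) = top-down C (arcs ∘ holeᵃ) b
   top-down (free C) arcs b = top-down C (arcs ∘ freeᵃ) b
   top-down (att {t} C a) arcs b with a Fin.≟ b
   ... | no _ = top-down C (arcs ∘ attᵃ) b
   ... | yes refl with top-down C (arcs ∘ attᵃ) a
   ... | inj₁ e = inj₂ (one (trans (arcs here) (cong (λ u → s + + u) e)) (+-monoʳ-< s (+<+ (hol<t C a))))
   ... | inj₂ d = inj₂ (more (arcs here) (+-monoʳ-< s (+<+ (top<t C a))) d)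

   arc-down : ∀ {t j} (C : Conf t j) → (∀ {u v} → Arc C u v → G (s + + v) ≡ s + + u) → ∀ {u v} → Arc C u v →
    Σ (Fin j) λ b → Down (s + + v) (s + + hol C b) × v ℕ.≤ top C b
   arc-down (hole C) arcs (holeᵃ a) with arc-down C (arcs ∘ holeᵃ) a
   ... | b , d , le = suc b , d , le
   arc-down (free C) arcs (freeᵃ a) = arc-down C (arcs ∘ freeᵃ) a
   arc-down (att {t} C a) arcs here with top-down (att C a) arcs a | top-att-≡ C a
   ... | inj₁ e | q = ⊥-elim (ℕP.<-irrefl (sym (trans (sym q) e)) (hol<t C a))
   ... | inj₂ d | q = a , subst (λ z → Down (s + + z) (s + + hol C a)) q d , ℕP.≤-reflexive (sym q)
   arc-down (att {t} C a) arcs (attᵃ ar) with arc-down C (arcs ∘ attᵃ) ar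
   ... | b , d , le with a Fin.≟ b
   ... | yes refl = b , d , ℕP.≤-trans (ℕP.<⇒≤ (arc<t ar)) (ℕP.≤-reflexive (sym (top-att-≡ C a)))
   ... | no ne = b , d , ℕP.≤-trans le (ℕP.≤-reflexive (sym (top-att C ne)))

 three : ℤ → ℤ → ℤ → Fin 3 → ℤ
 three a b c zero = a
 three a b c (suc zero) = b
 three a b c (suc (suc zero)) = c

 -- G belongs to y·t(p,b). The partner y·t(a,p) arises from it by sending a, p, b to x, z, u, where
 -- z is the value of y at a up to κ; a `Target` collects what `Redirect` and `cover-up` ask of this
 -- change.
 module Exchange (G : ℤ → ℤ) (per1 : ∀ q → G (q + N) ≡ G q + N) (inj : ∀ {a b} → G a ≡ G b → a ≡ b)
  (lo1 : ∀ q → q - N ≤ G q) (hi1 : ∀ q → G q ≤ q) (unc : ∀ e f → e - N ≤ G f → G f < G e → G e < f → f < e → ⊥)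
  (p b : ℤ) (p<b : p < b) (x<y : G b < G p) (gap : ∀ q → p < q → q < b → G b < G q → G q < G p → ⊥) where

  open Descent G per1 inj lo1 hi1 unc

  x y : ℤ
  x = G b
  y = G p

  record Target : Set where
   field
    a z u : ℤ
    a<p : a < p
    p<a+N : p < a + N
    z<x : z < x
    -- The second alternative is the wrapped exchange: b is a translate of a, and only two classes
    -- move.
    shape : (a < b × b < a + N × z ≡ G a × u ≡ y) ⊎ (b ≡ a + N × x ≡ a × y ≡ p × u ≡ b × z ≡ p - N)
    gap' : ∀ q → a < q → q < p → z < G q → G q < x → ⊥
    loU : ∀ i → three a p b i - N ≤ three x z u i
    hiU : ∀ i → three x z u i ≤ three a p b i
    in1 : ∀ i q → (∀ j → q ~/ three a p b j) → three a p b i - N ≤ G q → G q < three x z u i → three x z u i < q → q < three a p b i → ⊥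
    in2 : ∀ i q → (∀ j → q ~/ three a p b j) → q - N ≤ three x z u i → three x z u i < G q → G q < three a p b i → three a p b i < q → ⊥
    pair : ∀ i j τ → (τ ≤ 0ℤ - N ⊎ τ ≡ 0ℤ ⊎ N ≤ τ) → three a p b i - N ≤ three x z u j + τ → three x z u j + τ < three x z u i →
           three x z u i < three a p b j + τ → three a p b j + τ < three a p b i → ⊥

  private
   b≤x+N : b ≤ x + N
   b≤x+N = lia 3 (λ b x N → b :- N =< x => b =< x :+ N) b x N (lo1 b)

   y≤p : y ≤ p
   y≤p = hi1 p

   down1 : ∀ q → G (q - N) ≡ G q - N
   down1 q = lia 3 (λ a b N → b ≐ a :+ N => a ≐ b :- N) (G (q - N)) (G q) N (trans (cong G (lia 2 (λ q N → q ≐ q :- N :+ N) q N)) (per1 (q - N)))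

  -- The hypotheses are what decoding in the window from x + 1 to x + N provides: a point sent below
  -- the window is the bottom of a chain whose top is its image raised by N, and a point on a proper
  -- arc inside descends to such a bottom.
  module WithWindow
   (cut : ∀ q → x < q → q ≤ x + N → G q ≤ x → Σ ℤ λ τ → G q ≡ τ - N × τ ≤ x + N × (τ ≡ q ⊎ Down τ q))
   (climb : ∀ q → x < q → q ≤ x + N → x < G q → G q < q →
         Σ ℤ λ h → x < h × G h ≤ x × Down q h × Σ ℤ λ τ → G h ≡ τ - N × q ≤ τ × τ ≤ x + N × (τ ≡ h ⊎ Down τ h)) where

   beyond : ∀ q → G q + N < b → G q ≤ x
   beyond q h = lia 4 (λ g b x N → g :+ N <: b => b =< x :+ N => g =< x) (G q) b x N h b≤x+N

   -- The top of the chain of q lies in [p, b), and no arc of that chain passes over p.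
   reach : ∀ q → x < q → q < p → p ≤ G q + N → G q + N < b → Down p q
   reach q x<q q<p h h' with cut q x<q (<⇒≤ (<-≤-trans (<-trans q<p p<b) b≤x+N)) (beyond q h')
   ... | T' , e , _ , inj₁ refl = ⊥-elim (lia 4 (λ g q p N → g ≐ q :- N => q <: p => p =< g :+ N => false') (G q) q p N e q<p h)
   ... | T' , e , _ , inj₂ d' = cmp (<-cmp p T')
    where
    T'≡ : G q + N ≡ T'
    T'≡ = lia 3 (λ g τ N → g ≐ τ :- N => g :+ N ≐ τ) (G q) T' N e
    T'<b : T' < b
    T'<b = subst (_< b) T'≡ h'
    cmp : _ → Down p q
    cmp (tri> _ _ l) = ⊥-elim (<⇒≱ l (subst (p ≤_) T'≡ h))
    cmp (tri≈ _ e' _) = subst (λ v → Down v q) (sym e') d'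
    cmp (tri< l _ _) with over d' q<p l
    ... | inj₂ (_ , d1) = d1
    ... | inj₁ (r , h1 , h2 , h3 , h4) with <-cmp (G r) y
    ... | tri< m _ _ = ⊥-elim (gap r h3 (≤-<-trans h4 T'<b) (<-≤-trans x<q h1) m)
    ... | tri≈ _ m _ = ⊥-elim (<-irrefl (sym (inj m)) h3)
    ... | tri> _ _ m = ⊥-elim (unc r p (lia 6 (λ r τ b x y N → r =< τ => τ <: b => b =< x :+ N => x <: y => r :- N =< y) r T' b x y N h4 T'<b b≤x+N x<y) m h2 h3)

   γ1 : ∀ q → q ≢ p → b - N ≤ G q → G q < y → y < q → q < b → ⊥
   γ1 q q≢p h1 h2 h3 h4 with <-cmp q p
   ... | tri< l _ _ = unc p q (lia 4 (λ p b g N → p <: b => b :- N =< g => p :- N =< g) p b (G q) N p<b h1) h2 h3 l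
   ... | tri≈ _ e _ = q≢p e
   ... | tri> _ _ l with <-cmp (G q) x
   ... | tri< m _ _ = unc b q h1 m (<-trans x<y h3) h4
   ... | tri≈ _ e _ = <-irrefl (inj e) h4
   ... | tri> _ _ m = gap q l h4 m h2

   -- Here p starts a proper arc. The partner a is the bottom of its chain above x: p takes over the
   -- wrap-around value of a, and a receives x.
   attached : y < p → Target
   attached y<p = with-hole (climb p (<-trans x<y y<p) (≤-trans (<⇒≤ p<b) b≤x+N) x<y y<p)
    where
    with-hole : _ → Target
    with-hole (a , x<a , Ga≤x , d , τ , Ga≡ , p≤T , T≤ , top) = record
     { a = a ; z = z ; u = y ; a<p = Down-< d
     ; p<a+N = lia 5 (λ p b x a N → p <: b => b =< x :+ N => x <: a => p <: a :+ N) p b x a N p<b b≤x+N x<a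
     ; z<x = z<x
     ; shape = inj₁ (<-trans (Down-< d) p<b , lia 4 (λ b x a N → b =< x :+ N => x <: a => b <: a :+ N) b x a N b≤x+N x<a , refl , refl)
     ; gap' = λ q a<q q<p z<Gq Gq<x → merged1 d q (≤-trans p-N≤z (<⇒≤ z<Gq)) (<-trans Gq<x x<a) a<q q<p
     ; loU = λ { zero → lia 4 (λ x a p N → a =< p => p :- N =< x => a :- N =< x) x a p N (<⇒≤ (Down-< d)) (lia 4 (λ p b x N → p <: b => b =< x :+ N => p :- N =< x) p b x N p<b b≤x+N)
          ; (suc zero) → p-N≤z ; (suc (suc zero)) → lia 4 (λ b x y N → b =< x :+ N => x <: y => b :- N =< y) b x y N b≤x+N x<y }
     ; hiU = λ { zero → <⇒≤ x<a ; (suc zero) → <⇒≤ (<-trans z<x (<-trans x<a (Down-< d))) ; (suc (suc zero)) → <⇒≤ (<-trans y<p p<b) }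
     ; in1 = λ { zero q ne → α1 q ; (suc zero) q ne → merged1 dz q ; (suc (suc zero)) q ne → γ1 q (ne (suc zero) ∘ ~-reflexive) }
     ; in2 = λ { zero q ne → α2 q (ne (suc zero) ∘ ~-reflexive) (ne (suc (suc zero)) ∘ ~-reflexive) ; (suc zero) q ne → merged2 dz q ; (suc (suc zero)) q ne → γ2 q (ne zero) }
     ; pair = pairs }
     where
     z : ℤ
     z = G a
     a≤y : a ≤ y
     a≤y = Down-first d
     z<x : z < x
     z<x = ≤∧≢⇒< Ga≤x (λ e → <-irrefl (inj e) (<-trans (Down-< d) p<b))
     dz : Down p z
     dz = Down-trans d (one refl (<-trans z<x x<a))
     p-N≤z : p - N ≤ z
     p-N≤z = lia 4 (λ p z τ N → z ≐ τ :- N => p =< τ => p :- N =< z) p z τ N Ga≡ p≤T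
     -- The chain ends below b: passing over b it would cross the arc of b, and passing through b it
     -- would step down to x or below twice.
     under : (τ ≡ a ⊎ Down τ a) → τ < b
     under (inj₁ e) = ⊥-elim (<⇒≱ (Down-< d) (subst (p ≤_) e p≤T))
     under (inj₂ d') with <-cmp τ b
     ... | tri< h _ _ = h
     ... | tri≈ _ e _ = ⊥-elim (<⇒≱ x<a (subst (λ v → a ≤ G v) e (Down-first d')))
     ... | tri> _ _ b<T with over d' (<-trans (Down-< d) p<b) b<T
     ... | inj₁ (r , h1 , h2 , h3 , h4) = ⊥-elim (unc r b (lia 4 (λ r τ x N → r =< τ => τ =< x :+ N => r :- N =< x) r τ x N h4 T≤) (<-≤-trans x<a h1) h2 h3)
     ... | inj₂ (d'' , _) = ⊥-elim (<-irrefl (Down-unique d' d'' x<a (<-trans x<a (<-trans (Down-< d) p<b)) Ga≤x ≤-refl) (<-trans (Down-< d) p<b))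
     T<b : τ < b
     T<b = under top
     D : ∀ q → x < q → q < a → p ≤ G q + N → G q + N < b → ⊥
     D q x<q q<a h h' = <-irrefl (Down-unique (reach q x<q (<-trans q<a (Down-< d)) h h') d x<q x<a (beyond q h') Ga≤x) q<a
     α1 : ∀ q → a - N ≤ G q → G q < x → x < q → q < a → ⊥
     α1 q h1 h2 h3 h4 with (b - N) ≤? G q | p ≤? (G q + N)
     ... | yes h | _ = unc b q h h2 h3 (<-trans h4 (<-trans (Down-< d) p<b))
     ... | no nh | yes l = D q h3 h4 l (lia 3 (λ g b N → ¬' (b :- N =< g) => g :+ N <: b) (G q) b N nh)
     ... | no nh | no l with <-cmp a (G q + N)
     ... | tri> _ _ m = lia 3 (λ a g N → a :- N =< g => g :+ N <: a => false') a (G q) N h1 m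
     ... | tri< m _ _ = merged2 d (q + N) (lia 3 (λ q a N → q <: a => q :+ N :- N =< a) q a N h4)
      (subst (a <_) (sym (per1 q)) m) (subst (_< p) (sym (per1 q)) (≰⇒> l)) (lia 5 (λ p b x q N → p <: b => b =< x :+ N => x <: q => p <: q :+ N) p b x q N p<b b≤x+N h3)
     ... | tri≈ _ e _ with Down-last d
     ... | w , w≤p , Gw≡a = lia 6 (λ w p b x q N → w =< p => p <: b => b =< x :+ N => x <: q => w ≐ q :+ N => false') w p b x q N w≤p p<b b≤x+N h3 (inj (trans Gw≡a (trans e (sym (per1 q)))))
     α2 : ∀ q → q ≢ p → q ≢ b → q - N ≤ x → x < G q → G q < a → a < q → ⊥
     α2 q q≢p q≢b h1 h2 h3 h4 with <-cmp q p
     ... | tri< l _ _ = merged1 d q (lia 5 (λ p b x g N → p <: b => b =< x :+ N => x <: g => p :- N =< g) p b x (G q) N p<b b≤x+N h2) h3 h4 l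
     ... | tri≈ _ e _ = q≢p e
     ... | tri> _ _ l with <-cmp q b
     ... | tri< m _ _ = gap q l m h2 (<-≤-trans h3 a≤y)
     ... | tri≈ _ e _ = q≢b e
     ... | tri> _ _ m = unc q b h1 h2 (<-trans h3 (<-trans (Down-< d) p<b)) m
     γ2 : ∀ q → q ~/ a → q - N ≤ y → y < G q → G q < b → b < q → ⊥
     γ2 q q~/a h1 h2 h3 h4 with p ≤? G q | (q - N) ≤? x
     ... | no l | _ = unc q p h1 h2 (≰⇒> l) (<-trans p<b h4)
     ... | yes _ | yes l = unc q b l (<-trans x<y h2) h3 h4
     ... | yes p≤ | no nl with <-cmp (q - N) a
     ... | tri< m _ _ = D (q - N) (≰⇒> nl) m (lia 4 (λ p g g' N → g' ≐ g :- N => p =< g => p =< g' :+ N) p (G q) (G (q - N)) N (down1 q) p≤) (lia 4 (λ b g g' N → g' ≐ g :- N => g <: b => g' :+ N <: b) b (G q) (G (q - N)) N (down1 q) h3)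
     ... | tri≈ _ m _ = q~/a (~-trans (~-sym ~--N) (~-reflexive m))
     ... | tri> _ _ m = merged1 d (q - N) (lia 4 (λ p g g' N → g' ≐ g :- N => p =< g => p :- N =< g') p (G q) (G (q - N)) N (down1 q) p≤)
        (lia 6 (λ g g' b x a N → g' ≐ g :- N => g <: b => b =< x :+ N => x <: a => g' <: a) (G q) (G (q - N)) b x a N (down1 q) h3 b≤x+N x<a) m (≤-<-trans h1 y<p)
     z<b-N : z < b - N
     z<b-N = lia 4 (λ z τ b N → z ≐ τ :- N => τ <: b => z <: b :- N) z τ b N Ga≡ T<b
     a<p' = Down-< d
     pairs : ∀ i j τ → (τ ≤ 0ℤ - N ⊎ τ ≡ 0ℤ ⊎ N ≤ τ) → three a p b i - N ≤ three x z y j + τ → three x z y j + τ < three x z y i →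
           three x z y i < three a p b j + τ → three a p b j + τ < three a p b i → ⊥
     pairs zero zero τ t h1 h2 h3 h4 = lia 4 (λ a x τ N → x <: a => (τ =< #0 :- N ∨' τ ≐ #0 ∨' N =< τ) => #2 =< N => a :- N =< x :+ τ => x :+ τ <: x => false') a x τ N x<a t 2≤N h1 h2
     pairs zero (suc zero) τ t h1 h2 h3 h4 = lia 6 (λ a x z p τ N → x <: a => a <: p => z <: x => (τ =< #0 :- N ∨' τ ≐ #0 ∨' N =< τ) => #2 =< N => a :- N =< z :+ τ => p :+ τ <: a => false') a x z p τ N x<a a<p' z<x t 2≤N h1 h4
     pairs zero (suc (suc zero)) τ t h1 h2 h3 h4 = lia 6 (λ a x y b τ N → b =< x :+ N => a =< y => y <: b => (τ =< #0 :- N ∨' τ ≐ #0 ∨' N =< τ) => #2 =< N => x <: b :+ τ => b :+ τ <: a => false') a x y b τ N b≤x+N a≤y (<-trans y<p p<b) t 2≤N h3 h4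
     pairs (suc zero) zero τ t h1 h2 h3 h4 = lia 7 (λ p z x a b τ N → z <: x => p <: b => b =< x :+ N => x <: a => a <: p => p :- N =< z => (τ =< #0 :- N ∨' τ ≐ #0 ∨' N =< τ) => #2 =< N => p :- N =< x :+ τ => x :+ τ <: z => false') p z x a b τ N z<x p<b b≤x+N x<a a<p' p-N≤z t 2≤N h1 h2
     pairs (suc zero) (suc zero) τ t h1 h2 h3 h4 = lia 4 (λ p z τ N → z <: p => (τ =< #0 :- N ∨' τ ≐ #0 ∨' N =< τ) => #2 =< N => p :- N =< z :+ τ => z :+ τ <: z => false') p z τ N (<-trans z<x (<-trans x<a a<p')) t 2≤N h1 h2
     pairs (suc zero) (suc (suc zero)) τ t h1 h2 h3 h4 = lia 5 (λ p y b τ N → y <: p => p <: b => (τ =< #0 :- N ∨' τ ≐ #0 ∨' N =< τ) => #2 =< N => p :- N =< y :+ τ => b :+ τ <: p => false') p y b τ N y<p p<b t 2≤N h1 h4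
     pairs (suc (suc zero)) zero τ t h1 h2 h3 h4 = lia 6 (λ b y x a τ N → b =< x :+ N => x <: a => a =< y => (τ =< #0 :- N ∨' τ ≐ #0 ∨' N =< τ) => #2 =< N => y <: a :+ τ => b :- N =< x :+ τ => x :+ τ <: y => a :+ τ <: b => false') b y x a τ N b≤x+N x<a a≤y t 2≤N h3 h1 h2 h4
     pairs (suc (suc zero)) (suc zero) τ t h1 h2 h3 h4 = lia 6 (λ b z p x τ N → z <: b :- N => x <: p => b =< x :+ N => (τ =< #0 :- N ∨' τ ≐ #0 ∨' N =< τ) => #2 =< N => b :- N =< z :+ τ => p :+ τ <: b => false') b z p x τ N z<b-N (<-trans x<y y<p) b≤x+N t 2≤N h1 h4
     pairs (suc (suc zero)) (suc (suc zero)) τ t h1 h2 h3 h4 = lia 4 (λ p z τ N → z <: p => (τ =< #0 :- N ∨' τ ≐ #0 ∨' N =< τ) => #2 =< N => p :- N =< z :+ τ => z :+ τ <: z => false') b y τ N (<-trans y<p p<b) t 2≤N h1 h2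

   -- Here p is fixed by G and has no chain. The partner is x itself, the end of the arc of b; when
   -- that arc has full length N, b is a translate of x and the exchange wraps.
   detached : y ≡ p → Target
   detached y≡p = lem (<-cmp b (x + N))
    where
    x<p : x < p
    x<p = subst (x <_) y≡p x<y
    stuck : ∀ {u} → ¬ Down p u
    stuck d = <-irrefl y≡p (Down-moves d)
    D : ∀ q → x < q → q < p → p ≤ G q + N → G q + N < b → ⊥
    D q l u h h' = stuck (reach q l u h h')
    lem : _ → Target
    lem (tri> _ _ l) = ⊥-elim (<⇒≱ l b≤x+N)
    lem (tri≈ _ e _) = record
     { a = x ; z = p - N ; u = b ; a<p = x<p ; p<a+N = subst (p <_) e p<b ; z<x = z<x
     ; shape = inj₂ (e , refl , y≡p , refl , refl)
     ; gap' = λ q x<q q<p h1 h2 → D q x<q q<p (lia 3 (λ p g N → p :- N <: g => p =< g :+ N) p (G q) N h1) (subst (G q + N <_) (sym e) (+-monoˡ-< N h2))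
     ; loU = λ { zero → minus x ; (suc zero) → ≤-refl ; (suc (suc zero)) → minus b }
     ; hiU = λ { zero → ≤-refl ; (suc zero) → minus p ; (suc (suc zero)) → ≤-refl }
     ; in1 = λ { zero q ne _ _ h h' → <-asym h h' ; (suc zero) q ne h h' _ _ → <⇒≱ h' h ; (suc (suc zero)) q ne _ _ h h' → <-asym h h' }
     ; in2 = λ { zero q ne _ h h' _ → <-asym h h' ; (suc zero) q ne h _ _ h' → lia 3 (λ q p N → q :- N =< p :- N => p <: q => false') q p N h h' ; (suc (suc zero)) q ne _ h h' _ → <-asym h h' }
     ; pair = pairs }
     where
     minus : ∀ v → v - N ≤ v
     minus v = lia 2 (λ v N → #2 =< N => v :- N =< v) v N 2≤N
     z<x : p - N < x
     z<x = lia 3 (λ p x N → p <: x :+ N => p :- N <: x) p x N (subst (p <_) e p<b)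
     pairs : ∀ i j τ → (τ ≤ 0ℤ - N ⊎ τ ≡ 0ℤ ⊎ N ≤ τ) → three x p b i - N ≤ three x (p - N) b j + τ → three x (p - N) b j + τ < three x (p - N) b i →
           three x (p - N) b i < three x p b j + τ → three x p b j + τ < three x p b i → ⊥
     pairs zero _ τ t _ h2 h3 h4 = <-asym h3 h4
     pairs (suc (suc zero)) _ τ t _ h2 h3 h4 = <-asym h3 h4
     pairs (suc zero) _ τ t h1 h2 _ _ = <⇒≱ h2 h1
    lem (tri< b<x+N _ _) = record
     { a = x ; z = z ; u = y ; a<p = x<p
     ; p<a+N = <-trans p<b b<x+N ; z<x = z<x
     ; shape = inj₁ (<-trans x<p p<b , b<x+N , refl , refl)
     ; gap' = λ q x<q q<p z<Gq Gq<x → unc b q (≤-trans b-N≤z (<⇒≤ z<Gq)) Gq<x x<q (<-trans q<p p<b)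
     ; loU = λ { zero → lia 2 (λ v N → #2 =< N => v :- N =< v) x N 2≤N ; (suc zero) → lia 4 (λ p b z N → p <: b => b :- N =< z => p :- N =< z) p b z N p<b b-N≤z
          ; (suc (suc zero)) → lia 4 (λ b x y N → b =< x :+ N => x <: y => b :- N =< y) b x y N b≤x+N x<y }
     ; hiU = λ { zero → ≤-refl ; (suc zero) → <⇒≤ (<-trans z<x x<p) ; (suc (suc zero)) → ≤-trans y≤p (<⇒≤ p<b) }
     ; in1 = λ { zero q ne _ _ h h' → <-asym h h' ; (suc zero) q ne → β1 q (ne zero ∘ ~-reflexive)
          ; (suc (suc zero)) q ne → γ1 q (ne (suc zero) ∘ ~-reflexive) }
     ; in2 = λ { zero q ne _ h h' _ → <-asym h h' ; (suc zero) q ne → β2 q (ne (suc (suc zero)) ∘ ~-reflexive)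
          ; (suc (suc zero)) q ne h1 h2 h3 h4 → γ2 q (ne (suc zero)) (subst (q - N ≤_) y≡p h1) (subst (_< G q) y≡p h2) h3 h4 }
     ; pair = pairs }
     where
     z : ℤ
     z = G x
     z<x : z < x
     z<x = ≤∧≢⇒< (hi1 x) (λ e → <-irrefl (inj e) (<-trans x<p p<b))
     b-N≤z : b - N ≤ z
     b-N≤z with (b - N) ≤? z
     ... | yes h = h
     ... | no nh with <-cmp x (z + N)
     ... | tri< l _ _ = ⊥-elim (unc (x + N) b (lia 2 (λ x N → x :+ N :- N =< x) x N) (subst (x <_) (sym (per1 x)) l) (subst (_< b) (sym (per1 x)) (lia 3 (λ z b N → ¬' (b :- N =< z) => z :+ N <: b) z b N nh)) b<x+N)
     ... | tri≈ _ e _ = ⊥-elim (<-irrefl (inj (trans e (sym (per1 x)))) b<x+N)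
     ... | tri> _ _ l = ⊥-elim (lia 3 (λ x z N → x :- N =< z => z :+ N <: x => false') x z N (lo1 x) l)
     β1 : ∀ q → q ≢ x → p - N ≤ G q → G q < z → z < q → q < p → ⊥
     β1 q q≢x h1 h2 h3 h4 with <-cmp q x
     ... | tri< l _ _ = unc x q (lia 4 (λ x p g N → x <: p => p :- N =< g => x :- N =< g) x p (G q) N x<p h1) h2 h3 l
     ... | tri≈ _ e _ = q≢x e
     ... | tri> _ _ l with (b - N) ≤? G q
     ... | yes h = unc b q h (<-trans h2 z<x) l (<-trans h4 p<b)
     ... | no nh = D q l h4 (lia 3 (λ p g N → p :- N =< g => p =< g :+ N) p (G q) N h1) (lia 3 (λ g b N → ¬' (b :- N =< g) => g :+ N <: b) (G q) b N nh)
     β2 : ∀ q → q ≢ b → q - N ≤ z → z < G q → G q < p → p < q → ⊥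
     β2 q q≢b h1 h2 h3 h4 with <-cmp (G q) x
     ... | tri< m _ _ = unc q x h1 h2 m (<-trans x<p h4)
     ... | tri≈ _ e _ = q≢b (inj e)
     ... | tri> _ _ m with <-cmp q b
     ... | tri< l _ _ = gap q h4 l m (subst (G q <_) (sym y≡p) h3)
     ... | tri≈ _ e _ = q≢b e
     ... | tri> _ _ l = unc q b (≤-trans h1 (<⇒≤ z<x)) m (<-trans h3 p<b) l
     γ2 : ∀ q → q ~/ p → q - N ≤ p → p < G q → G q < b → b < q → ⊥
     γ2 q q~/p h1 h2 h3 h4 with (q - N) ≤? x
     ... | yes l = unc q b l (<-trans x<p h2) h3 h4
     ... | no nl with <-cmp (q - N) p
     ... | tri≈ _ e _ = q~/p (~-trans (~-sym ~--N) (~-reflexive e))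
     ... | tri> _ _ l = <⇒≱ l h1
     ... | tri< l _ _ = D (q - N) (≰⇒> nl) l (lia 4 (λ p g g' N → g' ≐ g :- N => p <: g => p =< g' :+ N) p (G q) (G (q - N)) N (down1 q) h2) (lia 4 (λ b g g' N → g' ≐ g :- N => g <: b => g' :+ N <: b) b (G q) (G (q - N)) N (down1 q) h3)
     pairs : ∀ i j τ → (τ ≤ 0ℤ - N ⊎ τ ≡ 0ℤ ⊎ N ≤ τ) → three x p b i - N ≤ three x z y j + τ → three x z y j + τ < three x z y i →
           three x z y i < three x p b j + τ → three x p b j + τ < three x p b i → ⊥
     pairs zero _ τ t h1 h2 h3 h4 = <-asym h3 h4
     pairs (suc zero) zero τ t h1 h2 h3 h4 = lia 6 (λ p z x b τ N → z <: x => x <: p => p <: b => b :- N =< z => (τ =< #0 :- N ∨' τ ≐ #0 ∨' N =< τ) => #2 =< N => p :- N =< x :+ τ => x :+ τ <: z => z <: x :+ τ => false') p z x b τ N z<x x<p p<b b-N≤z t 2≤N h1 h2 h3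
     pairs (suc zero) (suc zero) τ t h1 h2 h3 h4 = lia 4 (λ p z τ N → z <: p => (τ =< #0 :- N ∨' τ ≐ #0 ∨' N =< τ) => #2 =< N => p :- N =< z :+ τ => z :+ τ <: z => false') p z τ N (<-trans z<x x<p) t 2≤N h1 h2
     pairs (suc zero) (suc (suc zero)) τ t h1 h2 h3 h4 = lia 6 (λ p y z b τ N → y ≐ p => p <: b => b :- N =< z => (τ =< #0 :- N ∨' τ ≐ #0 ∨' N =< τ) => p :- N =< y :+ τ => z <: b :+ τ => b :+ τ <: p => false') p y z b τ N y≡p p<b b-N≤z t h1 h3 h4
     pairs (suc (suc zero)) zero τ t h1 h2 h3 h4 = lia 5 (λ b y x τ N → x <: y => b =< x :+ N => (τ =< #0 :- N ∨' τ ≐ #0 ∨' N =< τ) => x :+ τ <: y => y <: x :+ τ => false') b y x τ N x<y b≤x+N t h2 h3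
     pairs (suc (suc zero)) (suc zero) τ t h1 h2 h3 h4 = lia 6 (λ b y z p τ N → y ≐ p => p <: b => z <: y => (τ =< #0 :- N ∨' τ ≐ #0 ∨' N =< τ) => b :- N =< z => y <: p :+ τ => p :+ τ <: b => z :+ τ <: y => false') b y z p τ N y≡p p<b (<-trans z<x x<y) t b-N≤z h3 h4 h2
     pairs (suc (suc zero)) (suc (suc zero)) τ t h1 h2 h3 h4 = lia 4 (λ p z τ N → z <: p => (τ =< #0 :- N ∨' τ ≐ #0 ∨' N =< τ) => #2 =< N => p :- N =< z :+ τ => z :+ τ <: z => false') b y τ N (≤-<-trans y≤p p<b) t 2≤N h1 h2

 module _ (κ : ℤ) where

  -- An admissible cover to the right, expressed by values and gaps instead of lengths.
  record Rise (y : AP) (p b : ℤ) : Set where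
   field
    p~/b : p ~/ b
    asc : to y p < to y b
    ns : Near κ (y ⇌ p , b)
    gap : ∀ q → p < q → q < b → to y p < to y q → to y q < to y b → ⊥

  module _ {y p b} (p<b : p < b) (R : Rise y p b) where
   open Rise R

   private
    w : AP
    w = y ⇌ p , b
    G : ℤ → ℤ
    G = g κ w
    G-p : G p ≡ g κ y b
    G-p = cong (_+ κ) (⇌-a y p~/b)
    G-b : G b ≡ g κ y p
    G-b = cong (_+ κ) (⇌-b y p~/b)
    G-off : ∀ {q} → q ~/ p → q ~/ b → G q ≡ g κ y q
    G-off h h' = cong (_+ κ) (⇌-off y h h')
    cancel : ∀ {u v} → to y u + κ < to y v + κ → to y u < to y v
    cancel {u} {v} h = lia 3 (λ a b κ → a :+ κ <: b :+ κ => a <: b) (to y u) (to y v) κ h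

   -- From b - N ≤ G b < G p ≤ p.
   near-p : b < p + N
   near-p = lia 7 (λ b p yp yb gp gb N → gp ≐ yb => gb ≐ yp => yp <: yb => b :- N =< gb => gp =< p => b <: p :+ N) b p (g κ y p) (g κ y b) (G p) (G b) N G-p G-b (+-monoˡ-< κ asc) (lo ns b) (hi ns p)

   record Partner : Set where
    field
     a : ℤ
     a<p : a < p
     p<a+N : p < a + N
     near'' : Near κ (y ⇌ a , p)
     ℓ'' : ℓ (y ⇌ a , p) ≡ suc (ℓ y)

   partner : Partner
   partner = lem (<-cmp (G p) p)
    where
    x<y : G b < G p
    x<y = subst₂ _<_ (sym G-b) (sym G-p) (+-monoˡ-< κ asc)
    off-between : ∀ {q} → p < q → q < b → G q ≡ g κ y q
    off-between {q} l u = G-off (λ e → near-~/ l (<-trans u near-p) (~-sym e))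
     (near-~/ u (lia 4 (λ b p q N → b <: p :+ N => p <: q => b <: q :+ N) b p q N near-p l))
    module X = Exchange G (g-+N κ w) (g-inj κ w) (lo ns) (hi ns) (λ e f → uncrossed ns {e} {f}) p b p<b x<y
     (λ q l u h h' → gap q l u (cancel (subst₂ _<_ G-b (off-between l u) h)) (cancel (subst₂ _<_ (off-between l u) G-p h')))
    open X using (Target)
    open Descent G (g-+N κ w) (g-inj κ w) (lo ns) (hi ns) (λ e f → uncrossed ns {e} {f}) using (Down)
    -- Cutting just above `G b` puts p and b inside the window, while the arc of b leads below it.
    σ : ℤ
    σ = G b + 1ℤ
    module D = Decoding σ κ w ns
    in-window : ∀ q → G b < q → q ≤ G b + N → Σ ℕ λ u → u ℕ.< n × q ≡ σ + + u
    in-window q h h' = inWindow σ q (lia 2 (λ x q → x <: q => x :+ #1 =< q) (G b) q h) (lia 3 (λ x q N → q =< x :+ N => q <: x :+ #1 :+ N) (G b) q N h')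
    slot-lo : ∀ u → G b < σ + + u
    slot-lo u = lia 2 (λ x u → #0 =< u => x <: x :+ #1 :+ u) (G b) (+ u) 0≤+
    slot-hi : ∀ {u} → u ℕ.< n → σ + + u ≤ G b + N
    slot-hi {u} lt = lia 3 (λ x u N → u <: N => x :+ #1 :+ u =< x :+ N) (G b) (+ u) N (subst (+ u <_) (sym N-def) (+<+ lt))
    hole-≤ : ∀ b' → G (σ + + hol D.K b') ≤ G b
    hole-≤ b' = lia 4 (λ a T x N → a ≐ T :- N => T =< x :+ N => a =< x) (G (σ + + hol D.K b')) (σ + + top D.K b') (G b) N (D.holes-match b') (slot-hi (top<t D.K b'))
    module C = Descent.Colours G (g-+N κ w) (g-inj κ w) (lo ns) (hi ns) (λ e f → uncrossed ns {e} {f}) σ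
    tops : ∀ b' → σ + + top D.K b' ≡ σ + + hol D.K b' ⊎ Down (σ + + top D.K b') (σ + + hol D.K b')
    tops b' with C.top-down D.K (D.Scan.arcs D.P) b'
    ... | inj₁ e = inj₁ (cong (λ u → σ + + u) e)
    ... | inj₂ d = inj₂ d
    cut' : ∀ q → G b < q → q ≤ G b + N → G q ≤ G b → Σ ℤ λ T → G q ≡ T - N × T ≤ G b + N × (T ≡ q ⊎ Down T q)
    cut' q h h' h'' with in-window q h h'
    ... | v , v<n , refl with slotView D.K v v<n
    ... | isFree f = ⊥-elim (<⇒≱ h (subst (_≤ G b) (D.Scan.frees D.P f) h''))
    ... | isArc u a = ⊥-elim (<⇒≱ (slot-lo u) (subst (_≤ G b) (D.Scan.arcs D.P a) h''))
    ... | isHole b' refl = σ + + top D.K b' , D.holes-match b' , slot-hi (top<t D.K b') , tops b'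
    climb : ∀ q → G b < q → q ≤ G b + N → G b < G q → G q < q →
         Σ ℤ λ h → G b < h × G h ≤ G b × Down q h × Σ ℤ λ T → G h ≡ T - N × q ≤ T × T ≤ G b + N × (T ≡ h ⊎ Down T h)
    climb q h h' h'' h''' with in-window q h h'
    ... | v , v<n , refl with slotView D.K v v<n
    ... | isFree f = ⊥-elim (<-irrefl (D.Scan.frees D.P f) h''')
    ... | isHole b' refl = ⊥-elim (<⇒≱ h'' (hole-≤ b'))
    ... | isArc u a with C.arc-down D.K (D.Scan.arcs D.P) a
    ... | b' , d , le = σ + + hol D.K b' , slot-lo (hol D.K b') , hole-≤ b' , d , σ + + top D.K b' , D.holes-match b' , +-monoʳ-≤ σ (+≤+ le) , slot-hi (top<t D.K b') , tops b'
    module W = X.WithWindow cut' climb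

    from-target : Target → Partner
    from-target T = record { a = a ; a<p = a<p ; p<a+N = p<a+N
      ; near'' = near R.lo2 R.hi2 (λ {e} {f} → R.unc2 e f)
      ; ℓ'' = subst (λ q → ℓ (y ⇌ a , q) ≡ suc (ℓ y)) (sym p≡) (cover-up d y a (lia 4 (λ p a d N → p ≐ a :+ (#1 :+ d) => p <: a :+ N => #1 :+ d <: N) p a (+ d) N p≡ p<a+N)
         (subst (λ q → to y a < to y q) p≡ rise) (λ q l u → no-gap q l (subst (q <_) (sym p≡) u) ∘2 p≡)) }
     where
     open Target T
     y'' : AP
     y'' = y ⇌ a , p
     a~/p : a ~/ p
     a~/p = near-~/ a<p p<a+N
     d : ℕ
     d = proj₁ (offset a<p)
     p≡ : p ≡ a + + suc d
     p≡ = proj₂ (offset a<p)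
     turn : ∀ q → g κ y (q - N) ≡ g κ y q - N
     turn q = lia 3 (λ u v N → v ≐ u :+ N => u ≐ v :- N) (g κ y (q - N)) (g κ y q) N (trans (cong (g κ y) (lia 2 (λ q N → q ≐ q :- N :+ N) q N)) (g-+N κ y (q - N)))
     Y-a : g κ y a ≡ z
     Y-a with shape
     ... | inj₁ (a<b , b<a+N , z≡ , _) = trans (sym (G-off a~/p (near-~/ a<b b<a+N))) (sym z≡)
     ... | inj₂ (b≡ , _ , y≡p , _ , z≡) = trans (cong (g κ y) (lia 3 (λ a b N → b ≐ a :+ N => a ≐ b :- N) a b N b≡)) (trans (turn b) (trans (cong (_- N) (trans (sym G-p) y≡p)) (sym z≡)))
     g''-a : g κ y'' a ≡ G b
     g''-a = trans (cong (_+ κ) (⇌-a y a~/p)) (sym G-b)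
     g''-p : g κ y'' p ≡ z
     g''-p = trans (cong (_+ κ) (⇌-b y a~/p)) Y-a
     g''-b : g κ y'' b ≡ u
     g''-b with shape
     ... | inj₁ (a<b , b<a+N , _ , u≡) = trans (cong (_+ κ) (⇌-off y (λ e → near-~/ a<b b<a+N (~-sym e)) (p~/b ∘ ~-sym))) (trans (sym G-p) (sym u≡))
     ... | inj₂ (b≡ , x≡a , _ , u≡ , _) = trans (cong (g κ y'') b≡) (trans (g-+N κ y'' a) (trans (cong (_+ N) (trans g''-a x≡a)) (trans (sym b≡) (sym u≡))))
     new : ∀ i → g κ y'' (three a p b i) ≡ three (G b) z u i
     new zero = g''-a
     new (suc zero) = g''-p
     new (suc (suc zero)) = g''-b
     old : ∀ q → (∀ i → q ~/ three a p b i) → g κ y'' q ≡ G q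
     old q ne = trans (cong (_+ κ) (⇌-off y (ne zero) (ne (suc zero)))) (sym (G-off (ne (suc zero)) (ne (suc (suc zero)))))
     module R = Redirect G (g κ y'') (g-per κ w) (g-per κ y'') (lo ns) (hi ns) (λ e f → uncrossed ns {e} {f})
      (three (G b) z u) (three a p b) new old loU hiU in1 in2 pair
     rise : to y a < to y p
     rise = cancel (subst₂ _<_ (sym Y-a) G-b z<x)
     no-gap : ∀ q → a < q → q < p → to y a < to y q → to y q < to y p → ⊥
     no-gap q l u h h' = gap' q l u (subst₂ _<_ Y-a (sym Gq) (+-monoˡ-< κ h)) (subst₂ _<_ (sym Gq) (sym G-b) (+-monoˡ-< κ h'))
      where
      Gq : G q ≡ g κ y q
      Gq = G-off (near-~/ u (lia 4 (λ p a q N → p <: a :+ N => a <: q => p <: q :+ N) p a q N p<a+N l)) q~/b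
       where
       q~/b : q ~/ b
       q~/b with shape
       ... | inj₁ (_ , b<a+N , _) = near-~/ (<-trans u p<b) (lia 4 (λ p a q N → p <: a :+ N => a <: q => p <: q :+ N) b a q N b<a+N l)
       ... | inj₂ (b≡ , _) = near-~/ (<-trans u p<b) (lia 4 (λ b a q N → b ≐ a :+ N => a <: q => b <: q :+ N) b a q N b≡ l)
     _∘2_ : ∀ {q} → (to y a < to y q → to y q < to y p → ⊥) → p ≡ a + + suc d → to y a < to y q → to y q < to y (a + + suc d) → ⊥
     _∘2_ {q} f e h h' = f h (subst (λ r → to y q < to y r) (sym e) h')

    lem : _ → Partner
    lem (tri< l _ _) = from-target (W.attached l)
    lem (tri≈ _ e _) = from-target (W.detached e)
    lem (tri> _ _ l) = ⊥-elim (<⇒≱ l (hi ns p))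

  -- Either the value at b violates the gap condition of b', or, after the swap of p and b, the arcs
  -- of b' and b cross.
  rise-unique : ∀ {y p b b'} → p < b → b < b' → Rise y p b → Rise y p b' → ⊥
  rise-unique {y} {p} {b} {b'} p<b b<b' R R' = lem (<-cmp (to y b) (to y b'))
   where
   open Rise
   b~/b' : b ~/ b'
   b~/b' = near-~/ b<b' (lia 4 (λ b b' p N → p <: b => b' <: p :+ N => b' <: b :+ N) b b' p N p<b (near-p (<-trans p<b b<b') R'))
   lem : _ → ⊥
   lem (tri< l _ _) = gap R' b p<b b<b' (asc R) l
   lem (tri≈ _ e _) = <-irrefl (to-inj y e) b<b'
   lem (tri> _ _ l) = uncrossed (ns R) {b'} {b}
    (subst (b' - N ≤_) (trans (cong (_+ κ) (⇌-b y (p~/b R'))) (sym (cong (_+ κ) (⇌-b y (p~/b R))))) (lo (ns R') b'))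
    (subst₂ _<_ (sym (cong (_+ κ) (⇌-b y (p~/b R)))) (sym aside) (+-monoˡ-< κ (asc R')))
    (subst (_< b) (sym aside) (<-≤-trans (+-monoˡ-< κ l) (≤-trans (subst (_≤ p) (cong (_+ κ) (⇌-a y (p~/b R))) (hi (ns R) p)) (<⇒≤ p<b))))
    b<b'
    where
    aside : g κ (y ⇌ p , b) b' ≡ g κ y b'
    aside = cong (_+ κ) (⇌-off y (p~/b R' ∘ ~-sym) (b~/b' ∘ ~-sym))

 -- Counting covers over a period

 ∼0≤1 : 0ℚ ℚ.≤ 1ℚ
 ∼0≤1 = toWitness {a? = 0ℚ ℚP.≤? 1ℚ} _

 sumTo-mono : ∀ {f h : ℕ → ℚ} m → (∀ i → i ℕ.< m → f i ℚ.≤ h i) → sumTo m f ℚ.≤ sumTo m h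
 sumTo-mono zero le = ℚP.≤-refl
 sumTo-mono (suc m) le = ℚP.+-mono-≤ (sumTo-mono m (λ i lt → le i (m<n⇒m<1+n lt))) (le m (n<1+n m))

 sumTo-nonneg : ∀ {f : ℕ → ℚ} m → (∀ i → i ℕ.< m → 0ℚ ℚ.≤ f i) → 0ℚ ℚ.≤ sumTo m f
 sumTo-nonneg {f} m h = subst (ℚ._≤ sumTo m f) (sumTo-zero m (λ _ _ → refl)) (sumTo-mono {λ _ → 0ℚ} m h)

 sumTo-term : ∀ {f : ℕ → ℚ} m i → i ℕ.< m → (∀ i → i ℕ.< m → 0ℚ ℚ.≤ f i) → f i ℚ.≤ sumTo m f
 sumTo-term {f} (suc m) i lt h with i ℕP.≟ m
 ... | yes refl = subst (ℚ._≤ sumTo (suc i) f) (ℚP.+-identityˡ (f i)) (ℚP.+-monoˡ-≤ (f i) (sumTo-nonneg i (λ j lt → h j (m<n⇒m<1+n lt))))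
 ... | no ne = subst (ℚ._≤ sumTo (suc m) f) (ℚP.+-identityʳ (f i)) (ℚP.+-mono-≤ (sumTo-term m i (ℕP.≤∧≢⇒< (<⇒≤pred lt) ne) (λ j lt → h j (m<n⇒m<1+n lt))) (h m (n<1+n m)))

 sumTo-swap : ∀ m m' (f : ℕ → ℕ → ℚ) → sumTo m (λ i → sumTo m' (f i)) ≡ sumTo m' (λ j → sumTo m (λ i → f i j))
 sumTo-swap zero m' f = sym (sumTo-zero m' (λ _ _ → refl))
 sumTo-swap (suc m) m' f = trans (cong (ℚ._+ sumTo m' (f m)) (sumTo-swap m m' f)) (sym (sumTo-+ (λ j → sumTo m (λ i → f i j)) (f m) m'))

 sumTo-shift : ∀ m (f : ℕ → ℚ) → f 0 ℚ.+ sumTo m (λ i → f (suc i)) ≡ sumTo m f ℚ.+ f m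
 sumTo-shift zero f = ℚP.+-comm (f 0) 0ℚ
 sumTo-shift (suc m) f = trans (sym (ℚP.+-assoc (f 0) (sumTo m (λ i → f (suc i))) (f (suc m)))) (cong (ℚ._+ f (suc m)) (sumTo-shift m f))

 sumTo-rotate : ∀ m (f : ℕ → ℚ) → f m ≡ f 0 → sumTo m (λ i → f (suc i)) ≡ sumTo m f
 sumTo-rotate m f e = ∙-cancelˡ (f 0) _ _ (trans (sumTo-shift m f) (trans (cong (sumTo m f ℚ.+_) e) (ℚP.+-comm (sumTo m f) (f 0))))

 sum-window : ∀ (h : ℤ → ℚ) → (∀ q → h (q + N) ≡ h q) → ∀ d p → sumTo n (λ i → h (p + + i - + d)) ≡ sumTo n (λ i → h (p + + i))
 sum-window h per zero p = sumTo-cong n (λ i _ → cong h (+-identityʳ (p + + i)))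
 sum-window h per (suc d) p = trans (sym (trans (sumTo-cong n (λ i _ → cong h (lia 3 (λ p i d → p :+ i :- d ≐ p :+ (#1 :+ i) :- (#1 :+ d)) p (+ i) (+ d)))) (sumTo-rotate n (λ i → h (p + + i - + suc d))
   (trans (cong h (lia 4 (λ p n d N → N ≐ n => p :+ n :- d ≐ p :+ #0 :- d :+ N) p (+ n) (+ suc d) N N-def)) (per (p + 0ℤ - + suc d)))))) (sum-window h per d p)

 nonpositive-sum : ∀ {f : ℕ → ℚ} m → (∀ i → i ℕ.< m → f i ℚ.≤ 0ℚ) → sumTo m f ≡ 0ℚ → ∀ i → i ℕ.< m → f i ≡ 0ℚ
 nonpositive-sum {f} m h e i lt = ℚP.≤-antisym (h i lt) (subst (ℚ._≤ f i) e (subst (sumTo m f ℚ.≤_) (sumTo-single {λ j → pick j (j ℕP.≟ i)} m i lt (λ j _ ne → pick-no j ne) ∙ pick-yes) (sumTo-mono m λ j lt' → below j lt' (j ℕP.≟ i))))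
  where
  _∙_ = trans
  pick : ∀ j → Dec (j ≡ i) → ℚ
  pick j (yes _) = f i
  pick j (no _) = 0ℚ
  pick-no : ∀ j → j ≢ i → pick j (j ℕP.≟ i) ≡ 0ℚ
  pick-no j ne with j ℕP.≟ i
  ... | yes e = ⊥-elim (ne e)
  ... | no _ = refl
  pick-yes : pick i (i ℕP.≟ i) ≡ f i
  pick-yes with i ℕP.≟ i
  ... | yes _ = refl
  ... | no ne = ⊥-elim (ne refl)
  below : ∀ j → j ℕ.< m → (d : Dec (j ≡ i)) → f j ℚ.≤ pick j d
  below j lt (yes refl) = ℚP.≤-refl
  below j lt (no _) = h j lt

 module Indicator (κ : ℤ) (L : ℕ) (F : Fun) (ext : Ext F)
  (view : ∀ y → (Near κ y × Balanced y × ℓ y ≡ L × F y ≡ 1ℚ) ⊎ (¬ (Near κ y × Balanced y × ℓ y ≡ L) × F y ≡ 0ℚ)) (y : AP) where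

  private
   Term : ℤ → ℤ → Set
   Term a b = Near κ (y ⇌ a , b) × ℓ (y ⇌ a , b) ≡ suc (ℓ y) × Balanced (y ⇌ a , b) × ℓ (y ⇌ a , b) ≡ L × cov F y a b ≡ 1ℚ

   one-at : ∀ {z} → Near κ z × Balanced z × ℓ z ≡ L → F z ≡ 1ℚ
   one-at {z} S with view z
   ... | inj₁ (_ , _ , _ , f) = f
   ... | inj₂ (unsupported , _) = ⊥-elim (unsupported S)

   term : ∀ a b → Term a b ⊎ cov F y a b ≡ 0ℚ
   term a b with ℓ (y ⇌ a , b) ℕP.≟ suc (ℓ y)
   ... | no ne = inj₂ (cov-no ne)
   ... | yes e with view (y ⇌ a , b)
   ... | inj₁ (S , bal , l , f) = inj₁ (S , e , bal , l , trans (cov-yes e) f)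
   ... | inj₂ (_ , f) = inj₂ (trans (cov-yes e) f)

   term-~/ : ∀ {a b} → ℓ (y ⇌ a , b) ≡ suc (ℓ y) → a ~/ b
   term-~/ {a} {b} e h = suc≢ (trans (sym (ℓ-cong (agree λ m → cong (to y) (swap-~ h m)))) e)

   nonneg : ∀ a b → 0ℚ ℚ.≤ cov F y a b
   nonneg a b with term a b
   ... | inj₁ (_ , _ , _ , _ , e) = subst (0ℚ ℚ.≤_) (sym e) ∼0≤1
   ... | inj₂ e = ℚP.≤-reflexive (sym e)

   rise : ∀ {p b} → p < b → Term p b → Rise κ y p b
   rise {p} {b} p<b (S , e , _) = record { p~/b = ne ; asc = asc ; ns = S ; gap = gap }
    where
    ne : p ~/ b
    ne = term-~/ e
    asc : to y p < to y b
    asc = up-ordered y p<b (ℕP.≤-reflexive (sym e))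
    b<p+N : b < p + N
    b<p+N = lia 7 (λ b p yp yb gp gb N → gp ≐ yb => gb ≐ yp => yp <: yb => b :- N =< gb => gp =< p => b <: p :+ N) b p (g κ y p) (g κ y b) (g κ (y ⇌ p , b) p) (g κ (y ⇌ p , b) b) N
     (cong (_+ κ) (⇌-a y ne)) (cong (_+ κ) (⇌-b y ne)) (+-monoˡ-< κ asc) (lo S b) (hi S p)
    gap : ∀ q → p < q → q < b → to y p < to y q → to y q < to y b → ⊥
    gap q l u h h' = obstructed y l u (near-~/ l (<-trans u b<p+N)) (near-~/ u (lia 4 (λ b p q N → b <: p :+ N => p <: q => b <: q :+ N) b p q N b<p+N l)) ne h h' e

   A B : ℕ → ℤ → ℚ
   A M p = sumTo M (λ d → cov F y p (p + + suc d))
   B M p = sumTo M (λ d → cov F y (p - + suc d) p)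

   beyond : ∀ p d → p < p + + suc d
   beyond p d = lia 2 (λ p d → #0 =< d => p <: p :+ (#1 :+ d)) p (+ d) 0≤+

   search : ∀ M p → (Σ ℕ λ d → d ℕ.< M × Term p (p + + suc d)) ⊎ (∀ d → d ℕ.< M → cov F y p (p + + suc d) ≡ 0ℚ)
   search zero p = inj₂ λ _ ()
   search (suc M) p with term p (p + + suc M) | search M p
   ... | inj₁ t | _ = inj₁ (M , n<1+n M , t)
   ... | inj₂ _ | inj₁ (d , lt , t) = inj₁ (d , m<n⇒m<1+n lt , t)
   ... | inj₂ e | inj₂ h = inj₂ λ d lt → lem d lt (d ℕP.≟ M)
    where
    lem : ∀ d → d ℕ.< suc M → Dec (d ≡ M) → cov F y p (p + + suc d) ≡ 0ℚ
    lem d lt (yes refl) = e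
    lem d lt (no ne) = h d (ℕP.≤∧≢⇒< (<⇒≤pred lt) ne)

   -- The right-hand count has at most one nonzero term, by `rise-unique`, and then `partner`
   -- provides a term of the left-hand count. Its distance is below n, whence the bound on M.
   A≤B : ∀ M p → n ℕ.≤ M → A M p ℚ.≤ B M p
   A≤B M p n≤M with search M p
   ... | inj₂ h = subst (ℚ._≤ B M p) (sym (sumTo-zero M h)) (sumTo-nonneg M (λ d _ → nonneg (p - + suc d) p))
   ... | inj₁ (d , d<M , t) = subst (ℚ._≤ B M p) (sym (trans (sumTo-single M d d<M others) (t-cov t))) bound
    where
    t-cov : ∀ {a b} → Term a b → cov F y a b ≡ 1ℚ
    t-cov (_ , _ , _ , _ , e) = e
    R : Rise κ y p (p + + suc d)
    R = rise (beyond p d) t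
    others : ∀ i → i ℕ.< M → i ≢ d → cov F y p (p + + suc i) ≡ 0ℚ
    others i i<M ne with term p (p + + suc i)
    ... | inj₂ e = e
    ... | inj₁ t' with ℕP.<-cmp i d
    ... | tri< l _ _ = ⊥-elim (rise-unique κ (beyond p i) (+-monoʳ-< p (+<+ (ℕ.s≤s l))) (rise (beyond p i) t') R)
    ... | tri≈ _ e _ = ⊥-elim (ne e)
    ... | tri> _ _ l = ⊥-elim (rise-unique κ (beyond p d) (+-monoʳ-< p (+<+ (ℕ.s≤s l))) R (rise (beyond p i) t'))
    open Partner (partner κ (beyond p d) R)
    e : ℕ
    e = proj₁ (offset a<p)
    p≡ : p ≡ a + + suc e
    p≡ = proj₂ (offset a<p)
    a≡ : p - + suc e ≡ a
    a≡ = lia 3 (λ p a e → p ≐ a :+ e => p :- e ≐ a) p a (+ suc e) p≡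
    e<M : e ℕ.< M
    e<M = ℕP.≤-trans (ℕP.<⇒≤ (drop‿+<+ (subst (+ suc e <_) N-def (lia 4 (λ p a e N → p ≐ a :+ e => p <: a :+ N => e <: N) p a (+ suc e) N p≡ p<a+N)))) n≤M
    cov'' : cov F y a p ≡ 1ℚ
    cov'' = trans (cov-yes ℓ'') (one-at (near'' , trans (balance-⇌ y (term-~/ ℓ'')) (trans (sym (balance-⇌ y (Rise.p~/b R))) (proj₁ (proj₂ (proj₂ t)))) ,
        trans ℓ'' (trans (sym (proj₁ (proj₂ t))) (proj₁ (proj₂ (proj₂ (proj₂ t)))))))
    bound : 1ℚ ℚ.≤ B M p
    bound = subst (ℚ._≤ B M p) (trans (cong (λ q → cov F y q p) a≡) cov'') (sumTo-term M e e<M (λ d _ → nonneg (p - + suc d) p))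

   cov-per : ∀ a b → cov F y (a + N) (b + N) ≡ cov F y a b
   cov-per a b = lem (a ~? b)
    where
    trivial : ∀ a b → a ~ b → cov F y a b ≡ 0ℚ
    trivial a b h = cov-no (λ e → term-~/ e h)
    lem : Dec (a ~ b) → cov F y (a + N) (b + N) ≡ cov F y a b
    lem (yes h) = trans (trivial (a + N) (b + N) (~-shift N h)) (sym (trivial a b h))
    lem (no ne) = step (ℓ (y ⇌ a , b) ℕP.≟ suc (ℓ y))
     where
     ne' : a + N ~/ b + N
     ne' h = ne (~-trans (~-sym ~-+N) (~-trans h ~-+N))
     same : y ⇌ a + N , b + N ≗A y ⇌ a , b
     same = agree λ m → cong (to y) (trans (swap-tr ne' m) (trans (sym (tr-lift 1ℤ ne (cong (λ z → a + z) (sym 1·N)) (cong (λ z → b + z) (sym 1·N)) m)) (sym (swap-tr ne m))))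
     step : Dec (ℓ (y ⇌ a , b) ≡ suc (ℓ y)) → cov F y (a + N) (b + N) ≡ cov F y a b
     step (yes e) = trans (cov-yes (trans (ℓ-cong same) e)) (trans (ext same) (sym (cov-yes e)))
     step (no nq) = trans (cov-no (nq ∘ trans (sym (ℓ-cong same)))) (sym (cov-no nq))

   -- Over a full period every cover is counted once at its left end and once at its right end.
   total : ∀ M p → sumTo n (λ i → A M (p + + i)) ≡ sumTo n (λ i → B M (p + + i))
   total M p = trans (sumTo-swap n M (λ i d → cov F y (p + + i) (p + + i + + suc d))) (trans (sumTo-cong M (λ d _ → each d)) (sym (sumTo-swap n M (λ i d → cov F y (p + + i - + suc d) (p + + i)))))
    where
    each : ∀ d → sumTo n (λ i → cov F y (p + + i) (p + + i + + suc d)) ≡ sumTo n (λ i → cov F y (p + + i - + suc d) (p + + i))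
    each d = trans (sym (sum-window h (λ q → trans (cong (cov F y (q + N)) (lia 3 (λ q d N → q :+ N :+ d ≐ q :+ d :+ N) q (+ suc d) N)) (cov-per q (q + + suc d))) (suc d) p))
      (sumTo-cong n (λ i _ → cong (cov F y (p + + i - + suc d)) (lia 2 (λ q d → q :- d :+ d ≐ q) (p + + i) (+ suc d))))
     where
     h : ℤ → ℚ
     h q = cov F y q (q + + suc d)

   sumTo-neg : ∀ (f : ℕ → ℚ) m → sumTo m (λ i → ℚ.- f i) ≡ ℚ.- sumTo m f
   sumTo-neg f zero = refl
   sumTo-neg f (suc m) = trans (cong (ℚ._+ (ℚ.- f m)) (sumTo-neg f m)) (sym (ℚP.neg-distrib-+ (sumTo m f) (f m)))

   sumTo-minus : ∀ (f h : ℕ → ℚ) m → sumTo m (λ i → f i ℚ.- h i) ≡ sumTo m f ℚ.- sumTo m h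
   sumTo-minus f h m = trans (sumTo-+ f (λ i → ℚ.- h i) m) (cong (sumTo m f ℚ.+_) (sumTo-neg h m))

   monk-AB : ∀ M p → monk M p F y ≡ A M p ℚ.- B M p
   monk-AB M p = sumTo-minus (λ d → cov F y p (p + + suc d)) (λ d → cov F y (p - + suc d) p) M

  -- The differences at the positions of a period are nonpositive and sum to 0.
  monk-vanishes : ∀ p M → n ℕ.≤ M → monk M p F y ≡ 0ℚ
  monk-vanishes p M n≤M = trans (cong (λ q → monk M q F y) (sym (+-identityʳ p)))
   (nonpositive-sum {λ i → monk M (p + + i) F y} n
    (λ i _ → subst (ℚ._≤ 0ℚ) (sym (monk-AB M (p + + i))) (subst (A M (p + + i) ℚ.- B M (p + + i) ℚ.≤_) (ℚP.+-inverseʳ (B M (p + + i))) (ℚP.+-monoˡ-≤ (ℚ.- B M (p + + i)) (A≤B M (p + + i) n≤M))))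
    (trans (sumTo-cong n (λ i _ → monk-AB M (p + + i))) (trans (sumTo-minus (λ i → A M (p + + i)) (λ i → B M (p + + i)) n)
     (trans (cong (ℚ._- sumTo n (λ i → B M (p + + i))) (total M p)) (ℚP.+-inverseʳ (sumTo n (λ i → B M (p + + i))))))) 0 (ℕ.s≤s ℕ.z≤n))

 indicator-Ker : ∀ κ L F → Ext F →
  (∀ y → (Near κ y × Balanced y × ℓ y ≡ L × F y ≡ 1ℚ) ⊎ (¬ (Near κ y × Balanced y × ℓ y ≡ L) × F y ≡ 0ℚ)) → Ker F
 indicator-Ker κ L F ext view y p = n , λ M n≤M → Indicator.monk-vanishes κ L F ext view y p M n≤M

 -- Configurations as diagrams with removed cells

 -- The partition of a configuration: one part per particle, from right to left, counting the holes to its left.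
 partition : ∀ {t j} → Conf t j → List ℕ
 partition ε = []
 partition (hole C) = partition C
 partition (free {j = j} C) = j ∷ partition C
 partition (att {j = j} C _) = j ∷ partition C

 -- Holes are numbered from the most recent one, columns from the left.
 column : ∀ {j} → Fin j → ℕ
 column {j} b = j ℕ.∸ toℕ b

 removed : ∀ {t j} → Conf t j → ℕ → List Cell
 removed ε a = []
 removed (hole C) a = removed C a
 removed (free C) a = removed C (suc a)
 removed (att C b) a = (a , column b) ∷ removed C (suc a)

 column≤ : ∀ {j} (b : Fin j) → column b ℕ.≤ j
 column≤ {j} b = ℕP.m∸n≤m j (toℕ b)

 1≤column : ∀ {j} (b : Fin j) → 1 ℕ.≤ column b
 1≤column b = ℕP.m<n⇒0<n∸m (Finₚ.toℕ<n b)

 rowW : (Cell → Bool) → ℕ → ℕ → Word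
 rowW mem r zero = []
 rowW mem r (suc B) = (if mem (r , suc B) then List.[ residue k (r , suc B) ] else []) ++ rowW mem r B

 rowW-concat : ∀ mem r B → concatMap (λ b → if mem (r , b) then List.[ residue k (r , b) ] else []) (map suc (downFrom B)) ≡ rowW mem r B
 rowW-concat mem r zero = refl
 rowW-concat mem r (suc B) = cong ((if mem (r , suc B) then List.[ residue k (r , suc B) ] else []) ++_) (rowW-concat mem r B)

 rowsFrom : (Cell → Bool) → ℕ → ℕ → ℕ → Word
 rowsFrom mem B a zero = []
 rowsFrom mem B a (suc r) = rowsFrom mem B (suc a) r ++ rowW mem (suc a) B

 rowsFrom-top : ∀ mem B a r → rowW mem (suc (a ℕ.+ r)) B ++ rowsFrom mem B a r ≡ rowsFrom mem B a (suc r)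
 rowsFrom-top mem B a zero = trans (++-identityʳ _) (cong (λ z → rowW mem (suc z) B) (ℕP.+-identityʳ a))
 rowsFrom-top mem B a (suc r) = trans (sym (++-assoc (rowW mem (suc (a ℕ.+ suc r)) B) (rowsFrom mem B (suc a) r) (rowW mem (suc a) B)))
  (cong (_++ rowW mem (suc a) B) (trans (cong (λ z → rowW mem (suc z) B ++ rowsFrom mem B (suc a) r) (+-suc a r)) (rowsFrom-top mem B (suc a) r)))

 readWord-rows : ∀ mem M B → readWord k mem M B ≡ rowsFrom mem B 0 M
 readWord-rows mem zero B = refl
 readWord-rows mem (suc M) B = trans (cong₂ _++_ (rowW-concat mem (suc M) B) (readWord-rows mem M B)) (rowsFrom-top mem B 0 M)

 rowsFrom-+ : ∀ mem B a r r' → rowsFrom mem B a (r ℕ.+ r') ≡ rowsFrom mem B (a ℕ.+ r) r' ++ rowsFrom mem B a r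
 rowsFrom-+ mem B a zero r' = trans (cong (λ z → rowsFrom mem B z r') (sym (ℕP.+-identityʳ a))) (sym (++-identityʳ _))
 rowsFrom-+ mem B a (suc r) r' = trans (cong (_++ rowW mem (suc a) B) (trans (rowsFrom-+ mem B (suc a) r r') (cong (λ z → rowsFrom mem B z r' ++ rowsFrom mem B (suc a) r) (sym (+-suc a r)))))
  (++-assoc (rowsFrom mem B (a ℕ.+ suc r) r') (rowsFrom mem B (suc a) r) (rowW mem (suc a) B))

 row-absent : ∀ mem r j h → (∀ b → j ℕ.< b → b ℕ.≤ h ℕ.+ j → mem (r , b) ≡ false) → rowW mem r (h ℕ.+ j) ≡ rowW mem r j
 row-absent mem r j zero f = refl
 row-absent mem r j (suc h) f = trans (cong (λ t → (if t then List.[ residue k (r , suc (h ℕ.+ j)) ] else []) ++ rowW mem r (h ℕ.+ j)) (f (suc (h ℕ.+ j)) (ℕ.s≤s (m≤n+m j h)) ℕP.≤-refl))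
  (row-absent mem r j h (λ b l u → f b l (m≤n⇒m≤1+n u)))

 row-none : ∀ mem r j → (∀ b → 1 ℕ.≤ b → b ℕ.≤ j → mem (r , b) ≡ false) → rowW mem r j ≡ []
 row-none mem r j f = trans (cong (rowW mem r) (sym (ℕP.+-identityʳ j))) (row-absent mem r 0 j λ b l u → f b l (ℕP.≤-trans u (ℕP.≤-reflexive (ℕP.+-identityʳ j))))

 row-sweep : ∀ mem r j h ρ → ρ ≡ + j + 1ℤ - + r → rowW mem r j ≡ [] → (∀ b → j ℕ.< b → b ℕ.≤ h ℕ.+ j → mem (r , b) ≡ true) → rowW mem r (h ℕ.+ j) ≡ sweepW ρ h
 row-sweep mem r j zero ρ e z f = z
 row-sweep mem r j (suc h) ρ e z f = trans (cong (λ t → (if t then List.[ residue k (r , suc (h ℕ.+ j)) ] else []) ++ rowW mem r (h ℕ.+ j)) (f (suc (h ℕ.+ j)) (ℕ.s≤s (m≤n+m j h)) ℕP.≤-refl))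
  (cong₂ _∷_ (cong res (lia 4 (λ ρ j r h → ρ ≐ j :+ #1 :- r => #1 :+ (h :+ j) :- r ≐ ρ :+ h) ρ (+ j) (+ r) (+ h) e)) (row-sweep mem r j h ρ e z (λ b l u → f b l (m≤n⇒m≤1+n u))))

 row-full : ∀ mem r h ρ → ρ ≡ 1ℤ - + r → (∀ b → 1 ℕ.≤ b → b ℕ.≤ h → mem (r , b) ≡ true) → rowW mem r h ≡ sweepW ρ h
 row-full mem r h ρ e f = trans (cong (rowW mem r) (sym (ℕP.+-identityʳ h))) (row-sweep mem r 0 h ρ (trans e (lia 1 (λ r → #1 :- r ≐ #0 :+ #1 :- r) (+ r))) refl
  (λ b l u → f b l (ℕP.≤-trans u (ℕP.≤-reflexive (ℕP.+-identityʳ h)))))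

 row-skip : ∀ mem r {j} (β : Fin j) ρ → ρ ≡ 1ℤ - + r → (∀ b → 1 ℕ.≤ b → b ℕ.≤ j → b ≢ column β → mem (r , b) ≡ true) → mem (r , column β) ≡ false →
  rowW mem r j ≡ skipW ρ β
 row-skip mem r {suc j} zero ρ e f g = trans (cong (λ t → (if t then List.[ residue k (r , suc j) ] else []) ++ rowW mem r j) g)
  (row-full mem r j ρ e (λ b l u → f b l (m≤n⇒m≤1+n u) (<⇒≢ (ℕ.s≤s u))))
 row-skip mem r {suc j} (suc β) ρ e f g = trans (cong (λ t → (if t then List.[ residue k (r , suc j) ] else []) ++ rowW mem r j)
   (f (suc j) (ℕ.s≤s ℕ.z≤n) ℕP.≤-refl (λ q → <⇒≢ (ℕ.s≤s (column≤ β)) (sym q))))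
  (cong₂ _∷_ (cong res (lia 3 (λ ρ j r → ρ ≐ #1 :- r => #1 :+ j :- r ≐ ρ :+ j) ρ (+ j) (+ r) e)) (row-skip mem r β ρ e (λ b l u ne → f b l (m≤n⇒m≤1+n u) ne) g))

 -- The predicate mem describes, from row a + 1 downwards, the bottom part of the diagram of a configuration.
 Bottom : ∀ {t j} → Conf t j → ℕ → ℕ → (Cell → Bool) → Set
 Bottom ε B a mem = ⊤
 Bottom (hole C) B a mem = Bottom C B a mem
 Bottom (free {j = j} C) B a mem = (∀ b → 1 ℕ.≤ b → b ℕ.≤ j → mem (suc a , b) ≡ true) × (∀ b → j ℕ.< b → b ℕ.≤ B → mem (suc a , b) ≡ false) × Bottom C B (suc a) mem
 Bottom (att {j = j} C β) B a mem = ((∀ b → 1 ℕ.≤ b → b ℕ.≤ j → b ≢ column β → mem (suc a , b) ≡ true) × mem (suc a , column β) ≡ false) ×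
  (∀ b → j ℕ.< b → b ℕ.≤ B → mem (suc a , b) ≡ false) × Bottom C B (suc a) mem

 Top : ∀ {t j} → Conf t j → ℕ → ℕ → (Cell → Bool) → Set
 Top ε B a mem = ⊤
 Top (hole C) B a mem = Top C B a mem
 Top (free {j = j} C) B a mem = (∀ b → 1 ℕ.≤ b → b ℕ.≤ j → mem (suc a , b) ≡ false) × (∀ b → j ℕ.< b → b ℕ.≤ B → mem (suc a , b) ≡ true) × Top C B (suc a) mem
 Top (att {j = j} C β) B a mem = (∀ b → 1 ℕ.≤ b → b ℕ.≤ j → mem (suc a , b) ≡ false) × (∀ b → j ℕ.< b → b ℕ.≤ B → mem (suc a , b) ≡ true) × Top C B (suc a) mem

 private
  trim : ∀ mem r j B → j ℕ.≤ B → (∀ b → j ℕ.< b → b ℕ.≤ B → mem (r , b) ≡ false) → rowW mem r B ≡ rowW mem r j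
  trim mem r j B le f = trans (cong (rowW mem r) (sym (m∸n+n≡m le))) (row-absent mem r j (B ℕ.∸ j) (λ b l u → f b l (ℕP.≤-trans u (ℕP.≤-reflexive (m∸n+n≡m le)))))

 -- The equation on σ aligns letters with residues: in the row of the last particle, with one
 -- particle fewer to its left, it reads 1 - (a + 1), the content of the first cell.
 bottom-word : ∀ {t j} (C : Conf t j) B a mem σ → j ℕ.≤ B → Bottom C B a mem → σ + + np C ≡ 1ℤ - + a → rowsFrom mem B a (np C) ≡ botW σ C
 bottom-word ε B a mem σ le _ e = refl
 bottom-word (hole C) B a mem σ le h e = bottom-word C B a mem σ (ℕP.<⇒≤ le) h e
 bottom-word (free {j = j} C) B a mem σ le (f , g , h) e = cong₂ _++_ (bottom-word C B (suc a) mem σ le h e')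
   (trans (trim mem (suc a) j B le g) (row-full mem (suc a) j (σ + + np C) e' f))
  where
  e' : σ + + np C ≡ 1ℤ - + suc a
  e' = lia 3 (λ σ p a → σ :+ (#1 :+ p) ≐ #1 :- a => σ :+ p ≐ #1 :- (#1 :+ a)) σ (+ np C) (+ a) e
 bottom-word (att {j = j} C β) B a mem σ le ((f , z) , g , h) e = cong₂ _++_ (bottom-word C B (suc a) mem σ le h e')
   (trans (trim mem (suc a) j B le g) (row-skip mem (suc a) β (σ + + np C) e' f z))
  where
  e' : σ + + np C ≡ 1ℤ - + suc a
  e' = lia 3 (λ σ p a → σ :+ (#1 :+ p) ≐ #1 :- a => σ :+ p ≐ #1 :- (#1 :+ a)) σ (+ np C) (+ a) e

 -- These rows start in column j + 1, so the content of their first cell is j + 1 minus the row;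
 -- `np+j` rewrites it as s + t.
 top-word : ∀ {t j} (C : Conf t j) B a mem s h → j ℕ.+ h ≡ B → Top C B a mem → s + + np C ≡ 1ℤ - + a → rowsFrom mem B a (np C) ≡ topW s C h
 private
  top-row : ∀ {t j} (C : Conf t j) B a mem s h → j ℕ.+ h ≡ B → (∀ b → 1 ℕ.≤ b → b ℕ.≤ j → mem (suc a , b) ≡ false) → (∀ b → j ℕ.< b → b ℕ.≤ B → mem (suc a , b) ≡ true) →
   s + + np C ≡ 1ℤ - + suc a → rowW mem (suc a) B ≡ sweepW (s + + t) h
  top-row {t} {j} C B a mem s h j+h f g e = trans (cong (rowW mem (suc a)) (trans (sym j+h) (ℕP.+-comm j h))) (row-sweep mem (suc a) j h (s + + t)
   (lia 5 (λ s p t j a → s :+ p ≐ #1 :- a => p :+ j ≐ t => s :+ t ≐ j :+ #1 :- a) s (+ np C) (+ t) (+ j) (+ suc a) e (cong +_ (np+j C)))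
   (row-none mem (suc a) j f) (λ b l u → g b l (ℕP.≤-trans u (ℕP.≤-reflexive (trans (ℕP.+-comm h j) j+h)))))
 top-word ε B a mem s h j+h _ e = refl
 top-word (hole {j = j} C) B a mem s h j+h p e = top-word C B a mem s (suc h) (trans (+-suc j h) j+h) p e
 top-word (free {j = j} C) B a mem s h j+h (f , g , p) e = cong₂ _++_ (top-word C B (suc a) mem s h j+h p e') (top-row C B a mem s h j+h f g e')
  where
  e' : s + + np C ≡ 1ℤ - + suc a
  e' = lia 3 (λ σ p a → σ :+ (#1 :+ p) ≐ #1 :- a => σ :+ p ≐ #1 :- (#1 :+ a)) s (+ np C) (+ a) e
 top-word (att {j = j} C β) B a mem s h j+h (f , g , p) e = cong₂ _++_ (top-word C B (suc a) mem s h j+h p e') (top-row C B a mem s h j+h f g e')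
  where
  e' : s + + np C ≡ 1ℤ - + suc a
  e' = lia 3 (λ σ p a → σ :+ (#1 :+ p) ≐ #1 :- a => σ :+ p ≐ #1 :- (#1 :+ a)) s (+ np C) (+ a) e

 levels : ∀ {t j} → Conf t j → ℕ
 levels ε = 0
 levels (hole C) = levels C
 levels (free {j = j} C) = levels C ℕ.+ j
 levels (att {j = j} C _) = levels C ℕ.+ j

 length-sweepW : ∀ ρ j → length (sweepW ρ j) ≡ j
 length-sweepW ρ zero = refl
 length-sweepW ρ (suc j) = cong suc (length-sweepW ρ j)

 length-skipW : ∀ ρ {j} (b : Fin j) → suc (length (skipW ρ b)) ≡ j
 length-skipW ρ {suc j} zero = cong suc (length-sweepW ρ j)
 length-skipW ρ {suc j} (suc b) = cong suc (length-skipW ρ b)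

 length-botW : ∀ σ {t j} (C : Conf t j) a → length (botW σ C) ℕ.+ length (removed C a) ≡ levels C
 length-botW σ ε a = refl
 length-botW σ (hole C) a = length-botW σ C a
 length-botW σ (free {j = j} C) a = +-injective (lia 5 (λ w u j r L → w ≐ u :+ j => u :+ r ≐ L => w :+ r ≐ L :+ j) (+ length (botW σ (free C))) (+ length (botW σ C)) (+ j) (+ length (removed C (suc a))) (+ levels C)
  (cong +_ (trans (length-++ (botW σ C)) (cong (length (botW σ C) ℕ.+_) (length-sweepW (σ + + np C) j)))) (cong +_ (length-botW σ C (suc a))))
 length-botW σ (att {j = j} C b) a = +-injective (lia 6 (λ w u v j r L → w ≐ u :+ v => #1 :+ v ≐ j => u :+ r ≐ L => w :+ (#1 :+ r) ≐ L :+ j) (+ length (botW σ (att C b))) (+ length (botW σ C)) (+ length (skipW (σ + + np C) b)) (+ j) (+ length (removed C (suc a))) (+ levels C)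
  (cong +_ (length-++ (botW σ C))) (cong +_ (length-skipW (σ + + np C) b)) (cong +_ (length-botW σ C (suc a))))

 length-topW : ∀ s {t j} (C : Conf t j) h → length (topW s C h) ℕ.+ levels C ≡ np C ℕ.* (j ℕ.+ h)
 private
  particle-length : ∀ s {t j} (C : Conf t j) h → length (topW s C h ++ sweepW (s + + t) h) ℕ.+ (levels C ℕ.+ j) ≡ (j ℕ.+ h) ℕ.+ np C ℕ.* (j ℕ.+ h)
  particle-length s {t} {j} C h = +-injective (lia 6 (λ w u h L j p → w ≐ u :+ h => u :+ L ≐ p => w :+ (L :+ j) ≐ j :+ h :+ p) (+ length (topW s C h ++ sweepW (s + + t) h)) (+ length (topW s C h)) (+ h) (+ levels C) (+ j) (+ (np C ℕ.* (j ℕ.+ h)))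
   (cong +_ (trans (length-++ (topW s C h)) (cong (length (topW s C h) ℕ.+_) (length-sweepW (s + + t) h)))) (cong +_ (length-topW s C h)))
 length-topW s ε h = refl
 length-topW s (hole {j = j} C) h = trans (length-topW s C (suc h)) (cong (np C ℕ.*_) (+-suc j h))
 length-topW s (free C) h = particle-length s C h
 length-topW s (att C _) h = particle-length s C h

 -- The cells read in the top rows and in the bottom rows, together with the removed ones, make up
 -- the area of the rectangle.
 length-wordC : ∀ s {j} (C : Conf n j) a → length (wordC s C) ℕ.+ length (removed C a) ≡ np C ℕ.* j
 length-wordC s {j} C a = +-injective (lia 6 (λ x u w r L p → x ≐ u :+ w => u :+ r ≐ L => w :+ L ≐ p => x :+ r ≐ p) (+ length (wordC s C)) (+ length (botW (s - + np C) C)) (+ length (topW s C 0)) (+ length (removed C a)) (+ levels C) (+ (np C ℕ.* j))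
  (cong +_ (length-++ (botW (s - + np C) C))) (cong +_ (length-botW (s - + np C) C a)) (cong +_ (trans (length-topW s C 0) (cong (np C ℕ.*_) (ℕP.+-identityʳ j)))))

 row col : Cell → ℕ
 row = proj₁
 col = proj₂

 ∧-true : ∀ {a b} → a ≡ true → b ≡ true → a ∧ b ≡ true
 ∧-true refl refl = refl

 ∧-true⁻ : ∀ {a b} → a ∧ b ≡ true → a ≡ true × b ≡ true
 ∧-true⁻ {true} e = refl , e

 T-true : ∀ {b} → T b → b ≡ true
 T-true {true} _ = refl

 ¬T-false : ∀ {b} → ¬ T b → b ≡ false
 ¬T-false {false} _ = refl
 ¬T-false {true} h = ⊥-elim (h tt)

 all-true⁺ : ∀ {A : Set} (P : A → Bool) xs → (∀ {x} → x ∈ xs → P x ≡ true) → all P xs ≡ true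
 all-true⁺ P [] h = refl
 all-true⁺ P (x ∷ xs) h = ∧-true (h (here refl)) (all-true⁺ P xs (h ∘ there))

 all-true⁻ : ∀ {A : Set} (P : A → Bool) xs → all P xs ≡ true → ∀ {x} → x ∈ xs → P x ≡ true
 all-true⁻ P (x ∷ xs) e (here refl) = proj₁ (∧-true⁻ e)
 all-true⁻ P (x ∷ xs) e (there p) = all-true⁻ P xs (proj₂ (∧-true⁻ {P x} e)) p

 inShape-true : ∀ p a b → 1 ℕ.≤ b → b ℕ.≤ partAt p (suc a) → inShape p (suc a , b) ≡ true
 inShape-true p a b l u = ∧-true (T-true (ℕP.≤⇒≤ᵇ l)) (T-true (ℕP.≤⇒≤ᵇ u))

 inShape-false : ∀ p a b → partAt p (suc a) ℕ.< b → inShape p (suc a , b) ≡ false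
 inShape-false p a b l = trans (cong ((1 ℕ.≤ᵇ b) ∧_) (¬T-false (λ t → ℕP.<⇒≱ l (ℕP.≤ᵇ⇒≤ b _ t)))) (Boolₚ.∧-zeroʳ _)

 part-left : ∀ m c lam a → a ℕ.< m → partAt (replicate m c ++ lam) (suc a) ≡ c
 part-left (suc m) c lam zero _ = refl
 part-left (suc m) c lam (suc a) (ℕ.s≤s lt) = part-left m c lam a lt

 part-right : ∀ m c lam a → partAt (replicate m c ++ lam) (suc (m ℕ.+ a)) ≡ partAt lam (suc a)
 part-right zero c lam a = refl
 part-right (suc m) c lam a = part-right m c lam a

 part-beyond : ∀ lam a → length lam ℕ.≤ a → partAt lam (suc a) ≡ 0
 part-beyond [] a _ = refl
 part-beyond (x ∷ lam) (suc a) (ℕ.s≤s le) = part-beyond lam a le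

 length-partition : ∀ {t j} (C : Conf t j) → length (partition C) ≡ np C
 length-partition ε = refl
 length-partition (hole C) = length-partition C
 length-partition (free C) = cong suc (length-partition C)
 length-partition (att C _) = cong suc (length-partition C)

 memCell-above : ∀ {t j} (C : Conf t j) a r b → r ℕ.< a → memCell (r , b) (removed C a) ≡ false
 memCell-above ε a r b lt = refl
 memCell-above (hole C) a r b lt = memCell-above C a r b lt
 memCell-above (free C) a r b lt = memCell-above C (suc a) r b (m<n⇒m<1+n lt)
 memCell-above (att C β) a r b lt = cong₂ _∨_ (cong (_∧ (column β ℕ.≡ᵇ b)) (≡ᵇ-false {a} {r} (λ e → <⇒≢ lt (sym e)))) (memCell-above C (suc a) r b (m<n⇒m<1+n lt))

 memCell-below : ∀ {t j} (C : Conf t j) β a r b → a ℕ.< r → memCell (r , b) (removed (att C β) a) ≡ memCell (r , b) (removed C (suc a))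
 memCell-below C β a r b lt = cong (λ z → (z ∧ (column β ℕ.≡ᵇ b)) ∨ memCell (r , b) (removed C (suc a))) (≡ᵇ-false (<⇒≢ lt))

 memCell-row : ∀ {t j} (C : Conf t j) β a b → memCell (a , b) (removed (att C β) a) ≡ (column β ℕ.≡ᵇ b)
 memCell-row C β a b = trans (cong₂ (λ u v → (u ∧ (column β ℕ.≡ᵇ b)) ∨ v) (≡ᵇ-true {a} refl) (memCell-above C (suc a) a b (n<1+n a))) (Boolₚ.∨-identityʳ _)

 module Diagram (m c : ℕ) (lam : List ℕ) (xs : List Cell) (|lam| : length lam ≡ m) where

  RL : List ℕ
  RL = replicate m c ++ lam

  mem : Cell → Bool
  mem x = inShape RL x ∧ not (inShape lam x) ∧ not (memCell x xs)

  private
   open-cell : ∀ r b → inShape RL (r , b) ≡ true → inShape lam (r , b) ≡ false → memCell (r , b) xs ≡ false → mem (r , b) ≡ true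
   open-cell r b e f g = trans (cong₂ _∧_ e (cong₂ (λ u v → not u ∧ not v) f g)) refl

   no-RL : ∀ r b → inShape RL (r , b) ≡ false → mem (r , b) ≡ false
   no-RL r b e = cong (_∧ (not (inShape lam (r , b)) ∧ not (memCell (r , b) xs))) e

   in-lam : ∀ r b → inShape lam (r , b) ≡ true → mem (r , b) ≡ false
   in-lam r b e = trans (cong (λ u → inShape RL (r , b) ∧ not u ∧ not (memCell (r , b) xs)) e) (Boolₚ.∧-zeroʳ _)

   in-xs : ∀ r b → memCell (r , b) xs ≡ true → mem (r , b) ≡ false
   in-xs r b e = trans (cong (λ u → inShape RL (r , b) ∧ not (inShape lam (r , b)) ∧ not u) e) (trans (cong (inShape RL (r , b) ∧_) (Boolₚ.∧-zeroʳ _)) (Boolₚ.∧-zeroʳ _))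

   below-lam : ∀ a b → m ℕ.≤ a → 1 ℕ.≤ b → inShape lam (suc a , b) ≡ false
   below-lam a b le l = inShape-false lam a b (subst (ℕ._< b) (sym (part-beyond lam a (subst (ℕ._≤ a) (sym |lam|) le))) l)

  bottom-shape : ∀ {t j} (C : Conf t j) a → m ℕ.≤ a → (∀ r → partAt RL (suc (a ℕ.+ r)) ≡ partAt (partition C) (suc r)) →
   (∀ r b → suc a ℕ.≤ r → memCell (r , b) xs ≡ memCell (r , b) (removed C (suc a))) → Bottom C c a mem
  bottom-shape ε a le f g = tt
  bottom-shape (hole C) a le f g = bottom-shape C a le f g
  bottom-shape (free {j = j} C) a le f g =
    (λ b l u → open-cell (suc a) b (inShape-true RL a b l (subst (b ℕ.≤_) (sym part) u)) (below-lam a b le l) (trans (g (suc a) b ℕP.≤-refl) (memCell-above C (suc (suc a)) (suc a) b (n<1+n (suc a))))) ,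
    (λ b l _ → no-RL (suc a) b (inShape-false RL a b (subst (ℕ._< b) (sym part) l))) ,
    bottom-shape C (suc a) (m≤n⇒m≤1+n le) (λ r → trans (cong (λ z → partAt RL (suc z)) (sym (+-suc a r))) (f (suc r))) (λ r b h → g r b (ℕP.<⇒≤ h))
   where
   part : partAt RL (suc a) ≡ j
   part = trans (cong (λ z → partAt RL (suc z)) (sym (ℕP.+-identityʳ a))) (f 0)
  bottom-shape (att {j = j} C β) a le f g =
    ((λ b l u ne → open-cell (suc a) b (inShape-true RL a b l (subst (b ℕ.≤_) (sym part) u)) (below-lam a b le l)
      (trans (g (suc a) b ℕP.≤-refl) (trans (memCell-row C β (suc a) b) (≡ᵇ-false (ne ∘ sym))))) ,
     in-xs (suc a) (column β) (trans (g (suc a) (column β) ℕP.≤-refl) (trans (memCell-row C β (suc a) (column β)) (≡ᵇ-true {column β} refl)))) ,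
    (λ b l _ → no-RL (suc a) b (inShape-false RL a b (subst (ℕ._< b) (sym part) l))) ,
    bottom-shape C (suc a) (m≤n⇒m≤1+n le) (λ r → trans (cong (λ z → partAt RL (suc z)) (sym (+-suc a r))) (f (suc r)))
     (λ r b h → trans (g r b (ℕP.<⇒≤ h)) (memCell-below C β (suc a) r b h))
   where
   part : partAt RL (suc a) ≡ j
   part = trans (cong (λ z → partAt RL (suc z)) (sym (ℕP.+-identityʳ a))) (f 0)

  top-shape : ∀ {t j} (C : Conf t j) a → a ℕ.+ np C ≡ m → (∀ r → partAt lam (suc (a ℕ.+ r)) ≡ partAt (partition C) (suc r)) →
   (∀ r b → r ℕ.≤ m → memCell (r , b) xs ≡ false) → Top C c a mem
  private
   top-row-shape : ∀ j a → a ℕ.< m → partAt lam (suc a) ≡ j → (∀ r b → r ℕ.≤ m → memCell (r , b) xs ≡ false) →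
    (∀ b → 1 ℕ.≤ b → b ℕ.≤ j → mem (suc a , b) ≡ false) × (∀ b → j ℕ.< b → b ℕ.≤ c → mem (suc a , b) ≡ true)
   top-row-shape j a a<m part g = (λ b l u → in-lam (suc a) b (inShape-true lam a b l (subst (b ℕ.≤_) (sym part) u))) ,
    (λ b l u → open-cell (suc a) b (inShape-true RL a b (ℕP.≤-trans (ℕ.s≤s ℕ.z≤n) l) (subst (b ℕ.≤_) (sym (part-left m c lam a a<m)) u)) (inShape-false lam a b (subst (ℕ._< b) (sym part) l)) (g (suc a) b a<m))
   a<sum : ∀ {a p} → a ℕ.+ suc p ≡ m → a ℕ.< m
   a<sum {a} {p} e = subst (a ℕ.<_) (trans (sym (+-suc a p)) e) (ℕ.s≤s (m≤m+n a p))
  top-shape ε a e f g = tt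
  top-shape (hole C) a e f g = top-shape C a e f g
  top-shape (free {j = j} C) a e f g = proj₁ R , proj₂ R , top-shape C (suc a) (trans (sym (+-suc a (np C))) e) (λ r → trans (cong (λ z → partAt lam (suc z)) (sym (+-suc a r))) (f (suc r))) g
   where R = top-row-shape j a (a<sum e) (trans (cong (λ z → partAt lam (suc z)) (sym (ℕP.+-identityʳ a))) (f 0)) g
  top-shape (att {j = j} C _) a e f g = proj₁ R , proj₂ R , top-shape C (suc a) (trans (sym (+-suc a (np C))) e) (λ r → trans (cong (λ z → partAt lam (suc z)) (sym (+-suc a r))) (f (suc r))) g
   where R = top-row-shape j a (a<sum e) (trans (cong (λ z → partAt lam (suc z)) (sym (ℕP.+-identityʳ a))) (f 0)) g

 part≤ : ∀ {t j} (C : Conf t j) ν a → (∀ r → partAt ν (a ℕ.+ r) ≡ partAt (partition C) (suc r)) → ∀ {x} → x ∈ removed C a → partAt ν (row x) ℕ.≤ j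
 private
  next-part : ∀ {ν a p l} → (∀ r → partAt ν (a ℕ.+ r) ≡ partAt (p ∷ l) (suc r)) → ∀ r → partAt ν (suc a ℕ.+ r) ≡ partAt l (suc r)
  next-part {ν} {a} f r = trans (cong (partAt ν) (sym (+-suc a r))) (f (suc r))
  this-part : ∀ {ν a p l} → (∀ r → partAt ν (a ℕ.+ r) ≡ partAt (p ∷ l) (suc r)) → partAt ν a ≡ p
  this-part {ν} {a} f = trans (cong (partAt ν) (sym (ℕP.+-identityʳ a))) (f 0)
 part≤ (hole C) ν a f p = m≤n⇒m≤1+n (part≤ C ν a f p)
 part≤ (free {j = j} C) ν a f p = part≤ C ν (suc a) (next-part {ν} {a} {j} f) p
 part≤ (att {j = j} C β) ν a f (here refl) = ℕP.≤-reflexive (this-part {ν} {a} {j} f)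
 part≤ (att {j = j} C β) ν a f (there p) = part≤ C ν (suc a) (next-part {ν} {a} {j} f) p

 -- (C2) for one removed cell x and one column: a column to the right of x is out of reach in the
 -- row of x.
 Clear : List ℕ → Cell → ℕ → Set
 Clear ν x b = col x ℕ.< b → b ℕ.≤ partAt ν (row x) → ⊥

 column-mono : ∀ {j} {a b : Fin j} → column a ℕ.< column b → b Fin.< a
 column-mono {j} {a} {b} lt = ℕP.≰⇒> (λ le → ℕP.<⇒≱ lt (ℕP.∸-monoʳ-≤ j le))

 column-anti : ∀ {j} {a b : Fin j} → b Fin.< a → column a ℕ.< column b
 column-anti {j} {a} {b} lt = ℕP.∸-monoʳ-< lt (ℕP.<⇒≤ (Finₚ.toℕ<n a))

 -- Slots after hole b that are attached while it stays open remove cells at or to the right of its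
 -- column; slots before it have rows too short to reach that column.
 open-clear : ∀ {t j} (C : Conf t j) ν a → (∀ r → partAt ν (a ℕ.+ r) ≡ partAt (partition C) (suc r)) → ∀ b → Open C b → ∀ {x} → x ∈ removed C a → Clear ν x (column b)
 open-clear (hole C) ν a f zero o p _ u = ℕP.<⇒≱ (ℕ.s≤s (part≤ C ν a f p)) u
 open-clear (hole C) ν a f (suc b) o p = open-clear C ν a f b o p
 open-clear (free {j = j} C) ν a f b o p = open-clear C ν (suc a) (next-part {ν} {a} {j} f) b o p
 open-clear (att {j = j} C β) ν a f b (le , o) (here refl) l _ = ℕP.<⇒≱ (column-mono {a = β} {b} l) le
 open-clear (att {j = j} C β) ν a f b (le , o) (there p) = open-clear C ν (suc a) (next-part {ν} {a} {j} f) b o p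

 clear-open : ∀ {t j} (C : Conf t j) ν a → (∀ r → partAt ν (a ℕ.+ r) ≡ partAt (partition C) (suc r)) → ∀ b → (∀ {x} → x ∈ removed C a → Clear ν x (column b)) → Open C b
 clear-open (hole C) ν a f zero h = tt
 clear-open (hole C) ν a f (suc b) h = clear-open C ν a f b h
 clear-open (free {j = j} C) ν a f b h = clear-open C ν (suc a) (next-part {ν} {a} {j} f) b h
 clear-open (att {j = j} C β) ν a f b h = ℕP.≮⇒≥ (λ lt → h (here refl) (column-anti {a = β} {b} lt) (subst (column b ℕ.≤_) (sym (this-part {ν} {a} {j} f)) (column≤ b))) ,
  clear-open C ν (suc a) (next-part {ν} {a} {j} f) b (h ∘ there)

 row≥ : ∀ {t j} (C : Conf t j) a {x} → x ∈ removed C a → a ℕ.≤ row x × 1 ℕ.≤ col x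
 row≥ (hole C) a p = row≥ C a p
 row≥ (free C) a p = ℕP.<⇒≤ (proj₁ (row≥ C (suc a) p)) , proj₂ (row≥ C (suc a) p)
 row≥ (att C β) a (here refl) = ℕP.≤-refl , 1≤column β
 row≥ (att C β) a (there p) = ℕP.<⇒≤ (proj₁ (row≥ C (suc a) p)) , proj₂ (row≥ C (suc a) p)

 -- Together with `clear-nc`, the translation between (C2) and noncrossing: each attachment is
 -- compared with the cells removed in lower rows.
 nc-clear : ∀ {t j} (C : Conf t j) ν a → (∀ r → partAt ν (a ℕ.+ r) ≡ partAt (partition C) (suc r)) → NC C → ∀ {x y} → x ∈ removed C a → y ∈ removed C a → row y ℕ.< row x → Clear ν x (col y)
 nc-clear (hole C) ν a f nc p q = nc-clear C ν a f nc p q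
 nc-clear (free {j = j} C) ν a f nc p q = nc-clear C ν (suc a) (next-part {ν} {a} {j} f) nc p q
 nc-clear (att {j = j} C β) ν a f (nc , o) (here refl) (here refl) lt = ⊥-elim (ℕP.<-irrefl refl lt)
 nc-clear (att {j = j} C β) ν a f (nc , o) (here refl) (there q) lt = ⊥-elim (ℕP.<-asym lt (proj₁ (row≥ C (suc a) q)))
 nc-clear (att {j = j} C β) ν a f (nc , o) (there p) (here refl) lt = open-clear C ν (suc a) (next-part {ν} {a} {j} f) β o p
 nc-clear (att {j = j} C β) ν a f (nc , o) (there p) (there q) lt = nc-clear C ν (suc a) (next-part {ν} {a} {j} f) nc p q lt

 clear-nc : ∀ {t j} (C : Conf t j) ν a → (∀ r → partAt ν (a ℕ.+ r) ≡ partAt (partition C) (suc r)) → (∀ {x y} → x ∈ removed C a → y ∈ removed C a → row y ℕ.< row x → Clear ν x (col y)) → NC C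
 clear-nc ε ν a f h = tt
 clear-nc (hole C) ν a f h = clear-nc C ν a f h
 clear-nc (free {j = j} C) ν a f h = clear-nc C ν (suc a) (next-part {ν} {a} {j} f) h
 clear-nc (att {j = j} C β) ν a f h = clear-nc C ν (suc a) (next-part {ν} {a} {j} f) (λ p q → h (there p) (there q)) ,
  clear-open C ν (suc a) (next-part {ν} {a} {j} f) β (λ p → h (there p) (here refl) (proj₁ (row≥ C (suc a) p)))

 C2⁺ : ∀ ν xs → (∀ {x y} → x ∈ xs → y ∈ xs → row y ℕ.< row x → Clear ν x (col y)) → (∀ {x} → x ∈ xs → 1 ℕ.≤ row x) → C2 ν xs ≡ true
 C2⁺ ν xs h pos = all-true⁺ _ xs λ {x} p → all-true⁺ _ xs λ {y} q → cell x y p q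
  where
  cell : ∀ x y → x ∈ xs → y ∈ xs → not ((row y ℕ.<ᵇ row x) ∧ (col x ℕ.<ᵇ col y)) ∨ not (inShape ν (row x , col y)) ≡ true
  cell (suc a , b) y p q with row y ℕP.<? suc a | b ℕP.<? col y
  ... | no nl | _ = cong (λ z → not (z ∧ (b ℕ.<ᵇ col y)) ∨ not (inShape ν (suc a , col y))) (¬T-false (λ t → nl (ℕP.<ᵇ⇒< (row y) (suc a) t)))
  ... | yes _ | no nl = trans (cong (λ z → not ((row y ℕ.<ᵇ suc a) ∧ z) ∨ not (inShape ν (suc a , col y))) (¬T-false (λ t → nl (ℕP.<ᵇ⇒< b (col y) t)))) (cong (λ z → not z ∨ not (inShape ν (suc a , col y))) (Boolₚ.∧-zeroʳ (row y ℕ.<ᵇ suc a)))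
  ... | yes l | yes l' = trans (cong (λ z → not ((row y ℕ.<ᵇ suc a) ∧ (b ℕ.<ᵇ col y)) ∨ not z) (inShape-false ν a (col y) (ℕP.≰⇒> (λ u → h p q l l' u)))) (Boolₚ.∨-zeroʳ _)
  cell (zero , b) y p q = ⊥-elim (ℕP.<⇒≱ (pos p) ℕ.z≤n)

 C2⁻ : ∀ ν xs → C2 ν xs ≡ true → ∀ {x y} → x ∈ xs → y ∈ xs → row y ℕ.< row x → Clear ν x (col y)
 C2⁻ ν xs e {suc a , b} {y} p q l l' u with trans (sym (cong₂ (λ z z' → not z ∨ not z') (∧-true (T-true (ℕP.<⇒<ᵇ l)) (T-true (ℕP.<⇒<ᵇ l'))) (inShape-true ν a (col y) (ℕP.≤-trans (ℕ.s≤s ℕ.z≤n) l') u)))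
  (all-true⁻ (λ y → not ((row y ℕ.<ᵇ suc a) ∧ (b ℕ.<ᵇ col y)) ∨ not (inShape ν (suc a , col y))) xs (all-true⁻ _ xs e p) q)
 ... | ()

 -- Enumerating partitions and sets of cells

 ∈-concatMap⁺ : ∀ {A B : Set} (f : A → List B) {xs x y} → x ∈ xs → y ∈ f x → y ∈ concatMap f xs
 ∈-concatMap⁺ f (here refl) q = ∈-++⁺ˡ q
 ∈-concatMap⁺ f {x ∷ xs} (there p) q = ∈-++⁺ʳ (f x) (∈-concatMap⁺ f p q)

 ∈-concatMap⁻ : ∀ {A B : Set} (f : A → List B) xs {y} → y ∈ concatMap f xs → Σ A λ x → x ∈ xs × y ∈ f x
 ∈-concatMap⁻ f (x ∷ xs) p with ∈-++⁻ (f x) p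
 ... | inj₁ q = x , here refl , q
 ... | inj₂ q with ∈-concatMap⁻ f xs q
 ... | x' , r , q' = x' , there r , q'

 concatMap-unique : ∀ {A B : Set} (f : A → List B) {xs} → Unique xs → (∀ x → Unique (f x)) → (∀ {x x' y} → y ∈ f x → y ∈ f x' → x ≡ x') → Unique (concatMap f xs)
 concatMap-unique f {[]} _ _ _ = []
 concatMap-unique f {x ∷ xs} (x∉ ∷ u) uf inj = Uniqueₚ.++⁺ (uf x) (concatMap-unique f u uf inj) λ { (p , q) → clash (∈-concatMap⁻ f xs q) p }
  where
  clash : ∀ {y} → (Σ _ λ x' → x' ∈ xs × y ∈ f x') → y ∈ f x → ⊥
  clash (x' , r , q) p = All.lookup x∉ r (inj p q)

 data Descending : ℕ → List ℕ → Set where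
  [] : ∀ {j} → Descending j []
  _∷_ : ∀ {j x lam} → x ℕ.≤ j → Descending x lam → Descending j (x ∷ lam)

 partsIn⁻ : ∀ r m {lam} → lam ∈ partsIn r m → Descending m lam × length lam ≡ r
 partsIn⁻ zero m (here refl) = [] , refl
 partsIn⁻ (suc r) m p with ∈-concatMap⁻ (λ x → map (x ∷_) (partsIn r x)) (upTo (suc m)) p
 ... | x , x∈ , q with ∈-map⁻ (x ∷_) q
 ... | lam , l , refl = <⇒≤pred (∈-upTo⁻ x∈) ∷ proj₁ (partsIn⁻ r x l) , cong suc (proj₂ (partsIn⁻ r x l))

 partsIn⁺ : ∀ {m lam} → Descending m lam → lam ∈ partsIn (length lam) m
 partsIn⁺ [] = here refl
 partsIn⁺ {m} {x ∷ lam} (le ∷ d) = ∈-concatMap⁺ (λ x → map (x ∷_) (partsIn (length lam) x)) (∈-upTo⁺ (ℕ.s≤s le)) (∈-map⁺ (x ∷_) (partsIn⁺ d))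

 partsIn-unique : ∀ r m → Unique (partsIn r m)
 partsIn-unique zero m = [] ∷ []
 partsIn-unique (suc r) m = concatMap-unique (λ x → map (x ∷_) (partsIn r x)) (Uniqueₚ.upTo⁺ (suc m)) (λ x → Uniqueₚ.map⁺ Listₚ.∷-injectiveʳ (partsIn-unique r x)) heads
  where
  heads : ∀ {x x' y} → y ∈ map (x ∷_) (partsIn r x) → y ∈ map (x' ∷_) (partsIn r x') → x ≡ x'
  heads {x} {x'} p q with ∈-map⁻ (x ∷_) p | ∈-map⁻ (x' ∷_) q
  ... | _ , _ , refl | _ , _ , e = Listₚ.∷-injectiveˡ e

 rowCells : ℕ → ℕ → List Cell
 rowCells a x = map (λ b → (a , b)) (map suc (upTo x))

 cellsFrom : ℕ → List ℕ → List Cell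
 cellsFrom a [] = []
 cellsFrom a (x ∷ lam) = rowCells a x ++ cellsFrom (suc a) lam

 map-applyUpTo : ∀ {A B : Set} (f : A → B) (h : ℕ → A) m → map f (applyUpTo h m) ≡ applyUpTo (f ∘ h) m
 map-applyUpTo f h zero = refl
 map-applyUpTo f h (suc m) = cong (f (h 0) ∷_) (map-applyUpTo f (h ∘ suc) m)

 concatMap-rows : ∀ ν lam (h : ℕ → ℕ) a → (∀ r → h r ≡ a ℕ.+ r) → (∀ r → partAt ν (a ℕ.+ r) ≡ partAt lam (suc r)) →
  concatMap (λ a → rowCells a (partAt ν a)) (applyUpTo h (length lam)) ≡ cellsFrom a lam
 concatMap-rows ν [] h a e f = refl
 concatMap-rows ν (x ∷ lam) h a e f = cong₂ _++_ (cong₂ rowCells h0 (trans (cong (partAt ν) (e 0)) (f 0)))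
   (concatMap-rows ν lam (h ∘ suc) (suc a) (λ r → trans (e (suc r)) (+-suc a r)) (λ r → trans (cong (partAt ν) (sym (+-suc a r))) (f (suc r))))
  where
  h0 : h 0 ≡ a
  h0 = trans (e 0) (ℕP.+-identityʳ a)

 bottomCells-rows : ∀ c lam → length lam ≡ rowsR k c → bottomCells k c (replicate (rowsR k c) c ++ lam) ≡ cellsFrom (suc (rowsR k c)) lam
 bottomCells-rows c lam e = trans (cong (concatMap (λ a → rowCells a (partAt ν a))) (trans (map-applyUpTo (λ t → m ℕ.+ suc t) id m) (cong (applyUpTo (λ t → m ℕ.+ suc t)) (sym e))))
   (concatMap-rows ν lam (λ t → m ℕ.+ suc t) (suc m) (+-suc m) (part-right m c lam))
  where
  m = rowsR k c
  ν = replicate m c ++ lam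

 -- At most one cell from each row, listed by rows; this fixes the order of the list, so a set of
 -- cells appears only once.
 data Cells : ℕ → List ℕ → List Cell → Set where
  [] : ∀ {a} → Cells a [] []
  none : ∀ {a x lam xs} → Cells (suc a) lam xs → Cells a (x ∷ lam) xs
  some : ∀ {a x lam xs b} → 1 ℕ.≤ b → b ℕ.≤ x → Cells (suc a) lam xs → Cells a (x ∷ lam) ((a , b) ∷ xs)

 ∈-rowCells : ∀ {a x y} → y ∈ rowCells a x → row y ≡ a × 1 ℕ.≤ col y × col y ℕ.≤ x
 ∈-rowCells {a} {x} p with ∈-map⁻ (λ b → (a , b)) p
 ... | b , q , refl with ∈-map⁻ suc q
 ... | b' , r , refl = refl , ℕ.s≤s ℕ.z≤n , ∈-upTo⁻ r

 rowCells-∈ : ∀ {a x b} → 1 ℕ.≤ b → b ℕ.≤ x → (a , b) ∈ rowCells a x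
 rowCells-∈ {a} {b = suc b} _ u = ∈-map⁺ (λ b → (a , b)) (∈-map⁺ suc (∈-upTo⁺ u))

 skip-row : ∀ {a} (L : List Cell) {D rest} → All (λ y → row y ≡ a) L → All (λ y → row y ≢ a) D → D ⊆ L ++ rest → D ⊆ rest
 skip-row [] _ _ τ = τ
 skip-row (y ∷ L) (_ ∷ h) d (_ ∷ʳ τ) = skip-row L h d τ
 skip-row (y ∷ L) (e ∷ _) (ne ∷ _) (refl ∷ _) = ⊥-elim (ne e)

 one-per-row : ∀ {a} (L : List Cell) {D rest} → All (λ y → row y ≡ a) L → distinctRows D ≡ true → D ⊆ L ++ rest →
  D ⊆ rest ⊎ (Σ Cell λ y → Σ (List Cell) λ D' → D ≡ y ∷ D' × y ∈ L × D' ⊆ rest × distinctRows D' ≡ true)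
 one-per-row [] _ _ τ = inj₁ τ
 one-per-row (y ∷ L) (_ ∷ h) d (_ ∷ʳ τ) with one-per-row L h d τ
 ... | inj₁ σ = inj₁ σ
 ... | inj₂ (y' , D' , e , p , r) = inj₂ (y' , D' , e , there p , r)
 one-per-row {a} (y ∷ L) {.y ∷ D} (refl ∷ h) d (refl ∷ τ) = inj₂ (y , D , refl , here refl , skip-row L h apart τ , proj₂ (∧-true⁻ {all (λ z → not (row z ℕ.≡ᵇ row y)) D} d))
  where
  apart : All (λ z → row z ≢ row y) D
  apart = All.tabulate λ {z} p e → differs (all-true⁻ (λ z → not (row z ℕ.≡ᵇ row y)) D (proj₁ (∧-true⁻ d)) p) (≡ᵇ-true {row z} e)
   where
   differs : ∀ {b} → not b ≡ true → b ≡ true → ⊥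
   differs {true} () _

 cells⁺ : ∀ a lam {D} → distinctRows D ≡ true → D ⊆ cellsFrom a lam → Cells a lam D
 cells⁺ a [] _ [] = []
 cells⁺ a (x ∷ lam) d τ with one-per-row (rowCells a x) (All.tabulate λ p → proj₁ (∈-rowCells {a} {x} p)) d τ
 ... | inj₁ σ = none (cells⁺ (suc a) lam d σ)
 ... | inj₂ (y , D' , refl , p , σ , d') with ∈-rowCells {a} {x} p
 ... | refl , l , u = some l u (cells⁺ (suc a) lam d' σ)

 singleton-⊆ : ∀ {A : Set} {x : A} {xs} → x ∈ xs → x ∷ [] ⊆ xs
 singleton-⊆ (here refl) = refl ∷ Sublist.minimum _
 singleton-⊆ (there {x} p) = x ∷ʳ singleton-⊆ p

 cells⁻ : ∀ {a lam D} → Cells a lam D → D ⊆ cellsFrom a lam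
 cells⁻ [] = []
 cells⁻ {a} {x ∷ _} (none cs) = Sublistₚ.++⁺ˡ (rowCells a x) (cells⁻ cs)
 cells⁻ {a} {x ∷ _} (some l u cs) = Sublistₚ.++⁺ (singleton-⊆ (rowCells-∈ {a} {x} l u)) (cells⁻ cs)

 cells-row : ∀ {a lam D} → Cells a lam D → ∀ {y} → y ∈ D → a ℕ.≤ row y
 cells-row (none cs) p = ℕP.<⇒≤ (cells-row cs p)
 cells-row (some _ _ cs) (here refl) = ℕP.≤-refl
 cells-row (some _ _ cs) (there p) = ℕP.<⇒≤ (cells-row cs p)

 cells-distinct : ∀ {a lam D} → Cells a lam D → distinctRows D ≡ true
 cells-distinct [] = refl
 cells-distinct (none cs) = cells-distinct cs
 cells-distinct {a} (some {xs = xs} _ _ cs) = ∧-true (all-true⁺ (λ y → not (row y ℕ.≡ᵇ a)) xs (λ p → cong not (≡ᵇ-false (λ e → <⇒≢ (cells-row cs p) (sym e))))) (cells-distinct cs)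

 cellsFrom-unique : ∀ a lam → Unique (cellsFrom a lam)
 cellsFrom-unique a [] = []
 cellsFrom-unique a (x ∷ lam) = Uniqueₚ.++⁺ (Uniqueₚ.map⁺ (cong proj₂) (Uniqueₚ.map⁺ suc-injective (Uniqueₚ.upTo⁺ x))) (cellsFrom-unique (suc a) lam)
   λ { (p , q) → ℕP.<⇒≱ (from-row (suc a) lam q) (ℕP.≤-reflexive (proj₁ (∈-rowCells {a} {x} p))) }
  where
  from-row : ∀ a lam {y} → y ∈ cellsFrom a lam → a ℕ.≤ row y
  from-row a (x ∷ lam) p with ∈-++⁻ (rowCells a x) p
  ... | inj₁ q = ℕP.≤-reflexive (sym (proj₁ (∈-rowCells {a} {x} q)))
  ... | inj₂ q = ℕP.<⇒≤ (from-row (suc a) lam q)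

 partition-desc : ∀ {t j} (C : Conf t j) → Descending j (partition C)
 partition-desc ε = []
 partition-desc (hole C) with partition C | partition-desc C
 ... | [] | [] = []
 ... | x ∷ lam | le ∷ d = m≤n⇒m≤1+n le ∷ d
 partition-desc (free C) = ℕP.≤-refl ∷ partition-desc C
 partition-desc (att C _) = ℕP.≤-refl ∷ partition-desc C

 removed-cells : ∀ {t j} (C : Conf t j) a → Cells a (partition C) (removed C a)
 removed-cells ε a = []
 removed-cells (hole C) a = removed-cells C a
 removed-cells (free C) a = none (removed-cells C (suc a))
 removed-cells (att C β) a = some (1≤column β) (column≤ β) (removed-cells C (suc a))

 toFin : ∀ {j b} → 1 ℕ.≤ b → b ℕ.≤ j → Σ (Fin j) λ β → column β ≡ b
 toFin {j} {b} l u = fromℕ< lt , trans (cong (j ℕ.∸_) (Finₚ.toℕ-fromℕ< lt)) (ℕP.m∸[m∸n]≡n u)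
  where
  lt : j ℕ.∸ b ℕ.< j
  lt = ℕP.∸-monoʳ-< l u

 -- The boundary path is read off: a row of the current width becomes a particle, and otherwise a
 -- hole is laid and the width drops by one.
 build : ∀ j {lam xs} a → Descending j lam → Cells a lam xs → Σ ℕ λ t → Σ (Conf t j) λ C → partition C ≡ lam × removed C a ≡ xs
 build zero a [] [] = 0 , ε , refl , refl
 build (suc j) a [] [] with build j a [] []
 ... | t , C , e , e' = suc t , hole C , e , e'
 build j {x ∷ lam} a (le ∷ d) cs with x ℕP.≟ j
 build j {x ∷ lam} a (le ∷ d) (none cs) | yes refl with build j (suc a) d cs
 ... | t , C , e , e' = suc t , free C , cong (x ∷_) e , e'
 build j {x ∷ lam} a (le ∷ d) (some l u cs) | yes refl with build j (suc a) d cs | toFin l u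
 ... | t , C , e , e' | β , eβ = suc t , att C β , cong (x ∷_) e , cong₂ _∷_ (cong (a ,_) eβ) e'
 build zero {x ∷ lam} a (ℕ.z≤n ∷ d) cs | no ne = ⊥-elim (ne refl)
 build (suc j) {x ∷ lam} a (le ∷ d) cs | no ne with build j {x ∷ lam} a (<⇒≤pred (ℕP.≤∧≢⇒< le ne) ∷ d) cs
 ... | t , C , e , e' = suc t , hole C , e , e'

 module Parameters (c i : ℕ) (c≤k : c ℕ.≤ k) where

  m : ℕ
  m = rowsR k c

  m+c : m ℕ.+ c ≡ n
  m+c = m∸n+n≡m (m≤n⇒m≤1+n c≤k)

  RLof : List ℕ → List ℕ
  RLof lam = replicate m c ++ lam

  -- The noncrossing configuration behind one term of the sum. It has n slots since m rows and c
  -- columns give m + c boundary steps.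
  record Entry (lam : List ℕ) (xs : List Cell) : Set where
   constructor entry
   field
    C : Conf n c
    nc : NC C
    λ≡ : partition C ≡ lam
    xs≡ : removed C (suc m) ≡ xs
    |xs| : length xs ≡ i

  toEntry : ∀ {lam xs} → lam ∈ partsIn m c → xs ∈ admissible k c i (RLof lam) → Entry lam xs
  toEntry {lam} {xs} p q = from (build c (suc m) (proj₁ (partsIn⁻ m c p)) (cells⁺ (suc m) lam (proj₁ ok) (subst (xs ⊆_) (bottomCells-rows c lam |lam|) (proj₁ sub))))
   where
   |lam| : length lam ≡ m
   |lam| = proj₂ (partsIn⁻ m c p)
   fl : xs ∈ choose i (bottomCells k c (RLof lam)) × distinctRows xs ∧ C2 (RLof lam) xs ≡ true
   fl = ∈-filterᵇ⁻ (λ xs → distinctRows xs ∧ C2 (RLof lam) xs) (choose i (bottomCells k c (RLof lam))) q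
   ok : distinctRows xs ≡ true × C2 (RLof lam) xs ≡ true
   ok = ∧-true⁻ (proj₂ fl)
   sub : xs ⊆ bottomCells k c (RLof lam) × length xs ≡ i
   sub = choose-⊆ i (bottomCells k c (RLof lam)) (proj₁ fl)
   from : (Σ ℕ λ t → Σ (Conf t c) λ C → partition C ≡ lam × removed C (suc m) ≡ xs) → Entry lam xs
   from (t , C , refl , refl) = sized (trans (sym (np+j C)) (trans (cong (ℕ._+ c) (trans (sym (length-partition C)) |lam|)) m+c)) C refl refl
    where
    sized : ∀ {t} → t ≡ n → (C' : Conf t c) → partition C' ≡ partition C → removed C' (suc m) ≡ removed C (suc m) → Entry (partition C) (removed C (suc m))
    sized refl C' e e' = entry C' (clear-nc C' (RLof lam) (suc m) (λ r → trans (part-right m c lam r) (cong (λ l → partAt l (suc r)) (sym e)))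
      (λ p q → C2⁻ (RLof lam) xs (proj₂ ok) (subst (_ ∈_) e' p) (subst (_ ∈_) e' q))) e e' (proj₂ sub)

  fromConf : (C : Conf n c) → NC C → length (removed C (suc m)) ≡ i →
   partition C ∈ partsIn m c × removed C (suc m) ∈ admissible k c i (RLof (partition C))
  fromConf C nc e = subst (λ r → partition C ∈ partsIn r c) |lam| (partsIn⁺ (partition-desc C)) ,
    ∈-filterᵇ⁺ (λ xs → distinctRows xs ∧ C2 (RLof (partition C)) xs)
     (subst (λ r → xs ∈ choose r (bottomCells k c (RLof (partition C)))) e (⊆-choose (subst (xs ⊆_) (sym (bottomCells-rows c (partition C) |lam|)) (cells⁻ cs))))
     (∧-true (cells-distinct cs) (C2⁺ (RLof (partition C)) xs (nc-clear C (RLof (partition C)) (suc m) (part-right m c (partition C)) nc) (λ p → ℕP.≤-trans (ℕ.s≤s ℕ.z≤n) (cells-row cs p))))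
   where
   xs : List Cell
   xs = removed C (suc m)
   cs : Cells (suc m) (partition C) xs
   cs = removed-cells C (suc m)
   |lam| : length (partition C) ≡ m
   |lam| = trans (length-partition C) (ℕP.+-cancelʳ-≡ c (np C) m (trans (np+j C) (sym m+c)))

  admissible-unique : ∀ {lam} → length lam ≡ m → Unique (admissible k c i (RLof lam))
  admissible-unique {lam} e = AllPairs-⊆ (filterᵇ-⊆ (λ xs → distinctRows xs ∧ C2 (RLof lam) xs) (choose i (bottomCells k c (RLof lam)))) (choose-unique i (subst Unique (sym (bottomCells-rows c lam e)) (cellsFrom-unique (suc m) lam)))

 -- Uniqueness of the configuration

 Near-cong : ∀ {κ x y} → x ≗A y → Near κ y → Near κ x
 Near-cong {κ} {x} {y} h S = near (λ q → subst (q - N ≤_) (sym (e q)) (lo S q)) (λ q → subst (_≤ q) (sym (e q)) (hi S q))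
   (λ {a} {b} h1 h2 h3 → uncrossed S {a} {b} (subst (a - N ≤_) (e b) h1) (subst₂ _<_ (e b) (e a) h2) (subst (_< b) (e a) h3))
  where
  e : ∀ q → g κ x q ≡ g κ y q
  e q = cong (_+ κ) (at h q)

 record Facts (s : ℤ) (G : ℤ → ℤ) {t j} (C : Conf t j) : Set where
  field
   frees : ∀ {v} → Free C v → G (s + + v) ≡ s + + v
   arcs : ∀ {u v} → Arc C u v → G (s + + v) ≡ s + + u
   gaps : ∀ b → G (s + + hol C b) < s

 module _ {s : ℤ} {G : ℤ → ℤ} where
  open Facts

  private
   F-hole : ∀ {t j} {C : Conf t j} → Facts s G (hole C) → Facts s G C
   F-hole f = record { frees = frees f ∘ holeᶠ ; arcs = arcs f ∘ holeᵃ ; gaps = gaps f ∘ suc }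
   F-free : ∀ {t j} {C : Conf t j} → Facts s G (free C) → Facts s G C
   F-free f = record { frees = frees f ∘ freeᶠ ; arcs = arcs f ∘ freeᵃ ; gaps = gaps f }
   F-att : ∀ {t j} {C : Conf t j} {b} → Facts s G (att C b) → Facts s G C
   F-att f = record { frees = frees f ∘ attᶠ ; arcs = arcs f ∘ attᵃ ; gaps = gaps f }
   s≤ : ∀ u → s ≤ s + + u
   s≤ u = lia 2 (λ s u → #0 =< u => s =< s :+ u) s (+ u) 0≤+
   slot-inj : ∀ {u v} → s + + u ≡ s + + v → u ≡ v
   slot-inj {u} {v} e = +-injective (lia 3 (λ s u v → s :+ u ≐ s :+ v => u ≐ v) s (+ u) (+ v) e)

  -- The value of G at a slot tells whether it is a hole, free or attached, and in the last case its
  -- target determines the hole by `top-inj`.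
  facts-unique : ∀ {t j j'} (C : Conf t j) (C' : Conf t j') → Facts s G C → Facts s G C' → _≡_ {A = Σ ℕ (Conf t)} (j , C) (j' , C')
  facts-unique ε ε _ _ = refl
  facts-unique (hole C) (hole C') f f' with facts-unique C C' (F-hole f) (F-hole f')
  ... | refl = refl
  facts-unique (hole {t} C) (free C') f f' = ⊥-elim (<⇒≱ (gaps f zero) (subst (s ≤_) (sym (frees f' here)) (s≤ t)))
  facts-unique (hole C) (att C' b) f f' = ⊥-elim (<⇒≱ (gaps f zero) (subst (s ≤_) (sym (arcs f' here)) (s≤ (top C' b))))
  facts-unique (free {t} C) (hole C') f f' = ⊥-elim (<⇒≱ (gaps f' zero) (subst (s ≤_) (sym (frees f here)) (s≤ t)))
  facts-unique (free C) (free C') f f' with facts-unique C C' (F-free f) (F-free f')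
  ... | refl = refl
  facts-unique (free C) (att C' b) f f' = ⊥-elim (ℕP.<-irrefl (slot-inj (trans (sym (arcs f' here)) (frees f here))) (top<t C' b))
  facts-unique (att C b) (hole C') f f' = ⊥-elim (<⇒≱ (gaps f' zero) (subst (s ≤_) (sym (arcs f here)) (s≤ (top C b))))
  facts-unique (att C b) (free C') f f' = ⊥-elim (ℕP.<-irrefl (slot-inj (trans (sym (arcs f here)) (frees f' here))) (top<t C b))
  facts-unique (att C b) (att C' b') f f' with facts-unique C C' (F-att f) (F-att f')
  ... | refl with top-inj C (slot-inj (trans (sym (arcs f here)) (arcs f' here)))
  ... | refl = refl

 permC-facts : ∀ s {j} (C : Conf n j) → NC C → Facts s (g (+ np C - N) (permC s C)) C
 permC-facts s C nc = record { frees = E.g-free ; arcs = E.g-arc ; gaps = λ b → subst (_< s) (sym (E.g-hole b))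
   (lia 3 (λ s t N → t <: N => s :+ t :- N <: s) s (+ top C b) N (subst (+ top C b <_) (sym N-def) (+<+ (top<t C b)))) }
  where
  module E = Encode s C nc

 permC-injective : ∀ s {j} (C C' : Conf n j) → NC C → NC C' → permC s C ≗A permC s C' → C ≡ C'
 permC-injective s {j} C C' nc nc' h = ,-injectiveʳ-UIP ℕP.≡-irrelevant (facts-unique C C' (permC-facts s C nc)
   (subst (λ κ → Facts s (g κ (permC s C)) C') (cong (λ p → + p - N) (ℕP.+-cancelʳ-≡ j (np C') (np C) (trans (np+j C') (sym (np+j C))))) (moved (permC-facts s C' nc'))))
  where
  e : ∀ q → g (+ np C' - N) (permC s C) q ≡ g (+ np C' - N) (permC s C') q
  e q = cong (_+ (+ np C' - N)) (at h q)
  moved : Facts s (g (+ np C' - N) (permC s C')) C' → Facts s (g (+ np C' - N) (permC s C)) C'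
  moved f = record { frees = λ {v} a → trans (e (s + + v)) (Facts.frees f a) ; arcs = λ {u} {v} a → trans (e (s + + v)) (Facts.arcs f a)
   ; gaps = λ b → subst (_< s) (sym (e (s + + hol C' b))) (Facts.gaps f b) }

 -- The minimal coset representative in the support

 -- The configuration of the Grassmannian permutation: holes, then slots attached to the last hole, then free slots.
 data Mu : ∀ {t j} → ℕ → ℕ → Conf t j → Set where
  ε : Mu 0 0 ε
  hole : ∀ {t j} {C : Conf t j} → Mu 0 0 C → Mu 0 0 (hole C)
  att : ∀ {t j i} {C : Conf t (suc j)} → Mu i 0 C → Mu (suc i) 0 (att C zero)
  free : ∀ {t j i r} {C : Conf t j} → Mu i r C → Mu i (suc r) (free C)

 mu-np : ∀ {t j i r} {C : Conf t j} → Mu i r C → np C ≡ r ℕ.+ i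
 mu-np ε = refl
 mu-np (hole μ) = mu-np μ
 mu-np (att μ) = cong suc (mu-np μ)
 mu-np (free μ) = cong suc (mu-np μ)

 mu-removed : ∀ {t j i r} {C : Conf t j} → Mu i r C → ∀ a → length (removed C a) ≡ i
 mu-removed ε a = refl
 mu-removed (hole μ) a = mu-removed μ a
 mu-removed (att μ) a = cong suc (mu-removed μ (suc a))
 mu-removed (free μ) a = mu-removed μ (suc a)

 mu-top : ∀ {t j} {C : Conf t j} → Mu 0 0 C → ∀ s h → topW s C h ≡ []
 mu-top ε s h = refl
 mu-top (hole μ) s h = mu-top μ s (suc h)

 mu-topW : ∀ {t j i r} {C : Conf t j} → Mu i r C → ∀ s → topW s C 0 ≡ []
 mu-topW ε s = refl
 mu-topW (hole μ) s = mu-top (hole μ) s 0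
 mu-topW (att μ) s = trans (++-identityʳ _) (mu-topW μ s)
 mu-topW (free μ) s = trans (++-identityʳ _) (mu-topW μ s)

 mu-holes : ∀ {t j} {C : Conf t j} → Mu 0 0 C → ∀ B a mem → Bottom C B a mem
 mu-holes ε B a mem = tt
 mu-holes (hole μ) B a mem = mu-holes μ B a mem

 mu-attached : ∀ {t j i} {C : Conf t j} → Mu i 0 C → ∀ p a m → a ℕ.+ i ≡ m → (∀ {b} → a ℕ.≤ b → b ℕ.< m → partAt p (suc b) ≡ j ℕ.∸ 1) → Bottom C j a (inShape p)
 mu-attached ε p a m e f = tt
 mu-attached (hole μ) p a m e f = mu-holes (hole μ) _ a (inShape p)
 mu-attached {j = suc j} {suc i} {att C zero} (att μ) p a m e f =
   ((λ b l u ne → inShape-true p a b l (subst (b ℕ.≤_) (sym part) (<⇒≤pred (ℕP.≤∧≢⇒< u ne)))) , inShape-false p a (suc j) (ℕ.s≤s (ℕP.≤-reflexive part))) ,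
   (λ b l u → ⊥-elim (ℕP.<⇒≱ l u)) , mu-attached μ p (suc a) m (trans (sym (+-suc a i)) e) (λ le → f (ℕP.<⇒≤ le))
  where
  part : partAt p (suc a) ≡ j
  part = f ℕP.≤-refl (subst (a ℕ.<_) e (m<m+n a (ℕ.s≤s ℕ.z≤n)))

 mu-bottom : ∀ {t j i r} {C : Conf t j} → Mu i r C → ∀ p a r0 → a ℕ.+ r ≡ r0 → (∀ {b} → b ℕ.< r0 → partAt p (suc b) ≡ j) →
  (∀ {b} → r0 ℕ.≤ b → b ℕ.< r0 ℕ.+ i → partAt p (suc b) ≡ j ℕ.∸ 1) → Bottom C j a (inShape p)
 mu-bottom {j = j} {i} {suc r} {free C} (free μ) p a r0 e f h =
   (λ b l u → inShape-true p a b l (subst (b ℕ.≤_) (sym part) u)) , (λ b l u → ⊥-elim (ℕP.<⇒≱ l u)) ,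
   mu-bottom μ p (suc a) r0 (trans (sym (+-suc a r)) e) f h
  where
  part : partAt p (suc a) ≡ j
  part = f (subst (a ℕ.<_) e (m<m+n a (ℕ.s≤s ℕ.z≤n)))
 mu-bottom ε p a r0 e f h = tt
 mu-bottom (hole μ) p a r0 e f h = mu-holes (hole μ) _ a (inShape p)
 mu-bottom {i = i} (att μ) p a r0 e f h = mu-attached (att μ) p a (r0 ℕ.+ i) (cong (ℕ._+ i) a≡) λ le → h (subst (ℕ._≤ _) a≡ le)
  where
  a≡ : a ≡ r0
  a≡ = trans (sym (ℕP.+-identityʳ a)) e

 part-replicate : ∀ i x b → b ℕ.< i → partAt (replicate i x) (suc b) ≡ x
 part-replicate (suc i) x zero _ = refl
 part-replicate (suc i) x (suc b) (ℕ.s≤s lt) = part-replicate i x b lt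

 holesOnly : ∀ j → Σ (Conf j j) λ C → Mu 0 0 C × NC C
 holesOnly zero = ε , ε , tt
 holesOnly (suc j) with holesOnly j
 ... | C , μ , nc = hole C , hole μ , nc

 mu-exists : ∀ r i j → (j ≡ 0 → i ≡ 0) → Σ (Conf (r ℕ.+ (i ℕ.+ j)) j) λ C → Mu i r C × NC C
 mu-exists (suc r) i j z with mu-exists r i j z
 ... | C , μ , nc = free C , free μ , nc
 mu-exists zero i zero z with z refl
 ... | refl = ε , ε , tt
 mu-exists zero i (suc j) z = proj₁ (attached i) , proj₁ (proj₂ (attached i)) , proj₁ (proj₂ (proj₂ (attached i)))
  where
  attached : ∀ i → Σ (Conf (i ℕ.+ suc j) (suc j)) λ C → Mu i 0 C × NC C × Open C zero
  attached zero with holesOnly (suc j)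
  ... | hole C , μ , nc = hole C , μ , nc , tt
  ... | free C , () , _
  ... | att C b , () , _
  attached (suc i) with attached i
  ... | C , μ , nc , o = att C zero , att μ , (nc , o) , ℕ.z≤n , o

 module _ {s : ℤ} {G : ℤ → ℤ} (inc : ∀ {u v} → u ℕ.< v → v ℕ.< n → G (s + + u) < G (s + + v)) where
  open Facts

  Ordered : ∀ {t j} → Conf t j → Set
  Ordered C = ∀ {b b'} → b' Fin.< b → top C b ℕ.< top C b'

  -- Holes have values below the window, so they come first. A free slot before an attached one
  -- would violate the increase, and since newer chains must end later, only the newest hole can
  -- carry attachments.
  mu-of : ∀ {t j} (C : Conf t j) → t ℕ.≤ n → NC C → Ordered C → Facts s G C → Σ ℕ λ i → Σ ℕ λ r → Mu i r C
  mu-of ε _ _ _ _ = 0 , 0 , ε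
  mu-of (free C) le nc o f with mu-of C (ℕP.<⇒≤ le) nc o (record { frees = frees f ∘ freeᶠ ; arcs = arcs f ∘ freeᵃ ; gaps = gaps f })
  ... | i , r , μ = i , suc r , free μ
  mu-of (hole {t} C) le nc o f = lem (mu-of C (ℕP.<⇒≤ le) nc (λ lt → o (ℕ.s≤s lt)) (record { frees = frees f ∘ holeᶠ ; arcs = arcs f ∘ holeᵃ ; gaps = gaps f ∘ suc })) f inc le
   where
   lem : ∀ {t j} {C : Conf t j} → (Σ ℕ λ i → Σ ℕ λ r → Mu i r C) → Facts s G (hole C) → (∀ {u v} → u ℕ.< v → v ℕ.< n → G (s + + u) < G (s + + v)) → t ℕ.< n → Σ ℕ λ i → Σ ℕ λ r → Mu i r (hole C)
   lem (0 , 0 , μ) f inc lt = 0 , 0 , hole μ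
   lem {C = free {t} C} (i , suc r , free μ) f inc lt = ⊥-elim (too-low (s + + t) (inc (n<1+n t) lt) (gaps f zero) (frees f (holeᶠ here)) (lia 2 (λ s v → #0 =< v => s =< s :+ v) s (+ t) 0≤+))
    where
    too-low : ∀ {x y} z → x < y → y < s → x ≡ z → s ≤ z → ⊥
    too-low z l l' refl le = <⇒≱ (<-trans l l') le
   lem {C = att {t} C b} (suc i , 0 , att μ) f inc lt = ⊥-elim (too-low (s + + top C b) (inc (n<1+n t) lt) (gaps f zero) (arcs f (holeᵃ here)) (lia 2 (λ s v → #0 =< v => s =< s :+ v) s (+ top C b) 0≤+))
    where
    too-low : ∀ {x y} z → x < y → y < s → x ≡ z → s ≤ z → ⊥
    too-low z l l' refl le = <⇒≱ (<-trans l l') le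
  mu-of {j = suc j} (att {t} C (suc b)) le nc o f = ⊥-elim (ℕP.<-asym (top<t C zero) (subst₂ ℕ._<_ (top-att-≡ C (suc b)) (top-att C {suc b} {zero} (λ ())) (o {suc b} {zero} (ℕ.s≤s ℕ.z≤n))))
  mu-of {j = suc j} (att {t} C zero) le (nc , op) o f = lem (mu-of C (ℕP.<⇒≤ le) nc o' (record { frees = frees f ∘ attᶠ ; arcs = arcs f ∘ attᵃ ; gaps = gaps f })) f le
   where
   o' : Ordered C
   o' {suc b} {zero} lt = ℕP.<-≤-trans (open-top C {suc b} {zero} lt op) (hol≤top C zero)
   o' {b} {suc b'} lt = subst₂ ℕ._<_ (top-att C {zero} {b} (λ { refl → ℕP.<⇒≱ lt ℕ.z≤n })) (top-att C {zero} {suc b'} (λ ())) (o {b} {suc b'} lt)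
   lem : ∀ {t j} {C : Conf t (suc j)} → (Σ ℕ λ i → Σ ℕ λ r → Mu i r C) → Facts s G (att C zero) → t ℕ.< n → Σ ℕ λ i → Σ ℕ λ r → Mu i r (att C zero)
   lem (i , 0 , μ) f lt = suc i , 0 , att μ
   lem {C = free {t} C} (i , suc r , free μ) f lt = ⊥-elim (<-asym (subst₂ _<_ (frees f (attᶠ here)) (arcs f here) (inc (n<1+n t) lt)) (+-monoʳ-< s (+<+ (top<t C zero))))

 increasing-window : ∀ x → (∀ p → 1 ℕ.≤ p → p ℕ.≤ k → to x (+ p) < to x (+ p + 1ℤ)) → Increasing x
 increasing-window x asc {a} {b} 1≤a a<b b≤N = go (proj₁ (offset a<b)) b (proj₂ (offset a<b)) b≤N
  where
  go : ∀ d b → b ≡ a + + suc d → b ≤ N → to x a < to x b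
  step : ∀ q → a ≤ q → q < N → to x q < to x (q + 1ℤ)
  step q le lt with natural {q} (lia 2 (λ a q → #1 =< a => a =< q => #0 =< q) a q 1≤a le)
  ... | p , refl = asc p (drop‿+≤+ (≤-trans 1≤a le)) (<⇒≤pred (drop‿+<+ (subst (+ p <_) N-def lt)))
  go zero _ refl le = step a ≤-refl (lia 2 (λ a N → a :+ #1 =< N => a <: N) a N le)
  go (suc d) _ refl le = <-trans (go d (a + + suc d) refl (lia 3 (λ a d N → a :+ (#2 :+ d) =< N => a :+ (#1 :+ d) =< N) a (+ d) N le))
   (subst (λ z → to x (a + + suc d) < to x z) (lia 2 (λ a d → a :+ (#1 :+ d) :+ #1 ≐ a :+ (#2 :+ d)) a (+ d))
    (step (a + + suc d) (lia 2 (λ a d → #0 =< d => a =< a :+ (#1 :+ d)) a (+ d) 0≤+) (lia 3 (λ a d N → a :+ (#2 :+ d) =< N => a :+ (#1 :+ d) <: N) a (+ d) N le)))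

 -- Minimality is tested on one generator at a time: a descent at p would make the product with that
 -- generator shorter.
 InW0-increasing : ∀ x → InW0 k (win x) → Increasing x
 InW0-increasing x min = increasing-window x asc
  where
  asc : ∀ p → 1 ℕ.≤ p → p ℕ.≤ k → to x (+ p) < to x (+ p + 1ℤ)
  asc (suc p) _ p<k with <-cmp (to x (+ suc p)) (to x (+ suc p + 1ℤ))
  ... | tri< h _ _ = h
  ... | tri≈ _ e _ = ⊥-elim (<-irrefl (to-inj x e) (p<p+1 (+ suc p)))
  ... | tri> _ _ h = ⊥-elim (ℕP.<⇒≱ (ℕP.≤-reflexive (sym (right-down x (+ suc p) h))) (subst₂ ℕ._≤_ (sym (ℓ-def x)) shorter (min (fromℕ< p<k ∷ []))))
   where
   shorter : len (List.foldl rmul (win x) (suc (toℕ (fromℕ< p<k)) ∷ [])) ≡ ℓ (x ⇌ + suc p , + suc p + 1ℤ)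
   shorter = trans (cong (λ r → len (List.foldl rmul (win x) (suc r ∷ []))) (Finₚ.toℕ-fromℕ< p<k)) (trans (cong len (foldl-rmul x (suc p ∷ []))) (trans (sym (ℓ-def (x ∘A act (suc p ∷ []) idA)))
    (ℓ-cong (agree λ q → cong (to x) (sym (swap-tr (i~/i+1 (+ suc p)) q))))))

 -- The right-hand side as the indicator of noncrossing permutations

 module Main (c i : ℕ) (c≤k : c ℕ.≤ k) (i≤m : i ℕ.≤ rowsR k c) (degenerate : c ≡ 0 → i ≡ 0) where

  open Parameters c i c≤k

  κ s0 : ℤ
  κ = + m - N
  -- Chosen so that s0 + m = 1, the alignment which `top-word` asks for at the first row.
  s0 = 1ℤ - + m

  -- The common number of cells of the diagrams in the sum.
  L : ℕ
  L = m ℕ.* c ℕ.∸ i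

  i≤mc : i ℕ.≤ m ℕ.* c
  i≤mc = lem c degenerate
   where
   lem : ∀ c → (c ≡ 0 → i ≡ 0) → i ℕ.≤ m ℕ.* c
   lem zero z = subst (ℕ._≤ m ℕ.* 0) (sym (z refl)) ℕ.z≤n
   lem (suc c) _ = ℕP.≤-trans i≤m (ℕP.m≤m*n m (suc c))

  np≡m : (C : Conf n c) → np C ≡ m
  np≡m C = ℕP.+-cancelʳ-≡ c (np C) m (trans (np+j C) (sym m+c))

  Supp : AP → Set
  Supp y = Near κ y × Balanced y × ℓ y ≡ L

  ℓ-permC : ∀ s (C : Conf n c) → NC C → ℓ (permC s C) ≡ length (wordC s C)
  ℓ-permC s C nc = trans (Config.ascending s C nc) (trans (cong (length (wordC s C) ℕ.+_) (ℓ-rising idA Rising-id)) (ℕP.+-identityʳ _))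

  word-length : ∀ s (C : Conf n c) → length (wordC s C) ℕ.+ length (removed C (suc m)) ≡ m ℕ.* c
  word-length s C = trans (length-wordC s C (suc m)) (cong (ℕ._* c) (np≡m C))

  supp : ∀ s (C : Conf n c) → NC C → length (removed C (suc m)) ≡ i → ∀ {y} → y ≗A permC s C → Supp y
  supp s C nc e h = Near-cong h (subst (λ p → Near (+ p - N) (permC s C)) (np≡m C) (Encode.near-permC s C nc)) , trans (balance-cong h) (balance-act (wordC s C)) ,
   trans (ℓ-cong h) (trans (ℓ-permC s C nc) (trans (sym (ℕP.m+n∸n≡m (length (wordC s C)) i)) (cong (ℕ._∸ i) (trans (cong (length (wordC s C) ℕ.+_) (sym e)) (word-length s C)))))

  removed-size : ∀ s (C : Conf n c) → NC C → ∀ {y} → y ≗A permC s C → ℓ y ≡ L → length (removed C (suc m)) ≡ i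
  removed-size s C nc {y} h e = ℕP.+-cancelˡ-≡ L _ _ (trans (cong (ℕ._+ length (removed C (suc m))) (trans (sym e) (trans (ℓ-cong h) (ℓ-permC s C nc)))) (trans (word-length s C) (sym (m∸n+n≡m i≤mc))))

  -- This holds for every cut s: κ determines the number of particles, and the length determines the
  -- number of removed cells.
  config : ∀ s {y} → Supp y → Σ (Conf n c) λ C → NC C × y ≗A permC s C × length (removed C (suc m)) ≡ i
  config s {y} (S , bal , e) = from (Decoding.decoded s κ y S bal)
   where
   from : Decoded s κ y → Σ (Conf n c) λ C → NC C × y ≗A permC s C × length (removed C (suc m)) ≡ i
   from D = sized (Decoded.C D) (Decoded.nc D) (Decoded.perm≗ D) (ℕP.+-cancelˡ-≡ m _ _ (trans (cong (ℕ._+ Decoded.j D) (sym np≡)) (trans (np+j (Decoded.C D)) (sym m+c))))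
    where
    np≡ : np (Decoded.C D) ≡ m
    np≡ = +-injective (lia 3 (λ p m N → m :- N ≐ p :- N => p ≐ m) (+ np (Decoded.C D)) (+ m) N (Decoded.κ≡ D))
    sized : ∀ {j} (C : Conf n j) → NC C → y ≗A permC s C → j ≡ c → Σ (Conf n c) λ C → NC C × y ≗A permC s C × length (removed C (suc m)) ≡ i
    sized C nc h refl = C , nc , h , removed-size s C nc h e

  skew-word : ∀ {lam xs} (E : Entry lam xs) → skewWord k c lam xs ≡ wordC s0 (Entry.C E)
  skew-word (entry C nc refl refl e) = trans (readWord-rows mem (m ℕ.+ m) c) (trans (rowsFrom-+ mem c 0 m m)
    (cong₂ _++_ (trans (cong (rowsFrom mem c m) (sym (np≡m C))) (bottom-word C c m mem (s0 - + np C) ℕP.≤-refl (bottom-shape C m ℕP.≤-refl (part-right m c (partition C)) (λ r b _ → refl))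
      (lia 2 (λ m p → #1 :- m :- p :+ p ≐ #1 :- m) (+ m) (+ np C))))
     (trans (cong (rowsFrom mem c 0) (sym (np≡m C))) (top-word C c 0 mem s0 0 (ℕP.+-identityʳ c) (top-shape C 0 (np≡m C) (λ r → refl) (λ r b r≤m → memCell-above C (suc m) r b (ℕ.s≤s r≤m)))
      (lia 2 (λ m p → m ≐ p => #1 :- m :+ p ≐ #1 :- #0) (+ m) (+ np C) (cong +_ (sym (np≡m C))))))))
   where
   open Diagram m c (partition C) (removed C (suc m)) (trans (length-partition C) (np≡m C))

  word : List ℕ → List Cell → Word
  word = skewWord k c

  cellSets : List ℕ → List (List Cell)
  cellSets lam = admissible k c i (RLof lam)

  F : Fun
  F = lin (rhs k c i) δ

  F-sum : ∀ y → F y ≡ sumL (λ lam → sumL (λ xs → χ (word lam xs) y) (cellSets lam)) (partsIn m c)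
  F-sum y = trans (sumL-concatMap (λ t → proj₁ t ℚ.* op (proj₂ t) δ y) (λ lam → map (λ xs → (1ℚ , word lam xs)) (cellSets lam)) (partsIn m c))
   (sumL-cong (λ lam → trans (sumL-map (λ t → proj₁ t ℚ.* op (proj₂ t) δ y) (λ xs → (1ℚ , word lam xs)) (cellSets lam))
    (sumL-cong (λ xs → trans (ℚP.*-identityˡ _) (sym (χ-op (word lam xs) y))) (cellSets lam))) (partsIn m c))

  occurs : ∀ y {lam xs} → lam ∈ partsIn m c → xs ∈ cellSets lam → χ (word lam xs) y ≢ 0ℚ → Σ (Entry lam xs) λ E → y ≗A permC s0 (Entry.C E)
  occurs y {lam} {xs} p q nz = E , subst (λ w → y ≗A act w idA) (skew-word E) (proj₂ (op-support (word lam xs) y (λ z → nz (trans (χ-op (word lam xs) y) z))))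
   where
   E : Entry lam xs
   E = toEntry p q

  -- By `permC-injective` different pairs of a partition and a set of cells give different
  -- permutations, so exactly one term of the double sum survives.
  F-one : ∀ (C : Conf n c) → NC C → length (removed C (suc m)) ≡ i → ∀ {y} → y ≗A permC s0 C → F y ≡ 1ℚ
  F-one C nc e {y} h = trans (F-sum y) (trans (sumL-single (partsIn-unique m c) (proj₁ P) other-partition) (trans (sumL-single (admissible-unique (trans (length-partition C) (np≡m C))) (proj₂ P) other-cells)
    (χ-one (word (partition C) (removed C (suc m))) y (subst Reduced (sym sw) (ℓ-permC s0 C nc)) (subst (λ w → y ≗A act w idA) (sym sw) h))))
   where
   P : partition C ∈ partsIn m c × removed C (suc m) ∈ cellSets (partition C)
   P = fromConf C nc e
   sw : word (partition C) (removed C (suc m)) ≡ wordC s0 C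
   sw = skew-word (entry C nc refl refl e)
   unique : ∀ {lam xs} (E : Entry lam xs) → y ≗A permC s0 (Entry.C E) → partition C ≡ lam × removed C (suc m) ≡ xs
   unique (entry C' nc' refl refl _) h' with permC-injective s0 C C' nc nc' (≗A-trans (≗A-sym h) h')
   ... | refl = refl , refl
   zero-unless : ∀ {lam xs} → lam ∈ partsIn m c → xs ∈ cellSets lam → ¬ (partition C ≡ lam × removed C (suc m) ≡ xs) → χ (word lam xs) y ≡ 0ℚ
   zero-unless {lam} {xs} p q ne = lem (χ (word lam xs) y ℚP.≟ 0ℚ)
    where
    lem : Dec (χ (word lam xs) y ≡ 0ℚ) → χ (word lam xs) y ≡ 0ℚ
    lem (yes z) = z
    lem (no nz) = ⊥-elim (ne (unique (proj₁ (occurs y p q nz)) (proj₂ (occurs y p q nz))))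
   other-cells : ∀ {xs} → xs ∈ cellSets (partition C) → xs ≢ removed C (suc m) → χ (word (partition C) xs) y ≡ 0ℚ
   other-cells q ne = zero-unless (proj₁ P) q (λ { (_ , z) → ne (sym z) })
   other-partition : ∀ {lam} → lam ∈ partsIn m c → lam ≢ partition C → sumL (λ xs → χ (word lam xs) y) (cellSets lam) ≡ 0ℚ
   other-partition {lam} p ne = lem (sumL (λ xs → χ (word lam xs) y) (cellSets lam) ℚP.≟ 0ℚ)
    where
    lem : Dec (sumL (λ xs → χ (word lam xs) y) (cellSets lam) ≡ 0ℚ) → sumL (λ xs → χ (word lam xs) y) (cellSets lam) ≡ 0ℚ
    lem (yes z) = z
    lem (no nz) = ⊥-elim (term (sumL-nonzero (λ xs → χ (word lam xs) y) (cellSets lam) nz))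
     where
     term : (Σ (List Cell) λ xs → xs ∈ cellSets lam × χ (word lam xs) y ≢ 0ℚ) → ⊥
     term (xs , q , nz') = nz' (zero-unless p q (λ { (z , _) → ne (sym z) }))

  F-supp : ∀ y → F y ≢ 0ℚ → Supp y
  F-supp y nz = outer (sumL-nonzero (λ lam → sumL (λ xs → χ (word lam xs) y) (cellSets lam)) (partsIn m c) (λ z → nz (trans (F-sum y) z)))
   where
   inner : ∀ {lam} → lam ∈ partsIn m c → (Σ (List Cell) λ xs → xs ∈ cellSets lam × χ (word lam xs) y ≢ 0ℚ) → Supp y
   inner {lam} p (xs , q , nz') = from (occurs y p q nz')
    where
    from : (Σ (Entry lam xs) λ E → y ≗A permC s0 (Entry.C E)) → Supp y
    from (entry C nc _ refl e , h) = supp s0 C nc e h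
   outer : (Σ (List ℕ) λ lam → lam ∈ partsIn m c × sumL (λ xs → χ (word lam xs) y) (cellSets lam) ≢ 0ℚ) → Supp y
   outer (lam , p , nz') = inner p (sumL-nonzero (λ xs → χ (word lam xs) y) (cellSets lam) nz')

  supp-F : ∀ {y} → Supp y → F y ≡ 1ℚ
  supp-F {y} S = from (config s0 S)
   where
   from : (Σ (Conf n c) λ C → NC C × y ≗A permC s0 C × length (removed C (suc m)) ≡ i) → F y ≡ 1ℚ
   from (C , nc , h , e) = F-one C nc e h

  view : ∀ y → (Near κ y × Balanced y × ℓ y ≡ L × F y ≡ 1ℚ) ⊎ (¬ Supp y × F y ≡ 0ℚ)
  view y = lem (F y ℚP.≟ 0ℚ)
   where
   lem : Dec (F y ≡ 0ℚ) → (Near κ y × Balanced y × ℓ y ≡ L × F y ≡ 1ℚ) ⊎ (¬ Supp y × F y ≡ 0ℚ)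
   lem (yes z) = inj₂ ((λ S → 1≢0 (trans (sym (supp-F S)) z)) , z)
    where
    1≢0 : 1ℚ ≢ 0ℚ
    1≢0 ()
   lem (no nz) = inj₁ (proj₁ S , proj₁ (proj₂ S) , proj₂ (proj₂ S) , supp-F S)
    where
    S : Supp y
    S = F-supp y nz

  μword : Word
  μword = readWord k (inShape (muPart k c i)) m c

  -- With the cut at 1 no particle has a hole to its right, so the upper word is empty and the lower
  -- rows are those of μ.
  mu-word : ∀ {r} (C : Conf n c) → Mu i r C → wordC 1ℤ C ≡ μword
  mu-word {r} C μ = trans (cong₂ _++_ (sym (bottom-word C c 0 (inShape (muPart k c i)) (1ℤ - + np C) ℕP.≤-refl
     (mu-bottom μ (muPart k c i) 0 r refl first second) (lia 1 (λ p → #1 :- p :+ p ≐ #1 :- #0) (+ np C)))) (mu-topW μ 1ℤ))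
    (trans (++-identityʳ _) (trans (cong (rowsFrom (inShape (muPart k c i)) c 0) (np≡m C)) (sym (readWord-rows (inShape (muPart k c i)) m c))))
   where
   r≡ : m ℕ.∸ i ≡ r
   r≡ = trans (cong (ℕ._∸ i) (trans (sym (np≡m C)) (mu-np μ))) (ℕP.m+n∸n≡m r i)
   first : ∀ {b} → b ℕ.< r → partAt (muPart k c i) (suc b) ≡ c
   first {b} lt = part-left (m ℕ.∸ i) c (replicate i (c ℕ.∸ 1)) b (subst (b ℕ.<_) (sym r≡) lt)
   second : ∀ {b} → r ℕ.≤ b → b ℕ.< r ℕ.+ i → partAt (muPart k c i) (suc b) ≡ c ℕ.∸ 1
   second {b} le lt = trans (cong (λ z → partAt (muPart k c i) (suc z)) (trans (sym (m+[n∸m]≡n le)) (cong (ℕ._+ (b ℕ.∸ r)) (sym r≡))))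
    (trans (part-right (m ℕ.∸ i) c (replicate i (c ℕ.∸ 1)) (b ℕ.∸ r)) (part-replicate i (c ℕ.∸ 1) (b ℕ.∸ r) (subst (b ℕ.∸ r ℕ.<_) (ℕP.m+n∸m≡n r i) (ℕP.∸-monoˡ-< lt le))))

  xμ : AP
  xμ = act μword idA

  xμ-supp : Supp xμ
  xμ-supp = sized (trans (cong ((m ℕ.∸ i) ℕ.+_) refl) (trans (sym (ℕP.+-assoc (m ℕ.∸ i) i c)) (trans (cong (ℕ._+ c) (m∸n+n≡m i≤m)) m+c))) (mu-exists (m ℕ.∸ i) i c degenerate)
   where
   sized : ∀ {t} → t ≡ n → (Σ (Conf t c) λ C → Mu i (m ℕ.∸ i) C × NC C) → Supp xμ
   sized refl (C , μ , nc) = supp 1ℤ C nc (mu-removed μ (suc m)) (≗A-sym (subst (λ w → act w idA ≗A xμ) (sym (mu-word C μ)) ≗A-refl))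

  -- The cut at 1 makes the slots the positions 1, ..., n, on which x increases; `mu-of` then leaves
  -- a single shape, and the number of removed cells fixes its size.
  increasing-supp : ∀ {x} → Increasing x → Supp x → x ≗A xμ
  increasing-supp {x} inc S = from (config 1ℤ S)
   where
   from : (Σ (Conf n c) λ C → NC C × x ≗A permC 1ℤ C × length (removed C (suc m)) ≡ i) → x ≗A xμ
   from (C , nc , h , e) = shape (mu-of {1ℤ} {G} inc' C ℕP.≤-refl nc ordered (permC-facts 1ℤ C nc))
    where
    G : ℤ → ℤ
    G = g (+ np C - N) (permC 1ℤ C)
    inc' : ∀ {u v} → u ℕ.< v → v ℕ.< n → G (1ℤ + + u) < G (1ℤ + + v)
    inc' {u} {v} l l' = +-monoˡ-< (+ np C - N) (subst₂ _<_ (at h (1ℤ + + u)) (at h (1ℤ + + v))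
     (inc (+≤+ (ℕ.s≤s ℕ.z≤n)) (+<+ (ℕ.s≤s l)) (subst (+ suc v ≤_) (sym N-def) (+≤+ l'))))
    ordered : Ordered {1ℤ} {G} inc' C
    ordered {b} {b'} lt = drop‿+<+ (lia 5 (λ g g' t t' N → g ≐ #1 :+ t :- N => g' ≐ #1 :+ t' :- N => g <: g' => t <: t') (G (1ℤ + + hol C b)) (G (1ℤ + + hol C b')) (+ top C b) (+ top C b') N
     (Encode.g-hole 1ℤ C nc b) (Encode.g-hole 1ℤ C nc b') (inc' (hol-mono C lt) (hol<t C b')))
    shape : (Σ ℕ λ i' → Σ ℕ λ r → Mu i' r C) → x ≗A xμ
    shape (i' , r , μ) = subst (λ w → x ≗A act w idA) (mu-word C (subst (λ i → Mu i r C) (trans (sym (mu-removed μ (suc m))) e) μ)) h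

  schur : IsNCkSchur k (wMu k c i) (rhs k c i)
  schur = ker-InB (rhs k c i) (indicator-Ker κ L F (lin-ext (rhs k c i) δ-ext) view) , λ w _ min → coefficient w min (w ≟W wMu k c i)
   where
   wμ : wMu k c i ≡ win xμ
   wμ = permOf-act μword
   coefficient : ∀ w → InW0 k w → (d : Dec (w ≡ wMu k c i)) → coeff k (rhs k c i) w ≡ (if ⌊ d ⌋ then 1ℚ else 0ℚ)
   coefficient w min (yes e) = trans (cong (coeff k (rhs k c i)) (trans e wμ)) (trans (coeff-lin (rhs k c i) xμ) (supp-F xμ-supp))
   coefficient w min (no ne) = lem (coeff-AP (rhs k c i) w)
    where
    lem : (∃ λ x → w ≡ win x) ⊎ coeff k (rhs k c i) w ≡ 0ℚ → coeff k (rhs k c i) w ≡ 0ℚ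
    lem (inj₂ z) = z
    lem (inj₁ (x , e)) = trans (cong (coeff k (rhs k c i)) e) (trans (coeff-lin (rhs k c i) x) (zero' (F x ℚP.≟ 0ℚ)))
     where
     zero' : Dec (F x ≡ 0ℚ) → F x ≡ 0ℚ
     zero' (yes z) = z
     zero' (no nz) = ⊥-elim (ne (trans e (trans (win-cong (increasing-supp (InW0-increasing x (subst (InW0 k) e min)) (F-supp x nz))) (sym wμ))))

open import Data.Nat using (_≤_; _∸_)

theorem5p6 : (k c i : ℕ) → 1 ≤ k → c ≤ k → i ≤ suc k ∸ c → (c ≡ 0 → i ≡ 0) →
  IsNCkSchur k (wMu k c i) (rhs k c i)
theorem5p6 k c i 1≤k c≤k i≤m degenerate = Development.Main.schur k 1≤k c i c≤k i≤m degenerate
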